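{- Consider the Primal-Dual Cops and Robber game (defined in the context) and let $c^*(G)$ denote the primal-dual cop number of a plane graph $G$; let $\Delta(G)$ denote the maximum degree of $G$. Then: (1) For every plane graph $G$ with $\Delta(G)=3$ we have $c^*(G)\le 3$, and this is tight: there exists a plane graph $G$ with $\Delta(G)=3$ and $c^*(G)=3$. (2) For every plane graph $G$ with $\Delta(G)=4$ we have $c^*(G)\le 6$, and this is tight: there exists a plane graph $G$ with $\Delta(G)=4$ and $c^*(G)=6$. (3) There exist a constant $c>0$ and infinitely many plane graphs $G$ with $\Delta(G)=5$ such that, writing $n$ for the number of vertices of $G$, $c^*(G)\ge c\sqrt{\log n}$ (i.e. $c^*(G)=\Omega(\sqrt{\log n})$ for infinitely many $n$-vertex plane graphs with maximum degree $5$).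
   Context: A plane graph is a finite planar graph (not necessarily connected) together with a fixed crossing-free embedding in the plane; its faces are the connected regions of the complement of the drawing, and two faces are adjacent if they share an edge on their boundaries (i.e. they are adjacent in the dual graph $G^*$, which is always connected). A face is incident to a vertex $v$ if $v$ lies on its boundary. Primal-Dual Cops and Robber on a plane graph $G$ with $k$ cops: the cop player controls $k$ cops, each occupying a face of $G$ (several cops may share a face); the robber player controls one robber occupying a vertex of $G$. The cop player first chooses starting faces for all $k$ cops; then the robber, seeing these, chooses his starting vertex. The players then alternate turns, cops first: in a cop turn, each cop independently either stays or moves to an adjacent face; in a robber turn, the robber either stays or moves along an edge to an adjacent vertex. The robber is captured (and the cops win) as soon as every face incident to the robber's current vertex is occupied by at least one cop. The robber wins if he avoids capture forever. Both players have complete information. The primal-dual cop number $c^*(G)$ is the least $k$ such that $k$ cops have a strategy that captures the robber against every robber strategy. -}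

module Defs where

open import Data.Nat using (ℕ; zero; suc; _+_; _*_; _≤_; _<_)
open import Data.Fin using (Fin; _≟_)
open import Data.Fin.Properties using (any?; all?)
open import Data.List using (List; []; _∷_; length; filter; allFin)
import Data.List as L
open import Data.Nat.ListAction using (sum)
open import Data.Product using (Σ; ∃; ∃-syntax; _×_; _,_; proj₁; proj₂)
open import Data.Product.Properties using ()
open import Data.Sum using (_⊎_; inj₁; inj₂)
open import Data.Empty using (⊥)
open import Relation.Nullary using (¬_; Dec)
open import Relation.Nullary.Decidable using (_×-dec_; _⊎-dec_; ¬?)
open import Relation.Unary using (Decidable)
open import Relation.Binary.PropositionalEquality using (_≡_; _≢_)

iter : {A : Set} → (A → A) → ℕ → A → A
iter f zero    x = x
iter f (suc n) x = f (iter f n x)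

count : {n : ℕ} {P : Fin n → Set} → Decidable P → ℕ
count {n} P? = length (filter P? (allFin n))

data Conn {A : Set} (R : A → A → Set) : A → A → Set where
  here : {x : A} → Conn R x x
  fwd  : {x y z : A} → R x y → Conn R y z → Conn R x z
  bwd  : {x y z : A} → R y x → Conn R y z → Conn R x z

-- Raw data of a plane graph, given as a combinatorial map
-- (rotation system) plus the information needed for disconnected
-- graphs: which face contains each isolated vertex, and how the
-- boundary walks of the various components are grouped into faces.
--
--  * vertices  : Fin V
--  * darts     : Fin D   (half-edges; an edge = a pair {d , α d})
--  * faces     : Fin F
--  * tail d    : the vertex at which dart d starts
--  * α         : the other half of the same edge
--  * σ         : rotation (cyclic order of darts around their tail)
--  * face d    : the face whose boundary walk traverses dart d
--                (boundary walks = orbits of φ = σ ∘ α)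
--  * ivFace v  : the face containing v (only used when v is isolated)
--  * comp v    : the connected component of v (components : Fin K)

record Map : Set where
  field
    V D F K : ℕ
    tail   : Fin D → Fin V
    α σ    : Fin D → Fin D
    face   : Fin D → Fin F
    ivFace : Fin V → Fin F
    comp   : Fin V → Fin K

module MapNotions (M : Map) where
  open Map M

  φ : Fin D → Fin D
  φ d = σ (α d)

  VAdj : Fin V → Fin V → Set
  VAdj v w = ∃[ d ] (tail d ≡ v × tail (α d) ≡ w)

  Isolated : Fin V → Set
  Isolated v = ∀ d → tail d ≢ v

  isolated? : Decidable Isolated
  isolated? v = all? (λ d → ¬? (tail d ≟ v))

  Incident : Fin V → Fin F → Set
  Incident v f = (∃[ d ] (tail d ≡ v × face d ≡ f)) ⊎ (Isolated v × ivFace v ≡ f)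

  FAdj : Fin F → Fin F → Set
  FAdj f g = ∃[ d ] (face d ≡ f × face (α d) ≡ g)

  degree : Fin V → ℕ
  degree v = count (λ d → tail d ≟ v)

  nV : Fin K → ℕ
  nV c = count (λ v → comp v ≟ c)

  nD : Fin K → ℕ
  nD c = count (λ d → comp (tail d) ≟ c)

  CompFace : Fin K → Fin F → Set
  CompFace c f = ∃[ d ] (comp (tail d) ≡ c × face d ≡ f)

  compFace? : (c : Fin K) → Decidable (CompFace c)
  compFace? c f = any? (λ d → (comp (tail d) ≟ c) ×-dec (face d ≟ f))

  -- number of faces (= boundary walks) of the component c on its own
  nF : Fin K → ℕ
  nF c = count (compFace? c)

  BInc : Fin K → Fin F → Set
  BInc c f = CompFace c f ⊎ (∃[ v ] (Isolated v × comp v ≡ c × ivFace v ≡ f))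

  BInc? : (c : Fin K) → Decidable (BInc c)
  BInc? c f = compFace? c f ⊎-dec
              any? (λ v → isolated? v ×-dec ((comp v ≟ c) ×-dec (ivFace v ≟ f)))

  nB : ℕ
  nB = sum (L.map (λ c → count (BInc? c)) (allFin K))

  BRel : Fin K ⊎ Fin F → Fin K ⊎ Fin F → Set
  BRel (inj₁ c) (inj₂ f) = BInc c f
  BRel _        _        = ⊥

record IsPlaneMap (M : Map) : Set where
  open Map M
  open MapNotions M
  field
    α-invol  : ∀ d → α (α d) ≡ d
    α-nofix  : ∀ d → α d ≢ d
    σ-inj    : ∀ d d′ → σ d ≡ σ d′ → d ≡ d′
    σ-tail   : ∀ d → tail (σ d) ≡ tail d
    σ-trans  : ∀ d d′ → tail d ≡ tail d′ → ∃[ n ] (iter σ n d ≡ d′)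
    face-φ     : ∀ d → face (φ d) ≡ face d
    face-orbit : ∀ d d′ → comp (tail d) ≡ comp (tail d′) → face d ≡ face d′ →
                 ∃[ n ] (iter φ n d ≡ d′)
    comp-edge : ∀ d → comp (tail (α d)) ≡ comp (tail d)
    comp-conn : ∀ v w → comp v ≡ comp w → Conn VAdj v w
    comp-surj : ∀ c → ∃[ v ] (comp v ≡ c)
    -- every component with an edge is embedded in the sphere (genus 0):
    -- V_c - E_c + F_c = 2 with E_c = D_c / 2
    euler : ∀ c → (∃[ d ] (comp (tail d) ≡ c)) → 2 * (nV c + nF c) ≡ nD c + 4
    -- the component/face incidence graph is a tree (realisable nesting)
    nest-conn : ∀ x y → Conn BRel x y
    nest-tree : K + F ≡ nB + 1

record IsSimple (M : Map) : Set where
  open Map M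
  field
    no-loop  : ∀ d → tail (α d) ≢ tail d
    no-multi : ∀ d d′ → tail d ≡ tail d′ → tail (α d) ≡ tail (α d′) → d ≡ d′

record PlaneGraph : Set where
  field
    emb    : Map
    plane  : IsPlaneMap emb
    simple : IsSimple emb
  open Map emb public
  open MapNotions emb public

numVertices : PlaneGraph → ℕ
numVertices G = PlaneGraph.V G

MaxDegree : PlaneGraph → ℕ → Set
MaxDegree G m = (∀ v → degree v ≤ m) × (∃[ v ] (degree v ≡ m))
  where open PlaneGraph G

module Game (G : PlaneGraph) (k : ℕ) where
  open PlaneGraph G

  Config : Set
  Config = Fin k → Fin F

  State : Set
  State = Config × Fin V

  ValidCopMove : Config → Config → Set
  ValidCopMove c c′ = ∀ i → (c′ i ≡ c i) ⊎ FAdj (c i) (c′ i)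

  ValidRobberMove : Fin V → Fin V → Set
  ValidRobberMove v v′ = (v′ ≡ v) ⊎ VAdj v v′

  Captured : Config → Fin V → Set
  Captured c v = ∀ f → Incident v f → ∃[ i ] (c i ≡ f)

  -- History-dependent strategies.  The list argument is the history of
  -- earlier states (most recent first); the remaining arguments give the
  -- current position.
  record CopStrategy : Set where
    field
      start : Config
      move  : List State → Config → Fin V → Config
      valid : ∀ h c v → ValidCopMove c (move h c v)

  record RobberStrategy : Set where
    field
      start : Config → Fin V
      move  : List State → Config → Fin V → Config → Fin V
      valid : ∀ h c v c′ → ValidRobberMove v (move h c v c′)

  run : CopStrategy → RobberStrategy → ℕ → State × List State
  run σ τ zero = (CopStrategy.start σ , RobberStrategy.start τ (CopStrategy.start σ)) , []
  run σ τ (suc t) with run σ τ t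
  ... | (c , v) , h =
    let c′ = CopStrategy.move σ h c v in
    (c′ , RobberStrategy.move τ h c v c′) , ((c , v) ∷ h)

  copsAt : CopStrategy → RobberStrategy → ℕ → Config
  copsAt σ τ t = proj₁ (proj₁ (run σ τ t))

  robberAt : CopStrategy → RobberStrategy → ℕ → Fin V
  robberAt σ τ t = proj₂ (proj₁ (run σ τ t))

  -- capture happens at some moment: either after the robber's placement /
  -- move of round t, or right after the cops' move of round t+1
  CaptureOccurs : CopStrategy → RobberStrategy → Set
  CaptureOccurs σ τ =
    ∃[ t ] (Captured (copsAt σ τ t) (robberAt σ τ t)
            ⊎ Captured (copsAt σ τ (suc t)) (robberAt σ τ t))

  CopsWin : Set
  CopsWin = Σ CopStrategy (λ σ → ∀ τ → CaptureOccurs σ τ)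

CopsWin : PlaneGraph → ℕ → Set
CopsWin G k = Game.CopsWin G k

CopNumberIs : PlaneGraph → ℕ → Set
CopNumberIs G k = CopsWin G k × (∀ j → j < k → ¬ CopsWin G j)

-- Upper bounds.  For Δ ≤ 3 three cops aim at the faces around the robber; his
-- moves replace one of these faces at a time, and after each of them the cops
-- can exchange roles so that their total distance eventually drops to zero.
-- For Δ ≤ 4 four tokens can be kept on the faces around the robber such that
-- each moves like a robber on the dual graph.  By the argument of Aigner and
-- Fromme three cops catch such a token; three more sit on the tokens caught
-- before it.
--
-- Lower bounds.  Two cops cannot occupy the three faces at a vertex of K₄.
-- Against five cops the robber runs along a dodecahedral network: at every
-- junction a face close to two of his three ways out belongs to a set holding at
-- most three cops, so some way out has at most three cops near it, and four are
-- needed for a capture.  For Δ = 5 there is a planar grid on which the robber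
-- outruns the cops in both coordinates; he sweeps back and forth and dodges one
-- cop after another sideways, in a square whose size is exponential in the
-- number of cops.

module Submission where

open import Defs
open import Data.Nat using (ℕ; _≤_; _*_)
open import Data.Nat.Logarithm using (⌊log₂_⌋)
open import Data.Product using (Σ; ∃-syntax; _×_)
open import Algebra.Bundles using (module CommutativeRing)
open import Data.Bool using (Bool; T; T?; _xor_; _∧_; false; if_then_else_; not; true)
open import Data.Empty using (⊥; ⊥-elim)
open import Data.Fin using (Fin; _≟_; fromℕ<; inject₁; opposite; suc; toℕ; zero)
open import Data.Fin.Permutation using (permutation)
open import Data.Fin.Properties using (injective⇒≤; pigeonhole)
open import Data.List using (List; []; _++_; _∷_; allFin; filter; length; tabulate)
open import Data.List.Membership.Propositional using (_∈_; _∉_)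
open import Data.List.Membership.Propositional.Properties using (∈-++⁺ʳ; ∈-++⁺ˡ; ∈-++⁻; ∈-allFin; ∈-filter⁺; ∈-filter⁻; ∈-lookup; ∈-map⁻; ∈-tabulate⁺; ∈-tabulate⁻)
open import Data.List.Properties using (++-assoc; ++-conicalʳ; ++-conicalˡ; filter-all; length-++; length-map; length-tabulate; map-++)
open import Data.List.Relation.Binary.Permutation.Propositional using (↭⇒↭ₛ)
open import Data.List.Relation.Binary.Permutation.Propositional.Properties using (++-comm)
open import Data.List.Relation.Unary.All using ([]; _∷_; universal)
open import Data.List.Relation.Unary.All.Properties using (++⁻ʳ; ++⁻ˡ; All¬⇒¬Any; ¬Any⇒All¬)
open import Data.List.Relation.Unary.AllPairs using ([]; _∷_)
open import Data.List.Relation.Unary.Any using (here; index; there)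
open import Data.List.Relation.Unary.Any.Properties using (lookup-index)
open import Data.List.Relation.Unary.Unique.Propositional using (Unique)
open import Data.List.Relation.Unary.Unique.Propositional.Properties using (++⁺; allFin⁺; filter⁺; map⁺; tabulate⁺)
open import Data.Maybe using (Maybe; just; nothing)
open import Data.Nat using (_%_; _+_; _/_; _<?_; _<_; _<ᵇ_; _^_; _∸_; _≡ᵇ_; _≤?_; _≤ᵇ_; _⊓_; suc; s≤s; zero; z≤n; ∣_-_∣)
open import Data.Nat.DivMod using (m%n<n; m≡m%n+[m/n]*n)
open import Data.Nat.Logarithm using (⌊log₂[2^n]⌋≡n; ⌊log₂⌋-mono-≤)
open import Data.Nat.Solver using (module +-*-Solver)
open import Data.Product using (_,_; proj₁; proj₂)
open import Data.Product.Function.NonDependent.Propositional using (_×-↔_)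
open import Data.Sum using (_⊎_; inj₁; inj₂)
open import Data.Sum.Function.Propositional using (_⊎-↔_)
open import Data.Unit using (tt; ⊤)
open import Data.Vec using ([]; _∷_)
open import Function using (_∘_; id)
open import Function.Bundles using (Inverse; _↔_; mk↔ₛ′)
open import Function.Properties.Inverse using (↔-sym; ↔-trans)
open import Relation.Binary using (tri<; tri>; tri≈)
open import Relation.Binary.PropositionalEquality using (_≗_; _≡_; _≢_; cong; cong₂; refl; setoid; subst; subst₂; sym; trans)
open import Relation.Nullary using (Dec; does; no; yes; ¬_)
open import Relation.Nullary.Decidable using (_×-dec_; _⊎-dec_; dec-false; dec-true; recompute; toWitness; ¬?)
import Data.Bool.Properties as 𝔹
import Data.Fin.Permutation.Components as PC
import Data.Fin.Properties as Finₚ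
import Data.Nat.Properties as ℕₚ

-- No topology is available: a plane graph is a rotation system that satisfies Euler's formula in
-- every component. The Jordan curve theorem is replaced by one parity statement: a set of edges
-- that meets every face an even number of times is the cut of a 2-colouring of the vertices. A
-- spanning tree and a complementary dual tree prove it, and Euler's formula enters by counting
-- their edges. What the pursuit of a token needs from it is that a connected territory cannot touch
-- the interiors of three disjoint dual paths with common ends, a form of the non-planarity of K₃,₃.
-- As a face may border several components, these paths cross edges of the robber's component only,
-- while the cops use all edges. For Δ = 5, three moves change both coordinates of the robber by 7
-- and those of a cop by at most 6. The gain of one per trip is spent on one cop at a time.
-- Meanwhile the credit held against the others shrinks by up to 182 per trip, so the distance at
-- which a cop has to be noticed grows by a constant factor with each further cop. Hence the
-- exponential board, on which the number of cops needed is even linear in log n.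

-- Strategies from winning trees (cops) and from invariants (robber).

module PlayingOut where
  open import Data.Fin.Properties using (any?; all?)

  module Strategies (G : PlaneGraph) (k : ℕ) where
    open PlaneGraph G
    open Game G k hiding (CopsWin)

    vadj? : ∀ v w → Dec (VAdj v w)
    vadj? v w = any? (λ d → (tail d ≟ v) ×-dec (tail (α d) ≟ w))

    fadj? : ∀ f g → Dec (FAdj f g)
    fadj? f g = any? (λ d → (face d ≟ f) ×-dec (face (α d) ≟ g))

    robberMove? : ∀ v w → Dec (ValidRobberMove v w)
    robberMove? v w = (w ≟ v) ⊎-dec vadj? v w

    copMove? : ∀ c c′ → Dec (ValidCopMove c c′)
    copMove? c c′ = all? (λ i → (c′ i ≟ c i) ⊎-dec fadj? (c i) (c′ i))

    -- A well-founded game tree with the cops to move. Being inductive, it makes every play that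
    -- follows it end. The alternative in `step` is a capture directly after the cops' move, the
    -- second kind that `CaptureOccurs` admits.
    data Win (c : Config) (v : Fin V) : Set where
      done : Captured c v → Win c v
      step : (c′ : Config) → ValidCopMove c c′ →
             (Captured c′ v ⊎ (∀ v′ → ValidRobberMove v v′ → Win c′ v′)) → Win c v

    -- Configurations are functions, and only their pointwise equality can be tested; this takes the
    -- place of function extensionality.
    Win-resp : ∀ {c d v} → c ≗ d → Win c v → Win d v
    Win-resp e (done cap) = done λ f inc →
      let (i , p) = cap f inc in i , trans (sym (e i)) p
    Win-resp e (step c′ ok r) = step c′ (λ i → subst (λ x → (c′ i ≡ x) ⊎ FAdj x (c′ i)) (e i) (ok i)) r

    -- Capture does not depend on which cop stands where, so the cops may exchange roles. The next
    -- configuration has to be re-indexed backwards, hence the inverse `ρ`.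
    Win-perm : ∀ (π ρ : Fin k → Fin k) → (∀ i → π (ρ i) ≡ i) → (∀ i → ρ (π i) ≡ i) →
               ∀ {c d v} → (∀ i → d i ≡ c (π i)) → Win d v → Win c v
    Win-perm π ρ πρ ρπ e (done cap) = done λ f inc →
      let (i , p) = cap f inc in π i , trans (sym (e i)) p
    Win-perm π ρ πρ ρπ {c} {d} e (step c′ ok r) = step (λ i → c′ (ρ i))
      (λ i → subst (λ x → (c′ (ρ i) ≡ x) ⊎ FAdj x (c′ (ρ i)))
               (trans (e (ρ i)) (cong c (πρ i))) (ok (ρ i)))
      (case r)
      where
      case : (Captured c′ _ ⊎ (∀ v′ → ValidRobberMove _ v′ → Win c′ v′)) →
             Captured (λ i → c′ (ρ i)) _ ⊎ (∀ v′ → ValidRobberMove _ v′ → Win (λ i → c′ (ρ i)) v′)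
      case (inj₁ cap) = inj₁ λ f inc → let (i , p) = cap f inc in π i , trans (cong c′ (ρπ i)) p
      case (inj₂ w) = inj₂ λ v′ m → Win-perm π ρ πρ ρπ (λ i → cong c′ (sym (ρπ i))) (w v′ m)

    module _ (c₀ : Config) (w₀ : ∀ v → Win c₀ v) where

      continue : ∀ {c v} → Win c v → ∀ d w → Maybe (Win d w)
      continue (done _) d w = nothing
      continue (step c′ _ (inj₁ _)) d w = nothing
      continue {v = v} (step c′ _ (inj₂ next)) d w with all? (λ i → c′ i ≟ d i) | robberMove? v w
      ... | yes e | yes ok = just (Win-resp e (next w ok))
      ... | yes _ | no _   = nothing
      ... | no _  | _      = nothing

      -- A `CopStrategy` is shown the history and not the tree, so the subtree reached is recomputed
      -- from the history in every round. The value `nothing` belongs to histories that do not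
      -- follow the tree.
      recall : List State → ∀ c v → Maybe (Win c v)
      recall [] c v with all? (λ i → c₀ i ≟ c i)
      ... | yes e = just (Win-resp e (w₀ v))
      ... | no _  = nothing
      recall ((c₁ , v₁) ∷ h) c v with recall h c₁ v₁
      ... | just w  = continue w c v
      ... | nothing = nothing

      follow : ∀ {c v} → Maybe (Win c v) → Σ Config (ValidCopMove c)
      follow (just (step c′ ok _)) = c′ , ok
      follow {c} (just (done _))   = c , λ i → inj₁ refl
      follow {c} nothing           = c , λ i → inj₁ refl

      copStrategy : CopStrategy
      copStrategy = record
        { start = c₀
        ; move  = λ h c v → proj₁ (follow (recall h c v))
        ; valid = λ h c v → proj₂ (follow (recall h c v))
        }

      module _ (τ : RobberStrategy) where
        captures : ∀ {c v} (w : Win c v) {d h} (e : c ≗ d) t →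
                   run copStrategy τ t ≡ ((d , v) , h) →
                   recall h d v ≡ just (Win-resp e w) → CaptureOccurs copStrategy τ
        captures (done cap) {d} e t r q =
          t , inj₁ (subst (λ s → Captured (proj₁ (proj₁ s)) (proj₂ (proj₁ s))) (sym r)
                (λ f inc → let (i , p) = cap f inc in i , trans (sym (e i)) p))
        captures {v = v} (step c′ ok (inj₁ cap)) {d} {h} e t r q = t , inj₂ goal
          where
          goal : Captured (copsAt copStrategy τ (suc t)) (robberAt copStrategy τ t)
          goal rewrite r | q = cap
        captures {v = v} (step c′ ok (inj₂ next)) {d} {h} e t r q = goal
          where
          v′ = RobberStrategy.move τ h d v c′
          ok′ = RobberStrategy.valid τ h d v c′
          r′ : run copStrategy τ (suc t) ≡ ((c′ , v′) , ((d , v) ∷ h))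
          r′ rewrite r | q = refl
          goal : CaptureOccurs copStrategy τ
          -- Both tests succeed in an actual play. The equality they return need not be the
          -- reflexive one, which is why `captures` is stated for an arbitrary `e : c ≗ d`.
          goal with all? (λ i → c′ i ≟ c′ i) in eq₁ | robberMove? v v′ in eq₂
          ... | no ¬e | _ = ⊥-elim (¬e λ i → refl)
          ... | yes _ | no ¬ok = ⊥-elim (¬ok ok′)
          ... | yes e′ | yes ok″ = captures (next v′ ok″) e′ (suc t) r′ q′
            where
            q′ : recall ((d , v) ∷ h) c′ v′ ≡ just (Win-resp e′ (next v′ ok″))
            q′ rewrite q | eq₁ | eq₂ = refl

      copsWin : CopsWin G k
      copsWin = copStrategy , λ τ → win τ
        where
        win : ∀ τ → CaptureOccurs copStrategy τ
        win τ with all? (λ i → c₀ i ≟ c₀ i) in eq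
        ... | no ¬e = ⊥-elim (¬e λ i → refl)
        ... | yes e = captures τ (w₀ v₀) e 0 refl q
          where
          v₀ = RobberStrategy.start τ c₀
          q : recall [] c₀ v₀ ≡ just (Win-resp e (w₀ v₀))
          q rewrite eq = refl

    -- The robber's counterpart of `Win`. `S` is data, since the invariant may carry his current
    -- plan, so it too is recomputed from the history rather than merely known to hold.
    module _ (S : Config → Fin V → Set)
             (init : ∀ c → Σ (Fin V) (S c))
             (safe : ∀ {c v} → S c v → ¬ Captured c v)
             (evade : ∀ {c v} → S c v → ∀ c′ → ValidCopMove c c′ →
                      ¬ Captured c′ v × Σ (Fin V) (λ v′ → ValidRobberMove v v′ × S c′ v′)) where

      remember : ∀ {c v} → Maybe (S c v) → ∀ c′ v′ → Maybe (S c′ v′)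
      remember nothing c′ v′ = nothing
      remember {c} (just s) c′ v′ with copMove? c c′
      ... | no _ = nothing
      ... | yes ok with evade s c′ ok
      ...   | _ , w , _ , s′ with w ≟ v′
      ...     | yes refl = just s′
      ...     | no _     = nothing

      memory : List State → ∀ c v → Maybe (S c v)
      memory [] c v with init c
      ... | w , s with w ≟ v
      ...   | yes refl = just s
      ...   | no _     = nothing
      memory ((c₁ , v₁) ∷ h) c v = remember (memory h c₁ v₁) c v

      reply : ∀ {c v} → Maybe (S c v) → ∀ c′ → Σ (Fin V) (ValidRobberMove v)
      reply {v = v} nothing c′ = v , inj₁ refl
      reply {c} {v} (just s) c′ with copMove? c c′
      ... | no _   = v , inj₁ refl
      ... | yes ok with evade s c′ ok
      ...   | _ , w , m , _ = w , m

      robberStrategy : RobberStrategy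
      robberStrategy = record
        { start = λ c → proj₁ (init c)
        ; move  = λ h c v c′ → proj₁ (reply (memory h c v) c′)
        ; valid = λ h c v c′ → proj₂ (reply (memory h c v) c′)
        }

      remember-reply : ∀ {c v} (s : S c v) c′ → ValidCopMove c c′ →
                       ∃[ s′ ] (remember (just s) c′ (proj₁ (reply (just s) c′)) ≡ just s′)
      remember-reply {c} s c′ ok with copMove? c c′
      ... | no ¬ok = ⊥-elim (¬ok ok)
      ... | yes ok′ with evade s c′ ok′
      ...   | _ , w , m , s′ with w ≟ w
      ...     | yes refl = s′ , refl
      ...     | no ¬e    = ⊥-elim (¬e refl)

      Remembered : State × List State → Set
      Remembered ((c , v) , h) = ∃[ s ] (memory h c v ≡ just s)

      remembers : ∀ σ t → Remembered (run σ robberStrategy t)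
      remembers σ zero with init (CopStrategy.start σ)
      ... | w , s with w ≟ w
      ...   | yes refl = s , refl
      ...   | no ¬e    = ⊥-elim (¬e refl)
      remembers σ (suc t) with run σ robberStrategy t | remembers σ t
      ... | (c , v) , h | s , q rewrite q =
        remember-reply s (CopStrategy.move σ h c v) (CopStrategy.valid σ h c v)

      copsLose : ¬ CopsWin G k
      copsLose (σ , wins) with wins robberStrategy
      ... | t , inj₁ cap with run σ robberStrategy t | remembers σ t
      ...   | _ | s , _ = safe s cap
      copsLose (σ , wins) | t , inj₂ cap with run σ robberStrategy t | remembers σ t
      ...   | (c , v) , h | s , _ =
        proj₁ (evade s (CopStrategy.move σ h c v) (CopStrategy.valid σ h c v)) cap

-- Orbits of the rotation, and connectedness of the dual graph.

module Rotations where
  open import Data.List using (lookup)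

  iter-+ : ∀ {A : Set} (f : A → A) m n x → iter f (m + n) x ≡ iter f m (iter f n x)
  iter-+ f zero    n x = refl
  iter-+ f (suc m) n x = cong f (iter-+ f m n x)

  iter-inj : ∀ {A : Set} (f : A → A) → (∀ x y → f x ≡ f y → x ≡ y) →
             ∀ n x y → iter f n x ≡ iter f n y → x ≡ y
  iter-inj f inj zero    x y e = e
  iter-inj f inj (suc n) x y e = iter-inj f inj n x y (inj _ _ e)

  iter-period : ∀ {A : Set} (f : A → A) x p → iter f (suc p) x ≡ x →
                ∀ n → ∃[ r ] (r ≤ p × iter f n x ≡ iter f r x)
  iter-period f x p e zero = zero , z≤n , refl
  iter-period f x p e (suc n) with iter-period f x p e n
  ... | r , r≤p , q with r ℕₚ.≟ p
  ...   | yes refl = zero , z≤n , trans (cong f q) e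
  ...   | no r≢p   = suc r , ℕₚ.≤∧≢⇒< r≤p r≢p , cong f q

  module Faces (G : PlaneGraph) where
    open PlaneGraph G
    open IsPlaneMap plane

    face-σ : ∀ d → face (σ d) ≡ face (α d)
    face-σ d = trans (cong (face ∘ σ) (sym (α-invol d))) (face-φ (α d))

    face-σα : ∀ d → face (σ (α d)) ≡ face d
    face-σα d = face-φ d

    FAdj-sym : ∀ {f g} → FAdj f g → FAdj g f
    FAdj-sym (d , p , q) = α d , q , trans (cong face (α-invol d)) p

    Lazy : Fin F → Fin F → Set
    Lazy f g = (g ≡ f) ⊎ FAdj f g

    Lazy-sym : ∀ {f g} → Lazy f g → Lazy g f
    Lazy-sym (inj₁ e) = inj₁ (sym e)
    Lazy-sym (inj₂ a) = inj₂ (FAdj-sym a)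

    Lazy-dart : ∀ d → Lazy (face d) (face (α d))
    Lazy-dart d = inj₂ (d , refl , refl)

    Lazy-σ : ∀ d → Lazy (face d) (face (σ d))
    Lazy-σ d = subst (Lazy (face d)) (sym (face-σ d)) (Lazy-dart d)

    data Walk : ℕ → Fin F → Fin F → Set where
      []  : ∀ {f} → Walk 0 f f
      _∷_ : ∀ {n f g h} → Lazy f g → Walk n g h → Walk (suc n) f h

    Walk-snoc : ∀ {n f g h} → Walk n f g → Lazy g h → Walk (suc n) f h
    Walk-snoc [] l = l ∷ []
    Walk-snoc (k ∷ w) l = k ∷ Walk-snoc w l

    Walk-++ : ∀ {m n f g h} → Walk m f g → Walk n g h → Walk (m + n) f h
    Walk-++ [] w = w
    Walk-++ (l ∷ v) w = l ∷ Walk-++ v w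

    Walk-pad : ∀ {m n f g} → m ≤ n → Walk m f g → Walk n f g
    Walk-pad {n = zero} z≤n [] = []
    Walk-pad {n = suc n} z≤n [] = inj₁ refl ∷ Walk-pad {n = n} z≤n []
    Walk-pad (s≤s p) (l ∷ w) = l ∷ Walk-pad p w

    FConn : Fin F → Fin F → Set
    FConn f g = ∃[ n ] Walk n f g

    FConn-refl : ∀ {f} → FConn f f
    FConn-refl = 0 , []

    FConn-trans : ∀ {f g h} → FConn f g → FConn g h → FConn f h
    FConn-trans (_ , v) (_ , w) = _ , Walk-++ v w

    Lazy⇒FConn : ∀ {f g} → Lazy f g → FConn f g
    Lazy⇒FConn l = 1 , l ∷ []

    σ-FConn : ∀ n d → FConn (face d) (face (iter σ n d))
    σ-FConn zero d = FConn-refl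
    σ-FConn (suc n) d = FConn-trans (σ-FConn n d) (Lazy⇒FConn (Lazy-σ (iter σ n d)))

    tail-FConn : ∀ d d′ → tail d ≡ tail d′ → FConn (face d) (face d′)
    tail-FConn d d′ e with σ-trans d d′ e
    ... | n , q = subst (FConn (face d) ∘ face) q (σ-FConn n d)

    VConn-FConn : ∀ {v w} → Conn VAdj v w → ∀ d d′ → tail d ≡ v → tail d′ ≡ w →
                  FConn (face d) (face d′)
    VConn-FConn here d d′ p q = tail-FConn d d′ (trans p (sym q))
    VConn-FConn (fwd (e , p , q) c) d d′ r s =
      FConn-trans (tail-FConn d e (trans r (sym p)))
        (FConn-trans (Lazy⇒FConn (Lazy-dart e)) (VConn-FConn c (α e) d′ q s))
    VConn-FConn (bwd (e , p , q) c) d d′ r s =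
      FConn-trans (tail-FConn d (α e) (trans r (sym q)))
        (FConn-trans (Lazy⇒FConn (Lazy-sym (Lazy-dart e))) (VConn-FConn c e d′ p s))

    isolated-Conn : ∀ {v w} → Isolated v → Conn VAdj v w → v ≡ w
    isolated-Conn iso here = refl
    isolated-Conn iso (fwd (e , p , _) _) = ⊥-elim (iso e p)
    isolated-Conn iso (bwd (e , _ , q) _) = ⊥-elim (iso (α e) q)

    comp-FConn : ∀ d d′ → comp (tail d) ≡ comp (tail d′) → FConn (face d) (face d′)
    comp-FConn d d′ e = VConn-FConn (comp-conn _ _ e) d d′ refl refl

    BInc-FConn : ∀ {c f g} → BInc c f → BInc c g → FConn f g
    BInc-FConn (inj₁ (d , p , refl)) (inj₁ (d′ , q , refl)) = comp-FConn d d′ (trans p (sym q))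
    BInc-FConn (inj₁ (d , p , refl)) (inj₂ (v , iso , q , _)) =
      ⊥-elim (iso d (sym (isolated-Conn iso (comp-conn _ _ (trans q (sym p))))))
    BInc-FConn (inj₂ (v , iso , q , _)) (inj₁ (d , p , refl)) =
      ⊥-elim (iso d (sym (isolated-Conn iso (comp-conn _ _ (trans q (sym p))))))
    BInc-FConn (inj₂ (v , iso , p , refl)) (inj₂ (w , _ , q , refl))
      with isolated-Conn iso (comp-conn _ _ (trans p (sym q)))
    ... | refl = FConn-refl

    -- A path in the nesting tree alternates between faces and components. The induction along it
    -- therefore needs a version of connectedness to `g` for components too: all faces bordering the
    -- component have it.
    Meets : Fin K ⊎ Fin F → Fin F → Set
    Meets (inj₁ c) g = ∀ f → BInc c f → FConn f g
    Meets (inj₂ f) g = FConn f g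

    Conn-Meets : ∀ {x g} → Conn BRel x (inj₂ g) → Meets x g
    Conn-Meets here = FConn-refl
    Conn-Meets {inj₁ c} (fwd {y = inj₂ f} b r) f′ b′ = FConn-trans (BInc-FConn b′ b) (Conn-Meets r)
    Conn-Meets {inj₂ f} (bwd {y = inj₁ c} b r) = Conn-Meets r f b

    faces-connected : ∀ f g → FConn f g
    faces-connected f g = Conn-Meets (nest-conn (inj₂ f) (inj₂ g))

    -- Among the first `m + 2` iterates two coincide, as they are darts at one vertex; injectivity
    -- of `σ` cancels the common initial part.
    σ-period : ∀ {m} v → degree v ≤ suc m → ∀ d → tail d ≡ v → ∃[ p ] (p ≤ m × iter σ (suc p) d ≡ d)
    σ-period {m} v deg d td = found (pigeonhole (s≤s deg) slot)
      where
      tail-iter : ∀ n → tail (iter σ n d) ≡ v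
      tail-iter zero = td
      tail-iter (suc n) = trans (σ-tail _) (tail-iter n)
      member : ∀ n → iter σ n d ∈ filter (λ e → tail e ≟ v) (allFin D)
      member n = ∈-filter⁺ (λ e → tail e ≟ v) (∈-allFin _) (tail-iter n)
      slot : Fin (suc (suc m)) → Fin (degree v)
      slot i = index (member (toℕ i))
      found : (∃[ i ] ∃[ j ] (toℕ i < toℕ j × slot i ≡ slot j)) → ∃[ p ] (p ≤ m × iter σ (suc p) d ≡ d)
      found (i , j , i<j , eq) with ℕₚ.m≤n⇒∃[o]m+o≡n i<j
      ... | p , q = p , bound , iter-inj σ σ-inj (toℕ i) _ _ same
        where
        bound : p ≤ m
        bound = ℕₚ.≤-pred (ℕₚ.≤-trans (s≤s (ℕₚ.m≤n+m p (toℕ i)))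
                  (subst (_≤ suc m) (sym q) (ℕₚ.≤-pred (Data.Fin.Properties.toℕ<n j))))
          where import Data.Fin.Properties
        same : iter σ (toℕ i) (iter σ (suc p) d) ≡ iter σ (toℕ i) d
        same = trans (sym (iter-+ σ (toℕ i) (suc p) d))
          (trans (cong (λ n → iter σ n d) (trans (ℕₚ.+-suc (toℕ i) p) q))
            (trans (lookup-index (member (toℕ j)))
              (trans (cong (lookup (filter (λ e → tail e ≟ v) (allFin D))) (sym eq))
                (sym (lookup-index (member (toℕ i)))))))

-- Counting lemmas and greedily grown spanning trees.

module Forests where
  open import Data.Fin.Properties using (any?)
  open import Data.List using (lookup)
  open import Data.List.Relation.Unary.All as All using ([]; _∷_)
  open import Relation.Unary using (Decidable)

  lookup-injective : ∀ {A : Set} {xs : List A} → Unique xs → ∀ i j → lookup xs i ≡ lookup xs j → i ≡ j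
  lookup-injective (x≢ ∷ u) zero zero e = refl
  lookup-injective {xs = x ∷ xs} (x≢ ∷ u) zero (suc j) e = ⊥-elim (All¬⇒¬Any x≢ (subst (_∈ xs) (sym e) (∈-lookup j)))
  lookup-injective {xs = x ∷ xs} (x≢ ∷ u) (suc i) zero e = ⊥-elim (All¬⇒¬Any x≢ (subst (_∈ xs) e (∈-lookup i)))
  lookup-injective (x≢ ∷ u) (suc i) (suc j) e = cong suc (lookup-injective u i j e)

  unique-⊆-length : ∀ {A : Set} {xs ys : List A} → Unique xs → (∀ {x} → x ∈ xs → x ∈ ys) → length xs ≤ length ys
  unique-⊆-length {xs = xs} {ys} u sub = injective⇒≤ {f = f} inj
    where
    f : Fin (length xs) → Fin (length ys)
    f i = index (sub (∈-lookup i))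
    inj : ∀ {i j} → f i ≡ f j → i ≡ j
    inj {i} {j} e = lookup-injective u i j
      (trans (lookup-index (sub (∈-lookup i)))
        (trans (cong (lookup ys) e) (sym (lookup-index (sub (∈-lookup j))))))

  module _ {n} {P : Fin n → Set} (P? : Decidable P) where

    count-≥ : ∀ {xs} → Unique xs → (∀ {x} → x ∈ xs → P x) → length xs ≤ count P?
    count-≥ u all = unique-⊆-length u (λ i → ∈-filter⁺ P? (∈-allFin _) (all i))

    count-≤ : ∀ {xs} → (∀ x → P x → x ∈ xs) → count P? ≤ length xs
    count-≤ all = unique-⊆-length (filter⁺ P? (allFin⁺ n)) (λ i → all _ (proj₂ (∈-filter⁻ P? {xs = allFin n} i)))

  some-face : ∀ (G : PlaneGraph) {n} → ∃[ v ] (PlaneGraph.degree G v ≡ suc n) → Fin (PlaneGraph.F G)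
  some-face G {n} (v , deg) = pick (Finₚ.any? (λ d → tail d ≟ v))
    where
    open PlaneGraph G
    pick : Dec (∃[ d ] (tail d ≡ v)) → Fin F
    pick (yes (d , _)) = face d
    pick (no none) = ⊥-elim (ℕₚ.1+n≰n (ℕₚ.≤-trans (ℕₚ.≤-trans (ℕₚ.≤-reflexive (sym deg))
      (count-≤ (λ d → tail d ≟ v) {[]} (λ d e → ⊥-elim (none (d , e))))) (z≤n {n})))

  ∉-unique : ∀ {A : Set} {x : A} {xs} → x ∉ xs → Unique xs → Unique (x ∷ xs)
  ∉-unique x∉ u = ¬Any⇒All¬ _ x∉ ∷ u

  -- A tree grown from a root: each new dart leaves a new vertex towards the
  -- vertices already reached.
  module Growing {n m : ℕ} (src tgt : Fin m → Fin n) (P : Fin m → Set) (P? : Decidable P) (r₀ : Fin n) where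

    open import Data.List.Membership.DecPropositional (_≟_ {n}) using (_∈?_)

    data Tree : List (Fin n) → List (Fin m) → Set where
      root : Tree (r₀ ∷ []) []
      grow : ∀ {vs ds} → Tree vs ds → ∀ d → P d → src d ∉ vs → tgt d ∈ vs → Tree (src d ∷ vs) (d ∷ ds)

    Closed : List (Fin n) → Set
    Closed vs = ∀ d → P d → tgt d ∈ vs → src d ∈ vs

    unique : ∀ {vs ds} → Tree vs ds → Unique vs
    unique root = [] ∷ []
    unique (grow t d _ new _) = ∉-unique new (unique t)

    length-vs : ∀ {vs ds} → Tree vs ds → length vs ≡ suc (length ds)
    length-vs root = refl
    length-vs (grow t _ _ _ _) = cong suc (length-vs t)

    root∈ : ∀ {vs ds} → Tree vs ds → r₀ ∈ vs
    root∈ root = here refl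
    root∈ (grow t _ _ _ _) = there (root∈ t)

    src∈ : ∀ {vs ds} → Tree vs ds → ∀ {d} → d ∈ ds → src d ∈ vs
    src∈ (grow t d _ _ _) (here refl) = here refl
    src∈ (grow t d _ _ _) (there i) = there (src∈ t i)

    tgt∈ : ∀ {vs ds} → Tree vs ds → ∀ {d} → d ∈ ds → tgt d ∈ vs
    tgt∈ (grow t d _ _ old) (here refl) = there old
    tgt∈ (grow t d _ _ _) (there i) = there (tgt∈ t i)

    P∈ : ∀ {vs ds} → Tree vs ds → ∀ {d} → d ∈ ds → P d
    P∈ (grow t d p _ _) (here refl) = p
    P∈ (grow t d _ _ _) (there i) = P∈ t i

    unique-ds : ∀ {vs ds} → Tree vs ds → Unique ds
    unique-ds root = []
    unique-ds (grow t d _ new _) = ∉-unique (λ i → new (src∈ t i)) (unique-ds t)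

    -- If both directions of an edge were present, the later one would leave a vertex that the
    -- earlier one had already made part of the tree.
    oriented : (β : Fin m → Fin m) → (∀ d → src (β d) ≡ tgt d) → (∀ d → tgt (β d) ≡ src d) → (∀ d → β d ≢ d) →
               ∀ {vs ds} → Tree vs ds → ∀ {d} → d ∈ ds → β d ∉ ds
    oriented β s t nofix (grow tr d _ new _) (here refl) (here e) = nofix d e
    oriented β s t nofix (grow tr d _ new _) (here refl) (there j) = new (subst (_∈ _) (t d) (tgt∈ tr j))
    oriented β s t nofix (grow tr d _ new _) {e} (there i) (here q) =
      new (subst (_∈ _) (trans (sym (s e)) (cong src q)) (tgt∈ tr i))
    oriented β s t nofix (grow tr d _ new _) (there i) (there j) = oriented β s t nofix tr i j

    spanning : ∃[ vs ] ∃[ ds ] (Tree vs ds × Closed vs)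
    spanning = extend n root (ℕₚ.m≤m+n n 1)
      where
      extend : ∀ k {vs ds} → Tree vs ds → n ≤ k + length vs → ∃[ vs ] ∃[ ds ] (Tree vs ds × Closed vs)
      extend k {vs} {ds} t le with any? (λ d → P? d ×-dec (tgt d ∈? vs) ×-dec ¬? (src d ∈? vs))
      ... | no ¬x = vs , ds , t , closed
        where
        closed : Closed vs
        closed d p i with src d ∈? vs
        ... | yes j = j
        ... | no ¬j = ⊥-elim (¬x (d , p , i , ¬j))
      extend zero {vs} t le | yes (d , p , i , new) = ⊥-elim (ℕₚ.<-irrefl refl
        (ℕₚ.≤-trans (s≤s le) (subst (suc (length vs) ≤_) (Data.List.Properties.length-tabulate {n = n} (λ z → z))
          (unique-⊆-length (∉-unique new (unique t)) (λ _ → ∈-allFin _)))))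
        where import Data.List.Properties
      extend (suc k) {vs} t le | yes (d , p , i , new) =
        extend k (grow t d p new i) (subst (n ≤_) (sym (ℕₚ.+-suc k (length vs))) le)

-- Three cops win when no degree exceeds three.

module DegreeThree where
  open PlayingOut
  open Forests
  open Rotations
  open import Data.Fin.Patterns

  module ThreeCops (G : PlaneGraph) (deg≤3 : ∀ v → PlaneGraph.degree G v ≤ 3) where
    open PlaneGraph G
    open IsPlaneMap plane
    open Game G 3 hiding (CopsWin)
    open Strategies G 3
    open Faces G

    Side : Fin D → Fin F → Fin F → Set
    Side e x y = (face e ≡ x × face (α e) ≡ y) ⊎ (face e ≡ y × face (α e) ≡ x)

    Side-sym : ∀ {e x y} → Side e x y → Side e y x
    Side-sym (inj₁ p) = inj₂ p
    Side-sym (inj₂ p) = inj₁ p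

    -- t₁ t₂ t₃ list the faces around v, with repetitions when deg v < 3.
    record Tri (v : Fin V) (t₁ t₂ t₃ : Fin F) : Set where
      field
        cover : ∀ f → Incident v f → f ≡ t₁ ⊎ f ≡ t₂ ⊎ f ≡ t₃
        adj₁₂ : Lazy t₁ t₂
        adj₁₃ : Lazy t₁ t₃
        adj₂₃ : Lazy t₂ t₃
        edges : ∀ e → tail e ≡ v → Side e t₁ t₂ ⊎ Side e t₁ t₃ ⊎ Side e t₂ t₃

    open Tri

    swap₁₂ : ∀ {v a b c} → Tri v a b c → Tri v b a c
    swap₁₂ T .cover f i with cover T f i
    ... | inj₁ p = inj₂ (inj₁ p)
    ... | inj₂ (inj₁ p) = inj₁ p
    ... | inj₂ (inj₂ p) = inj₂ (inj₂ p)
    swap₁₂ T .adj₁₂ = Lazy-sym (adj₁₂ T)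
    swap₁₂ T .adj₁₃ = adj₂₃ T
    swap₁₂ T .adj₂₃ = adj₁₃ T
    swap₁₂ T .edges e p with edges T e p
    ... | inj₁ s = inj₁ (Side-sym s)
    ... | inj₂ (inj₁ s) = inj₂ (inj₂ s)
    ... | inj₂ (inj₂ s) = inj₂ (inj₁ s)

    swap₂₃ : ∀ {v a b c} → Tri v a b c → Tri v a c b
    swap₂₃ T .cover f i with cover T f i
    ... | inj₁ p = inj₁ p
    ... | inj₂ (inj₁ p) = inj₂ (inj₂ p)
    ... | inj₂ (inj₂ p) = inj₂ (inj₁ p)
    swap₂₃ T .adj₁₂ = adj₁₃ T
    swap₂₃ T .adj₁₃ = adj₁₂ T
    swap₂₃ T .adj₂₃ = Lazy-sym (adj₂₃ T)
    swap₂₃ T .edges e p with edges T e p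
    ... | inj₁ s = inj₂ (inj₁ s)
    ... | inj₂ (inj₁ s) = inj₁ s
    ... | inj₂ (inj₂ s) = inj₂ (inj₂ (Side-sym s))

    around : ∀ e → Tri (tail e) (face e) (face (α e)) (face (σ (σ e)))
    around e = go (σ-period (tail e) (deg≤3 _) e refl)
      where
      go : (∃[ p ] (p ≤ 2 × iter σ (suc p) e ≡ e)) → Tri (tail e) (face e) (face (α e)) (face (σ (σ e)))
      go (p , p≤2 , q) = record
        { cover = cov
        ; adj₁₂ = Lazy-dart e
        ; adj₁₃ = third p p≤2 q
        ; adj₂₃ = subst (λ f → Lazy f (face (σ (σ e)))) (face-σ e) (Lazy-σ (σ e))
        ; edges = λ d eq → side d (turn d eq)
        }
        where
        turn : ∀ d → tail d ≡ tail e → ∃[ r ] (r ≤ p × iter σ r e ≡ d)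
        turn d eq with σ-trans e d (sym eq)
        ... | n , s with iter-period σ e p q n
        ...   | r , r≤p , s′ = r , r≤p , trans (sym s′) s
        dart : ∀ d → (∃[ r ] (r ≤ p × iter σ r e ≡ d)) →
               face d ≡ face e ⊎ face d ≡ face (α e) ⊎ face d ≡ face (σ (σ e))
        dart d (0 , _ , refl) = inj₁ refl
        dart d (1 , _ , refl) = inj₂ (inj₁ (face-σ e))
        dart d (2 , _ , refl) = inj₂ (inj₂ refl)
        dart d (suc (suc (suc r)) , r≤p , _) with ℕₚ.≤-trans r≤p p≤2
        ... | s≤s (s≤s ())
        cov : ∀ f → Incident (tail e) f → f ≡ face e ⊎ f ≡ face (α e) ⊎ f ≡ face (σ (σ e))
        cov f (inj₁ (d , eq , refl)) = dart d (turn d eq)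
        cov f (inj₂ (iso , _)) = ⊥-elim (iso e refl)
        third : ∀ p → p ≤ 2 → iter σ (suc p) e ≡ e → Lazy (face e) (face (σ (σ e)))
        third 0 _ q = subst (Lazy (face e)) (trans (sym (face-σ e)) (cong face (sym (cong σ q)))) (Lazy-dart e)
        third 1 _ q = inj₁ (cong face q)
        third 2 _ q = Lazy-sym (subst (λ d → Lazy (face (σ (σ e))) (face d)) q (Lazy-σ (σ (σ e))))
        third (suc (suc (suc _))) (s≤s (s≤s ())) q
        side : ∀ d → (∃[ r ] (r ≤ p × iter σ r e ≡ d)) →
               Side d (face e) (face (α e)) ⊎ Side d (face e) (face (σ (σ e))) ⊎ Side d (face (α e)) (face (σ (σ e)))
        side d (0 , _ , refl) = inj₁ (inj₁ (refl , refl))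
        side d (1 , _ , refl) = inj₂ (inj₂ (inj₁ (face-σ e , sym (face-σ (σ e)))))
        side d (2 , r≤p , refl) = inj₂ (inj₁ (inj₂ (refl , trans (sym (face-σ (σ (σ e))))
          (cong face (subst (λ p → iter σ (suc p) e ≡ e) (ℕₚ.≤-antisym p≤2 r≤p) q)))))
        side d (suc (suc (suc r)) , r≤p , _) with ℕₚ.≤-trans r≤p p≤2
        ... | s≤s (s≤s ())

    tri : ∀ v → ∃[ a ] ∃[ b ] ∃[ c ] Tri v a b c
    tri v with isolated? v
    ... | yes iso = ivFace v , ivFace v , ivFace v , record
        { cover = λ { f (inj₁ (d , p , _)) → ⊥-elim (iso d p) ; f (inj₂ (_ , p)) → inj₁ (sym p) }
        ; adj₁₂ = inj₁ refl ; adj₁₃ = inj₁ refl ; adj₂₃ = inj₁ refl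
        ; edges = λ e p → ⊥-elim (iso e p) }
    ... | no ¬iso with some-dart v ¬iso
      where
      open import Data.Fin.Properties using (any?)
      open import Relation.Nullary.Decidable using (decidable-stable)
      some-dart : ∀ v → ¬ Isolated v → ∃[ d ] tail d ≡ v
      some-dart v ¬iso with any? (λ d → tail d ≟ v)
      ... | yes x = x
      ... | no ¬x = ⊥-elim (¬iso λ d p → ¬x (d , p))
    ...   | d , refl = _ , _ , _ , around d

    Replace : Fin V → (t₁ t₂ t₃ : Fin F) → Set
    Replace w t₁ t₂ t₃ = (∃[ g ] Tri w g t₂ t₃) ⊎ (∃[ g ] Tri w t₁ g t₃) ⊎ (∃[ g ] Tri w t₁ t₂ g)

    arrive : ∀ e {x y} → Side e x y → ∃[ g ] Tri (tail (α e)) x y g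
    arrive e (inj₂ (refl , refl)) =
      _ , subst (λ f → Tri (tail (α e)) (face (α e)) f (face (σ (σ (α e))))) (cong face (α-invol e)) (around (α e))
    arrive e (inj₁ (refl , refl)) = _ , swap₁₂ (proj₂ (arrive e (inj₂ (refl , refl))))

    robber-moves : ∀ {v w a b c} → Tri v a b c → ValidRobberMove v w → Replace w a b c
    -- Staying put counts as replacing the first face by itself.
    robber-moves T (inj₁ refl) = inj₁ (_ , T)
    robber-moves T (inj₂ (e , p , refl)) with edges T e p
    ... | inj₁ s = inj₂ (inj₂ (arrive e s))
    ... | inj₂ (inj₁ s) = inj₂ (inj₁ (_ , swap₂₃ (proj₂ (arrive e s))))
    ... | inj₂ (inj₂ s) = inj₁ (_ , swap₁₂ (swap₂₃ (proj₂ (arrive e s))))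

    cops : Fin F → Fin F → Fin F → Config
    cops x y z 0F = x
    cops x y z 1F = y
    cops x y z 2F = z

    Next : Config → Fin V → Set
    Next c v = Captured c v ⊎ (∀ w → ValidRobberMove v w → Win c w)

    advance : ∀ {c c′ v} → ValidCopMove c c′ → Next c′ v → Win c v
    advance ok n = step _ ok n

    Win₁₂ : ∀ {x y z v} → Win (cops x y z) v → Win (cops y x z) v
    Win₁₂ = Win-perm π π inv inv λ { 0F → refl ; 1F → refl ; 2F → refl }
      where
      π : Fin 3 → Fin 3
      π 0F = 1F
      π 1F = 0F
      π 2F = 2F
      inv : ∀ i → π (π i) ≡ i
      inv 0F = refl
      inv 1F = refl
      inv 2F = refl

    Win₂₃ : ∀ {x y z v} → Win (cops x y z) v → Win (cops x z y) v
    Win₂₃ = Win-perm π π inv inv λ { 0F → refl ; 1F → refl ; 2F → refl }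
      where
      π : Fin 3 → Fin 3
      π 0F = 0F
      π 1F = 2F
      π 2F = 1F
      inv : ∀ i → π (π i) ≡ i
      inv 0F = refl
      inv 1F = refl
      inv 2F = refl

    moves : ∀ {x y z x′ y′ z′} → Lazy x x′ → Lazy y y′ → Lazy z z′ →
            ValidCopMove (cops x y z) (cops x′ y′ z′)
    moves p q r 0F = p
    moves p q r 1F = q
    moves p q r 2F = r

    caught : ∀ {v a b c} → Tri v a b c → Captured (cops a b c) v
    caught T f i with cover T f i
    ... | inj₁ refl = 0F , refl
    ... | inj₂ (inj₁ refl) = 1F , refl
    ... | inj₂ (inj₂ refl) = 2F , refl

    Goal₁ : ℕ → Set
    Goal₁ m = ∀ {v t₁ t₂ t₃ x₁ x₂ x₃ n₁ n₂ n₃} → Tri v t₁ t₂ t₃ →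
      Walk n₁ x₁ t₁ → Walk n₂ x₂ t₂ → Walk n₃ x₃ t₃ → n₁ + n₂ + n₃ ≤ m → Next (cops x₁ x₂ x₃) v

    -- A kept slot whose cop has not arrived: that cop advances, while the
    -- other two cops exchange roles to follow the replaced slot.
    rotate : ∀ {m v t₁ t₂ t₃ g x₁ x₂ x₃ n₁ n₂ n₃} → Goal₁ m → Tri v t₁ t₂ g →
             Lazy t₃ t₂ → Walk (suc n₁) x₁ t₁ → Walk n₂ x₂ t₂ → Walk n₃ x₃ t₃ →
             n₁ + n₂ + n₃ ≤ m → Win (cops x₁ x₂ x₃) v
    -- The two walks of the exchanging cops become longer by one edge and shorter by one step, so
    -- their lengths are unchanged; the first walk alone changes the sum, which falls by one.
    rotate ih T l (k ∷ w₁) w₂ w₃ le with Walk-snoc w₂ (adj₂₃ T) | Walk-snoc w₃ l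
    ... | k₂ ∷ w₂′ | k₃ ∷ w₃′ = advance (moves k k₂ k₃) (ih (swap₂₃ T) w₁ w₂′ w₃′ le)

    -- All cops but the third have arrived; a is the face the third one misses,
    -- p is the pivot and q the remaining face.
    Goal₂ : ℕ → Set
    Goal₂ m = ∀ {v a p q x} → Tri v a p q → Walk m x a → Walk m x p → Next (cops q p x) v

    -- The face `q` is the only empty one. If the robber keeps it, the third cop comes closer
    -- through `rotate`. If he replaces it, the cop on `a` steps onto the new face and the third cop
    -- heads for `a`, which is at distance `m` after his step.
    shift₃ : ∀ {m} → Goal₁ m → ∀ {v a p q x} → Tri v a p q → Walk m x p → Walk (suc m) x q →
             Next (cops a p x) v
    shift₃ {m} ih {v} {a} {p} {q} {x} T wp wq = inj₂ λ w mv → go (robber-moves T mv)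
      where
      flat : m + 0 + 0 ≤ m
      flat = ℕₚ.≤-reflexive (trans (ℕₚ.+-identityʳ _) (ℕₚ.+-identityʳ m))
      go : ∀ {w} → Replace w a p q → Win (cops a p x) w
      go (inj₁ (g , T′)) = Win₁₂ (Win₂₃ (Win₁₂
        (rotate ih (swap₁₂ (swap₂₃ (swap₁₂ T′))) (adj₁₂ T) wq [] [] flat)))
      go (inj₂ (inj₁ (g , T′))) = Win₂₃ (Win₁₂
        (rotate ih (swap₁₂ (swap₂₃ T′)) (Lazy-sym (adj₁₂ T)) wq [] [] flat))
      go (inj₂ (inj₂ (g , T′))) with Walk-snoc wp (Lazy-sym (adj₁₂ T))
      ... | k ∷ w₃ = advance (moves (adj₁₃ T′) (inj₁ refl) k)
        (ih (swap₁₂ (swap₂₃ (swap₁₂ T′))) [] [] w₃ ℕₚ.≤-refl)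

    -- If the empty face `a` is kept, `rotate` shortens the only walk left. If it is replaced, the
    -- cop on `q` takes the new face, so that `q` becomes the empty one; the third cop steps towards
    -- `p`, and `shift₃` makes the gain one round later.
    shift₂ : ∀ {m} → Goal₁ m → Goal₂ (suc m)
    shift₂ {m} ih {v} {a} {p} {q} {x} T wa (k ∷ w₃) = inj₂ λ w mv → go (robber-moves T mv)
      where
      flat : m + 0 + 0 ≤ m
      flat = ℕₚ.≤-reflexive (trans (ℕₚ.+-identityʳ _) (ℕₚ.+-identityʳ m))
      go : ∀ {w} → Replace w a p q → Win (cops q p x) w
      go (inj₁ (g , T′)) = advance (moves (Lazy-sym (adj₁₃ T′)) (inj₁ refl) k)
        (shift₃ ih T′ w₃ (Walk-snoc w₃ (adj₂₃ T)))
      go (inj₂ (inj₁ (g , T′))) = Win₂₃ (Win₁₂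
        (rotate ih (swap₂₃ T′) (adj₂₃ T) wa [] [] flat))
      go (inj₂ (inj₂ (g , T′))) = Win₂₃ (Win₁₂ (Win₂₃
        (rotate ih T′ (Lazy-sym (adj₂₃ T)) wa [] [] flat)))

    -- A cop not yet on a kept face makes the sum fall by `rotate`. If both kept faces are occupied,
    -- only the walk to the replaced face is left and nothing can be gained at once. The cop on `t₁`
    -- then moves to the new face and leaves `t₁` to the third cop, who is within `suc m` of both
    -- `t₁` and `t₂`; `shift₂` and `shift₃` use this to force the gain later.
    approach : ∀ {m} → Goal₁ m → ∀ {v t₁ t₂ t₃ g x₁ x₂ x₃ n₁ n₂ n₃} → Tri v t₁ t₂ g →
               Lazy t₁ t₃ → Lazy t₂ t₃ → Walk n₁ x₁ t₁ → Walk n₂ x₂ t₂ → Walk n₃ x₃ t₃ →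
               n₁ + n₂ + n₃ ≤ suc m → Win (cops x₁ x₂ x₃) v
    approach ih {n₁ = suc n₁} T k l w₁ w₂ w₃ (s≤s le) = rotate ih T (Lazy-sym l) w₁ w₂ w₃ le
    approach ih {n₁ = zero} {suc n₂} T k l [] w₂ w₃ (s≤s le) =
      Win₁₂ (rotate ih (swap₁₂ T) (Lazy-sym k) w₂ [] w₃ (subst (λ s → s + _ ≤ _) (sym (ℕₚ.+-identityʳ n₂)) le))
    approach ih {n₁ = zero} {zero} T k l [] [] w₃ le with Walk-pad le w₃
    ... | j ∷ w = advance (moves (adj₁₃ T) (inj₁ refl) j)
      (shift₂ ih T (Walk-snoc w (Lazy-sym k)) (Walk-snoc w (Lazy-sym l)))

    chase : ∀ m → Goal₁ m
    chase zero {n₁ = zero} {zero} {zero} T [] [] [] _ = inj₁ (caught T)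
    chase (suc m) {v} {t₁} {t₂} {t₃} {x₁} {x₂} {x₃} {n₁} {n₂} {n₃} T w₁ w₂ w₃ le =
      inj₂ λ w mv → go (robber-moves T mv)
      where
      go : ∀ {w} → Replace w t₁ t₂ t₃ → Win (cops x₁ x₂ x₃) w
      go (inj₁ (g , T′)) = Win₂₃ (Win₁₂ (Win₂₃ (approach (chase m) (swap₂₃ (swap₁₂ (swap₂₃ T′)))
        (Lazy-sym (adj₁₃ T)) (Lazy-sym (adj₁₂ T)) w₃ w₂ w₁
        (subst (_≤ suc m) (trans (ℕₚ.+-comm (n₁ + n₂) n₃)
          (trans (cong (n₃ +_) (ℕₚ.+-comm n₁ n₂)) (sym (ℕₚ.+-assoc n₃ n₂ n₁)))) le))))
      go (inj₂ (inj₁ (g , T′))) = Win₂₃ (approach (chase m) (swap₂₃ T′)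
        (adj₁₂ T) (Lazy-sym (adj₂₃ T)) w₁ w₃ w₂
        (subst (_≤ suc m) (trans (ℕₚ.+-assoc n₁ n₂ n₃)
          (trans (cong (n₁ +_) (ℕₚ.+-comm n₂ n₃)) (sym (ℕₚ.+-assoc n₁ n₃ n₂)))) le))
      go (inj₂ (inj₂ (g , T′))) = approach (chase m) T′ (adj₁₃ T) (adj₂₃ T) w₁ w₂ w₃ le

    three-cops-win : Fin F → CopsWin G 3
    three-cops-win f₀ = copsWin (cops f₀ f₀ f₀) start
      where
      start : ∀ v → Win (cops f₀ f₀ f₀) v
      start v with tri v
      ... | a , b , c , T with faces-connected f₀ a | faces-connected f₀ b | faces-connected f₀ c
      ...   | n₁ , w₁ | n₂ , w₂ | n₃ , w₃ =
        step _ (λ _ → inj₁ refl) (chase (n₁ + n₂ + n₃) T w₁ w₂ w₃ ℕₚ.≤-refl)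

  three-suffice : ∀ (G : PlaneGraph) → MaxDegree G 3 → CopsWin G 3
  three-suffice G Δ = ThreeCops.three-cops-win G (proj₁ Δ) (some-face G (proj₂ Δ))

  exactly-three : ∀ (G : PlaneGraph) → MaxDegree G 3 → (∀ j → j < 3 → ¬ CopsWin G j) → Σ PlaneGraph (λ G → MaxDegree G 3 × CopNumberIs G 3)
  exactly-three G Δ lose = G , Δ , three-suffice G Δ , lose

-- A combinatorial Jordan curve theorem over the field with two elements.

module JordanCurves where
  open Rotations
  open Forests
  open import Data.List using (map)
  open import Algebra.Properties.CommutativeMonoid.Sum

    (CommutativeRing.+-commutativeMonoid 𝔹.xor-∧-commutativeRing) public
    using (sum; sum-cong-≗; ∑-distrib-+; ∑-permute; sum-replicate-zero)

  sum-zero : ∀ {n} (f : Fin n → Bool) → (∀ i → f i ≡ false) → sum f ≡ false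
  sum-zero {n} f z = trans (sum-cong-≗ z) (sum-replicate-zero n)

  sum-single : ∀ {n} (f : Fin n → Bool) i → (∀ j → j ≢ i → f j ≡ false) → sum f ≡ f i
  sum-single f zero z = trans (cong (f zero xor_) (sum-zero (f ∘ suc) λ j → z (suc j) λ ()))
    (𝔹.xor-identityʳ (f zero))
  sum-single f (suc i) z = trans (cong (_xor sum (f ∘ suc)) (z zero λ ()))
    (sum-single (f ∘ suc) i λ j j≢i → z (suc j) λ { refl → j≢i refl })

  xor-cancel : ∀ x y → x xor (x xor y) ≡ y
  xor-cancel x y = trans (sym (𝔹.xor-assoc x x y)) (cong (_xor y) (𝔹.xor-same x))

  xor-false⇒≡ : ∀ x y → x xor y ≡ false → x ≡ y
  xor-false⇒≡ x y e = trans (sym (trans (cong (x xor_) e) (𝔹.xor-identityʳ x))) (xor-cancel x y)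

  module Colouring (G : PlaneGraph) (base : Fin (PlaneGraph.D G)) where
    open PlaneGraph G
    open IsPlaneMap plane
    open Faces G

    κ₀ : Fin K
    κ₀ = comp (tail base)

    Here : Fin D → Set
    Here d = comp (tail d) ≡ κ₀

    Here-α : ∀ {d} → Here d → Here (α d)
    Here-α {d} h = trans (comp-edge d) h

    Here-tail : ∀ {d e} → tail d ≡ tail e → Here d → Here e
    Here-tail q h = trans (cong comp (sym q)) h

    σ-pre : ∀ e → ∃[ d ] σ d ≡ e
    σ-pre e with σ-trans (σ e) e (σ-tail e)
    ... | n , q = iter σ n e , trans (shift n) q
      where
      shift : ∀ n → σ (iter σ n e) ≡ iter σ n (σ e)
      shift zero = refl
      shift (suc n) = cong σ (shift n)

    φ⁻¹ : Fin D → Fin D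
    φ⁻¹ e = α (proj₁ (σ-pre e))

    φφ⁻¹ : ∀ e → φ (φ⁻¹ e) ≡ e
    φφ⁻¹ e = trans (cong σ (α-invol _)) (proj₂ (σ-pre e))

    α-inj : ∀ {x y} → α x ≡ α y → x ≡ y
    α-inj {x} {y} e = trans (sym (α-invol x)) (trans (cong α e) (α-invol y))

    φ-inj : ∀ {x y} → φ x ≡ φ y → x ≡ y
    φ-inj e = α-inj (σ-inj _ _ e)

    φ⁻¹φ : ∀ e → φ⁻¹ (φ e) ≡ e
    φ⁻¹φ e = φ-inj (φφ⁻¹ (φ e))

    on : Fin F → Fin D → Bool
    on f d = does (face d ≟ f)

    boundary : Fin F → (Fin D → Bool) → Bool
    boundary f z = sum λ d → on f d ∧ z d

    boundary-cong : ∀ f {y z} → (∀ d → y d ≡ z d) → boundary f y ≡ boundary f z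
    boundary-cong f e = sum-cong-≗ λ d → cong (on f d ∧_) (e d)

    boundary-xor : ∀ f y z → boundary f (λ d → y d xor z d) ≡ boundary f y xor boundary f z
    boundary-xor f y z = trans (sum-cong-≗ λ d → 𝔹.∧-distribˡ-xor (on f d) (y d) (z d)) (∑-distrib-+ (λ d → on f d ∧ y d) (λ d → on f d ∧ z d))

    δ : (Fin V → Bool) → Fin D → Bool
    δ κ d = κ (tail d) xor κ (tail (α d))

    -- Walking round a face, the head of `d` is the tail of `φ d`; as `φ` permutes the darts of `f`,
    -- heads and tails contribute the same sum.
    boundary-δ : ∀ f κ → boundary f (δ κ) ≡ false
    boundary-δ f κ = trans (boundary-xor f (κ ∘ tail) (κ ∘ tail ∘ α))
      (trans (cong (_xor boundary f (κ ∘ tail ∘ α)) reindexed) (𝔹.xor-same (boundary f (κ ∘ tail ∘ α))))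
      where
      reindexed : boundary f (κ ∘ tail) ≡ boundary f (κ ∘ tail ∘ α)
      reindexed = trans (∑-permute (λ d → on f d ∧ κ (tail d)) (permutation φ φ⁻¹ φφ⁻¹ φ⁻¹φ))
        (sum-cong-≗ λ d → cong₂ (λ g v → does (g ≟ f) ∧ κ v) (face-φ d) (σ-tail (α d)))

    open module TV = Growing tail (tail ∘ α) (λ _ → ⊤) (λ _ → yes tt) (tail base)
      using () renaming (Tree to VTree; root to vroot; grow to vgrow)

    abstract
      primal : ∃[ vs ] ∃[ ds ] (VTree vs ds × TV.Closed vs)
      primal = TV.spanning

    vs = proj₁ primal
    ds = proj₁ (proj₂ primal)
    vtree = proj₁ (proj₂ (proj₂ primal))
    vclosed = proj₂ (proj₂ (proj₂ primal))

    vs-comp : ∀ {ws es} → VTree ws es → ∀ {v} → v ∈ ws → comp v ≡ κ₀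
    vs-comp vroot (here refl) = refl
    vs-comp (vgrow t d _ _ old) (here refl) = trans (sym (comp-edge d)) (vs-comp t old)
    vs-comp (vgrow t d _ _ _) (there i) = vs-comp t i

    vs-all : ∀ v → comp v ≡ κ₀ → v ∈ vs
    vs-all v e = reach (comp-conn (tail base) v (sym e)) (TV.root∈ vtree)
      where
      reach : ∀ {v w} → Conn VAdj v w → v ∈ vs → w ∈ vs
      reach here i = i
      reach (fwd (e , refl , refl) c) i =
        reach c (vclosed (α e) tt (subst (_∈ vs) (cong tail (sym (α-invol e))) i))
      reach (bwd (e , refl , refl) c) i = reach c (vclosed e tt i)

    Free : List (Fin D) → Fin D → Set
    Free es e = e ∉ es × α e ∉ es × Here e

    data Link (es : List (Fin D)) : Fin F → Fin F → Set where
      stop : ∀ {f} → Link es f f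
      hop  : ∀ {g} e → Free es e → Link es (face (α e)) g → Link es (face e) g

    Link-trans : ∀ {es f g h} → Link es f g → Link es g h → Link es f h
    Link-trans stop m = m
    Link-trans (hop e p l) m = hop e p (Link-trans l m)

    Free-α : ∀ {es e} → Free es e → Free es (α e)
    Free-α {es} {e} (p , q , h) = q , (λ i → p (subst (_∈ es) (α-invol e) i)) , Here-α h

    Link-hop : ∀ {es} e → Free es e → Link es (face e) (face (α e))
    Link-hop e p = hop e p stop

    Link-sym : ∀ {es f g} → Link es f g → Link es g f
    Link-sym stop = stop
    Link-sym {es} (hop e p l) = Link-trans (Link-sym l)
      (subst (Link es (face (α e))) (cong face (α-invol e)) (Link-hop (α e) (Free-α p)))

    Link-σ : ∀ {es} e → Free es e → Link es (face e) (face (σ e))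
    Link-σ {es} e p = subst (Link es (face e)) (sym (face-σ e)) (Link-hop e p)

    tail-iter : ∀ n d → tail (iter σ n d) ≡ tail d
    tail-iter zero d = refl
    tail-iter (suc n) d = trans (σ-tail _) (tail-iter n d)

    -- When a vertex is attached by the dart d, crossing d is replaced by
    -- walking around the new vertex.
    linked : ∀ {ws es} → VTree ws es → ∀ x y → tail x ∈ ws → tail y ∈ ws → Link es (face x) (face y)
    linked vroot x y (here p) (here q) with σ-trans x y (trans p (sym q))
    ... | n , refl = spin n
      where
      spin : ∀ n → Link [] (face x) (face (iter σ n x))
      spin zero = stop
      spin (suc n) = Link-trans (spin n)
        (Link-σ _ ((λ ()) , (λ ()) , cong comp (trans (tail-iter n x) p)))
    linked {w ∷ ws} {.(d ∷ es)} (vgrow {ds = es} t d _ new old) x y px py =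
      Link-trans (Link-sym (anchor x px)) (anchor y py)
      where
      here-d : Here d
      here-d = vs-comp (vgrow t d tt new old) (here refl)
      spin : ∀ n → Link (d ∷ es) (face (σ d)) (face (iter σ n (σ d)))
      spin zero = stop
      spin (suc n) with iter σ n (σ d) ≟ d
      ... | yes q = subst (Link (d ∷ es) (face (σ d)) ∘ face) (cong σ (sym q)) stop
      ... | no ¬q = Link-trans (spin n) (Link-σ e (e∉ , αe∉ , Here-tail (sym te) here-d))
        where
        e = iter σ n (σ d)
        te : tail e ≡ tail d
        te = trans (tail-iter n (σ d)) (σ-tail d)
        e∉ : e ∉ d ∷ es
        e∉ (here q) = ¬q q
        e∉ (there i) = new (subst (_∈ ws) te (TV.src∈ t i))
        αe∉ : α e ∉ d ∷ es
        αe∉ (here q) = new (subst (_∈ ws) (trans (cong tail (trans (cong α (sym q)) (α-invol e))) te) old)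
        αe∉ (there i) = new (subst (_∈ ws) (trans (cong tail (α-invol e)) te) (TV.tgt∈ t i))
      detour : Link (d ∷ es) (face (σ d)) (face d)
      detour with σ-trans (σ d) d (σ-tail d)
      ... | n , q = subst (Link (d ∷ es) (face (σ d)) ∘ face) q (spin n)
      widen : ∀ {f g} → Link es f g → Link (d ∷ es) f g
      widen stop = stop
      widen (hop e (p , q , h) l) with e ≟ d | α e ≟ d
      ... | yes refl | _ = Link-trans (subst (Link (d ∷ es) (face d)) (face-σ d) (Link-sym detour)) (widen l)
      ... | no _ | yes refl = Link-trans (subst (λ f → Link (d ∷ es) f (face d))
            (trans (face-σ d) (cong face (α-invol e))) detour) (widen l)
      ... | no ¬p | no ¬q = hop e ((λ { (here r) → ¬p r ; (there i) → p i })
                                  , (λ { (here r) → ¬q r ; (there i) → q i }) , h) (widen l)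
      anchor : ∀ x → tail x ∈ w ∷ ws → Link (d ∷ es) (face (α d)) (face x)
      anchor x (there i) = widen (linked t (α d) x old i)
      anchor x (here q) with σ-trans (σ d) x (trans (σ-tail d) (sym q))
      ... | n , refl = subst (λ f → Link (d ∷ es) f (face x)) (face-σ d) (spin n)

    open import Data.List.Membership.DecPropositional (_≟_ {D}) using () renaming (_∈?_ to _∈D?_)

    Free? : ∀ e → Dec (Free ds e)
    Free? e = ¬? (e ∈D? ds) ×-dec ¬? (α e ∈D? ds) ×-dec (comp (tail e) ≟ κ₀)

    open module TF = Growing face (face ∘ α) (Free ds) Free? (face base)
      using () renaming (Tree to FTree; root to froot; grow to fgrow)

    abstract
      dual : ∃[ fs ] ∃[ es ] (FTree fs es × TF.Closed fs)
      dual = TF.spanning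

    fs = proj₁ dual
    es = proj₁ (proj₂ dual)
    ftree = proj₁ (proj₂ (proj₂ dual))
    fclosed = proj₂ (proj₂ (proj₂ dual))

    fs-comp : ∀ {gs xs} → FTree gs xs → ∀ {f} → f ∈ gs → CompFace κ₀ f
    fs-comp froot (here refl) = base , refl , refl
    fs-comp (fgrow t d (_ , _ , h) _ _) (here refl) = d , h , refl
    fs-comp (fgrow t _ _ _ _) (there i) = fs-comp t i

    fs-all : ∀ f → CompFace κ₀ f → f ∈ fs
    fs-all f (d , h , refl) = reach (linked vtree base d (TV.root∈ vtree) (vs-all _ h)) (TF.root∈ ftree)
      where
      reach : ∀ {f g} → Link ds f g → f ∈ fs → g ∈ fs
      reach stop i = i
      reach (hop e p l) i =
        reach l (fclosed (α e) (Free-α p) (subst (_∈ fs) (cong face (sym (α-invol e))) i))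

    edges : List (Fin D)
    edges = (ds ++ map α ds) ++ (es ++ map α es)

    ds-here : ∀ {d} → d ∈ ds → Here d
    ds-here i = vs-comp vtree (TV.src∈ vtree i)

    es-free : ∀ {d} → d ∈ es → Free ds d
    es-free i = TF.P∈ ftree i

    tail-αα : ∀ d → tail (α (α d)) ≡ tail d
    tail-αα d = cong tail (α-invol d)

    face-αα : ∀ d → face (α (α d)) ≡ face d
    face-αα d = cong face (α-invol d)

    both : ∀ {xs} → Unique xs → (∀ {d} → d ∈ xs → α d ∉ xs) → Unique (xs ++ map α xs)
    both {xs} u o = ++⁺ u (map⁺ α-inj u) λ (i , j) → let (e , k , q) = ∈-map⁻ α j in
      o k (subst (_∈ xs) q i)

    edges-unique : Unique edges
    edges-unique = ++⁺ (both (TV.unique-ds vtree) (TV.oriented α (λ _ → refl) tail-αα α-nofix vtree))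
      (both (TF.unique-ds ftree) (TF.oriented α (λ _ → refl) face-αα α-nofix ftree)) disj
      where
      half : ∀ {d} → d ∈ ds ++ map α ds → d ∈ ds ⊎ α d ∈ ds
      half i with ∈-++⁻ ds i
      ... | inj₁ j = inj₁ j
      ... | inj₂ j = let (e , k , q) = ∈-map⁻ α j in
        inj₂ (subst (_∈ ds) (trans (sym (α-invol e)) (cong α (sym q))) k)
      free : ∀ {d} → d ∈ es ++ map α es → Free ds d
      free i with ∈-++⁻ es i
      ... | inj₁ j = es-free j
      ... | inj₂ j = let (e , k , q) = ∈-map⁻ α j in subst (Free ds) (sym q) (Free-α (es-free k))
      disj : ∀ {d} → d ∈ ds ++ map α ds × d ∈ es ++ map α es → ⊥
      disj (i , j) with half i | free j
      ... | inj₁ k | p , _ , _ = p k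
      ... | inj₂ k | _ , q , _ = q k

    edges-here : ∀ {d} → d ∈ edges → Here d
    edges-here i with ∈-++⁻ (ds ++ map α ds) i
    ... | inj₁ j with ∈-++⁻ ds j
    ...   | inj₁ k = ds-here k
    ...   | inj₂ k = let (e , m , q) = ∈-map⁻ α k in subst Here (sym q) (Here-α (ds-here m))
    edges-here i | inj₂ j with ∈-++⁻ es j
    ...   | inj₁ k = proj₂ (proj₂ (es-free k))
    ...   | inj₂ k = let (e , m , q) = ∈-map⁻ α k in subst Here (sym q) (Here-α (proj₂ (proj₂ (es-free m))))

    -- Here planarity enters. The tree has one edge fewer than the component has vertices, the dual
    -- tree at least one fewer than it has faces, and each edge counts for two darts; Euler's
    -- formula says that this already accounts for all darts.
    edges-length : nD κ₀ ≤ length edges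
    edges-length = ℕₚ.+-cancelʳ-≤ 4 _ _ (ℕₚ.≤-trans (ℕₚ.≤-reflexive (sym (euler κ₀ (base , refl))))
      (ℕₚ.≤-trans (ℕₚ.*-monoʳ-≤ 2 (ℕₚ.+-mono-≤ nV≤ nF≤)) (ℕₚ.≤-reflexive count-up)))
      where
      nV≤ : nV κ₀ ≤ suc (length ds)
      nV≤ = ℕₚ.≤-trans (count-≤ _ vs-all) (ℕₚ.≤-reflexive (TV.length-vs vtree))
      nF≤ : nF κ₀ ≤ suc (length es)
      nF≤ = ℕₚ.≤-trans (count-≤ (compFace? κ₀) fs-all) (ℕₚ.≤-reflexive (TF.length-vs ftree))
      len : ∀ (xs : List (Fin D)) → length (xs ++ map α xs) ≡ length xs + length xs
      len xs = trans (length-++ xs) (cong (length xs +_) (length-map α xs))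
      count-up : 2 * (suc (length ds) + suc (length es)) ≡ length edges + 4
      count-up = trans (arith (length ds) (length es))
        (cong (_+ 4) (sym (trans (length-++ (ds ++ map α ds)) (cong₂ _+_ (len ds) (len es)))))
        where
        open +-*-Solver
        arith : ∀ a b → 2 * (suc a + suc b) ≡ (a + a) + (b + b) + 4
        arith = solve 2 (λ a b → con 2 :* ((con 1 :+ a) :+ (con 1 :+ b)) :=
                  ((a :+ a) :+ (b :+ b)) :+ con 4) refl

    edges-all : ∀ d → Here d → d ∈ edges
    edges-all d h with d ∈D? edges
    ... | yes i = i
    ... | no ¬i = ⊥-elim (ℕₚ.<-irrefl refl (ℕₚ.≤-trans
      (count-≥ (λ d → comp (tail d) ≟ κ₀) (∉-unique ¬i edges-unique)
        λ { (here refl) → h ; (there i) → edges-here i }) edges-length))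

    -- κ is read off the tree; the defect z xor δ κ lives on the cotree, where
    -- evenness around the faces removes it leaf by leaf.
    module _ (z : Fin D → Bool) (z-α : ∀ d → z (α d) ≡ z d)
             (z-here : ∀ d → ¬ Here d → z d ≡ false)
             (even : ∀ f → boundary f z ≡ false) where

      potential : ∀ {ws xs} → VTree ws xs → Σ (Fin V → Bool) λ κ → ∀ {d} → d ∈ xs → z d ≡ δ κ d
      potential vroot = (λ _ → false) , λ ()
      potential (vgrow {vs = ws} {ds = xs} t d _ new old) with potential t
      ... | κ , good = κ′ , good′
        where
        κ′ : Fin V → Bool
        κ′ v = if does (v ≟ tail d) then z d xor κ (tail (α d)) else κ v
        κ′-old : ∀ {v} → v ∈ ws → κ′ v ≡ κ v
        κ′-old {v} i with v ≟ tail d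
        ... | yes refl = ⊥-elim (new i)
        ... | no _ = refl
        κ′-new : κ′ (tail d) ≡ z d xor κ (tail (α d))
        κ′-new with tail d ≟ tail d
        ... | yes _ = refl
        ... | no ¬p = ⊥-elim (¬p refl)
        good′ : ∀ {e} → e ∈ d ∷ xs → z e ≡ δ κ′ e
        good′ (here refl) = sym (trans (cong₂ _xor_ κ′-new (κ′-old old))
          (trans (𝔹.xor-assoc (z d) (κ (tail (α d))) (κ (tail (α d)))) (trans (cong (z d xor_) (𝔹.xor-same (κ (tail (α d))))) (𝔹.xor-identityʳ (z d)))))
        good′ (there i) = trans (good i) (sym (cong₂ _xor_ (κ′-old (TV.src∈ t i)) (κ′-old (TV.tgt∈ t i))))

      κ : Fin V → Bool
      κ = proj₁ (potential vtree)

      defect : Fin D → Bool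
      defect d = if does (comp (tail d) ≟ κ₀) then z d xor δ κ d else false

      defect-here : ∀ d → Here d → defect d ≡ z d xor δ κ d
      defect-here d h with comp (tail d) ≟ κ₀
      ... | yes _ = refl
      ... | no ¬h = ⊥-elim (¬h h)

      -- Cleared outside the component, so that `defect` equals `z xor δ κ″` on all darts and
      -- `boundary-δ` applies even to faces that border other components.
      κ″ : Fin V → Bool
      κ″ v = if does (comp v ≟ κ₀) then κ v else false

      defect-split : ∀ d → defect d ≡ z d xor δ κ″ d
      defect-split d with comp (tail d) ≟ κ₀ | comp (tail (α d)) ≟ κ₀
      ... | yes _ | yes _ = refl
      ... | yes h | no ¬h = ⊥-elim (¬h (Here-α h))
      ... | no ¬h | yes h = ⊥-elim (¬h (trans (sym (comp-edge d)) h))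
      ... | no ¬h | no _ = sym (trans (𝔹.xor-identityʳ (z d)) (z-here d ¬h))

      defect-even : ∀ f → boundary f defect ≡ false
      defect-even f = trans (boundary-cong f defect-split)
        (trans (boundary-xor f z (δ κ″)) (cong₂ _xor_ (even f) (boundary-δ f κ″)))

      defect-α : ∀ d → defect (α d) ≡ defect d
      defect-α d = trans (defect-split (α d)) (trans (cong₂ _xor_ (z-α d)
        (trans (cong (κ″ (tail (α d)) xor_) (cong κ″ (tail-αα d))) (𝔹.xor-comm (κ″ (tail (α d))) (κ″ (tail d))))) (sym (defect-split d)))

      defect-tree : ∀ {d} → d ∈ ds → defect d ≡ false
      defect-tree {d} i = trans (defect-here d (ds-here i))
        (trans (cong (_xor δ κ d) (proj₂ (potential vtree) i)) (𝔹.xor-same (δ κ d)))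

      peel : ∀ {gs xs} → FTree gs xs → (∀ d → d ∉ xs → α d ∉ xs → defect d ≡ false) → ∀ d → defect d ≡ false
      peel froot off d = off d (λ ()) (λ ())
      peel (fgrow {vs = gs} {ds = xs} t d p new old) off = peel t off′
        where
        leaf : defect d ≡ false
        leaf = trans (sym (trans (sum-single (λ e → on (face d) e ∧ defect e) d single) (cong (_∧ defect d) (dec-true (face d ≟ face d) refl))))
          (defect-even (face d))
          where
          single : ∀ e → e ≢ d → on (face d) e ∧ defect e ≡ false
          single e e≢d with face e ≟ face d
          ... | no _ = refl
          ... | yes q = off e
            (λ { (here r) → e≢d r ; (there i) → new (subst (_∈ gs) q (TF.src∈ t i)) })
            (λ { (here r) → new (subst (_∈ gs) (trans (cong (face ∘ α) (sym r)) (trans (face-αα e) q)) old)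
               ; (there i) → new (subst (_∈ gs) (trans (face-αα e) q) (TF.tgt∈ t i)) })
        off′ : ∀ e → e ∉ xs → α e ∉ xs → defect e ≡ false
        off′ e e∉ αe∉ with e ≟ d | α e ≟ d
        ... | yes refl | _ = leaf
        ... | no _ | yes q = trans (sym (defect-α e)) (trans (cong defect q) leaf)
        ... | no ¬p | no ¬q = off e (λ { (here r) → ¬p r ; (there i) → e∉ i })
                                     (λ { (here r) → ¬q r ; (there i) → αe∉ i })

      defect-zero : ∀ d → defect d ≡ false
      defect-zero = peel ftree outside
        where
        outside : ∀ d → d ∉ es → α d ∉ es → defect d ≡ false
        outside d d∉ αd∉ with comp (tail d) ≟ κ₀
        ... | no ¬h = refl
        ... | yes h with ∈-++⁻ (ds ++ map α ds) (edges-all d h)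
        ...   | inj₁ i with ∈-++⁻ ds i
        ...     | inj₁ j = trans (sym (defect-here d h)) (defect-tree j)
        ...     | inj₂ j = let (e , k , q) = ∈-map⁻ α j in
                  trans (sym (defect-here d h)) (trans (cong defect q) (trans (defect-α e) (defect-tree k)))
        outside d d∉ αd∉ | yes h | inj₂ i with ∈-++⁻ es i
        ...     | inj₁ j = ⊥-elim (d∉ j)
        ...     | inj₂ j = let (e , k , q) = ∈-map⁻ α j in
                  ⊥-elim (αd∉ (subst (_∈ es) (trans (sym (α-invol e)) (cong α (sym q))) k))

      -- Read dually, `z` is a set of closed curves through the faces, and `κ` tells on which side
      -- of them a vertex lies: exactly the edges in `z` join vertices of different colours.
      coloured : ∀ d → Here d → z d ≡ κ (tail d) xor κ (tail (α d))
      coloured d h = xor-false⇒≡ (z d) _ (trans (sym (defect-here d h)) (defect-zero d))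

-- Three disjoint dual paths with common ends.

module Thetas where
  open Rotations
  open Forests
  open JordanCurves
  open import Data.List using (map)

  xor-swap : ∀ a b c d → (a xor b) xor (c xor d) ≡ (a xor c) xor (b xor d)
  xor-swap true  true  c d = xor-swap′ c d
    where
    xor-swap′ : ∀ c d → c xor d ≡ not c xor not d
    xor-swap′ c d = sym (𝔹.xor-annihilates-not c d)
  xor-swap true  false c d = 𝔹.not-distribˡ-xor c d
  xor-swap false true  c d = 𝔹.not-distribʳ-xor c d
  xor-swap false false c d = refl

  module Theta (G : PlaneGraph) (base : Fin (PlaneGraph.D G)) where
    open PlaneGraph G
    open IsPlaneMap plane
    open Faces G
    open Colouring G base

    Path : Fin F → List (Fin D) → Fin F → Set
    Path a [] b = a ≡ b
    Path a (d ∷ ds) b = face d ≡ a × Here d × Path (face (α d)) ds b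

    sources targets : List (Fin D) → List (Fin F)
    sources = map face
    targets = map (face ∘ α)

    mark : Fin D → Fin D → Bool
    mark e d = does (e ≟ d) xor does (α e ≟ d)

    trace : List (Fin D) → Fin D → Bool
    trace [] d = false
    trace (e ∷ es) d = mark e d xor trace es d

    does-α : ∀ e d → does (e ≟ α d) ≡ does (α e ≟ d)
    does-α e d with e ≟ α d
    ... | yes refl = sym (dec-true (α (α d) ≟ d) (α-invol d))
    ... | no ¬p = sym (dec-false (α e ≟ d) λ q → ¬p (trans (sym (α-invol e)) (cong α q)))

    mark-α : ∀ e d → mark e (α d) ≡ mark e d
    mark-α e d = trans (cong₂ _xor_ (does-α e d) other) (𝔹.xor-comm (does (α e ≟ d)) (does (e ≟ d)))
      where
      other : does (α e ≟ α d) ≡ does (e ≟ d)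
      other = trans (does-α (α e) d) (cong (λ x → does (x ≟ d)) (α-invol e))

    trace-α : ∀ es d → trace es (α d) ≡ trace es d
    trace-α [] d = refl
    trace-α (e ∷ es) d = cong₂ _xor_ (mark-α e d) (trace-α es d)

    trace-here : ∀ es {a b d} → Path a es b → ¬ Here d → trace es d ≡ false
    trace-here [] p ¬h = refl
    trace-here (e ∷ es) {d = d} (_ , h , p) ¬h = cong₂ _xor_
      (cong₂ _xor_ (dec-false (e ≟ d) λ { refl → ¬h h }) (dec-false (α e ≟ d) λ { refl → ¬h (Here-α h) }))
      (trace-here es p ¬h)

    boundary-dart : ∀ f e → boundary f (λ d → does (e ≟ d)) ≡ does (face e ≟ f)
    boundary-dart f e = trans (sum-single _ e λ d d≢e →
        trans (cong (on f d ∧_) (dec-false (e ≟ d) (d≢e ∘ sym))) (𝔹.∧-zeroʳ (on f d)))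
      (trans (cong (on f e ∧_) (dec-true (e ≟ e) refl)) (𝔹.∧-identityʳ (on f e)))

    boundary-trace : ∀ f es {a b} → Path a es b → boundary f (trace es) ≡ does (a ≟ f) xor does (b ≟ f)
    boundary-trace f [] {a} refl = trans (sum-zero _ λ d → 𝔹.∧-zeroʳ (on f d)) (sym (𝔹.xor-same (does (a ≟ f))))
    boundary-trace f (e ∷ es) {a} {b} (refl , h , p) =
      trans (boundary-xor f (mark e) (trace es))
        (trans (cong₂ _xor_
            (trans (boundary-xor f (λ d → does (e ≟ d)) (λ d → does (α e ≟ d)))
              (cong₂ _xor_ (boundary-dart f e) (boundary-dart f (α e))))
            (boundary-trace f es p))
          (trans (𝔹.xor-assoc s t _) (cong (s xor_) (xor-cancel t (does (b ≟ f))))))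
      where
      s = does (face e ≟ f)
      t = does (face (α e) ≟ f)

    trace-off : ∀ es d → face d ∉ sources es → face d ∉ targets es → trace es d ≡ false
    trace-off [] d _ _ = refl
    trace-off (e ∷ es) d s t = cong₂ _xor_
      (cong₂ _xor_ (dec-false (e ≟ d) λ { refl → s (here refl) }) (dec-false (α e ≟ d) λ { refl → t (here refl) }))
      (trace-off es d (s ∘ there) (t ∘ there))

    targets-⊆ : ∀ e es {a b} → Path a (e ∷ es) b → ∀ {f} → f ∈ targets (e ∷ es) → f ≡ b ⊎ f ∈ sources es
    targets-⊆ e [] (_ , _ , refl) (here refl) = inj₁ refl
    targets-⊆ e (d ∷ es) (_ , _ , p , _) (here refl) = inj₂ (here (sym p))
    targets-⊆ e (d ∷ es) (_ , _ , p) (there i) with targets-⊆ d es p i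
    ... | inj₁ q = inj₁ q
    ... | inj₂ j = inj₂ (there j)

    record Arc (a b : Fin F) : Set where
      field
        first : Fin D
        rest  : List (Fin D)
        path  : Path a (first ∷ rest) b
        a∉    : a ∉ sources rest
        b∉    : b ∉ sources rest

      darts : List (Fin D)
      darts = first ∷ rest

      Inside : Fin F → Set
      Inside f = f ∈ sources rest

    data Linked (Good : Fin F → Set) : Fin F → Fin F → Set where
      stop : ∀ {f} → Linked Good f f
      hop  : ∀ {g} e → Here e → Good (face e) → Good (face (α e)) → Linked Good (face (α e)) g → Linked Good (face e) g

    module _ {a b : Fin F} (a≢b : a ≢ b) where
      open Arc

      Off : Arc a b → Fin F → Set
      Off X f = f ≢ a × f ≢ b × ¬ Inside X f

      off-sources : ∀ (X : Arc a b) {f} → Off X f → f ∉ sources (darts X)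
      off-sources X (p , q , r) (here e) = p (trans e (proj₁ (path X)))
      off-sources X (p , q , r) (there i) = r i

      off-targets : ∀ (X : Arc a b) {f} → Off X f → f ∉ targets (darts X)
      off-targets X (p , q , r) i with targets-⊆ (first X) (rest X) (path X) i
      ... | inj₁ e = q e
      ... | inj₂ j = r j

      trace-at : ∀ (X : Arc a b) d → face d ≡ a → trace (darts X) d ≡ does (first X ≟ d)
      trace-at X d refl = trans (cong₂ _xor_
          (trans (cong (does (first X ≟ d) xor_) (dec-false (α (first X) ≟ d) back))
            (𝔹.xor-identityʳ (does (first X ≟ d))))
          (trace-off (rest X) d (a∉ X) (λ i → away (there i))))
        (𝔹.xor-identityʳ (does (first X ≟ d)))
        where
        away : face d ∉ targets (darts X)
        away i with targets-⊆ (first X) (rest X) (path X) i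
        ... | inj₁ e = a≢b e
        ... | inj₂ j = a∉ X j
        back : α (first X) ≢ d
        back q = away (here (cong face (sym q)))

      -- Together `X` and `Y` form a closed dual curve, because modulo 2 their ends cancel; `colour`
      -- distinguishes its two sides.
      module Pair (X Y : Arc a b) where
        z : Fin D → Bool
        z d = trace (darts X) d xor trace (darts Y) d

        z-α : ∀ d → z (α d) ≡ z d
        z-α d = cong₂ _xor_ (trace-α (darts X) d) (trace-α (darts Y) d)

        z-here : ∀ d → ¬ Here d → z d ≡ false
        z-here d ¬h = cong₂ _xor_ (trace-here (darts X) (path X) ¬h) (trace-here (darts Y) (path Y) ¬h)

        even : ∀ f → boundary f z ≡ false
        even f = trans (boundary-xor f (trace (darts X)) (trace (darts Y)))
          (trans (cong₂ _xor_ (boundary-trace f (darts X) (path X)) (boundary-trace f (darts Y) (path Y)))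
            (𝔹.xor-same (does (a ≟ f) xor does (b ≟ f))))

        abstract
          colour : Fin V → Bool
          colour = κ z z-α z-here even

          crossing : ∀ d → Here d → z d ≡ colour (tail d) xor colour (tail (α d))
          crossing = coloured z z-α z-here even

        Clear : Fin F → Set
        Clear f = Off X f × Off Y f

        cross : ∀ d → Here d → colour (tail (α d)) ≡ colour (tail d) xor z d
        cross d h = trans (sym (xor-cancel (colour (tail d)) (colour (tail (α d)))))
          (cong (colour (tail d) xor_) (sym (crossing d h)))

        uncrossed : ∀ d → Here d → Clear (face d) → colour (tail (α d)) ≡ colour (tail d)
        uncrossed d h (o , p) = trans (cross d h) (trans (cong (colour (tail d) xor_)
          (cong₂ _xor_ (trace-off (darts X) d (off-sources X o) (off-targets X o))
                       (trace-off (darts Y) d (off-sources Y p) (off-targets Y p))))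
          (𝔹.xor-identityʳ (colour (tail d))))

        around-face : ∀ d d′ → Here d → Here d′ → face d ≡ face d′ → Clear (face d) →
                      colour (tail d) ≡ colour (tail d′)
        around-face d d′ h h′ e o with face-orbit d d′ (trans h (sym h′)) e
        ... | n , refl = sym (turn n)
          where
          face-iter : ∀ n → face (iter φ n d) ≡ face d
          face-iter zero = refl
          face-iter (suc n) = trans (face-φ _) (face-iter n)
          here-iter : ∀ n → Here (iter φ n d)
          here-iter zero = h
          here-iter (suc n) = trans (cong comp (σ-tail _)) (Here-α (here-iter n))
          turn : ∀ n → colour (tail (iter φ n d)) ≡ colour (tail d)
          turn zero = refl
          turn (suc n) = trans (cong colour (σ-tail _))
            (trans (uncrossed (iter φ n d) (here-iter n) (subst Clear (sym (face-iter n)) o)) (turn n))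

        along : ∀ {Good : Fin F → Set} → (∀ {f} → Good f → Clear f) → ∀ {f g} → Linked Good f g → Good g →
                ∀ d d′ → Here d → Here d′ → face d ≡ f → face d′ ≡ g → colour (tail d) ≡ colour (tail d′)
        along good stop gg d d′ h h′ refl q = around-face d d′ h h′ (sym q) (good gg)
        along good (hop e he ge gα l) gg d d′ h h′ p q =
          trans (around-face d e h he p (subst Clear (sym p) (good ge)))
            (trans (sym (uncrossed e he (good ge))) (along good l gg (α e) d′ (Here-α he) h′ refl q))

      -- A plane K₃,₃ would arise: `a`, `b` and the connected territory around `dᵣ` on one side, the
      -- interiors of the three paths on the other. The contradiction is found by turning once round
      -- the face `a` and recording for each vertex its side of the curves `X₁X₂` and `X₂X₃`.
      module Three (X₁ X₂ X₃ : Arc a b)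
        (dis₁₂ : ∀ {f} → Inside X₁ f → ¬ Inside X₂ f)
        (dis₁₃ : ∀ {f} → Inside X₁ f → ¬ Inside X₃ f)
        (dis₂₃ : ∀ {f} → Inside X₂ f → ¬ Inside X₃ f)
        (dᵣ : Fin D) (hᵣ : Here dᵣ)
        (off₁ : Off X₁ (face dᵣ)) (off₂ : Off X₂ (face dᵣ)) (off₃ : Off X₃ (face dᵣ))
        (link₁ : Linked (λ f → Off X₂ f × Off X₃ f) (face (α (first X₁))) (face dᵣ))
        (link₂ : Linked (λ f → Off X₁ f × Off X₃ f) (face (α (first X₂))) (face dᵣ))
        (link₃ : Linked (λ f → Off X₁ f × Off X₂ f) (face (α (first X₃))) (face dᵣ))
        (in₁ : Inside X₁ (face (α (first X₁))))
        (in₂ : Inside X₂ (face (α (first X₂))))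
        (in₃ : Inside X₃ (face (α (first X₃))))
        where

        module P = Pair X₁ X₂
        module Q = Pair X₂ X₃

        e₁ = first X₁
        e₂ = first X₂
        e₃ = first X₃

        -- Normalised so that p, q and p xor q vanish along the third,
        -- the first and the second path respectively.
        p q : Fin D → Bool
        p d = P.colour (tail d) xor P.colour (tail dᵣ)
        q d = Q.colour (tail d) xor Q.colour (tail dᵣ)

        here₁ : Here e₁
        here₁ = proj₁ (proj₂ (path X₁))
        here₂ : Here e₂
        here₂ = proj₁ (proj₂ (path X₂))
        here₃ : Here e₃
        here₃ = proj₁ (proj₂ (path X₃))

        same : ∀ (c : Fin V → Bool) {d} → c (tail d) ≡ c (tail dᵣ) → c (tail d) xor c (tail dᵣ) ≡ false
        same c e = trans (cong (_xor c (tail dᵣ)) e) (𝔹.xor-same (c (tail dᵣ)))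

        step-xor : ∀ x y s t → x ≡ y xor s → x xor t ≡ (y xor t) xor s
        step-xor x y s t refl = trans (𝔹.xor-assoc y s t)
          (trans (cong (y xor_) (𝔹.xor-comm s t)) (sym (𝔹.xor-assoc y t s)))

        p-step : ∀ d → Here d → face d ≡ a → p (α d) ≡ p d xor (does (e₁ ≟ d) xor does (e₂ ≟ d))
        p-step d h e = trans (step-xor (P.colour (tail (α d))) (P.colour (tail d)) (P.z d) (P.colour (tail dᵣ)) (P.cross d h))
          (cong (p d xor_) (cong₂ _xor_ (trace-at X₁ d e) (trace-at X₂ d e)))

        q-step : ∀ d → Here d → face d ≡ a → q (α d) ≡ q d xor (does (e₂ ≟ d) xor does (e₃ ≟ d))
        q-step d h e = trans (step-xor (Q.colour (tail (α d))) (Q.colour (tail d)) (Q.z d) (Q.colour (tail dᵣ)) (Q.cross d h))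
          (cong (q d xor_) (cong₂ _xor_ (trace-at X₂ d e) (trace-at X₃ d e)))

        at : ∀ (X : Arc a b) → face (first X) ≡ a
        at X = proj₁ (path X)

        distinct : ∀ (X Y : Arc a b) → (∀ {f} → Inside X f → ¬ Inside Y f) → Inside X (face (α (first X))) →
                   Inside Y (face (α (first Y))) → first X ≢ first Y
        distinct X Y dis i j e = dis i (subst (Inside Y ∘ face ∘ α) (sym e) j)

        e₁≢e₂ : e₁ ≢ e₂
        e₁≢e₂ = distinct X₁ X₂ dis₁₂ in₁ in₂
        e₁≢e₃ : e₁ ≢ e₃
        e₁≢e₃ = distinct X₁ X₃ dis₁₃ in₁ in₃
        e₂≢e₃ : e₂ ≢ e₃
        e₂≢e₃ = distinct X₂ X₃ dis₂₃ in₂ in₃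

        p₃ : p e₃ ≡ false
        p₃ = trans (sym (trans (p-step e₃ here₃ (at X₃)) (trans (cong (p e₃ xor_)
               (cong₂ _xor_ (dec-false (e₁ ≟ e₃) e₁≢e₃) (dec-false (e₂ ≟ e₃) e₂≢e₃))) (𝔹.xor-identityʳ (p e₃)))))
             (same P.colour (P.along (λ g → g) link₃ (off₁ , off₂) (α e₃) dᵣ (Here-α here₃) hᵣ refl refl))

        q₁ : q e₁ ≡ false
        q₁ = trans (sym (trans (q-step e₁ here₁ (at X₁)) (trans (cong (q e₁ xor_)
               (cong₂ _xor_ (dec-false (e₂ ≟ e₁) (e₁≢e₂ ∘ sym)) (dec-false (e₃ ≟ e₁) (e₁≢e₃ ∘ sym))))
               (𝔹.xor-identityʳ (q e₁)))))
             (same Q.colour (Q.along (λ g → g) link₁ (off₂ , off₃) (α e₁) dᵣ (Here-α here₁) hᵣ refl refl))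

        -- The colouring that belongs to the curve through `X₁` and `X₃`: the contributions of `X₂`
        -- cancel modulo 2.
        pq : Fin V → Bool
        pq v = P.colour v xor Q.colour v

        pq-split : ∀ d → pq (tail d) xor pq (tail dᵣ) ≡ p d xor q d
        pq-split d = xor-swap (P.colour (tail d)) (Q.colour (tail d)) (P.colour (tail dᵣ)) (Q.colour (tail dᵣ))

        pq-uncrossed : ∀ d → Here d → Off X₁ (face d) → Off X₃ (face d) → pq (tail (α d)) ≡ pq (tail d)
        pq-uncrossed d h o o′ = trans (cong₂ _xor_ (P.cross d h) (Q.cross d h))
          (trans (xor-swap (P.colour (tail d)) (P.z d) (Q.colour (tail d)) (Q.z d))
            (trans (cong (pq (tail d) xor_) cancel) (𝔹.xor-identityʳ (pq (tail d)))))
          where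
          cancel : P.z d xor Q.z d ≡ false
          cancel = trans (cong₂ (λ s t → (s xor trace (darts X₂) d) xor (trace (darts X₂) d xor t))
              (trace-off (darts X₁) d (off-sources X₁ o) (off-targets X₁ o))
              (trace-off (darts X₃) d (off-sources X₃ o′) (off-targets X₃ o′)))
            (trans (cong (trace (darts X₂) d xor_) (𝔹.xor-identityʳ _)) (𝔹.xor-same (trace (darts X₂) d)))

        pq-around : ∀ d d′ → Here d → Here d′ → face d ≡ face d′ → Off X₁ (face d) → Off X₃ (face d) →
                    pq (tail d) ≡ pq (tail d′)
        pq-around d d′ h h′ e o o′ with face-orbit d d′ (trans h (sym h′)) e
        ... | n , refl = sym (turn n)
          where
          face-iter : ∀ n → face (iter φ n d) ≡ face d
          face-iter zero = refl
          face-iter (suc n) = trans (face-φ _) (face-iter n)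
          here-iter : ∀ n → Here (iter φ n d)
          here-iter zero = h
          here-iter (suc n) = trans (cong comp (σ-tail _)) (Here-α (here-iter n))
          turn : ∀ n → pq (tail (iter φ n d)) ≡ pq (tail d)
          turn zero = refl
          turn (suc n) = trans (cong pq (σ-tail _)) (trans (pq-uncrossed (iter φ n d) (here-iter n)
            (subst (Off X₁) (sym (face-iter n)) o) (subst (Off X₃) (sym (face-iter n)) o′)) (turn n))

        pq-along : ∀ {f} → Linked (λ f → Off X₁ f × Off X₃ f) f (face dᵣ) → ∀ d → Here d → face d ≡ f →
                   pq (tail d) ≡ pq (tail dᵣ)
        pq-along stop d h e = pq-around d dᵣ h hᵣ e (subst (Off X₁) (sym e) off₁) (subst (Off X₃) (sym e) off₃)
        pq-along (hop e he ge gα l) d h eq =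
          trans (pq-around d e h he eq (subst (Off X₁) (sym eq) (proj₁ ge)) (subst (Off X₃) (sym eq) (proj₂ ge)))
            (trans (sym (pq-uncrossed e he (proj₁ ge) (proj₂ ge))) (pq-along l (α e) (Here-α he) refl))

        pq₂ : p e₂ xor q e₂ ≡ false
        pq₂ = trans (sym (pq-split e₂)) (trans (cong (_xor pq (tail dᵣ)) before) (𝔹.xor-same (pq (tail dᵣ))))
          where
          before : pq (tail e₂) ≡ pq (tail dᵣ)
          before = trans (sym (trans (cong₂ _xor_ (P.cross e₂ here₂) (Q.cross e₂ here₂))
              (trans (xor-swap (P.colour (tail e₂)) (P.z e₂) (Q.colour (tail e₂)) (Q.z e₂))
                (trans (cong (pq (tail e₂) xor_) cancel) (𝔹.xor-identityʳ (pq (tail e₂)))))))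
            (pq-along link₂ (α e₂) (Here-α here₂) refl)
            where
            cancel : P.z e₂ xor Q.z e₂ ≡ false
            cancel = trans (cong₂ (λ s t → (s xor trace (darts X₂) e₂) xor (trace (darts X₂) e₂ xor t))
                (trans (trace-at X₁ e₂ (at X₂)) (dec-false (e₁ ≟ e₂) e₁≢e₂))
                (trans (trace-at X₃ e₂ (at X₂)) (dec-false (e₃ ≟ e₂) (e₂≢e₃ ∘ sym))))
              (trans (cong (trace (darts X₂) e₂ xor_) (𝔹.xor-identityʳ _)) (𝔹.xor-same (trace (darts X₂) e₂)))

        φ-here : ∀ {d} → Here d → Here (φ d)
        φ-here h = trans (cong comp (σ-tail _)) (Here-α h)

        after : ∀ (c : Fin V → Bool) d → c (tail (φ d)) ≡ c (tail (α d))
        after c d = cong c (σ-tail (α d))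

        State : Bool → Bool → Fin D → Set
        State x y d = p d ≡ x × q d ≡ y

        spread : ∀ x y → (∀ d → Here d → face d ≡ a → State x y d → State x y (α d)) →
                 ∀ {d} → Here d → face d ≡ a → State x y d → ∀ {d′} → Here d′ → face d′ ≡ a → State x y d′
        spread x y inv {d} h e s {d′} h′ e′ with face-orbit d d′ (trans h (sym h′)) (trans e (sym e′))
        ... | n , refl = proj₂ (proj₂ (turn n))
          where
          turn : ∀ n → Here (iter φ n d) × face (iter φ n d) ≡ a × State x y (iter φ n d)
          turn zero = h , e , s
          turn (suc n) with turn n
          ... | hn , en , sn with inv (iter φ n d) hn en sn
          ...   | i , j = φ-here hn , trans (face-φ _) en
                        , trans (cong (_xor _) (after P.colour (iter φ n d))) i
                        , trans (cong (_xor _) (after Q.colour (iter φ n d))) j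

        pass : ∀ x y d → Here d → face d ≡ a → State x y d →
               State (x xor (does (e₁ ≟ d) xor does (e₂ ≟ d))) (y xor (does (e₂ ≟ d) xor does (e₃ ≟ d))) (α d)
        pass x y d h e (refl , refl) = p-step d h e , q-step d h e

        quiet : ∀ x y d → Here d → face d ≡ a → d ≢ e₁ → d ≢ e₂ → d ≢ e₃ → State x y d → State x y (α d)
        quiet x y d h e n₁ n₂ n₃ s with pass x y d h e s
        ... | i , j rewrite dec-false (e₁ ≟ d) (n₁ ∘ sym) | dec-false (e₂ ≟ d) (n₂ ∘ sym) | dec-false (e₃ ≟ d) (n₃ ∘ sym)
            | 𝔹.xor-identityʳ x | 𝔹.xor-identityʳ y = i , j

        pass₁ : State (not (p e₁)) false (α e₁)
        pass₁ with pass (p e₁) (q e₁) e₁ here₁ (at X₁) (refl , refl)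
        ... | i , j rewrite dec-true (e₁ ≟ e₁) refl | dec-false (e₂ ≟ e₁) (e₁≢e₂ ∘ sym) | dec-false (e₃ ≟ e₁) (e₁≢e₃ ∘ sym)
            | 𝔹.xor-comm (p e₁) true | 𝔹.xor-identityʳ (q e₁) = i , trans j q₁

        pass₂ : State (not (p e₂)) (not (p e₂)) (α e₂)
        pass₂ with pass (p e₂) (q e₂) e₂ here₂ (at X₂) (refl , refl)
        ... | i , j rewrite dec-true (e₂ ≟ e₂) refl | dec-false (e₁ ≟ e₂) e₁≢e₂ | dec-false (e₃ ≟ e₂) (e₂≢e₃ ∘ sym)
            | 𝔹.xor-comm (p e₂) true | 𝔹.xor-comm (q e₂) true = i , trans j (cong not (sym (xor-false⇒≡ (p e₂) (q e₂) pq₂)))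

        pass₃ : State false (not (q e₃)) (α e₃)
        pass₃ with pass (p e₃) (q e₃) e₃ here₃ (at X₃) (refl , refl)
        ... | i , j rewrite dec-true (e₃ ≟ e₃) refl | dec-false (e₁ ≟ e₃) e₁≢e₃ | dec-false (e₂ ≟ e₃) e₂≢e₃
            | 𝔹.xor-comm (q e₃) true | 𝔹.xor-identityʳ (p e₃) = trans i p₃ , j

        before : ∀ {x y d} → State x y (α d) → State x y (φ d)
        before {d = d} (i , j) = trans (cong (_xor _) (after P.colour d)) i , trans (cong (_xor _) (after Q.colour d)) j

        clash : ∀ {x} → x ≡ true → x ≡ false → ⊥
        clash refl ()

        -- Otherwise crossing `e₁` would lead to the state `(true , false)`. None of the three
        -- crossing darts can be met in that state, as they require `p = false` at `e₁` (by
        -- assumption) and at `e₃`, and `p = q` at `e₂`. So the state would persist all round the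
        -- face, `e₃` included. `not-q₃` and `not-p₂` argue alike.
        not-q₁ : p e₁ ≢ false
        not-q₁ e with spread true false inv (φ-here here₁) (trans (face-φ e₁) (at X₁)) start here₃ (at X₃)
          where
          start : State true false (φ e₁)
          start = before (subst (λ x → State (not x) false (α e₁)) e pass₁)
          inv : ∀ d → Here d → face d ≡ a → State true false d → State true false (α d)
          inv d h f s with d ≟ e₁ | d ≟ e₂ | d ≟ e₃
          ... | yes refl | _ | _ = ⊥-elim (clash (proj₁ s) e)
          ... | _ | yes refl | _ = ⊥-elim (clash (trans (cong₂ _xor_ (proj₁ s) (proj₂ s)) refl) pq₂)
          ... | _ | _ | yes refl = ⊥-elim (clash (proj₁ s) p₃)
          ... | no n₁ | no n₂ | no n₃ = quiet true false d h f n₁ n₂ n₃ s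
        ... | i , _ = clash i p₃

        not-q₃ : q e₃ ≢ false
        not-q₃ e with spread false true inv (φ-here here₃) (trans (face-φ e₃) (at X₃)) start here₁ (at X₁)
          where
          start : State false true (φ e₃)
          start = before (subst (λ x → State false (not x) (α e₃)) e pass₃)
          inv : ∀ d → Here d → face d ≡ a → State false true d → State false true (α d)
          inv d h f s with d ≟ e₁ | d ≟ e₂ | d ≟ e₃
          ... | yes refl | _ | _ = ⊥-elim (clash (proj₂ s) q₁)
          ... | _ | yes refl | _ = ⊥-elim (clash (trans (cong₂ _xor_ (proj₁ s) (proj₂ s)) refl) pq₂)
          ... | _ | _ | yes refl = ⊥-elim (clash (proj₂ s) e)
          ... | no n₁ | no n₂ | no n₃ = quiet false true d h f n₁ n₂ n₃ s
        ... | _ , i = clash i q₁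

        not-p₂ : p e₂ ≢ false
        not-p₂ e with spread true true inv (φ-here here₂) (trans (face-φ e₂) (at X₂)) start here₁ (at X₁)
          where
          start : State true true (φ e₂)
          start = before (subst (λ x → State (not x) (not x) (α e₂)) e pass₂)
          inv : ∀ d → Here d → face d ≡ a → State true true d → State true true (α d)
          inv d h f s with d ≟ e₁ | d ≟ e₂ | d ≟ e₃
          ... | yes refl | _ | _ = ⊥-elim (clash (proj₂ s) q₁)
          ... | _ | yes refl | _ = ⊥-elim (clash (proj₁ s) e)
          ... | _ | _ | yes refl = ⊥-elim (clash (proj₁ s) p₃)
          ... | no n₁ | no n₂ | no n₃ = quiet true true d h f n₁ n₂ n₃ s
        ... | _ , i = clash i q₁

        ≢false : ∀ x → x ≢ false → x ≡ true
        ≢false true n = refl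
        ≢false false n = ⊥-elim (n refl)

        -- By the three preceding facts every crossing ends in the state `(false , false)`, which
        -- therefore holds all round the face. But `e₁` starts in a state with `p = true`.
        absurd : ⊥
        absurd with spread false false inv (φ-here here₁) (trans (face-φ e₁) (at X₁)) start here₁ (at X₁)
          where
          start : State false false (φ e₁)
          start = before (subst (λ x → State (not x) false (α e₁)) (≢false _ not-q₁) pass₁)
          inv : ∀ d → Here d → face d ≡ a → State false false d → State false false (α d)
          inv d h f s with d ≟ e₁ | d ≟ e₂ | d ≟ e₃
          ... | yes refl | _ | _ = subst (λ x → State (not x) false (α e₁)) (≢false _ not-q₁) pass₁
          ... | _ | yes refl | _ = subst (λ x → State (not x) (not x) (α e₂)) (≢false _ not-p₂) pass₂
          ... | _ | _ | yes refl = subst (λ x → State false (not x) (α e₃)) (≢false _ not-q₃) pass₃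
          ... | no n₁ | no n₂ | no n₃ = quiet false false d h f n₁ n₂ n₃ s
        ... | i , _ = not-q₁ i

-- Pursuit on the faces: guards, territories and taking up a guard.

module CatchingTokens where
  open Rotations
  open Forests
  open JordanCurves
  open Thetas
  open import Data.Fin.Patterns
  open import Data.Fin.Properties using (any?)
  open import Relation.Unary using (Decidable)

  module Catching (G : PlaneGraph) (base : Fin (PlaneGraph.D G)) where
    open PlaneGraph G
    open IsPlaneMap plane
    open Faces G
    open Colouring G base using (κ₀; Here; Here-α)
    open Thetas.Theta G base using (Path; sources; targets; Linked; stop; hop)

    E : Fin F → Fin F → Set
    E f g = ∃[ d ] (Here d × face d ≡ f × face (α d) ≡ g)

    E? : ∀ f g → Dec (E f g)
    E? f g = any? λ d → (comp (tail d) ≟ κ₀) ×-dec (face d ≟ f) ×-dec (face (α d) ≟ g)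

    E-sym : ∀ {f g} → E f g → E g f
    E-sym (d , h , p , q) = α d , Here-α h , q , trans (cong face (α-invol d)) p

    E⇒Lazy : ∀ {f g} → E f g → Lazy f g
    E⇒Lazy (d , _ , p , q) = inj₂ (d , p , q)

    Step : Fin F → Fin F → Set
    Step r r′ = (r′ ≡ r) ⊎ E r r′

    Trio : Set
    Trio = Fin 3 → Fin F

    cops : Fin F → Fin F → Fin F → Trio
    cops x y z 0F = x
    cops x y z 1F = y
    cops x y z 2F = z

    -- Three cops walking on the faces, against a robber who also walks on the
    -- faces, but only along edges of one component.
    data Catch (c : Trio) (r : Fin F) : Set where
      step : ∀ c′ → (∀ i → Lazy (c i) (c′ i)) →
             ((∃[ i ] c′ i ≡ r) ⊎ (∀ r′ → Step r r′ → Catch c′ r′)) → Catch c r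

    Post : Trio → Fin F → Set
    Post c r = (∃[ i ] c i ≡ r) ⊎ (∀ r′ → Step r r′ → Catch c r′)

    Catch-perm : ∀ (π ρ : Fin 3 → Fin 3) → (∀ i → π (ρ i) ≡ i) → (∀ i → ρ (π i) ≡ i) →
                 ∀ {c d r} → (∀ i → d i ≡ c (π i)) → Catch d r → Catch c r
    Catch-perm π ρ πρ ρπ {c} {d} e (step c′ ok n) = step (c′ ∘ ρ)
      (λ i → subst (λ x → Lazy x (c′ (ρ i))) (trans (e (ρ i)) (cong c (πρ i))) (ok (ρ i)))
      (case n)
      where
      case : ((∃[ i ] c′ i ≡ _) ⊎ (∀ r′ → Step _ r′ → Catch c′ r′)) →
             (∃[ i ] c′ (ρ i) ≡ _) ⊎ (∀ r′ → Step _ r′ → Catch (c′ ∘ ρ) r′)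
      case (inj₁ (i , p)) = inj₁ (π i , trans (cong c′ (ρπ i)) p)
      case (inj₂ w) = inj₂ λ r′ s → Catch-perm π ρ πρ ρπ (λ i → cong c′ (sym (ρπ i))) (w r′ s)

    Post-perm : ∀ (π ρ : Fin 3 → Fin 3) → (∀ i → π (ρ i) ≡ i) → (∀ i → ρ (π i) ≡ i) →
                ∀ {c d r} → (∀ i → d i ≡ c (π i)) → Post d r → Post c r
    Post-perm π ρ πρ ρπ e (inj₁ (i , p)) = inj₁ (π i , trans (sym (e i)) p)
    Post-perm π ρ πρ ρπ e (inj₂ w) = inj₂ λ r′ s → Catch-perm π ρ πρ ρπ e (w r′ s)

    Post₁₂ : ∀ {x y z r} → Post (cops x y z) r → Post (cops y x z) r
    Post₁₂ = Post-perm π π inv inv λ { 0F → refl ; 1F → refl ; 2F → refl }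
      where
      π : Fin 3 → Fin 3
      π 0F = 1F
      π 1F = 0F
      π 2F = 2F
      inv : ∀ i → π (π i) ≡ i
      inv 0F = refl
      inv 1F = refl
      inv 2F = refl

    Post₂₃ : ∀ {x y z r} → Post (cops x y z) r → Post (cops x z y) r
    Post₂₃ = Post-perm π π inv inv λ { 0F → refl ; 1F → refl ; 2F → refl }
      where
      π : Fin 3 → Fin 3
      π 0F = 0F
      π 1F = 2F
      π 2F = 1F
      inv : ∀ i → π (π i) ≡ i
      inv 0F = refl
      inv 1F = refl
      inv 2F = refl

    moves : ∀ {x y z x′ y′ z′} → Lazy x x′ → Lazy y y′ → Lazy z z′ →
            ∀ i → Lazy (cops x y z i) (cops x′ y′ z′ i)
    moves p q r 0F = p
    moves p q r 1F = q
    moves p q r 2F = r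

    -- A cop standing on the shadow f r of the robber r catches him as soon as
    -- he steps from R into S.
    record Guard (R S : Fin F → Set) (f : Fin F → Fin F) : Set where
      field
        inside : ∀ {x y} → R x → R y → E x y → Lazy (f x) (f y)
        catch  : ∀ {x s} → R x → S s → E x s → Lazy (f x) s
    open Guard public

    Guard-mono : ∀ {R R′ S S′ f} → (∀ {x} → R′ x → R x) → (∀ {s} → S′ s → S s) → Guard R S f → Guard R′ S′ f
    Guard-mono ρ σ g .inside x y e = inside g (ρ x) (ρ y) e
    Guard-mono ρ σ g .catch x s e = catch g (ρ x) (σ s) e

    record Territory (R : Fin F → Set) : Set where
      field
        inside?   : Decidable R
        connected : ∀ {x y} → R x → R y → Linked R x y
    open Territory public

    Bounded : (R S₁ S₂ : Fin F → Set) → Set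
    Bounded R S₁ S₂ = ∀ {x y} → R x → E x y → R y ⊎ S₁ y ⊎ S₂ y

    module _ {R S₁ S₂ f₁ f₂} (g₁ : Guard R S₁ f₁) (g₂ : Guard R S₂ f₂) (bd : Bounded R S₁ S₂) where

      shadow : ∀ {S f r r′} → Guard R S f → R r → R r′ → Step r r′ → Lazy (f r) (f r′)
      shadow g p q (inj₁ refl) = inj₁ refl
      shadow g p q (inj₂ e) = inside g p q e

      -- A token that leaves `R` enters `S₁` or `S₂` and is caught by the guard there. So only its
      -- moves inside `R` need an answer: the two guards follow their shadows and the third cop
      -- moves freely.
      respond : ∀ {r x} → R r →
                (∀ {r′} → R r′ → Step r r′ → Σ (Fin F) λ z → Lazy x z × Post (cops (f₁ r′) (f₂ r′) z) r′) →
                Post (cops (f₁ r) (f₂ r) x) r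
      respond {r} {x} p k = inj₂ answer
        where
        stay : ∀ {r′} → R r′ → Step r r′ → Catch (cops (f₁ r) (f₂ r) x) r′
        stay q s with k q s
        ... | z , l , post = step _ (moves (shadow g₁ p q s) (shadow g₂ p q s) l) post
        answer : ∀ r′ → Step r r′ → Catch (cops (f₁ r) (f₂ r) x) r′
        answer r′ (inj₁ refl) = stay p (inj₁ refl)
        answer r′ (inj₂ e) with bd p e
        ... | inj₁ q = stay q (inj₂ e)
        ... | inj₂ (inj₁ s) = step (cops r′ (f₂ r) x) (moves (catch g₁ p s e) (inj₁ refl) (inj₁ refl)) (inj₁ (0F , refl))
        ... | inj₂ (inj₂ s) = step (cops (f₁ r) r′ x) (moves (inj₁ refl) (catch g₂ p s e) (inj₁ refl)) (inj₁ (1F , refl))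

      module _ (p : ℕ → Fin F) (ℓ : Fin F → ℕ) (k : ℕ)
               (p-step : ∀ {i} → i < k → Lazy (p i) (p (suc i)))
               (ℓ≤k : ∀ {x} → R x → ℓ x ≤ k)
               (ℓ-lip : ∀ {x y} → R x → R y → E x y → ℓ y ≤ suc (ℓ x))
               (arrived : ∀ {r} → R r → Post (cops (f₁ r) (f₂ r) (p (ℓ r))) r) where

        -- From `c < ℓ r` follows `c ≤ ℓ r′` after one move of the token, so its shadow on the path
        -- cannot slip past the climbing cop. Each round either brings him onto the shadow or lets
        -- him climb one step, and there are only `k` steps.
        climb : ∀ m c {r} → R r → c ≤ ℓ r → k ≤ c + m → Post (cops (f₁ r) (f₂ r) (p c)) r
        climb m c {r} q c≤ le with c ℕₚ.≟ ℓ r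
        ... | yes e = subst (λ i → Post (cops (f₁ r) (f₂ r) (p i)) r) (sym e) (arrived q)
        climb zero c {r} q c≤ le | no c≢ = ⊥-elim (c≢ (ℕₚ.≤-antisym c≤
          (ℕₚ.≤-trans (ℓ≤k q) (subst (k ≤_) (ℕₚ.+-identityʳ c) le))))
        climb (suc m) c {r} q c≤ le | no c≢ = respond q next
          where
          c< : c < ℓ r
          c< = ℕₚ.≤∧≢⇒< c≤ c≢
          near : ∀ {r′} → R r′ → Step r r′ → c ≤ ℓ r′
          near q′ (inj₁ refl) = c≤
          near q′ (inj₂ e) = ℕₚ.≤-pred (ℕₚ.≤-trans c< (ℓ-lip q′ q (E-sym e)))
          next : ∀ {r′} → R r′ → Step r r′ → Σ (Fin F) λ z → Lazy (p c) z × Post (cops (f₁ r′) (f₂ r′) z) r′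
          next {r′} q′ s with c <? ℓ r′
          ... | yes lt = p (suc c) , p-step (ℕₚ.<-≤-trans c< (ℓ≤k q))
                       , climb m (suc c) q′ lt (subst (k ≤_) (ℕₚ.+-suc c m) le)
          ... | no ge = p c , inj₁ refl
                      , subst (λ i → Post (cops (f₁ r′) (f₂ r′) (p i)) r′)
                          (ℕₚ.≤-antisym (ℕₚ.≮⇒≥ ge) (near q′ s)) (arrived q′)

        install : ∀ {n x r} → R r → Walk n x (p 0) → Post (cops (f₁ r) (f₂ r) x) r
        install q [] = climb k 0 q z≤n ℕₚ.≤-refl
        install q (l ∷ w) = respond q λ q′ _ → _ , l , install q′ w

    Linked-mono : ∀ {P Q : Fin F → Set} → (∀ {x} → P x → Q x) → ∀ {f g} → Linked P f g → Linked Q f g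
    Linked-mono m stop = stop
    Linked-mono m (hop e h p q l) = hop e h (m p) (m q) (Linked-mono m l)

    Linked-trans : ∀ {P : Fin F → Set} {f g h} → Linked P f g → Linked P g h → Linked P f h
    Linked-trans stop m = m
    Linked-trans (hop e h p q l) m = hop e h p q (Linked-trans l m)

    Linked-E : ∀ {P : Fin F → Set} {f g} → E f g → P f → P g → Linked P f g
    Linked-E (d , h , refl , refl) p q = hop d h p q stop

    Linked-sym : ∀ {P : Fin F → Set} {f g} → Linked P f g → Linked P g f
    Linked-sym stop = stop
    Linked-sym (hop e h p q l) = Linked-trans (Linked-sym l) (Linked-E (E-sym (e , h , refl , refl)) q p)

    module Component {T : Fin F → Set} (T? : Decidable T) {r : Fin F} (t : T r) where

      private
        open module TC = Growing face (face ∘ α) (λ d → Here d × T (face d) × T (face (α d)))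
          (λ d → (comp (tail d) ≟ κ₀) ×-dec T? (face d) ×-dec T? (face (α d))) r

      open import Data.List.Membership.DecPropositional (_≟_ {F}) using (_∈?_)

      abstract
        tree : ∃[ vs ] ∃[ ds ] (Tree vs ds × Closed vs)
        tree = spanning

      members : List (Fin F)
      members = proj₁ tree

      Member : Fin F → Set
      Member x = x ∈ members

      start : Member r
      start = root∈ (proj₁ (proj₂ (proj₂ tree)))

      member-T : ∀ {x} → Member x → T x
      member-T = go (proj₁ (proj₂ (proj₂ tree)))
        where
        go : ∀ {vs ds} → Tree vs ds → ∀ {x} → x ∈ vs → T x
        go root (here refl) = t
        go (grow tr d (_ , p , _) _ _) (here refl) = p
        go (grow tr _ _ _ _) (there i) = go tr i

      member-step : ∀ {x y} → Member x → E x y → T y → Member y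
      member-step {x} {y} i (d , h , refl , refl) ty = proj₂ (proj₂ (proj₂ tree)) (α d)
        (Here-α h , ty , subst T (sym back) (member-T i)) (subst (_∈ members) (sym back) i)
        where
        back : face (α (α d)) ≡ face d
        back = cong face (α-invol d)

      territory : Territory Member
      territory .inside? x = x ∈? members
      territory .connected i j = Linked-trans (to-root i) (Linked-sym (to-root j))
        where
        go : ∀ {vs ds} → Tree vs ds → ∀ {x} → x ∈ vs → Linked (_∈ vs) x r
        go root (here refl) = stop
        go (grow tr d (h , _) _ old) (here refl) = hop d h (here refl) (there old) (Linked-mono there (go tr old))
        go (grow tr _ _ _ _) (there i) = Linked-mono there (go tr i)
        to-root : ∀ {x} → Member x → Linked Member x r
        to-root = go (proj₁ (proj₂ (proj₂ tree)))

-- Shortest paths through a territory, and their shadows.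

module ShortestPaths where
  open Rotations
  open JordanCurves
  open Thetas
  open CatchingTokens
  open import Data.Fin.Properties using (any?)
  open import Relation.Unary using (Decidable)
  open Forests using (∉-unique)

  module Geodesics (G : PlaneGraph) (base : Fin (PlaneGraph.D G)) where
    open PlaneGraph G
    open IsPlaneMap plane
    open Faces G
    open Colouring G base using (κ₀; Here; Here-α)
    open Thetas.Theta G base using (Path; sources; targets; Linked; stop; hop)
    open Catching G base

    module Levels {R : Fin F → Set} (T : Territory R) (a : Fin F) where

      -- Breadth-first search, cumulative: faces reachable from `a` in at most `n + 1` steps within
      -- `R`. The search starts from the neighbours of `a` because `a` itself lies outside the
      -- territory in the applications.
      Level : ℕ → Fin F → Set
      Level zero    x = R x × E a x
      Level (suc n) x = Level n x ⊎ (R x × ∃[ y ] (Level n y × E y x))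

      Level? : ∀ n → Decidable (Level n)
      Level? zero    x = inside? T x ×-dec E? a x
      Level? (suc n) x = Level? n x ⊎-dec (inside? T x ×-dec any? λ y → Level? n y ×-dec E? y x)

      Level-R : ∀ n {x} → Level n x → R x
      Level-R zero (r , _) = r
      Level-R (suc n) (inj₁ l) = Level-R n l
      Level-R (suc n) (inj₂ (r , _)) = r

      Level-next : ∀ n {x y} → Level n x → R y → E x y → Level (suc n) y
      Level-next n l r e = inj₂ (r , _ , l , e)

      Level-mono : ∀ {m n} → m ≤ n → ∀ {x} → Level m x → Level n x
      Level-mono {m} {n} le l with ℕₚ.m≤n⇒∃[o]m+o≡n le
      ... | o , refl = go o l
        where
        go : ∀ o {x} → Level m x → Level (m + o) x
        go zero {x} l = subst (λ n → Level n x) (sym (ℕₚ.+-identityʳ m)) l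
        go (suc o) {x} l = subst (λ n → Level n x) (sym (ℕₚ.+-suc m o)) (inj₁ (go o l))

      Fresh : ℕ → Fin F → Set
      Fresh n x = ∀ {m} → m < n → ¬ Level m x

      -- The level cut off at `k`, which gives a value also to faces that the search does not reach
      -- in time and keeps the function 1-Lipschitz.
      lev : ℕ → Fin F → ℕ
      lev zero x = zero
      lev (suc k) x with Level? k x
      ... | yes _ = lev k x
      ... | no _  = suc k

      lev≤ : ∀ k x → lev k x ≤ k
      lev≤ zero x = z≤n
      lev≤ (suc k) x with Level? k x
      ... | yes _ = ℕₚ.m≤n⇒m≤1+n (lev≤ k x)
      ... | no _  = ℕₚ.≤-refl

      lev-fresh : ∀ k x → Fresh (lev k x) x
      lev-fresh (suc k) x {m} lt l with Level? k x
      ... | yes _ = lev-fresh k x lt l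
      ... | no ¬l = ¬l (Level-mono (ℕₚ.≤-pred lt) l)

      lev-level : ∀ k x → lev k x < k → Level (lev k x) x
      lev-level (suc k) x lt with Level? k x
      ... | no _ = ⊥-elim (ℕₚ.<-irrefl refl lt)
      ... | yes l with lev k x <? k
      ...   | yes lt′ = lev-level k x lt′
      ...   | no ge = Level-mono (ℕₚ.≮⇒≥ ge) l

      lev-bound : ∀ k x {n} → Level n x → lev k x ≤ n
      lev-bound k x {n} l with n <? lev k x
      ... | yes lt = ⊥-elim (lev-fresh k x lt l)
      ... | no ge = ℕₚ.≮⇒≥ ge

      lev-exact : ∀ k x {n} → n ≤ k → Level n x → Fresh n x → lev k x ≡ n
      lev-exact k x {n} n≤k l f with ℕₚ.<-cmp (lev k x) n
      ... | tri≈ _ e _ = e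
      ... | tri< lt _ _ = ⊥-elim (f lt (lev-level k x (ℕₚ.<-≤-trans lt n≤k)))
      ... | tri> _ _ gt = ⊥-elim (ℕₚ.<⇒≱ gt (lev-bound k x l))

      lev-lip : ∀ k {x y} → R y → E x y → lev k y ≤ suc (lev k x)
      lev-lip k {x} {y} r e with lev k x <? k
      ... | yes lt = lev-bound k y (Level-next (lev k x) (lev-level k x lt) r e)
      ... | no ge = ℕₚ.m≤n⇒m≤1+n (ℕₚ.≤-trans (lev≤ k y) (ℕₚ.≮⇒≥ ge))

      record Chain (k : ℕ) (x : Fin F) : Set where
        field
          p     : ℕ → Fin F
          p-end : p k ≡ x
          level : ∀ {i} → i ≤ k → Level i (p i)
          fresh : ∀ {i} → i ≤ k → Fresh i (p i)
          link  : ∀ {i} → i < k → E (p i) (p (suc i))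

      chain : ∀ k {x} → Level k x → Fresh k x → Chain k x
      chain zero {x} l f = record
        { p = λ _ → x ; p-end = refl
        ; level = λ { z≤n → l } ; fresh = λ { z≤n → f } ; link = λ () }
      chain (suc k) l f with l
      ... | inj₁ l′ = ⊥-elim (f ℕₚ.≤-refl l′)
      ... | inj₂ (r , y , ly , e) = record { p = p′ ; p-end = end ; level = level′ ; fresh = fresh′ ; link = link′ }
        where
        x = _
        open Chain (chain k ly (λ {m} lt lm → f (s≤s lt) (Level-next m lm r e)))
        p′ : ℕ → Fin F
        p′ i with i ≤? k
        ... | yes _ = p i
        ... | no _  = x
        old : ∀ {i} → i ≤ k → p′ i ≡ p i
        old {i} le with i ≤? k
        ... | yes _ = refl
        ... | no ¬le = ⊥-elim (¬le le)
        end : p′ (suc k) ≡ x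
        end with suc k ≤? k
        ... | yes le = ⊥-elim (ℕₚ.1+n≰n le)
        ... | no _ = refl
        split : ∀ {i} → i ≤ suc k → i ≤ k ⊎ i ≡ suc k
        split {i} le with i ≤? k
        ... | yes le′ = inj₁ le′
        ... | no ¬le = inj₂ (ℕₚ.≤-antisym le (ℕₚ.≰⇒> ¬le))
        level′ : ∀ {i} → i ≤ suc k → Level i (p′ i)
        level′ {i} le with split le
        ... | inj₁ le′ = subst (Level i) (sym (old le′)) (level le′)
        ... | inj₂ refl = subst (Level (suc k)) (sym end) l
        fresh′ : ∀ {i} → i ≤ suc k → Fresh i (p′ i)
        fresh′ {i} le {m} lt with split le
        ... | inj₁ le′ = fresh le′ lt ∘ subst (Level m) (old le′)
        ... | inj₂ refl = f lt ∘ subst (Level m) end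
        link′ : ∀ {i} → i < suc k → E (p′ i) (p′ (suc i))
        link′ {i} lt with split lt
        ... | inj₁ lt′ = subst₂ E (sym (old (ℕₚ.<⇒≤ lt′))) (sym (old lt′)) (link lt′)
        ... | inj₂ refl = subst₂ E (sym (trans (old ℕₚ.≤-refl) p-end)) (sym end) e

      linked-level : ∀ {x y} → Linked R x y → ∀ n → Level n x → ∃[ m ] Level m y
      linked-level stop n l = n , l
      linked-level (hop e h p q lk) n l = linked-level lk (suc n) (Level-next n l q (e , h , refl , refl))

      module _ (b : Fin F) where

        Hit : ℕ → Set
        Hit n = ∃[ x ] (Level n x × E x b)

        Hit? : ∀ n → Dec (Hit n)
        Hit? n = any? λ x → Level? n x ×-dec E? x b

        least : ∀ n → Hit n → ∃[ k ] (Hit k × (∀ {m} → m < k → ¬ Hit m))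
        least n h = go n 0 (λ ()) (subst Hit (sym (ℕₚ.+-identityʳ n)) h)
          where
          go : ∀ m k → (∀ {i} → i < k → ¬ Hit i) → Hit (m + k) → ∃[ k ] (Hit k × (∀ {m} → m < k → ¬ Hit m))
          go m k none h with Hit? k
          ... | yes hk = k , hk , none
          go zero k none h | no ¬h = ⊥-elim (¬h h)
          go (suc m) k none h | no ¬h = go m (suc k) none′ (subst Hit (sym (ℕₚ.+-suc m k)) h)
            where
            none′ : ∀ {i} → i < suc k → ¬ Hit i
            none′ {i} lt with i ℕₚ.≟ k
            ... | yes refl = ¬h
            ... | no i≢k = none (ℕₚ.≤∧≢⇒< (ℕₚ.≤-pred lt) i≢k)

    -- A shortest path from a to b whose inner faces p 0, …, p k lie in R.
    record Geodesic (R : Fin F → Set) (a b : Fin F) : Set where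
      field
        k       : ℕ
        p       : ℕ → Fin F
        ℓ       : Fin F → ℕ
        p-in    : ∀ {i} → i ≤ k → R (p i)
        p-first : E a (p 0)
        p-last  : E (p k) b
        p-link  : ∀ {i} → i < k → E (p i) (p (suc i))
        ℓ≤k     : ∀ x → ℓ x ≤ k
        ℓ-lip   : ∀ {x y} → R y → E x y → ℓ y ≤ suc (ℓ x)
        ℓ-p     : ∀ {i} → i ≤ k → ℓ (p i) ≡ i
        ℓ-a     : ∀ {x} → R x → E x a → ℓ x ≡ 0
        ℓ-b     : ∀ {x} → R x → E x b → ℓ x ≡ k

    abstract
      geodesic : ∀ {R} → Territory R → ∀ {a b x y} → R x → E a x → R y → E y b → Geodesic R a b
      geodesic {R} T {a} {b} {x} {y} rx ea ry eb = go (Lv.least b _ found)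
        where
        module Lv = Levels T a
        reached : ∃[ m ] Lv.Level m y
        reached = Lv.linked-level (connected T rx ry) 0 (rx , ea)
        found : Lv.Hit b (proj₁ reached)
        found = y , proj₂ reached , eb
        go : (∃[ k ] (Lv.Hit b k × (∀ {m} → m < k → ¬ Lv.Hit b m))) → Geodesic R a b
        go (k , (z , lz , ez) , none) = record
          { k = k ; p = p ; ℓ = Lv.lev k
          ; p-in = λ {i} le → Lv.Level-R i (level le)
          ; p-first = proj₂ (level {0} z≤n)
          ; p-last = subst (λ q → E q b) (sym p-end) ez
          ; p-link = link
          ; ℓ≤k = Lv.lev≤ k
          ; ℓ-lip = Lv.lev-lip k
          ; ℓ-p = λ {i} le → Lv.lev-exact k (p i) le (level le) (fresh le)
          ; ℓ-a = λ {w} rw e → ℕₚ.n≤0⇒n≡0 (Lv.lev-bound k w (rw , E-sym e))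
          ; ℓ-b = λ {w} rw e → ℕₚ.≤-antisym (Lv.lev≤ k w) (ℕₚ.≮⇒≥ λ lt → none lt (w , Lv.lev-level k w lt , e))
          }
          where
          open Lv.Chain (Lv.chain k lz (λ {m} lt lm → none lt (z , lm , ez)))

    module OnGeodesic {R a b} (g : Geodesic R a b) (a∉ : ¬ R a) (b∉ : ¬ R b) where
      open Geodesic g

      OnPath : Fin F → Set
      OnPath s = s ≡ a ⊎ s ≡ b ⊎ ∃[ i ] (i ≤ k × p i ≡ s)

      shade : Fin F → Fin F
      shade x = p (ℓ x)

      near : ∀ {i j} → i ≤ suc j → j ≤ suc i → i ≤ k → j ≤ k → Lazy (p i) (p j)
      near {i} {j} i≤ j≤ ik jk with ℕₚ.<-cmp i j
      ... | tri≈ _ refl _ = inj₁ refl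
      ... | tri< lt _ _ with ℕₚ.≤-antisym j≤ lt
      ...   | refl = E⇒Lazy (p-link jk)
      near {i} {j} i≤ j≤ ik jk | tri> _ _ gt with ℕₚ.≤-antisym i≤ gt
      ...   | refl = E⇒Lazy (E-sym (p-link ik))

      -- Since `ℓ` is 1-Lipschitz, the shadow `p (ℓ x)` moves at most one step along the path.
      -- Neighbours of `a` have level 0, and neighbours of `b` level `k`, as a lower one would give
      -- a shorter path; so the shadow is next to either end when the token gets there.
      guard : Guard R OnPath shade
      guard .inside {x} {y} rx ry e = near (ℓ-lip rx (E-sym e)) (ℓ-lip ry e) (ℓ≤k x) (ℓ≤k y)
      guard .catch {x} rx (inj₁ refl) e rewrite ℓ-a rx e = E⇒Lazy (E-sym p-first)
      guard .catch {x} rx (inj₂ (inj₁ refl)) e rewrite ℓ-b rx e = E⇒Lazy p-last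
      guard .catch {x} rx (inj₂ (inj₂ (i , le , refl))) e =
        near (subst (λ j → ℓ x ≤ suc j) (ℓ-p le) (ℓ-lip rx (E-sym e)))
             (subst (_≤ suc (ℓ x)) (ℓ-p le) (ℓ-lip (p-in le) e)) (ℓ≤k x) le

      shade-fix : ∀ {x} → R x → OnPath x → shade x ≡ x
      shade-fix rx (inj₁ refl) = ⊥-elim (a∉ rx)
      shade-fix rx (inj₂ (inj₁ refl)) = ⊥-elim (b∉ rx)
      shade-fix rx (inj₂ (inj₂ (i , le , refl))) = cong p (ℓ-p le)

      OnPath? : Decidable OnPath
      OnPath? s = (s ≟ a) ⊎-dec (s ≟ b) ⊎-dec dec
        where
        dec : Dec (∃[ i ] (i ≤ k × p i ≡ s))
        dec with p (ℓ s) ≟ s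
        ... | yes e = yes (ℓ s , ℓ≤k s , e)
        ... | no ¬e = no λ { (i , le , refl) → ¬e (cong p (ℓ-p le)) }

      segment : ∀ m i → i + m ≡ k → ∃[ ds ] (Path (p i) ds b × Unique (sources ds) ×
                (∀ {s} → s ∈ sources ds → ∃[ j ] (i ≤ j × j ≤ k × p j ≡ s)) ×
                (∀ {j} → i ≤ j → j ≤ k → p j ∈ sources ds))
      segment zero i e with p-last | trans (sym (ℕₚ.+-identityʳ i)) e
      ... | d , h , q , r | refl = d ∷ [] , (q , h , r) , ∉-unique (λ ()) []
          , (λ { (here refl) → i , ℕₚ.≤-refl , ℕₚ.≤-refl , sym q })
          , (λ le ge → here (trans (cong p (ℕₚ.≤-antisym ge le)) (sym q)))
      segment (suc m) i e with segment m (suc i) (trans (sym (ℕₚ.+-suc i m)) e)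
                             | p-link {i} (subst (suc i ≤_) e (subst (suc i ≤_) (sym (ℕₚ.+-suc i m)) (s≤s (ℕₚ.m≤m+n i m))))
      ... | ds , path , uq , out , all | d , h , refl′ , r = d ∷ ds
          , (refl′ , h , subst (λ f → Path f ds b) (sym r) path)
          , ∉-unique new uq
          , (λ { (here refl) → i , ℕₚ.≤-refl , i≤k , sym refl′
               ; (there s) → let (j , le , ge , q) = out s in j , ℕₚ.<⇒≤ le , ge , q })
          , every
        where
        i≤k : i ≤ k
        i≤k = subst (i ≤_) e (ℕₚ.m≤m+n i (suc m))
        new : face d ∉ sources ds
        new s with out s
        ... | j , le , ge , q = ℕₚ.<-irrefl (trans (sym (ℓ-p i≤k)) (trans (cong ℓ (trans (sym refl′) (sym q))) (ℓ-p ge))) le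
        every : ∀ {j} → i ≤ j → j ≤ k → p j ∈ sources (d ∷ ds)
        every {j} le ge with i ℕₚ.≟ j
        ... | yes refl = here (sym refl′)
        ... | no i≢j = there (all (ℕₚ.≤∧≢⇒< le i≢j) ge)

      record Route : Set where
        field
          first  : Fin D
          rest   : List (Fin D)
          path   : Path a (first ∷ rest) b
          unique : Unique (sources rest)
          inner  : ∀ {s} → s ∈ sources rest → ∃[ i ] (i ≤ k × p i ≡ s)
          inner′ : ∀ {i} → i ≤ k → p i ∈ sources rest

      abstract
        route : Route
        route with segment k 0 refl | p-first
        ... | ds , path , uq , out , all | d , h , q , r = record
          { first = d ; rest = ds ; path = q , h , subst (λ f → Path f ds b) (sym r) path ; unique = uq
          ; inner = λ s → let (j , _ , ge , e) = out s in j , ge , e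
          ; inner′ = all z≤n
          }

-- Three cops catch a token on the faces (Aigner and Fromme).

module AignerFromme where
  open Rotations
  open Forests
  open JordanCurves
  open Thetas
  open CatchingTokens
  open ShortestPaths
  open import Data.Fin.Properties using (any?)
  open import Relation.Unary using (Decidable)

  module _ {A : Set} where
    import Data.List.Relation.Binary.Permutation.Setoid.Properties (setoid A) as ↭ₚ

    unique-++ˡ : ∀ (xs : List A) {ys} → Unique (xs ++ ys) → Unique xs
    unique-++ˡ [] u = []
    unique-++ˡ (x ∷ xs) (x∉ ∷ u) = ++⁻ˡ xs x∉ ∷ unique-++ˡ xs u

    unique-++ʳ : ∀ (xs : List A) {ys} → Unique (xs ++ ys) → Unique ys
    unique-++ʳ [] u = u
    unique-++ʳ (x ∷ xs) (_ ∷ u) = unique-++ʳ xs u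

    unique-disjoint : ∀ (xs : List A) {ys} → Unique (xs ++ ys) → ∀ {s} → s ∈ xs → s ∉ ys
    unique-disjoint (x ∷ xs) (x∉ ∷ u) (here refl) j = All¬⇒¬Any (++⁻ʳ xs x∉) j
    unique-disjoint (x ∷ xs) (_ ∷ u) (there i) j = unique-disjoint xs u i j

    unique-comm : ∀ (xs ys : List A) → Unique (xs ++ ys) → Unique (ys ++ xs)
    unique-comm xs ys = ↭ₚ.Unique-resp-↭ (↭⇒↭ₛ (++-comm xs ys))

    unique-rotate : ∀ (p m o q : List A) → Unique ((p ++ (m ++ o)) ++ q) → Unique (m ++ (o ++ (q ++ p)))
    unique-rotate p m o q u = subst Unique (trans (++-assoc (m ++ o) q p) (++-assoc m o (q ++ p)))
      (subst Unique refl (subst (λ l → Unique (l ++ p)) refl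
        (unique-comm p ((m ++ o) ++ q) (subst Unique (++-assoc p (m ++ o) q) u))
        ) )

    nonempty : ∀ (xs : List A) → xs ≢ [] → ∃[ y ] ∃[ ys ] xs ≡ y ∷ ys
    nonempty [] n = ⊥-elim (n refl)
    nonempty (x ∷ xs) n = x , xs , refl

  module Pursuit (G : PlaneGraph) (base : Fin (PlaneGraph.D G)) where
    open PlaneGraph G
    open IsPlaneMap plane
    open Faces G
    open Colouring G base using (κ₀; Here; Here-α)
    open Thetas.Theta G base
    open Catching G base
    open Geodesics G base
    open import Data.List.Membership.DecPropositional (_≟_ {F}) using (_∈?_)

    Path-++ : ∀ xs {ys a b c} → Path a xs b → Path b ys c → Path a (xs ++ ys) c
    Path-++ [] refl q = q
    Path-++ (x ∷ xs) (e , h , p) q = e , h , Path-++ xs p q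

    revP : List (Fin D) → List (Fin D)
    revP [] = []
    revP (d ∷ ds) = revP ds ++ (α d ∷ [])

    Path-rev : ∀ ds {a b} → Path a ds b → Path b (revP ds) a
    Path-rev [] refl = refl
    Path-rev (d ∷ ds) (refl , h , p) = Path-++ (revP ds) (Path-rev ds p)
      (refl , Here-α h , cong face (α-invol d))

    sources-rev : ∀ ds {s} → s ∈ sources (revP ds) → s ∈ targets ds
    sources-rev (d ∷ ds) i with ∈-++⁻ (sources (revP ds)) (subst (_ ∈_) (map-++ face (revP ds) (α d ∷ [])) i)
    ... | inj₁ j = there (sources-rev ds j)
    ... | inj₂ (here refl) = here refl

    rev-sources : ∀ ds {s} → s ∈ targets ds → s ∈ sources (revP ds)
    rev-sources (d ∷ ds) {s} i = subst (s ∈_) (sym (map-++ face (revP ds) (α d ∷ []))) (go i)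
      where
      go : s ∈ targets (d ∷ ds) → s ∈ sources (revP ds) ++ (face (α d) ∷ [])
      go (here refl) = ∈-++⁺ʳ (sources (revP ds)) (here refl)
      go (there j) = ∈-++⁺ˡ (rev-sources ds j)

    unique-rev : ∀ ds → Unique (targets ds) → Unique (sources (revP ds))
    unique-rev [] u = []
    unique-rev (d ∷ ds) (d∉ ∷ u) = subst Unique (sym (map-++ face (revP ds) (α d ∷ [])))
      (++⁺ (unique-rev ds u) ([] ∷ []) λ { (i , here refl) → All¬⇒¬Any d∉ (sources-rev ds i) })

    rev≢[] : ∀ d ds → revP (d ∷ ds) ≢ []
    rev≢[] d ds e with ++-conicalʳ (revP ds) (α d ∷ []) e
    ... | ()

    targets≡ : ∀ d ds {a b} → Path a (d ∷ ds) b → targets (d ∷ ds) ≡ sources ds ++ (b ∷ [])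
    targets≡ d [] (_ , _ , refl) = refl
    targets≡ d (e ∷ ds) (_ , _ , p) = cong₂ _∷_ (sym (proj₁ p)) (targets≡ e ds p)

    unique-targets : ∀ d ds {a b} → Path a (d ∷ ds) b → Unique (sources ds) → b ∉ sources ds → Unique (targets (d ∷ ds))
    unique-targets d ds {b = b} p u b∉ = subst Unique (sym (targets≡ d ds p))
      (++⁺ u ([] ∷ []) λ { (i , here refl) → b∉ i })

    Vert : List (Fin D) → Fin F → Fin F → Set
    Vert ds v s = s ∈ sources ds ⊎ s ≡ v

    vert⇒ : ∀ ds {u v s} → Path u ds v → Vert ds v s → s ≡ u ⊎ s ∈ targets ds
    vert⇒ [] refl (inj₂ e) = inj₁ e
    vert⇒ (d ∷ ds) (refl , _ , p) (inj₁ (here e)) = inj₁ e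
    vert⇒ (d ∷ ds) (refl , _ , p) (inj₁ (there i)) with vert⇒ ds p (inj₁ i)
    ... | inj₁ e = inj₂ (here e)
    ... | inj₂ j = inj₂ (there j)
    vert⇒ (d ∷ ds) (refl , _ , p) (inj₂ e) with vert⇒ ds p (inj₂ e)
    ... | inj₁ e = inj₂ (here e)
    ... | inj₂ j = inj₂ (there j)

    start-vert : ∀ ds {u v} → Path u ds v → Vert ds v u
    start-vert [] p = inj₂ p
    start-vert (d ∷ ds) (e , _) = inj₁ (here (sym e))

    Vert-++ˡ : ∀ xs {ys u b v s} → Path u xs b → Path b ys v → Vert xs b s → Vert (xs ++ ys) v s
    Vert-++ˡ xs {ys} p q (inj₁ i) = inj₁ (subst (_ ∈_) (sym (map-++ face xs ys)) (∈-++⁺ˡ i))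
    Vert-++ˡ xs {ys} p q (inj₂ refl) with start-vert ys q
    ... | inj₁ i = inj₁ (subst (_ ∈_) (sym (map-++ face xs ys)) (∈-++⁺ʳ (sources xs) i))
    ... | inj₂ e = inj₂ e

    Vert-++ʳ : ∀ xs {ys v s} → Vert ys v s → Vert (xs ++ ys) v s
    Vert-++ʳ xs {ys} (inj₁ i) = inj₁ (subst (_ ∈_) (sym (map-++ face xs ys)) (∈-++⁺ʳ (sources xs) i))
    Vert-++ʳ xs (inj₂ e) = inj₂ e

    module _ {N : Fin F → Set} (N? : Decidable N) where

      first-in : ∀ ds {u v} → Path u ds v →
        (∃[ pre ] ∃[ post ] ∃[ a ] (ds ≡ pre ++ post × Path u pre a × Path a post v × N a ×
          (∀ {s} → s ∈ sources pre → ¬ N s)))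
        ⊎ (∀ {s} → Vert ds v s → ¬ N s)
      first-in [] {u} refl with N? u
      ... | yes n = inj₁ ([] , [] , u , refl , refl , refl , n , λ ())
      ... | no ¬n = inj₂ λ { (inj₂ refl) → ¬n }
      first-in (d ∷ ds) (refl , h , p) with N? (face d)
      ... | yes n = inj₁ ([] , d ∷ ds , face d , refl , refl , (refl , h , p) , n , λ ())
      ... | no ¬n with first-in ds p
      ...   | inj₁ (pre , post , a , refl , q , q′ , n , none) =
              inj₁ (d ∷ pre , post , a , refl , (refl , h , q) , q′ , n , λ { (here refl) → ¬n ; (there i) → none i })
      ...   | inj₂ none = inj₂ λ { (inj₁ (here refl)) → ¬n ; (inj₁ (there i)) → none (inj₁ i) ; (inj₂ e) → none (inj₂ e) }

      last-in : ∀ ds {u v} → Path u ds v →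
        (∃[ mid ] ∃[ post ] ∃[ b ] (ds ≡ mid ++ post × Path u mid b × Path b post v × N b ×
          (∀ {s} → s ∈ targets post → ¬ N s)))
        ⊎ (¬ N u × (∀ {s} → s ∈ targets ds → ¬ N s))
      last-in [] {u} refl with N? u
      ... | yes n = inj₁ ([] , [] , u , refl , refl , refl , n , λ ())
      ... | no ¬n = inj₂ (¬n , λ ())
      last-in (d ∷ ds) (refl , h , p) with last-in ds p
      ... | inj₁ (mid , post , b , refl , q , q′ , n , none) =
            inj₁ (d ∷ mid , post , b , refl , (refl , h , q) , q′ , n , none)
      ... | inj₂ (¬n , none) with N? (face d)
      ...   | yes n = inj₁ ([] , d ∷ ds , face d , refl , refl , (refl , h , p) , n , λ { (here refl) → ¬n ; (there i) → none i })
      ...   | no ¬n′ = inj₂ (¬n′ , λ { (here refl) → ¬n ; (there i) → none i })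

    -- The contacts of a path with the territory. Only the stretch from the first to the last
    -- contact matters afterwards; in the case `two` it has at least one edge.
    data Ends (N : Fin F → Set) (u : Fin F) (ds : List (Fin D)) (v : Fin F) : Set where
      none : (∀ {s} → Vert ds v s → ¬ N s) → Ends N u ds v
      one  : ∀ a → N a → Vert ds v a → (∀ {s} → Vert ds v s → N s → s ≡ a) → Ends N u ds v
      two  : ∀ pre d mid post a b → ds ≡ pre ++ ((d ∷ mid) ++ post) →
             Path u pre a → Path a (d ∷ mid) b → Path b post v → N a → N b →
             (∀ {s} → Vert ds v s → N s → Vert (d ∷ mid) b s) → Ends N u ds v

    ends : ∀ {N} → Decidable N → ∀ ds {u v} → Path u ds v → Ends N u ds v
    ends N? ds p with first-in N? ds p
    ... | inj₂ none′ = none none′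
    ... | inj₁ (pre , post , a , refl , q , q′ , n , before) with last-in N? post q′
    ...   | inj₂ (¬n , _) = ⊥-elim (¬n n)
    ...   | inj₁ ([] , post′ , b , refl , refl , r′ , nb , after) =
            one a n (Vert-++ʳ pre (start-vert post′ r′)) only
            where
            only : ∀ {s} → Vert (pre ++ post′) _ s → _ → s ≡ a
            only (inj₂ e) ns with vert⇒ post′ r′ (inj₂ e)
            ... | inj₁ e′ = e′
            ... | inj₂ i = ⊥-elim (after i ns)
            only {s} (inj₁ i) ns with ∈-++⁻ (sources pre) (subst (s ∈_) (map-++ face pre post′) i)
            ... | inj₁ j = ⊥-elim (before j ns)
            ... | inj₂ j with vert⇒ post′ r′ (inj₁ j)
            ...   | inj₁ e′ = e′
            ...   | inj₂ k = ⊥-elim (after k ns)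
    ...   | inj₁ (d ∷ mid , post′ , b , refl , r , r′ , nb , after) =
            two pre d mid post′ a b refl q r r′ n nb only
            where
            tail-part : ∀ {s} → Vert post′ _ s → _ → s ≡ b
            tail-part w ns with vert⇒ post′ r′ w
            ... | inj₁ e = e
            ... | inj₂ i = ⊥-elim (after i ns)
            only : ∀ {s} → Vert (pre ++ ((d ∷ mid) ++ post′)) _ s → _ → Vert (d ∷ mid) b s
            only (inj₂ e) ns = inj₂ (tail-part (inj₂ e) ns)
            only {s} (inj₁ i) ns with ∈-++⁻ (sources pre) (subst (s ∈_) (map-++ face pre ((d ∷ mid) ++ post′)) i)
            ... | inj₁ j = ⊥-elim (before j ns)
            ... | inj₂ j with ∈-++⁻ (sources (d ∷ mid)) (subst (s ∈_) (map-++ face (d ∷ mid) post′) j)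
            ...   | inj₁ k = inj₁ k
            ...   | inj₂ k = inj₂ (tail-part (inj₁ k) ns)

    Nb : (Fin F → Set) → Fin F → Set
    Nb R q = ∃[ x ] (R x × E x q)

    Nb? : ∀ {R} → Decidable R → Decidable (Nb R)
    Nb? R? q = any? λ x → R? x ×-dec E? x q

    -- lone: the territory touches a single guarded path.
    -- cycle: it touches a closed curve made of two guarded paths.
    data Shape (R S₁ S₂ : Fin F → Set) : Set where
      lone  : ∀ u ds v → Path u ds v → Unique (sources ds) → v ∉ sources ds →
              (∀ {s} → S₁ s → Vert ds v s) → (∀ {s} → Vert ds v s → ¬ R s) → (∀ {s} → ¬ S₂ s) → Shape R S₁ S₂
      cycle : ∀ u ds v es → Path u ds v → Path v es u → Unique (sources ds ++ sources es) → ds ≢ [] → es ≢ [] →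
              (∀ {s} → S₁ s → Vert ds v s) → (∀ {s} → S₂ s → Vert es u s) →
              (∀ {s} → s ∈ sources ds → ¬ R s) → (∀ {s} → s ∈ sources es → ¬ R s) → Shape R S₁ S₂

    -- Induction on the number of faces in the territory. Two cops hold the guards, and the third
    -- may be anywhere.
    Goal : ℕ → Set₁
    Goal m = ∀ {R S₁ S₂ f₁ f₂} (T : Territory R) → count (inside? T) ≤ m →
             Guard R S₁ f₁ → Guard R S₂ f₂ → Bounded R S₁ S₂ → Shape R S₁ S₂ →
             ∀ {r x} → R r → Post (cops (f₁ r) (f₂ r) x) r

    module Refine {m} (ih : Goal m) {R S₁ S₂ f₁ f₂} (T : Territory R) (size : count (inside? T) ≤ suc m)
                  (g₁ : Guard R S₁ f₁) (g₂ : Guard R S₂ f₂) (bd : Bounded R S₁ S₂) where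

      Smaller : (S₃ : Fin F → Set) (f₃ : Fin F → Fin F) → Set₁
      Smaller S₃ f₃ = ∀ {R′} (T′ : Territory R′) → count (inside? T′) ≤ m →
        (∀ {x} → R′ x → R x) → (∀ {x} → R′ x → ¬ S₃ x) →
        (∀ {x y} → R′ x → E x y → R′ y ⊎ S₁ y ⊎ S₂ y ⊎ S₃ y) →
        ∀ {r} → R′ r → Post (cops (f₁ r) (f₂ r) (f₃ r)) r

      -- The third cop takes up the shadow on a new guarded set `S₃`; the continuation plays on in
      -- the component of `R` without `S₃` that holds the token. The witness `w`, in `R` and on
      -- `S₃`, is lost to the territory, and this is why the measure falls.
      refine : (p : ℕ → Fin F) (ℓ : Fin F → ℕ) (k : ℕ) →
               (∀ {i} → i < k → Lazy (p i) (p (suc i))) → (∀ {x} → R x → ℓ x ≤ k) →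
               (∀ {x y} → R x → R y → E x y → ℓ y ≤ suc (ℓ x)) →
               {S₃ : Fin F → Set} → Decidable S₃ → (∀ {x} → R x → S₃ x → p (ℓ x) ≡ x) →
               ∀ w → R w → S₃ w → Smaller S₃ (p ∘ ℓ) → ∀ {r x} → R r → Post (cops (f₁ r) (f₂ r) x) r
      refine p ℓ k p-step ℓ≤k ℓ-lip {S₃} S₃? fix w rw sw cont {r} {x} rr =
        install g₁ g₂ bd p ℓ k p-step ℓ≤k ℓ-lip arrived rr (proj₂ (faces-connected x (p 0)))
        where
        arrived : ∀ {r} → R r → Post (cops (f₁ r) (f₂ r) (p (ℓ r))) r
        arrived {r} rr with S₃? r
        ... | yes s = inj₁ (2F , fix rr s)
          where open import Data.Fin.Patterns
        ... | no ¬s = cont territory smaller (proj₁ ∘ member-T) (proj₂ ∘ member-T) bounded start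
          where
          open Component {T = λ x → R x × ¬ S₃ x} (λ x → inside? T x ×-dec ¬? (S₃? x)) (rr , ¬s)
          smaller : count (inside? territory) ≤ m
          smaller = ℕₚ.≤-pred (ℕₚ.≤-trans (count-≥ (inside? T)
            (∉-unique (λ i → proj₂ (member-T (proj₂ (∈-filter⁻ (inside? territory) {xs = allFin F} i))) sw)
              (filter⁺ (inside? territory) (allFin⁺ F)))
            λ { (here refl) → rw ; (there i) → proj₁ (member-T (proj₂ (∈-filter⁻ (inside? territory) {xs = allFin F} i))) })
            size)
          bounded : ∀ {x y} → Member x → E x y → Member y ⊎ S₁ y ⊎ S₂ y ⊎ S₃ y
          bounded {x} {y} i e with bd (proj₁ (member-T i)) e
          ... | inj₂ (inj₁ s) = inj₂ (inj₁ s)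
          ... | inj₂ (inj₂ s) = inj₂ (inj₂ (inj₁ s))
          ... | inj₁ ry with S₃? y
          ...   | yes s = inj₂ (inj₂ (inj₂ s))
          ...   | no ¬s = inj₁ (member-step i e (ry , ¬s))

      still : ∀ {R S f} → Guard R S f → Guard R (λ _ → ⊥) f
      still = Guard-mono id λ ()

      Post₁₃ : ∀ {x y z r} → Post (cops x y z) r → Post (cops z y x) r
      Post₁₃ = Post₁₂ ∘ Post₂₃ ∘ Post₁₂

      few₀ : (∀ {s} → Nb R s → ¬ S₁ s) → (∀ {s} → Nb R s → ¬ S₂ s) → ∀ {r x} → R r → Post (cops (f₁ r) (f₂ r) x) r
      few₀ no₁ no₂ {r} rr = refine (λ _ → r) (λ _ → 0) 0 (λ ()) (λ _ → z≤n) (λ _ _ _ → z≤n) (_≟ r)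
          (λ _ → sym) r rr refl next rr
        where
        next : Smaller (_≡ r) (λ _ → r)
        next T′ le sub out bd′ r′ = Post₁₃ (ih T′ le guard (still (Guard-mono sub id g₂)) bounded
          (lone r [] r refl [] (λ ()) inj₂ (λ { (inj₂ refl) q → out q refl }) (λ ())) r′)
          where
          guard : Guard _ (_≡ r) (λ _ → r)
          guard .inside _ _ _ = inj₁ refl
          guard .catch _ e _ = inj₁ e
          bounded : Bounded _ (_≡ r) (λ _ → ⊥)
          bounded q e with bd′ q e
          ... | inj₁ i = inj₁ i
          ... | inj₂ (inj₁ s) = ⊥-elim (no₁ (_ , sub q , e) s)
          ... | inj₂ (inj₂ (inj₁ s)) = ⊥-elim (no₂ (_ , sub q , e) s)
          ... | inj₂ (inj₂ (inj₂ s)) = inj₂ (inj₁ s)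

      -- All contacts lie at `a`, so a cop standing on a neighbour `y` of `a` in the territory takes
      -- over both duties: he guards the edge from `a` to `y`, and removing `y` shrinks the
      -- territory.
      few₁ : ∀ a → ¬ R a → Nb R a → (∀ {s} → Nb R s → S₁ s → s ≡ a) → (∀ {s} → Nb R s → S₂ s → s ≡ a) →
             ∀ {r x} → R r → Post (cops (f₁ r) (f₂ r) x) r
      few₁ a a∉ (y , ry , e) only₁ only₂ {r} rr =
        refine (λ _ → y) (λ _ → 0) 0 (λ ()) (λ _ → z≤n) (λ _ _ _ → z≤n) (λ s → (s ≟ a) ⊎-dec (s ≟ y)) fix y ry (inj₂ refl)
          (next (E-sym e)) rr
        where
        S₃ : Fin F → Set
        S₃ s = s ≡ a ⊎ s ≡ y
        fix : ∀ {x} → R x → S₃ x → y ≡ x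
        fix rx (inj₁ refl) = ⊥-elim (a∉ rx)
        fix rx (inj₂ q) = sym q
        next : E a y → Smaller S₃ (λ _ → y)
        next (d , h , refl , q) T′ le sub out bd′ r′ =
          Post₁₃ (ih T′ le guard (still (Guard-mono sub id g₂)) bounded
            (lone a (d ∷ []) y (refl , h , q) ([] ∷ []) (λ { (here refl) → a∉ ry }) verts avoid (λ ())) r′)
          where
          verts : ∀ {s} → S₃ s → Vert (d ∷ []) y s
          verts (inj₁ refl) = inj₁ (here refl)
          verts (inj₂ refl) = inj₂ refl
          avoid : ∀ {s} → Vert (d ∷ []) y s → _
          avoid (inj₁ (here refl)) i = out i (inj₁ refl)
          avoid (inj₂ refl) i = out i (inj₂ refl)
          guard : Guard _ S₃ (λ _ → y)
          guard .inside _ _ _ = inj₁ refl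
          guard .catch _ (inj₁ refl) _ = E⇒Lazy e
          guard .catch _ (inj₂ refl) _ = inj₁ refl
          bounded : Bounded _ S₃ (λ _ → ⊥)
          bounded q e with bd′ q e
          ... | inj₁ i = inj₁ i
          ... | inj₂ (inj₁ s) = inj₂ (inj₁ (inj₁ (only₁ (_ , sub q , e) s)))
          ... | inj₂ (inj₂ (inj₁ s)) = inj₂ (inj₁ (inj₁ (only₂ (_ , sub q , e) s)))
          ... | inj₂ (inj₂ (inj₂ s)) = inj₂ (inj₁ s)

      chord : ∀ {a b} → Nb R a → Nb R b → Geodesic R a b
      chord (_ , rx , ea) (_ , ry , eb) = geodesic T rx (E-sym ea) ry eb

      module Chord {a b} (geo : Geodesic R a b) (a∉ : ¬ R a) (b∉ : ¬ R b) where

        open Geodesic geo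
        open OnGeodesic geo a∉ b∉ public
        open Route route public

        P₃ : List (Fin D)
        P₃ = first ∷ rest

        a∉rest : a ∉ sources rest
        a∉rest i = let (j , le , e) = inner i in a∉ (subst R e (p-in le))

        b∉rest : b ∉ sources rest
        b∉rest i = let (j , le , e) = inner i in b∉ (subst R e (p-in le))

        refineChord : Smaller OnPath shade → ∀ {r x} → R r → Post (cops (f₁ r) (f₂ r) x) r
        refineChord = refine p ℓ k (E⇒Lazy ∘ p-link) (λ {x} _ → ℓ≤k x) (λ _ ry e → ℓ-lip ry e) OnPath? shade-fix
          (p 0) (p-in z≤n) (inj₂ (inj₂ (0 , z≤n , refl)))

        on-verts : ∀ {s} → OnPath s → Vert P₃ b s
        on-verts (inj₁ refl) = inj₁ (here (sym (proj₁ path)))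
        on-verts (inj₂ (inj₁ refl)) = inj₂ refl
        on-verts (inj₂ (inj₂ (i , le , refl))) = inj₁ (there (inner′ le))

        verts-on : ∀ {s} → Vert P₃ b s → OnPath s
        verts-on (inj₁ (here refl)) = inj₁ (proj₁ path)
        verts-on (inj₁ (there i)) = inj₂ (inj₂ (inner i))
        verts-on (inj₂ refl) = inj₂ (inj₁ refl)

        rev-on : ∀ {s} → s ∈ sources (revP P₃) → s ≡ b ⊎ ∃[ i ] (i ≤ k × p i ≡ s)
        rev-on i with targets-⊆ first rest path (sources-rev P₃ i)
        ... | inj₁ e = inj₁ e
        ... | inj₂ j = inj₂ (inner j)

        on-rev : ∀ {s} → OnPath s → Vert (revP P₃) a s
        on-rev o with vert⇒ P₃ path (on-verts o)
        ... | inj₁ e = inj₂ e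
        ... | inj₂ i = inj₁ (rev-sources P₃ i)

        module _ {R′ S : Fin F → Set} (sub : ∀ {x} → R′ x → R x) (out : ∀ {x} → R′ x → ¬ OnPath x) where

          close : ∀ d ds → Path a (d ∷ ds) b → Unique (sources (d ∷ ds)) → b ∉ sources (d ∷ ds) →
                  (∀ {s} → s ∈ sources (d ∷ ds) → ¬ R s) → (∀ {s} → S s → Vert (d ∷ ds) b s) → Shape R′ S OnPath
          close d ds q u b∉′ avoid on = cycle a (d ∷ ds) b (revP P₃) q (Path-rev P₃ path)
            (++⁺ u (unique-rev P₃ (unique-targets first rest path unique b∉rest)) apart)
            (λ ()) (rev≢[] first rest) on on-rev (λ i r → avoid i (sub r)) avoid′
            where
            apart : ∀ {s} → s ∈ sources (d ∷ ds) × s ∈ sources (revP P₃) → ⊥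
            apart (i , j) with rev-on j
            ... | inj₁ refl = b∉′ i
            ... | inj₂ (n , le , refl) = avoid i (p-in le)
            avoid′ : ∀ {s} → s ∈ sources (revP P₃) → ¬ R′ s
            avoid′ i r with rev-on i
            ... | inj₁ refl = b∉ (sub r)
            ... | inj₂ o = out r (inj₂ (inj₂ o))

          close′ : ∀ d ds → Path b (d ∷ ds) a → Unique (sources (d ∷ ds)) → a ∉ sources (d ∷ ds) →
                   (∀ {s} → s ∈ sources (d ∷ ds) → ¬ R s) → (∀ {s} → S s → Vert (d ∷ ds) a s) → Shape R′ OnPath S
          close′ d ds q u a∉′ avoid on = cycle a P₃ b (d ∷ ds) path q
            (++⁺ (∉-unique (λ i → a∉rest (subst (_∈ sources rest) (proj₁ path) i)) unique) u apart)
            (λ ()) (λ ()) on-verts on (λ i r → out r (verts-on (inj₁ i))) (λ i r → avoid i (sub r))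
            where
            apart : ∀ {s} → s ∈ sources P₃ × s ∈ sources (d ∷ ds) → ⊥
            apart (here refl , j) = a∉′ (subst (_∈ sources (d ∷ ds)) (proj₁ path) j)
            apart (there i , j) with inner i
            ... | n , le , refl = avoid j (p-in le)

    arc-rev : ∀ x xs {a b} → Path b (x ∷ xs) a → Unique (sources (x ∷ xs)) → a ∉ sources (x ∷ xs) →
              Σ (Arc a b) λ X → (∀ {s} → Arc.Inside X s → s ∈ sources xs) × (∀ {s} → s ∈ sources xs → Arc.Inside X s)
    arc-rev x xs {a} {b} q u a∉ with nonempty (revP (x ∷ xs)) (rev≢[] x xs)
    ... | e , es , eq = record { first = e ; rest = es ; path = q′ ; a∉ = a∉′ ; b∉ = b∉′ } , to , from
      where
      q′ : Path a (e ∷ es) b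
      q′ = subst (λ l → Path a l b) eq (Path-rev (x ∷ xs) q)
      u′ : Unique (sources (e ∷ es))
      u′ = subst (Unique ∘ sources) eq (unique-rev (x ∷ xs)
        (unique-targets x xs q (unique-++ʳ (face x ∷ []) u) (a∉ ∘ there)))
      a∉′ : a ∉ sources es
      a∉′ i = unique-disjoint (face e ∷ []) u′ (here refl) (subst (_∈ sources es) (sym (proj₁ q′)) i)
      back : ∀ {s} → s ∈ sources es → s ≡ a ⊎ s ∈ sources xs
      back {s} i = targets-⊆ x xs q (sources-rev (x ∷ xs) (subst (λ l → s ∈ sources l) (sym eq) (there i)))
      to : ∀ {s} → s ∈ sources es → s ∈ sources xs
      to i with back i
      ... | inj₁ refl = ⊥-elim (a∉′ i)
      ... | inj₂ j = j
      b∉′ : b ∉ sources es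
      b∉′ i = unique-disjoint (face x ∷ []) u (here refl) (subst (_∈ sources xs) (sym (proj₁ q)) (to i))
      from : ∀ {s} → s ∈ sources xs → s ∈ sources es
      from {s} i with subst (λ l → s ∈ sources l) eq (rev-sources (x ∷ xs)
                        (subst (s ∈_) (sym (targets≡ x xs q)) (∈-++⁺ˡ i)))
      ... | here refl = ⊥-elim (a∉ (subst (_∈ sources (x ∷ xs)) (proj₁ q′) (there i)))
      ... | there j = j

    inner-link : ∀ {Good : Fin F → Set} ds {y b q} → Path y ds b → q ∈ sources ds →
                 (∀ {s} → s ∈ sources ds → Good s) → Linked Good y q
    inner-link (d ∷ ds) (refl , h , p) (here refl) good = stop
    inner-link (d ∷ []) _ (there ()) good
    inner-link (d ∷ e ∷ ds) (refl , h , p) (there i) good =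
      hop d h (good (here refl)) (good (there (here (sym (proj₁ p))))) (inner-link (e ∷ ds) p i (good ∘ there))

    head-source : ∀ ds {y b q} → Path y ds b → q ∈ sources ds → y ∈ sources ds
    head-source (d ∷ ds) (refl , _) _ = here refl

    module Divide {m} (ih : Goal m) {R S₁ S₂ f₁ f₂} (T : Territory R) (size : count (inside? T) ≤ suc m)
                  (g₁ : Guard R S₁ f₁) (g₂ : Guard R S₂ f₂) (bd : Bounded R S₁ S₂) where
      open Refine ih T size g₁ g₂ bd

      -- The third cop guards a chord from the first contact to the last. Chord and middle stretch
      -- form the two paths of a cycle; the rest of the old path is out of the token's reach.
      lone-two : ∀ {u v pre d mid post a b} → Path u pre a → Path a (d ∷ mid) b → Path b post v →
                 Unique (sources (pre ++ ((d ∷ mid) ++ post))) → v ∉ sources (pre ++ ((d ∷ mid) ++ post)) →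
                 (∀ {s} → S₁ s → Vert (pre ++ ((d ∷ mid) ++ post)) v s) →
                 (∀ {s} → Vert (pre ++ ((d ∷ mid) ++ post)) v s → ¬ R s) → (∀ {s} → ¬ S₂ s) →
                 Nb R a → Nb R b → (∀ {s} → Vert (pre ++ ((d ∷ mid) ++ post)) v s → Nb R s → Vert (d ∷ mid) b s) →
                 ∀ {r x} → R r → Post (cops (f₁ r) (f₂ r) x) r
      lone-two {u} {v} {pre} {d} {mid} {post} {a} {b} pu pm po uq v∉ on avoid none₂ na nb only = refineChord next
        where
        M = d ∷ mid
        a∉ : ¬ R a
        a∉ = avoid (Vert-++ʳ pre (Vert-++ˡ M pm po (start-vert M pm)))
        b∉ : ¬ R b
        b∉ = avoid (Vert-++ʳ pre (Vert-++ʳ M (start-vert post po)))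
        open Chord (chord na nb) a∉ b∉
        uMO : Unique (sources M ++ sources post)
        uMO = unique-++ʳ (sources pre) (subst Unique (trans (map-++ face pre (M ++ post))
          (cong (sources pre ++_) (map-++ face M post))) uq)
        b∉M : b ∉ sources M
        b∉M i with start-vert post po
        ... | inj₁ j = unique-disjoint (sources M) uMO i j
        ... | inj₂ refl with Vert-++ʳ pre (Vert-++ˡ M pm po (inj₁ i))
        ...   | inj₁ k = v∉ k
        ...   | inj₂ _ = v∉ (subst (b ∈_) (sym (map-++ face pre (M ++ post))) (∈-++⁺ʳ (sources pre)
                  (subst (b ∈_) (sym (map-++ face M post)) (∈-++⁺ˡ i))))
        next : Smaller OnPath shade
        next {R′} T′ le sub out bd′ r′ = Post₂₃ (ih T′ le (Guard-mono sub proj₁ g₁) (Guard-mono sub id guard) bounded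
          (close sub out d mid pm (unique-++ˡ (sources M) uMO) b∉M
            (λ i → avoid (Vert-++ʳ pre (Vert-++ˡ M pm po (inj₁ i)))) proj₂) r′)
          where
          bounded : Bounded R′ (λ s → S₁ s × Vert M b s) OnPath
          bounded q e with bd′ q e
          ... | inj₁ i = inj₁ i
          ... | inj₂ (inj₁ s) = inj₂ (inj₁ (s , only (on s) (_ , sub q , e)))
          ... | inj₂ (inj₂ (inj₁ s)) = ⊥-elim (none₂ s)
          ... | inj₂ (inj₂ (inj₂ s)) = inj₂ (inj₂ s)

      -- Outside contacts are the two ends of the chord only, so the cop on the chord replaces both
      -- old guards, and a lone path remains.
      chord-two : ∀ {a b} → ¬ R a → ¬ R b → Nb R a → Nb R b → (∀ {s} → Nb R s → S₁ s → s ≡ a ⊎ s ≡ b) →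
                  (∀ {s} → Nb R s → S₂ s → s ≡ a ⊎ s ≡ b) → a ≢ b → ∀ {r x} → R r → Post (cops (f₁ r) (f₂ r) x) r
      chord-two {a} {b} a∉ b∉ na nb only₁ only₂ a≢b = refineChord next
        where
        open Chord (chord na nb) a∉ b∉
        path-on : ∀ {s} → s ≡ a ⊎ s ≡ b → OnPath s
        path-on (inj₁ e) = inj₁ e
        path-on (inj₂ e) = inj₂ (inj₁ e)
        b∉P₃ : b ∉ sources P₃
        b∉P₃ (here e) = a≢b (trans (sym (proj₁ path)) (sym e))
        b∉P₃ (there i) = b∉rest i
        next : Smaller OnPath shade
        next {R′} T′ le sub out bd′ r′ = Post₁₃ (ih T′ le (Guard-mono sub id guard) (still (Guard-mono sub id g₂)) bounded
          (lone a P₃ b path (∉-unique (λ i → a∉rest (subst (_∈ sources rest) (proj₁ path) i)) unique) b∉P₃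
            on-verts (λ w q → out q (verts-on w)) (λ ())) r′)
          where
          bounded : Bounded R′ OnPath (λ _ → ⊥)
          bounded q e with bd′ q e
          ... | inj₁ i = inj₁ i
          ... | inj₂ (inj₁ s) = inj₂ (inj₁ (path-on (only₁ (_ , sub q , e) s)))
          ... | inj₂ (inj₂ (inj₁ s)) = inj₂ (inj₁ (path-on (only₂ (_ , sub q , e) s)))
          ... | inj₂ (inj₂ (inj₂ s)) = inj₂ (inj₁ s)

      -- The chord P₃ divides the region bounded by the cycle; by the theta lemma
      -- what is left of the territory misses the interior of one of three paths.
      module CycleTwo {u v pre d mid post es a b x xs}
        (pu : Path u pre a) (pm : Path a (d ∷ mid) b) (po : Path b post v) (pe : Path v es u)
        (eq : post ++ (es ++ pre) ≡ x ∷ xs)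
        (uq : Unique (sources (pre ++ ((d ∷ mid) ++ post)) ++ sources es)) (es≢ : es ≢ [])
        (on₁ : ∀ {s} → S₁ s → Vert (pre ++ ((d ∷ mid) ++ post)) v s) (on₂ : ∀ {s} → S₂ s → Vert es u s)
        (avoid₁ : ∀ {s} → s ∈ sources (pre ++ ((d ∷ mid) ++ post)) → ¬ R s) (avoid₂ : ∀ {s} → s ∈ sources es → ¬ R s)
        (na : Nb R a) (nb : Nb R b)
        (only : ∀ {s} → Vert (pre ++ ((d ∷ mid) ++ post)) v s → Nb R s → Vert (d ∷ mid) b s) where

        M = d ∷ mid
        ds = pre ++ (M ++ post)

        split-ds : sources ds ≡ sources pre ++ (sources M ++ sources post)
        split-ds = trans (map-++ face pre (M ++ post)) (cong (sources pre ++_) (map-++ face M post))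

        split-X : sources (x ∷ xs) ≡ sources post ++ (sources es ++ sources pre)
        split-X = trans (cong sources (sym eq)) (trans (map-++ face post (es ++ pre))
          (cong (sources post ++_) (map-++ face es pre)))

        U : Unique (sources M ++ sources (x ∷ xs))
        U = subst (λ l → Unique (sources M ++ l)) (sym split-X) (unique-rotate (sources pre) (sources M) (sources post)
          (sources es) (subst (λ l → Unique (l ++ sources es)) split-ds uq))

        X : Path b (x ∷ xs) a
        X = subst (λ l → Path b l a) eq (Path-++ post po (Path-++ es pe pu))

        M-ds : ∀ {s} → s ∈ sources M → s ∈ sources ds
        M-ds {s} i = subst (s ∈_) (sym split-ds) (∈-++⁺ʳ (sources pre) (∈-++⁺ˡ i))

        avoid-M : ∀ {s} → s ∈ sources M → ¬ R s
        avoid-M i = avoid₁ (M-ds i)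

        avoid-X : ∀ {s} → s ∈ sources (x ∷ xs) → ¬ R s
        avoid-X {s} i with ∈-++⁻ (sources post) (subst (s ∈_) split-X i)
        ... | inj₁ j = avoid₁ (subst (s ∈_) (sym split-ds) (∈-++⁺ʳ (sources pre) (∈-++⁺ʳ (sources M) j)))
        ... | inj₂ j with ∈-++⁻ (sources es) j
        ...   | inj₁ k = avoid₂ k
        ...   | inj₂ k = avoid₁ (subst (s ∈_) (sym split-ds) (∈-++⁺ˡ k))

        a∈M : a ∈ sources M
        a∈M = here (sym (proj₁ pm))
        b∈X : b ∈ sources (x ∷ xs)
        b∈X = here (sym (proj₁ X))
        a∉X : a ∉ sources (x ∷ xs)
        a∉X = unique-disjoint (sources M) U a∈M
        b∉M : b ∉ sources M
        b∉M i = unique-disjoint (sources M) U i b∈X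
        uM : Unique (sources M)
        uM = unique-++ˡ (sources M) U
        uX : Unique (sources (x ∷ xs))
        uX = unique-++ʳ (sources M) U
        a∉mid : a ∉ sources mid
        a∉mid i = unique-disjoint (face d ∷ []) uM (here refl) (subst (_∈ sources mid) (sym (proj₁ pm)) i)
        b∉xs : b ∉ sources xs
        b∉xs i = unique-disjoint (face x ∷ []) uX (here refl) (subst (_∈ sources xs) (sym (proj₁ X)) i)
        a≢b : a ≢ b
        a≢b refl = b∉M a∈M
        a∉ : ¬ R a
        a∉ = avoid-M a∈M
        b∉ : ¬ R b
        b∉ = avoid-X b∈X

        open Chord (chord na nb) a∉ b∉

        on-X : ∀ {s} → S₂ s → Vert (x ∷ xs) a s
        on-X {s} i = subst (λ l → Vert l a s) eq (Vert-++ʳ post (Vert-++ˡ es pe pu (on₂ i)))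

        arc₁ arc₃ : Arc a b
        arc₁ = record { first = d ; rest = mid ; path = pm ; a∉ = a∉mid ; b∉ = b∉M ∘ there }
        arc₃ = record { first = first ; rest = rest ; path = path ; a∉ = a∉rest ; b∉ = b∉rest }

        module _ {R′ : Fin F → Set} (T′ : Territory R′) (sub : ∀ {x} → R′ x → R x) (out : ∀ {x} → R′ x → ¬ OnPath x) where

          Touch : List (Fin D) → Set
          Touch l = ∃[ s ] (s ∈ sources l × Nb R′ s)

          touch? : ∀ l → Dec (Touch l)
          touch? l = any? λ s → (s ∈? sources l) ×-dec Nb? (inside? T′) s

          theta : Touch mid → Touch xs → Touch rest → ⊥
          theta (s₁ , i₁ , x₁ , r₁ , (d₁ , h₁ , refl , q₁)) (s₂ , i₂ , x₂ , r₂ , e₂) (s₃ , i₃ , x₃ , r₃ , e₃)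
            with arc-rev x xs X uX a∉X
          ... | arc₂ , to , from = Three.absurd a≢b arc₁ arc₂ arc₃ dis₁₂ dis₁₃ dis₂₃ d₁ h₁ (off₁ r₁) (off₂ r₁) (off₃ r₁)
                (Linked-trans (inner-link mid (proj₂ (proj₂ pm)) i₁ λ i → in₁-off₂ i , in₁-off₃ i)
                  (Linked-E (E-sym (d₁ , h₁ , refl , q₁)) (in₁-off₂ i₁ , in₁-off₃ i₁) (off₂ r₁ , off₃ r₁)))
                (Linked-trans (inner-link (Arc.rest arc₂) (proj₂ (proj₂ (Arc.path arc₂))) (from i₂) λ i → in₂-off₁ (to i) , in₂-off₃ (to i))
                  (Linked-trans (Linked-E (E-sym e₂) (in₂-off₁ i₂ , in₂-off₃ i₂) (off₁ r₂ , off₃ r₂))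
                    (Linked-mono (λ r → off₁ r , off₃ r) (connected T′ r₂ r₁))))
                (Linked-trans (inner-link rest (proj₂ (proj₂ path)) i₃ λ i → in₃-off₁ i , in₃-off₂ i)
                  (Linked-trans (Linked-E (E-sym e₃) (in₃-off₁ i₃ , in₃-off₂ i₃) (off₁ r₃ , off₂ r₃))
                    (Linked-mono (λ r → off₁ r , off₂ r) (connected T′ r₃ r₁))))
                (head-source mid (proj₂ (proj₂ pm)) i₁)
                (head-source (Arc.rest arc₂) (proj₂ (proj₂ (Arc.path arc₂))) (from i₂))
                (head-source rest (proj₂ (proj₂ path)) i₃)
            where
            rest-R : ∀ {s} → s ∈ sources rest → R s
            rest-R i = let (j , le , e) = inner i in subst R e (Geodesic.p-in (chord na nb) le)
            dis₁₂ : ∀ {f} → f ∈ sources mid → ¬ Arc.Inside arc₂ f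
            dis₁₂ i j = unique-disjoint (sources M) U (there i) (there (to j))
            dis₁₃ : ∀ {f} → f ∈ sources mid → f ∉ sources rest
            dis₁₃ i j = avoid-M (there i) (rest-R j)
            dis₂₃ : ∀ {f} → Arc.Inside arc₂ f → f ∉ sources rest
            dis₂₃ i j = avoid-X (there (to i)) (rest-R j)
            ends-off : ∀ {s} → R s → s ≢ a × s ≢ b
            ends-off r = (λ { refl → a∉ r }) , (λ { refl → b∉ r })
            off₁ : ∀ {s} → R′ s → Off a≢b arc₁ s
            off₁ r = proj₁ (ends-off (sub r)) , proj₂ (ends-off (sub r)) , λ i → avoid-M (there i) (sub r)
            off₂ : ∀ {s} → R′ s → Off a≢b arc₂ s
            off₂ r = proj₁ (ends-off (sub r)) , proj₂ (ends-off (sub r)) , λ i → avoid-X (there (to i)) (sub r)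
            off₃ : ∀ {s} → R′ s → Off a≢b arc₃ s
            off₃ r = proj₁ (ends-off (sub r)) , proj₂ (ends-off (sub r)) , λ i → out r (inj₂ (inj₂ (inner i)))
            ends₁ : ∀ {s} → s ∈ sources mid → s ≢ a × s ≢ b
            ends₁ i = (λ { refl → a∉mid i }) , (λ { refl → b∉M (there i) })
            ends₂ : ∀ {s} → s ∈ sources xs → s ≢ a × s ≢ b
            ends₂ i = (λ { refl → a∉X (there i) }) , (λ { refl → b∉xs i })
            in₁-off₂ : ∀ {s} → s ∈ sources mid → Off a≢b arc₂ s
            in₁-off₂ i = proj₁ (ends₁ i) , proj₂ (ends₁ i) , dis₁₂ i
            in₁-off₃ : ∀ {s} → s ∈ sources mid → Off a≢b arc₃ s
            in₁-off₃ i = proj₁ (ends₁ i) , proj₂ (ends₁ i) , dis₁₃ i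
            in₂-off₁ : ∀ {s} → s ∈ sources xs → Off a≢b arc₁ s
            in₂-off₁ i = proj₁ (ends₂ i) , proj₂ (ends₂ i) , λ j → dis₁₂ j (from i)
            in₂-off₃ : ∀ {s} → s ∈ sources xs → Off a≢b arc₃ s
            in₂-off₃ i = proj₁ (ends₂ i) , proj₂ (ends₂ i) , dis₂₃ (from i)
            in₃-off₁ : ∀ {s} → s ∈ sources rest → Off a≢b arc₁ s
            in₃-off₁ i = proj₁ (ends-off (rest-R i)) , proj₂ (ends-off (rest-R i)) , λ j → dis₁₃ j i
            in₃-off₂ : ∀ {s} → s ∈ sources rest → Off a≢b arc₂ s
            in₃-off₂ i = proj₁ (ends-off (rest-R i)) , proj₂ (ends-off (rest-R i)) , λ j → dis₂₃ j i

        -- The untouched path decides which cop is released: the first if the token no longer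
        -- reaches the inside of `M`, the second if it no longer reaches the inside of the
        -- complementary path, and the third, keeping the old cycle, if it no longer reaches the
        -- inside of the chord.
        next : Smaller OnPath shade
        next {R′} T′ le sub out bd′ r′ with touch? T′ sub out mid | touch? T′ sub out xs | touch? T′ sub out rest
        ... | no ¬t | _ | _ = Post₁₃ (ih T′ le (Guard-mono sub id guard) (Guard-mono sub id g₂) bounded
                (close′ sub out x xs X uX a∉X avoid-X on-X) r′)
          where
          bounded : Bounded R′ OnPath S₂
          bounded q e with bd′ q e
          ... | inj₁ i = inj₁ i
          ... | inj₂ (inj₂ (inj₁ s)) = inj₂ (inj₂ s)
          ... | inj₂ (inj₂ (inj₂ s)) = inj₂ (inj₁ s)
          ... | inj₂ (inj₁ s) with only (on₁ s) (_ , sub q , e)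
          ...   | inj₁ (here refl) = inj₂ (inj₁ (inj₁ (proj₁ pm)))
          ...   | inj₁ (there i) = ⊥-elim (¬t (_ , i , _ , q , e))
          ...   | inj₂ refl = inj₂ (inj₁ (inj₂ (inj₁ refl)))
        ... | yes _ | no ¬t | _ = Post₂₃ (ih T′ le (Guard-mono sub proj₁ g₁) (Guard-mono sub id guard) bounded
                (close sub out d mid pm uM b∉M avoid-M proj₂) r′)
          where
          bounded : Bounded R′ (λ s → S₁ s × Vert M b s) OnPath
          bounded q e with bd′ q e
          ... | inj₁ i = inj₁ i
          ... | inj₂ (inj₁ s) = inj₂ (inj₁ (s , only (on₁ s) (_ , sub q , e)))
          ... | inj₂ (inj₂ (inj₂ s)) = inj₂ (inj₂ s)
          ... | inj₂ (inj₂ (inj₁ s)) with on-X s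
          ...   | inj₁ (here refl) = inj₂ (inj₂ (inj₂ (inj₁ (proj₁ X))))
          ...   | inj₁ (there i) = ⊥-elim (¬t (_ , i , _ , q , e))
          ...   | inj₂ refl = inj₂ (inj₂ (inj₁ refl))
        ... | yes _ | yes _ | no ¬t = ih T′ le (Guard-mono sub id g₁) (Guard-mono sub id g₂) bounded
                (cycle u ds v es (Path-++ pre pu (Path-++ M pm po)) pe uq ds≢ es≢ on₁ on₂
                  (λ i r → avoid₁ i (sub r)) (λ i r → avoid₂ i (sub r))) r′
          where
          ds≢ : ds ≢ []
          ds≢ e with ++-conicalʳ pre (M ++ post) e
          ... | ()
          bounded : Bounded R′ S₁ S₂
          bounded q e with bd′ q e
          ... | inj₁ i = inj₁ i
          ... | inj₂ (inj₁ s) = inj₂ (inj₁ s)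
          ... | inj₂ (inj₂ (inj₁ s)) = inj₂ (inj₂ s)
          ... | inj₂ (inj₂ (inj₂ o)) with bd (sub q) e
          ...   | inj₂ s = inj₂ s
          ...   | inj₁ ry with o
          ...     | inj₁ refl = ⊥-elim (a∉ ry)
          ...     | inj₂ (inj₁ refl) = ⊥-elim (b∉ ry)
          ...     | inj₂ (inj₂ (i , le , refl)) = ⊥-elim (¬t (_ , inner′ le , _ , q , e))
        next T′ le sub out bd′ r′ | yes t₁ | yes t₂ | yes t₃ = ⊥-elim (theta T′ sub out t₁ t₂ t₃)

        cycle-two : ∀ {r x} → R r → Post (cops (f₁ r) (f₂ r) x) r
        cycle-two = refineChord next

    solve : ∀ m → Goal m
    solve zero T size g₁ g₂ bd sh rr = ⊥-elim (ℕₚ.1+n≰n (ℕₚ.≤-trans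
      (count-≥ (inside? T) {xs = _ ∷ []} ([] ∷ []) λ { (here refl) → rr }) size))
    solve (suc m) {R} {S₁} {S₂} T size g₁ g₂ bd (lone u ds v p uq v∉ on avoid none₂) with ends (Nb? (inside? T)) ds p
    ... | none nn = Refine.few₀ (solve m) T size g₁ g₂ bd (λ n s → nn (on s) n) (λ _ → none₂)
    ... | one a na va only = Refine.few₁ (solve m) T size g₁ g₂ bd a (avoid va) na (λ n s → only (on s) n) (λ _ s → ⊥-elim (none₂ s))
    ... | two pre d mid post a b refl pu pm po na nb only =
          Divide.lone-two (solve m) T size g₁ g₂ bd pu pm po uq v∉ on avoid none₂ na nb only
    solve (suc m) {R} {S₁} {S₂} T size g₁ g₂ bd (cycle u ds v es p q uq ds≢ es≢ on₁ on₂ avoid₁ avoid₂)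
      with ends (Nb? (inside? T)) ds p | ends (Nb? (inside? T)) es q
    ... | two pre d mid post a b refl pu pm po na nb only | _ =
          let (x , xs , eq) = nonempty (post ++ (es ++ pre)) λ e → es≢ (++-conicalˡ es pre (++-conicalʳ post (es ++ pre) e)) in
          Divide.CycleTwo.cycle-two (solve m) T size g₁ g₂ bd pu pm po q eq uq es≢ on₁ on₂ avoid₁ avoid₂ na nb only
    ... | _ | two pre d mid post a b refl pu pm po na nb only =
          let (x , xs , eq) = nonempty (post ++ (ds ++ pre)) λ e → ds≢ (++-conicalˡ ds pre (++-conicalʳ post (ds ++ pre) e)) in
          λ rr → Post₁₂ (Divide.CycleTwo.cycle-two (solve m) T size g₂ g₁ swapped pu pm po p eq
            (unique-comm (sources ds) _ uq) ds≢ on₂ on₁ avoid₂ avoid₁ na nb only rr)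
          where
          swapped : Bounded R S₂ S₁
          swapped i e with bd i e
          ... | inj₁ r = inj₁ r
          ... | inj₂ (inj₁ s) = inj₂ (inj₂ s)
          ... | inj₂ (inj₂ s) = inj₂ (inj₁ s)
    ... | none n₁ | none n₂ = Refine.few₀ (solve m) T size g₁ g₂ bd (λ n s → n₁ (on₁ s) n) (λ n s → n₂ (on₂ s) n)
    ... | one a na va only | none n₂ = Refine.few₁ (solve m) T size g₁ g₂ bd a (outside va) na
          (λ n s → only (on₁ s) n) (λ n s → ⊥-elim (n₂ (on₂ s) n))
      where
      outside : ∀ {s} → Vert ds v s → ¬ R s
      outside (inj₁ i) = avoid₁ i
      outside (inj₂ refl) with nonempty es es≢
      ... | y , ys , refl = avoid₂ (here (sym (proj₁ q)))
    ... | none n₁ | one b nb vb only = Refine.few₁ (solve m) T size g₁ g₂ bd b (outside vb) nb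
          (λ n s → ⊥-elim (n₁ (on₁ s) n)) (λ n s → only (on₂ s) n)
      where
      outside : ∀ {s} → Vert es u s → ¬ R s
      outside (inj₁ i) = avoid₂ i
      outside (inj₂ refl) with nonempty ds ds≢
      ... | y , ys , refl = avoid₁ (here (sym (proj₁ p)))
    ... | one a na va only₁ | one b nb vb only₂ with a ≟ b
    ...   | yes refl = Refine.few₁ (solve m) T size g₁ g₂ bd a (outside va) na (λ n s → only₁ (on₁ s) n) (λ n s → only₂ (on₂ s) n)
      where
      outside : ∀ {s} → Vert ds v s → ¬ R s
      outside (inj₁ i) = avoid₁ i
      outside (inj₂ refl) with nonempty es es≢
      ... | y , ys , refl = avoid₂ (here (sym (proj₁ q)))
    ...   | no a≢b = Divide.chord-two (solve m) T size g₁ g₂ bd (outside va) (outside′ vb) na nb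
          (λ n s → inj₁ (only₁ (on₁ s) n)) (λ n s → inj₂ (only₂ (on₂ s) n)) a≢b
      where
      outside : ∀ {s} → Vert ds v s → ¬ R s
      outside (inj₁ i) = avoid₁ i
      outside (inj₂ refl) with nonempty es es≢
      ... | y , ys , refl = avoid₂ (here (sym (proj₁ q)))
      outside′ : ∀ {s} → Vert es u s → ¬ R s
      outside′ (inj₁ i) = avoid₂ i
      outside′ (inj₂ refl) with nonempty ds ds≢
      ... | y , ys , refl = avoid₁ (here (sym (proj₁ p)))

    whole : Territory (CompFace κ₀)
    whole .inside? = compFace? κ₀
    whole .connected (d , h , refl) (d′ , h′ , refl) = go (linked vtree d d′ (vs-all _ h) (vs-all _ h′))
      where
      open Colouring G base using (linked; vtree; vs-all; Link) renaming (stop to lstop; hop to lhop; ds to tree-darts)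
      go : ∀ {f g} → Link tree-darts f g → Linked (CompFace κ₀) f g
      go lstop = stop
      go (lhop e (_ , _ , h) l) = hop e h (e , h , refl) (α e , Here-α h , refl) (go l)

    -- Initially the territory is the whole component, which no step of the token leaves, and two
    -- cops idly guard the empty set.
    three-cops-catch : ∀ x y z {r} → CompFace κ₀ r → Post (cops x y z) r
    three-cops-catch x y z rr = Refine.few₀ (solve (count (compFace? κ₀))) whole (ℕₚ.n≤1+n _)
      (idle x) (idle y) (λ { _ (d , h , refl , refl) → inj₁ (α d , Here-α h , refl) }) (λ _ ()) (λ _ ()) rr
      where
      idle : ∀ x → Guard (CompFace κ₀) (λ _ → ⊥) (λ _ → x)
      idle x .inside _ _ _ = inj₁ refl
      idle x .catch _ ()

-- Six cops win when no degree exceeds four.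

module DegreeFour where
  open PlayingOut
  open Forests
  open Rotations
  open JordanCurves
  open CatchingTokens
  open AignerFromme
  open import Data.Fin.Patterns
  open import Data.Fin.Properties using (any?)

  module SixCops (G : PlaneGraph) (deg≤4 : ∀ v → PlaneGraph.degree G v ≤ 4) where
    open PlaneGraph G
    open IsPlaneMap plane
    open Game G 6 hiding (CopsWin)
    open Strategies G 6
    open Faces G

    Next : Config → Fin V → Set
    Next c v = Captured c v ⊎ (∀ w → ValidRobberMove v w → Win c w)

    Next-perm : ∀ i j {c v} → Next (λ k → c (PC.transpose i j k)) v → Next c v
    Next-perm i j (inj₁ cap) = inj₁ λ f inc → let (k , p) = cap f inc in PC.transpose i j k , p
    Next-perm i j (inj₂ w) = inj₂ λ v m → Win-perm (PC.transpose i j) (PC.transpose j i)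
      (λ k → PC.transpose-inverse i j) (λ k → PC.transpose-inverse j i) (λ _ → refl) (w v m)

    module _ (base : Fin D) where
      open Colouring G base using (Here; Here-α)
      open Catching G base hiding (cops; moves)
      open Pursuit G base using (three-cops-catch)

      Side : Fin D → Fin F → Fin F → Set
      Side e x y = (face e ≡ x × face (α e) ≡ y) ⊎ (face e ≡ y × face (α e) ≡ x)

      Side-sym : ∀ {e x y} → Side e x y → Side e y x
      Side-sym (inj₁ p) = inj₂ p
      Side-sym (inj₂ p) = inj₁ p

      Step-sym : ∀ {f g} → Step f g → Step g f
      Step-sym (inj₁ e) = inj₁ (sym e)
      Step-sym (inj₂ e) = inj₂ (E-sym e)

      Step⇒Lazy : ∀ {f g} → Step f g → Lazy f g
      Step⇒Lazy (inj₁ e) = inj₁ e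
      Step⇒Lazy (inj₂ e) = E⇒Lazy e

      -- The faces around v in cyclic order, with repetitions when deg v < 4.
      record Quad (v : Fin V) (a b c d : Fin F) : Set where
        field
          cover : ∀ f → Incident v f → f ≡ a ⊎ f ≡ b ⊎ f ≡ c ⊎ f ≡ d
          ab : Step a b
          bc : Step b c
          cd : Step c d
          da : Step d a
          edges : ∀ e → tail e ≡ v → Side e a b ⊎ Side e b c ⊎ Side e c d ⊎ Side e d a
      open Quad

      rotate : ∀ {v a b c d} → Quad v a b c d → Quad v b c d a
      rotate Q .cover f i with cover Q f i
      ... | inj₁ p = inj₂ (inj₂ (inj₂ p))
      ... | inj₂ (inj₁ p) = inj₁ p
      ... | inj₂ (inj₂ (inj₁ p)) = inj₂ (inj₁ p)
      ... | inj₂ (inj₂ (inj₂ p)) = inj₂ (inj₂ (inj₁ p))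
      rotate Q .ab = bc Q
      rotate Q .bc = cd Q
      rotate Q .cd = da Q
      rotate Q .da = ab Q
      rotate Q .edges e p with edges Q e p
      ... | inj₁ s = inj₂ (inj₂ (inj₂ s))
      ... | inj₂ (inj₁ s) = inj₁ s
      ... | inj₂ (inj₂ (inj₁ s)) = inj₂ (inj₁ s)
      ... | inj₂ (inj₂ (inj₂ s)) = inj₂ (inj₂ (inj₁ s))

      reflect : ∀ {v a b c d} → Quad v a b c d → Quad v d c b a
      reflect Q .cover f i with cover Q f i
      ... | inj₁ p = inj₂ (inj₂ (inj₂ p))
      ... | inj₂ (inj₁ p) = inj₂ (inj₂ (inj₁ p))
      ... | inj₂ (inj₂ (inj₁ p)) = inj₂ (inj₁ p)
      ... | inj₂ (inj₂ (inj₂ p)) = inj₁ p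
      reflect Q .ab = Step-sym (cd Q)
      reflect Q .bc = Step-sym (bc Q)
      reflect Q .cd = Step-sym (ab Q)
      reflect Q .da = Step-sym (da Q)
      reflect Q .edges e p with edges Q e p
      ... | inj₁ s = inj₂ (inj₂ (inj₁ (Side-sym s)))
      ... | inj₂ (inj₁ s) = inj₂ (inj₁ (Side-sym s))
      ... | inj₂ (inj₂ (inj₁ s)) = inj₁ (Side-sym s)
      ... | inj₂ (inj₂ (inj₂ s)) = inj₂ (inj₂ (inj₂ (Side-sym s)))

      E-σ : ∀ e → Here e → E (face e) (face (σ e))
      E-σ e h = e , h , refl , sym (face-σ e)

      Here-σ : ∀ {e} → Here e → Here (σ e)
      Here-σ h = trans (cong comp (σ-tail _)) h

      around : ∀ e → Here e → Quad (tail e) (face e) (face (σ e)) (face (σ (σ e))) (face (σ (σ (σ e))))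
      around e h = go (σ-period (tail e) (deg≤4 _) e refl)
        where
        f₁ = face (σ e)
        f₂ = face (σ (σ e))
        f₃ = face (σ (σ (σ e)))
        go : (∃[ p ] (p ≤ 3 × iter σ (suc p) e ≡ e)) → Quad (tail e) (face e) f₁ f₂ f₃
        go (p , p≤3 , q) = record
          { cover = cov
          ; ab = inj₂ (E-σ e h)
          ; bc = inj₂ (E-σ (σ e) (Here-σ h))
          ; cd = inj₂ (E-σ (σ (σ e)) (Here-σ (Here-σ h)))
          ; da = last p p≤3 q
          ; edges = λ d eq → side d (turn d eq)
          }
          where
          turn : ∀ d → tail d ≡ tail e → ∃[ r ] (r ≤ p × iter σ r e ≡ d)
          turn d eq with σ-trans e d (sym eq)
          ... | n , s with iter-period σ e p q n
          ...   | r , r≤p , s′ = r , r≤p , trans (sym s′) s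
          dart : ∀ d → (∃[ r ] (r ≤ p × iter σ r e ≡ d)) → face d ≡ face e ⊎ face d ≡ f₁ ⊎ face d ≡ f₂ ⊎ face d ≡ f₃
          dart d (0 , _ , refl) = inj₁ refl
          dart d (1 , _ , refl) = inj₂ (inj₁ refl)
          dart d (2 , _ , refl) = inj₂ (inj₂ (inj₁ refl))
          dart d (3 , _ , refl) = inj₂ (inj₂ (inj₂ refl))
          dart d (suc (suc (suc (suc r))) , r≤p , _) with ℕₚ.≤-trans r≤p p≤3
          ... | s≤s (s≤s (s≤s ()))
          cov : ∀ f → Incident (tail e) f → f ≡ face e ⊎ f ≡ f₁ ⊎ f ≡ f₂ ⊎ f ≡ f₃
          cov f (inj₁ (d , eq , refl)) = dart d (turn d eq)
          cov f (inj₂ (iso , _)) = ⊥-elim (iso e refl)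
          last : ∀ p → p ≤ 3 → iter σ (suc p) e ≡ e → Step f₃ (face e)
          last 0 _ q = inj₁ (cong face (sym (trans (cong σ (trans (cong σ q) q)) q)))
          last 1 _ q = inj₂ (subst (λ x → E x (face e)) (cong face (cong σ (sym q))) (E-sym (E-σ e h)))
          last 2 _ q = inj₁ (cong face (sym q))
          last 3 _ q = inj₂ (subst (E f₃) (cong face q) (E-σ (σ (σ (σ e))) (Here-σ (Here-σ (Here-σ h)))))
          last (suc (suc (suc (suc _)))) (s≤s (s≤s (s≤s ()))) q
          side : ∀ d → (∃[ r ] (r ≤ p × iter σ r e ≡ d)) →
                 Side d (face e) f₁ ⊎ Side d f₁ f₂ ⊎ Side d f₂ f₃ ⊎ Side d f₃ (face e)
          side d (0 , _ , refl) = inj₁ (inj₁ (refl , sym (face-σ e)))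
          side d (1 , _ , refl) = inj₂ (inj₁ (inj₁ (refl , sym (face-σ (σ e)))))
          side d (2 , _ , refl) = inj₂ (inj₂ (inj₁ (inj₁ (refl , sym (face-σ (σ (σ e)))))))
          side d (3 , r≤p , refl) = inj₂ (inj₂ (inj₂ (inj₁ (refl , trans (sym (face-σ (σ (σ (σ e)))))
            (cong face (subst (λ p → iter σ (suc p) e ≡ e) (ℕₚ.≤-antisym p≤3 r≤p) q))))))
          side d (suc (suc (suc (suc r))) , r≤p , _) with ℕₚ.≤-trans r≤p p≤3
          ... | s≤s (s≤s (s≤s ()))

      Moved : Fin V → (a b c d : Fin F) → Set
      Moved w a b c d = ∃[ a′ ] ∃[ b′ ] ∃[ c′ ] ∃[ d′ ]
        (Quad w a′ b′ c′ d′ × Step a a′ × Step b b′ × Step c c′ × Step d d′)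

      arrive : ∀ e {x y} → Here e → Side e x y → ∃[ g ] ∃[ g′ ] Quad (tail (α e)) x y g g′
      arrive e h (inj₂ (refl , refl)) = _ , _ ,
        subst (λ f → Quad (tail (α e)) (face (α e)) f (face (σ (σ (α e)))) (face (σ (σ (σ (α e)))))) (face-σα e) (around (α e) (Here-α h))
      arrive e h (inj₁ (refl , refl)) with arrive e h (inj₂ (refl , refl))
      ... | g , g′ , Q = g′ , g , rotate (rotate (reflect Q))

      -- Crossing between a and b, the tokens on c, d fall back onto the kept
      -- faces while those on a, b advance to the new ones.
      leave : ∀ {v a b c d} → Quad v a b c d → ∀ e → Here e → Side e a b → Moved (tail (α e)) a b c d
      leave Q e h s with arrive e h s
      ... | g , g′ , Q′ = g′ , g , _ , _ , reflect Q′ , Step-sym (da Q′) , bc Q′ , Step-sym (bc Q) , da Q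

      turnback : ∀ {w a b c d} → Moved w b c d a → Moved w a b c d
      turnback (b′ , c′ , d′ , a′ , Q , sb , sc , sd , sa) =
        a′ , b′ , c′ , d′ , rotate (rotate (rotate Q)) , sa , sb , sc , sd

      robber-moves : ∀ {v w a b c d} → comp v ≡ comp (tail base) → Quad v a b c d → ValidRobberMove v w →
                     comp w ≡ comp (tail base) × Moved w a b c d
      robber-moves hv Q (inj₁ refl) = hv , _ , _ , _ , _ , Q , inj₁ refl , inj₁ refl , inj₁ refl , inj₁ refl
      robber-moves hv Q (inj₂ (e , refl , refl)) = Here-α hv , go Q (edges Q e refl)
        where
        go : ∀ {a b c d} (Q : Quad (tail e) a b c d) → Side e a b ⊎ Side e b c ⊎ Side e c d ⊎ Side e d a →
             Moved (tail (α e)) a b c d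
        go Q (inj₁ s) = leave Q e hv s
        go Q (inj₂ (inj₁ s)) = turnback (leave (rotate Q) e hv s)
        go Q (inj₂ (inj₂ (inj₁ s))) = turnback (turnback (leave (rotate (rotate Q)) e hv s))
        go Q (inj₂ (inj₂ (inj₂ s))) = turnback (turnback (turnback (leave (rotate (rotate (rotate Q))) e hv s)))

      InComp : Fin V → Set
      InComp v = comp v ≡ comp (tail base)

      Catch-ready : ∀ {c : Fin 3 → Fin F} {r} → CompFace (comp (tail base)) r → Post c r
      Catch-ready {c} rr = Post-perm (λ i → i) (λ i → i) (λ _ → refl) (λ _ → refl)
        (λ { 0F → refl ; 1F → refl ; 2F → refl }) (three-cops-catch (c 0F) (c 1F) (c 2F) rr)

      Faces : (b c d : Fin F) → Set
      Faces b c d = C b × C c × C d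
        where C = CompFace (comp (tail base))

      step-face : ∀ {f g} → CompFace (comp (tail base)) f → Step f g → CompFace (comp (tail base)) g
      step-face i (inj₁ refl) = i
      step-face i (inj₂ (d , h , _ , refl)) = α d , Here-α h , refl

      step-faces : ∀ {b c d b′ c′ d′} → Faces b c d → Step b b′ → Step c c′ → Step d d′ → Faces b′ c′ d′
      step-faces (i , j , k) sb sc sd = step-face i sb , step-face j sc , step-face k sd

      -- With n tokens guarded by cops 0, …, n-1, the next three cops pursue token n.
      stage₃ : ∀ {v a b c d} (x : Config) (ch : Trio) → InComp v → Quad v a b c d → x 0F ≡ a → x 1F ≡ b → x 2F ≡ c →
               x 3F ≡ ch 0F → x 4F ≡ ch 1F → x 5F ≡ ch 2F → Post ch d → Next x v
      -- `Post` speaks of the moment after the cops' move, when the tokens on `a`, `b` and `c` are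
      -- occupied as well. Catching the last token is therefore already the capture of the robber.
      stage₃ x ch hv Q e₀ e₁ e₂ e₃ e₄ e₅ (inj₁ (i , p)) = inj₁ caught
        where
        on-d : ∀ i → ch i ≡ _ → ∃[ j ] x j ≡ _
        on-d 0F p = 3F , trans e₃ p
        on-d 1F p = 4F , trans e₄ p
        on-d 2F p = 5F , trans e₅ p
        caught : Captured x _
        caught f inc with cover Q f inc
        ... | inj₁ refl = 0F , e₀
        ... | inj₂ (inj₁ refl) = 1F , e₁
        ... | inj₂ (inj₂ (inj₁ refl)) = 2F , e₂
        ... | inj₂ (inj₂ (inj₂ refl)) = on-d i p
      stage₃ x ch hv Q refl refl refl e₃ e₄ e₅ (inj₂ k) = inj₂ λ w m → go (robber-moves hv Q m)
        where
        go : ∀ {w} → InComp w × Moved w _ _ _ _ → Win x w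
        go (hw , a′ , b′ , c′ , d′ , Q′ , sa , sb , sc , sd) with k d′ sd
        ... | step ch′ ok n = step y valid (stage₃ y ch′ hw Q′ refl refl refl refl refl refl n)
          where
          y : Config
          y = λ { 0F → a′ ; 1F → b′ ; 2F → c′ ; 3F → ch′ 0F ; 4F → ch′ 1F ; 5F → ch′ 2F }
          valid : ValidCopMove x y
          valid 0F = Step⇒Lazy sa
          valid 1F = Step⇒Lazy sb
          valid 2F = Step⇒Lazy sc
          valid 3F = subst (λ z → Lazy z (ch′ 0F)) (sym e₃) (ok 0F)
          valid 4F = subst (λ z → Lazy z (ch′ 1F)) (sym e₄) (ok 1F)
          valid 5F = subst (λ z → Lazy z (ch′ 2F)) (sym e₅) (ok 2F)

      trio : Fin F → Fin F → Fin F → Trio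
      trio x y z = λ { 0F → x ; 1F → y ; 2F → z }

      -- A cop that has caught a token can follow it, since tokens move only to adjacent faces.
      -- `Next-perm` seats this cop, and the two remaining hunters are joined by a fresh one for the
      -- next token; the other stages pass on in the same way.
      stage₂ : ∀ {v a b c d} (x : Config) (ch : Trio) → InComp v → Faces b c d → Quad v a b c d → x 0F ≡ a → x 1F ≡ b →
               x 2F ≡ ch 0F → x 3F ≡ ch 1F → x 4F ≡ ch 2F → Post ch c → Next x v
      stage₂ {v} {a} {b} {c} {d} x ch hv fs Q e₀ e₁ e₂ e₃ e₄ (inj₁ (i , p)) = caught i p
        where
        seated : ∀ y → y 0F ≡ a → y 1F ≡ b → y 2F ≡ c → Next y v
        seated y p q r = stage₃ y (trio (y 3F) (y 4F) (y 5F)) hv Q p q r refl refl refl (Catch-ready (proj₂ (proj₂ fs)))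
        caught : ∀ i → ch i ≡ c → Next x v
        caught 0F p = seated x e₀ e₁ (trans e₂ p)
        caught 1F p = Next-perm 2F 3F (seated _ e₀ e₁ (trans e₃ p))
        caught 2F p = Next-perm 2F 4F (seated _ e₀ e₁ (trans e₄ p))
      stage₂ x ch hv fs Q refl refl e₂ e₃ e₄ (inj₂ k) = inj₂ λ w m → go (robber-moves hv Q m)
        where
        go : ∀ {w} → InComp w × Moved w _ _ _ _ → Win x w
        go (hw , a′ , b′ , c′ , d′ , Q′ , sa , sb , sc , sd) with k c′ sc
        ... | step ch′ ok n = step y valid (stage₂ y ch′ hw (step-faces fs sb sc sd) Q′ refl refl refl refl refl n)
          where
          y : Config
          y = λ { 0F → a′ ; 1F → b′ ; 2F → ch′ 0F ; 3F → ch′ 1F ; 4F → ch′ 2F ; 5F → x 5F }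
          valid : ValidCopMove x y
          valid 0F = Step⇒Lazy sa
          valid 1F = Step⇒Lazy sb
          valid 2F = subst (λ z → Lazy z (ch′ 0F)) (sym e₂) (ok 0F)
          valid 3F = subst (λ z → Lazy z (ch′ 1F)) (sym e₃) (ok 1F)
          valid 4F = subst (λ z → Lazy z (ch′ 2F)) (sym e₄) (ok 2F)
          valid 5F = inj₁ refl

      stage₁ : ∀ {v a b c d} (x : Config) (ch : Trio) → InComp v → Faces b c d → Quad v a b c d → x 0F ≡ a →
               x 1F ≡ ch 0F → x 2F ≡ ch 1F → x 3F ≡ ch 2F → Post ch b → Next x v
      stage₁ {v} {a} {b} x ch hv fs Q e₀ e₁ e₂ e₃ (inj₁ (i , p)) = caught i p
        where
        seated : ∀ y → y 0F ≡ a → y 1F ≡ b → Next y v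
        seated y p q = stage₂ y (trio (y 2F) (y 3F) (y 4F)) hv fs Q p q refl refl refl (Catch-ready (proj₁ (proj₂ fs)))
        caught : ∀ i → ch i ≡ b → Next x v
        caught 0F p = seated x e₀ (trans e₁ p)
        caught 1F p = Next-perm 1F 2F (seated _ e₀ (trans e₂ p))
        caught 2F p = Next-perm 1F 3F (seated _ e₀ (trans e₃ p))
      stage₁ x ch hv fs Q refl e₁ e₂ e₃ (inj₂ k) = inj₂ λ w m → go (robber-moves hv Q m)
        where
        go : ∀ {w} → InComp w × Moved w _ _ _ _ → Win x w
        go (hw , a′ , b′ , c′ , d′ , Q′ , sa , sb , sc , sd) with k b′ sb
        ... | step ch′ ok n = step y valid (stage₁ y ch′ hw (step-faces fs sb sc sd) Q′ refl refl refl refl n)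
          where
          y : Config
          y = λ { 0F → a′ ; 1F → ch′ 0F ; 2F → ch′ 1F ; 3F → ch′ 2F ; 4F → x 4F ; 5F → x 5F }
          valid : ValidCopMove x y
          valid 0F = Step⇒Lazy sa
          valid 1F = subst (λ z → Lazy z (ch′ 0F)) (sym e₁) (ok 0F)
          valid 2F = subst (λ z → Lazy z (ch′ 1F)) (sym e₂) (ok 1F)
          valid 3F = subst (λ z → Lazy z (ch′ 2F)) (sym e₃) (ok 2F)
          valid 4F = inj₁ refl
          valid 5F = inj₁ refl

      stage₀ : ∀ {v a b c d} (x : Config) (ch : Trio) → InComp v → Faces b c d → Quad v a b c d →
               x 0F ≡ ch 0F → x 1F ≡ ch 1F → x 2F ≡ ch 2F → Post ch a → Next x v
      stage₀ {v} {a} x ch hv fs Q e₀ e₁ e₂ (inj₁ (i , p)) = caught i p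
        where
        seated : ∀ y → y 0F ≡ a → Next y v
        seated y p = stage₁ y (trio (y 1F) (y 2F) (y 3F)) hv fs Q p refl refl refl (Catch-ready (proj₁ fs))
        caught : ∀ i → ch i ≡ a → Next x v
        caught 0F p = seated x (trans e₀ p)
        caught 1F p = Next-perm 0F 1F (seated _ (trans e₁ p))
        caught 2F p = Next-perm 0F 2F (seated _ (trans e₂ p))
      stage₀ x ch hv fs Q e₀ e₁ e₂ (inj₂ k) = inj₂ λ w m → go (robber-moves hv Q m)
        where
        go : ∀ {w} → InComp w × Moved w _ _ _ _ → Win x w
        go (hw , a′ , b′ , c′ , d′ , Q′ , sa , sb , sc , sd) with k a′ sa
        ... | step ch′ ok n = step y valid (stage₀ y ch′ hw (step-faces fs sb sc sd) Q′ refl refl refl n)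
          where
          y : Config
          y = λ { 0F → ch′ 0F ; 1F → ch′ 1F ; 2F → ch′ 2F ; 3F → x 3F ; 4F → x 4F ; 5F → x 5F }
          valid : ValidCopMove x y
          valid 0F = subst (λ z → Lazy z (ch′ 0F)) (sym e₀) (ok 0F)
          valid 1F = subst (λ z → Lazy z (ch′ 1F)) (sym e₁) (ok 1F)
          valid 2F = subst (λ z → Lazy z (ch′ 2F)) (sym e₂) (ok 2F)
          valid 3F = inj₁ refl
          valid 4F = inj₁ refl
          valid 5F = inj₁ refl

      start : ∀ x → Next x (tail base)
      start x = stage₀ x (trio (x 0F) (x 1F) (x 2F)) refl
        ((σ base , Here-σ refl , refl) , (σ (σ base) , Here-σ (Here-σ refl) , refl)
          , (σ (σ (σ base)) , Here-σ (Here-σ (Here-σ refl)) , refl))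
        (around base refl) refl refl refl (Catch-ready (base , refl , refl))

    -- An isolated vertex is incident with one face only and offers no moves, so the cops walk there
    -- together.
    isolated-caught : ∀ {n v f} → Isolated v → Walk n f (ivFace v) → Next (λ _ → f) v
    isolated-caught iso [] = inj₁ λ
      { f (inj₁ (d , p , _)) → ⊥-elim (iso d p)
      ; f (inj₂ (_ , p)) → 0F , p }
    isolated-caught iso (l ∷ w) = inj₂ λ
      { _ (inj₁ refl) → step _ (λ _ → l) (isolated-caught iso w)
      ; _ (inj₂ (d , p , _)) → ⊥-elim (iso d p) }

    six-cops-win : Fin F → CopsWin G 6
    six-cops-win f₀ = copsWin (λ _ → f₀) begin
      where
      begin : ∀ v → Win (λ _ → f₀) v
      begin v with any? (λ d → tail d ≟ v)
      ... | yes (d , refl) = step _ (λ _ → inj₁ refl) (start d _)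
      ... | no ¬d = step _ (λ _ → inj₁ refl)
        (isolated-caught (λ d p → ¬d (d , p)) (proj₂ (faces-connected f₀ (ivFace v))))

  six-suffice : ∀ (G : PlaneGraph) → MaxDegree G 4 → CopsWin G 6
  six-suffice G Δ = SixCops.six-cops-win G (proj₁ Δ) (some-face G (proj₂ Δ))

  exactly-six : ∀ (G : PlaneGraph) → MaxDegree G 4 → (∀ j → j < 6 → ¬ CopsWin G j) → Σ PlaneGraph (λ G → MaxDegree G 4 × CopNumberIs G 6)
  exactly-six G Δ lose = G , Δ , six-suffice G Δ , lose

-- A criterion for connected plane maps.

module ConnectedMaps where
  open Rotations
  open Forests
  open import Relation.Unary using (Decidable)

  count-all : ∀ {n} {P : Fin n → Set} (P? : Decidable P) → (∀ i → P i) → count P? ≡ n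
  count-all {n} P? all = trans (cong length (filter-all P? (universal all (allFin n)))) (length-tabulate (λ i → i))

  iter-returns : ∀ {n} (f : Fin n → Fin n) → (∀ x y → f x ≡ f y → x ≡ y) → ∀ x → ∃[ p ] iter f (suc p) x ≡ x
  iter-returns {n} f inj x with Finₚ.pigeonhole (ℕₚ.n<1+n n) (λ i → iter f (toℕ i) x)
  ... | i , j , i<j , eq with ℕₚ.m≤n⇒∃[o]m+o≡n i<j
  ...   | p , q = p , iter-inj f inj (toℕ i) _ _
          (trans (sym (iter-+ f (toℕ i) (suc p) x))
            (trans (cong (λ k → iter f k x) (trans (ℕₚ.+-suc (toℕ i) p) q)) (sym eq)))

  iter-* : ∀ {A : Set} (f : A → A) p x → iter f p x ≡ x → ∀ k → iter f (k * p) x ≡ x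
  iter-* f p x e zero = refl
  iter-* f p x e (suc k) = trans (iter-+ f p (k * p) x) (trans (cong (iter f p) (iter-* f p x e k)) e)

  iter-back : ∀ {n} (f : Fin n → Fin n) → (∀ x y → f x ≡ f y → x ≡ y) →
              ∀ k x y → iter f k x ≡ y → ∃[ m ] iter f m y ≡ x
  iter-back f inj k x y refl with iter-returns f inj x
  ... | p , e = k * p , trans (sym (iter-+ f (k * p) k x))
        (trans (cong (λ m → iter f m x) (trans (ℕₚ.+-comm (k * p) k) (sym (ℕₚ.*-suc k p)))) (iter-* f (suc p) x e k))

  iter-meet : ∀ {n} (f : Fin n → Fin n) → (∀ x y → f x ≡ f y → x ≡ y) →
              ∀ {x y b} → (∃[ k ] iter f k x ≡ b) → (∃[ k ] iter f k y ≡ b) → ∃[ m ] iter f m x ≡ y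
  iter-meet f inj {x} {y} (k , p) (l , q) with iter-back f inj l y _ q
  ... | m , r = m + k , trans (iter-+ f m k x) (trans (cong (iter f m) p) r)

  -- Orbits are described by one marked dart each, `dart v` or `side f`, that every dart of the
  -- orbit reaches. On a finite set an injective map can be run backwards by iterating it, so this
  -- already makes any two darts of the orbit reach one another.
  record Connected : Set where
    field
      V D F     : ℕ
      tail      : Fin D → Fin V
      α σ       : Fin D → Fin D
      face      : Fin D → Fin F
      dart      : Fin V → Fin D
      side      : Fin F → Fin D
      tail-dart : ∀ v → tail (dart v) ≡ v
      face-side : ∀ f → face (side f) ≡ f
      α-invol   : ∀ d → α (α d) ≡ d
      α-nofix   : ∀ d → α d ≢ d
      σ-inj     : ∀ d e → σ d ≡ σ e → d ≡ e
      σ-tail    : ∀ d → tail (σ d) ≡ tail d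
      σ-dart    : ∀ d → ∃[ n ] (iter σ n d ≡ dart (tail d))
      φ-face    : ∀ d → face (σ (α d)) ≡ face d
      φ-side    : ∀ d → ∃[ n ] (iter (λ e → σ (α e)) n d ≡ side (face d))
      root      : Fin V

    Adjacent : Fin V → Fin V → Set
    Adjacent v w = ∃[ d ] (tail d ≡ v × tail (α d) ≡ w)

    field
      climbs    : ∀ v → Conn Adjacent v root
      euler     : 2 * (V + F) ≡ D + 4
      no-loop   : ∀ d → tail (α d) ≢ tail d
      no-multi  : ∀ d e → tail d ≡ tail e → tail (α d) ≡ tail (α e) → d ≡ e

    map : Map
    map = record { V = V ; D = D ; F = F ; K = 1 ; tail = tail ; α = α ; σ = σ ; face = face
                 ; ivFace = λ v → face (dart v) ; comp = λ _ → zero }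

    open MapNotions map using (BInc; BInc?; CompFace; compFace?; nB; nV; nF; nD; BRel)

    Conn-trans : ∀ {A : Set} {R : A → A → Set} {x y z} → Conn R x y → Conn R y z → Conn R x z
    Conn-trans here r = r
    Conn-trans (fwd e c) r = fwd e (Conn-trans c r)
    Conn-trans (bwd e c) r = bwd e (Conn-trans c r)

    Conn-sym : ∀ {A : Set} {R : A → A → Set} {x y} → Conn R x y → Conn R y x
    Conn-sym here = here
    Conn-sym (fwd e c) = Conn-trans (Conn-sym c) (bwd e here)
    Conn-sym (bwd e c) = Conn-trans (Conn-sym c) (fwd e here)

    φ-inj : ∀ d e → σ (α d) ≡ σ (α e) → d ≡ e
    φ-inj d e q = trans (sym (α-invol d)) (trans (cong α (σ-inj _ _ q)) (α-invol e))

    only : ∀ (c d : Fin 1) → c ≡ d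
    only zero zero = refl

    touches : ∀ c f → CompFace c f
    touches c f = side f , only _ _ , face-side f

    nB-F : nB ≡ F
    nB-F = trans (ℕₚ.+-identityʳ _) (count-all (BInc? zero) λ f → inj₁ (touches zero f))

    nV-V : ∀ c → nV c ≡ V
    nV-V c = count-all {P = λ v → zero ≡ c} (λ v → zero ≟ c) λ _ → only _ _

    nD-D : ∀ c → nD c ≡ D
    nD-D c = count-all {P = λ d → zero ≡ c} (λ d → zero ≟ c) λ _ → only _ _

    nF-F : ∀ c → nF c ≡ F
    nF-F c = count-all (compFace? c) (touches c)

    isPlane : IsPlaneMap map
    isPlane = record
      { α-invol = α-invol
      ; α-nofix = α-nofix
      ; σ-inj = σ-inj
      ; σ-tail = σ-tail
      ; σ-trans = λ d e q → iter-meet σ σ-inj (σ-dart d)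
          (let (n , r) = σ-dart e in n , trans r (cong dart (sym q)))
      ; face-φ = φ-face
      ; face-orbit = λ d e _ q → iter-meet (λ x → σ (α x)) φ-inj (φ-side d)
          (let (n , r) = φ-side e in n , trans r (cong side (sym q)))
      ; comp-edge = λ _ → refl
      ; comp-conn = λ v w _ → Conn-trans (climbs v) (Conn-sym (climbs w))
      ; comp-surj = λ c → root , only _ _
      ; euler = λ c _ → trans (cong₂ (λ x y → 2 * (x + y)) (nV-V c) (nF-F c)) (trans euler (cong (_+ 4) (sym (nD-D c))))
      ; nest-conn = λ x y → Conn-trans (hub x) (Conn-sym (hub y))
      ; nest-tree = trans (ℕₚ.+-comm 1 F) (cong (_+ 1) (sym nB-F))
      }
      where
      hub : ∀ x → Conn BRel x (inj₁ zero)
      hub (inj₁ zero) = here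
      hub (inj₂ f) = bwd (inj₁ (touches zero f)) here

    graph : PlaneGraph
    graph = record { emb = map ; plane = isPlane ; simple = record { no-loop = no-loop ; no-multi = no-multi } }

-- Plane maps given by tables and verified by evaluation.

module NumberedMaps where
  open Rotations
  open Forests
  open ConnectedMaps
  open import Data.Fin.Patterns

  module _ {A : Set} where
    nth : A → List A → ℕ → A
    nth z [] n = z
    nth z (x ∷ xs) zero = x
    nth z (x ∷ xs) (suc n) = nth z xs n

  -- Tables are kept in rows of ten, so that a lookup passes through short lists only.
  at : List (List ℕ) → ℕ → ℕ
  at t n = nth 0 (nth [] t (n / 10)) (n % 10)

  below : ℕ → (ℕ → Bool) → Bool
  below zero f = true
  below (suc n) f = f n ∧ below n f

  ∧-true : ∀ {a b} → a ∧ b ≡ true → a ≡ true × b ≡ true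
  ∧-true {true} {true} e = refl , refl

  below-sound : ∀ n f → below n f ≡ true → ∀ {i} → i < n → f i ≡ true
  below-sound (suc n) f e {i} lt with i ℕₚ.≟ n
  ... | yes refl = proj₁ (∧-true e)
  ... | no i≢n = below-sound n f (proj₂ (∧-true {f n} e)) (ℕₚ.≤∧≢⇒< (ℕₚ.≤-pred lt) i≢n)

  ≡true⇒T : ∀ {b} → b ≡ true → T b
  ≡true⇒T refl = tt

  T⇒≡true : ∀ {b} → T b → b ≡ true
  T⇒≡true {true} _ = refl

  eqᵇ : ∀ {m n} → (m ≡ᵇ n) ≡ true → m ≡ n
  eqᵇ {m} {n} e = ℕₚ.≡ᵇ⇒≡ m n (≡true⇒T e)

  not-true : ∀ {b} → not b ≡ true → b ≢ true
  not-true {false} _ ()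

  seek : ℕ → (ℕ → ℕ) → ℕ → ℕ → Bool
  seek zero f y x = x ≡ᵇ y
  seek (suc k) f y x = if x ≡ᵇ y then true else seek k f y (f x)

  iter-shift : ∀ {A : Set} (f : A → A) n x → iter f n (f x) ≡ f (iter f n x)
  iter-shift f zero x = refl
  iter-shift f (suc n) x = cong f (iter-shift f n x)

  seek-sound : ∀ k f y x → seek k f y x ≡ true → ∃[ n ] (n ≤ k × iter f n x ≡ y)
  seek-sound zero f y x e = 0 , z≤n , eqᵇ e
  seek-sound (suc k) f y x e with x ≡ᵇ y in q
  ... | true = 0 , z≤n , eqᵇ q
  ... | false with seek-sound k f y (f x) e
  ...   | n , le , r = suc n , s≤s le , trans (sym (iter-shift f n x)) r

  bounded : ∀ n m (f : ℕ → ℕ) → below n (λ i → f i <ᵇ m) ≡ true → ∀ {i} → i < n → f i < m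
  bounded n m f ok lt = ℕₚ.<ᵇ⇒< _ m (≡true⇒T (below-sound n _ ok lt))

  finite : ∀ {n m} (f : ℕ → ℕ) → (∀ {i} → i < n → f i < m) → Fin n → Fin m
  finite f ok i = fromℕ< (ok (Finₚ.toℕ<n i))

  toℕ-finite : ∀ {n m} (f : ℕ → ℕ) (ok : ∀ {i} → i < n → f i < m) i → toℕ (finite f ok i) ≡ f (toℕ i)
  toℕ-finite f ok i = Finₚ.toℕ-fromℕ< (ok (Finₚ.toℕ<n i))

  toℕ-iter : ∀ {n} (f : ℕ → ℕ) (g : Fin n → Fin n) → (∀ i → toℕ (g i) ≡ f (toℕ i)) →
             ∀ k i → toℕ (iter g k i) ≡ iter f k (toℕ i)
  toℕ-iter f g e zero i = refl
  toℕ-iter f g e (suc k) i = trans (e (iter g k i)) (cong f (toℕ-iter f g e k i))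

  -- All data are functions on plain numbers, so that the checks run on built-in arithmetic; the
  -- passage to `Fin` comes afterwards. `δ` is one less than the degree bound and `period` one less
  -- than a common multiple of the `σ`-orbit lengths, which makes `σ` injective. `longest` and
  -- `height` limit the searches along faces and up the tree.
  record Tables : Set where
    field
      #V #D #F : ℕ
      tailₙ αₙ σₙ faceₙ dartₙ sideₙ parentₙ : ℕ → ℕ
      rootₙ δ period longest height : ℕ

    φₙ upₙ : ℕ → ℕ
    φₙ d = σₙ (αₙ d)
    upₙ v = if v ≡ᵇ rootₙ then v else tailₙ (αₙ (parentₙ v))

    fan : ℕ → ℕ → ℕ
    fan v n = iter σₙ n (dartₙ v)

    distinctNeighbours : ℕ → ℕ → Bool
    distinctNeighbours d e = if d ≡ᵇ e then true else not (tailₙ (αₙ d) ≡ᵇ tailₙ (αₙ e))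

  record Numbering (tables : Tables) : Set where
    open Tables tables public
    field
      tail-bounded   : below #D (λ d → tailₙ d <ᵇ #V) ≡ true
      α-bounded      : below #D (λ d → αₙ d <ᵇ #D) ≡ true
      σ-bounded      : below #D (λ d → σₙ d <ᵇ #D) ≡ true
      face-bounded   : below #D (λ d → faceₙ d <ᵇ #F) ≡ true
      dart-bounded   : below #V (λ v → dartₙ v <ᵇ #D) ≡ true
      parent-bounded : below #V (λ v → parentₙ v <ᵇ #D) ≡ true
      side-bounded   : below #F (λ f → sideₙ f <ᵇ #D) ≡ true
      root-bounded   : (rootₙ <ᵇ #V) ≡ true
      α-check        : below #D (λ d → αₙ (αₙ d) ≡ᵇ d) ≡ true
      loop-check     : below #D (λ d → not (tailₙ (αₙ d) ≡ᵇ tailₙ d)) ≡ true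
      σ-tail-check   : below #D (λ d → tailₙ (σₙ d) ≡ᵇ tailₙ d) ≡ true
      period-check   : below #D (λ d → iter σₙ (suc period) d ≡ᵇ d) ≡ true
      σ-dart-check   : below #D (λ d → seek δ σₙ (dartₙ (tailₙ d)) d) ≡ true
      dart-σ-check   : below #D (λ d → seek δ σₙ d (dartₙ (tailₙ d))) ≡ true
      φ-face-check   : below #D (λ d → faceₙ (φₙ d) ≡ᵇ faceₙ d) ≡ true
      φ-side-check   : below #D (λ d → seek longest φₙ (sideₙ (faceₙ d)) d) ≡ true
      dart-check     : below #V (λ v → tailₙ (dartₙ v) ≡ᵇ v) ≡ true
      side-check     : below #F (λ f → faceₙ (sideₙ f) ≡ᵇ f) ≡ true
      parent-check   : below #V (λ v → if v ≡ᵇ rootₙ then true else (tailₙ (parentₙ v) ≡ᵇ v)) ≡ true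
      up-check       : below #V (λ v → seek height upₙ rootₙ v) ≡ true
      multi-check    : below #D (λ d → below (suc δ) (λ n → distinctNeighbours d (fan (tailₙ d) n))) ≡ true
      euler-check    : 2 * (#V + #F) ≡ #D + 4

    tail : Fin #D → Fin #V
    tail = finite tailₙ (bounded #D #V tailₙ tail-bounded)
    α σ : Fin #D → Fin #D
    α = finite αₙ (bounded #D #D αₙ α-bounded)
    σ = finite σₙ (bounded #D #D σₙ σ-bounded)
    face : Fin #D → Fin #F
    face = finite faceₙ (bounded #D #F faceₙ face-bounded)
    dart : Fin #V → Fin #D
    dart = finite dartₙ (bounded #V #D dartₙ dart-bounded)
    parent : Fin #V → Fin #D
    parent = finite parentₙ (bounded #V #D parentₙ parent-bounded)
    side : Fin #F → Fin #D
    side = finite sideₙ (bounded #F #D sideₙ side-bounded)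
    root : Fin #V
    root = fromℕ< (ℕₚ.<ᵇ⇒< rootₙ #V (≡true⇒T root-bounded))

    toℕ-root : toℕ root ≡ rootₙ
    toℕ-root = Finₚ.toℕ-fromℕ< (ℕₚ.<ᵇ⇒< rootₙ #V (≡true⇒T root-bounded))

    ⌜tail⌝ : ∀ d → toℕ (tail d) ≡ tailₙ (toℕ d)
    ⌜tail⌝ = toℕ-finite tailₙ (bounded #D #V tailₙ tail-bounded)
    ⌜α⌝ : ∀ d → toℕ (α d) ≡ αₙ (toℕ d)
    ⌜α⌝ = toℕ-finite αₙ (bounded #D #D αₙ α-bounded)
    ⌜σ⌝ : ∀ d → toℕ (σ d) ≡ σₙ (toℕ d)
    ⌜σ⌝ = toℕ-finite σₙ (bounded #D #D σₙ σ-bounded)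
    ⌜face⌝ : ∀ d → toℕ (face d) ≡ faceₙ (toℕ d)
    ⌜face⌝ = toℕ-finite faceₙ (bounded #D #F faceₙ face-bounded)
    ⌜dart⌝ : ∀ v → toℕ (dart v) ≡ dartₙ (toℕ v)
    ⌜dart⌝ = toℕ-finite dartₙ (bounded #V #D dartₙ dart-bounded)
    ⌜parent⌝ : ∀ v → toℕ (parent v) ≡ parentₙ (toℕ v)
    ⌜parent⌝ = toℕ-finite parentₙ (bounded #V #D parentₙ parent-bounded)
    ⌜side⌝ : ∀ f → toℕ (side f) ≡ sideₙ (toℕ f)
    ⌜side⌝ = toℕ-finite sideₙ (bounded #F #D sideₙ side-bounded)

    ⌜tailα⌝ : ∀ d → toℕ (tail (α d)) ≡ tailₙ (αₙ (toℕ d))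
    ⌜tailα⌝ d = trans (⌜tail⌝ (α d)) (cong tailₙ (⌜α⌝ d))

    ⌜faceα⌝ : ∀ d → toℕ (face (α d)) ≡ faceₙ (αₙ (toℕ d))
    ⌜faceα⌝ d = trans (⌜face⌝ (α d)) (cong faceₙ (⌜α⌝ d))

    ⌜fan⌝ : ∀ n v → toℕ (iter σ n (dart v)) ≡ fan (toℕ v) n
    ⌜fan⌝ n v = trans (toℕ-iter σₙ σ ⌜σ⌝ n (dart v)) (cong (iter σₙ n) (⌜dart⌝ v))

    holds : ∀ {n} (f : ℕ → Bool) → below n f ≡ true → ∀ (i : Fin n) → f (toℕ i) ≡ true
    holds f e i = below-sound _ f e (Finₚ.toℕ<n i)

    σ-period : ∀ d → iter σ (suc period) d ≡ d
    σ-period d = Finₚ.toℕ-injective (trans (toℕ-iter σₙ σ ⌜σ⌝ (suc period) d)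
      (eqᵇ (holds (λ d → iter σₙ (suc period) d ≡ᵇ d) period-check d)))

    σ-inj : ∀ d e → σ d ≡ σ e → d ≡ e
    σ-inj d e q = trans (sym (σ-period d)) (trans (sym (iter-shift σ period d))
      (trans (cong (iter σ period) q) (trans (iter-shift σ period e) (σ-period e))))

    σ-tail : ∀ d → tail (σ d) ≡ tail d
    σ-tail d = Finₚ.toℕ-injective (trans (⌜tail⌝ (σ d)) (trans (cong tailₙ (⌜σ⌝ d))
      (trans (eqᵇ (holds (λ d → tailₙ (σₙ d) ≡ᵇ tailₙ d) σ-tail-check d)) (sym (⌜tail⌝ d)))))

    tail-dart : ∀ v → tail (dart v) ≡ v
    tail-dart v = Finₚ.toℕ-injective (trans (⌜tail⌝ (dart v)) (trans (cong tailₙ (⌜dart⌝ v))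
      (eqᵇ (holds (λ v → tailₙ (dartₙ v) ≡ᵇ v) dart-check v))))

    face-side : ∀ f → face (side f) ≡ f
    face-side f = Finₚ.toℕ-injective (trans (⌜face⌝ (side f)) (trans (cong faceₙ (⌜side⌝ f))
      (eqᵇ (holds (λ f → faceₙ (sideₙ f) ≡ᵇ f) side-check f))))

    α-invol : ∀ d → α (α d) ≡ d
    α-invol d = Finₚ.toℕ-injective (trans (⌜α⌝ (α d)) (trans (cong αₙ (⌜α⌝ d))
      (eqᵇ (holds (λ d → αₙ (αₙ d) ≡ᵇ d) α-check d))))

    no-loop : ∀ d → tail (α d) ≢ tail d
    no-loop d q = not-true (holds (λ d → not (tailₙ (αₙ d) ≡ᵇ tailₙ d)) loop-check d)
      (T⇒≡true (ℕₚ.≡⇒≡ᵇ _ _ (trans (sym (⌜tailα⌝ d)) (trans (cong toℕ q) (⌜tail⌝ d)))))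

    ⌜dart∘tail⌝ : ∀ d → toℕ (dart (tail d)) ≡ dartₙ (tailₙ (toℕ d))
    ⌜dart∘tail⌝ d = trans (⌜dart⌝ (tail d)) (cong dartₙ (⌜tail⌝ d))

    σ-dart : ∀ d → ∃[ n ] (iter σ n d ≡ dart (tail d))
    σ-dart d with seek-sound δ σₙ _ _ (holds (λ d → seek δ σₙ (dartₙ (tailₙ d)) d) σ-dart-check d)
    ... | n , _ , e = n , Finₚ.toℕ-injective (trans (toℕ-iter σₙ σ ⌜σ⌝ n d) (trans e (sym (⌜dart∘tail⌝ d))))

    dart-σ : ∀ d → ∃[ n ] (n ≤ δ × iter σ n (dart (tail d)) ≡ d)
    dart-σ d with seek-sound δ σₙ _ _ (holds (λ d → seek δ σₙ d (dartₙ (tailₙ d))) dart-σ-check d)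
    ... | n , n≤ , e = n , n≤ , Finₚ.toℕ-injective (trans (toℕ-iter σₙ σ ⌜σ⌝ n _)
            (trans (cong (iter σₙ n) (⌜dart∘tail⌝ d)) e))

    φ-face : ∀ d → face (σ (α d)) ≡ face d
    φ-face d = Finₚ.toℕ-injective (trans (⌜face⌝ _) (trans (cong faceₙ (trans (⌜σ⌝ (α d)) (cong σₙ (⌜α⌝ d))))
      (trans (eqᵇ (holds (λ d → faceₙ (φₙ d) ≡ᵇ faceₙ d) φ-face-check d)) (sym (⌜face⌝ d)))))

    φ-side : ∀ d → ∃[ n ] (iter (λ e → σ (α e)) n d ≡ side (face d))
    φ-side d with seek-sound longest φₙ _ _ (holds (λ d → seek longest φₙ (sideₙ (faceₙ d)) d) φ-side-check d)
    ... | n , _ , e = n , Finₚ.toℕ-injective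
      (trans (toℕ-iter φₙ (λ e → σ (α e)) (λ x → trans (⌜σ⌝ (α x)) (cong σₙ (⌜α⌝ x))) n d)
        (trans e (sym (trans (⌜side⌝ (face d)) (cong sideₙ (⌜face⌝ d))))))

    no-multi : ∀ d e → tail d ≡ tail e → tail (α d) ≡ tail (α e) → d ≡ e
    no-multi d e p q with dart-σ e
    ... | n , n≤ , r with toℕ d ≡ᵇ toℕ e in s
                        | subst (λ x → distinctNeighbours (toℕ d) x ≡ true) r′
                            (below-sound (suc δ) _
                              (holds (λ d → below (suc δ) (λ n → distinctNeighbours d (fan (tailₙ d) n))) multi-check d)
                              (s≤s n≤))
      where
      r′ : fan (tailₙ (toℕ d)) n ≡ toℕ e
      r′ = trans (cong (λ v → fan v n) (trans (sym (⌜tail⌝ d)) (cong toℕ p)))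
                 (trans (sym (⌜fan⌝ n (tail e))) (cong toℕ r))
    ...   | true  | _ = Finₚ.toℕ-injective (eqᵇ s)
    ...   | false | t = ⊥-elim (not-true t
            (T⇒≡true (ℕₚ.≡⇒≡ᵇ _ _ (trans (sym (⌜tailα⌝ d)) (trans (cong toℕ q) (⌜tailα⌝ e))))))

    Adjacent : Fin #V → Fin #V → Set
    Adjacent v w = ∃[ d ] (tail d ≡ v × tail (α d) ≡ w)

    climbs : ∀ v → Conn Adjacent v root
    climbs v with seek-sound height upₙ _ _ (holds (λ v → seek height upₙ rootₙ v) up-check v)
    ... | n , _ , e = go n v e
      where
      go : ∀ n v → iter upₙ n (toℕ v) ≡ rootₙ → Conn Adjacent v root
      go zero v e = subst (λ w → Conn Adjacent w root)
        (Finₚ.toℕ-injective (trans toℕ-root (sym e))) here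
      go (suc n) v e with toℕ v ≡ᵇ rootₙ in q | holds (λ v → if v ≡ᵇ rootₙ then true else (tailₙ (parentₙ v) ≡ᵇ v)) parent-check v
      ... | true  | _ = subst (λ w → Conn Adjacent w root) (Finₚ.toℕ-injective (trans toℕ-root (sym (eqᵇ q)))) here
      ... | false | t = fwd (parent v , Finₚ.toℕ-injective (trans (⌜tail⌝ _) (trans (cong tailₙ (⌜parent⌝ v)) (eqᵇ t)) ) , refl)
              (go n (tail (α (parent v))) (trans (cong (iter upₙ n)
                (trans (⌜tailα⌝ _) (trans (cong (λ x → tailₙ (αₙ x)) (⌜parent⌝ v)) (sym (up-false q))))) (trans (iter-shift upₙ n (toℕ v)) e)))
        where
        up-false : ∀ {v} → (v ≡ᵇ rootₙ) ≡ false → upₙ v ≡ tailₙ (αₙ (parentₙ v))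
        up-false q rewrite q = refl

    connected : Connected
    connected = record
      { V = #V ; D = #D ; F = #F ; tail = tail ; α = α ; σ = σ ; face = face ; dart = dart ; side = side
      ; tail-dart = tail-dart ; face-side = face-side ; α-invol = α-invol
      ; α-nofix = λ d e → no-loop d (cong tail e)
      ; σ-inj = σ-inj ; σ-tail = σ-tail ; σ-dart = σ-dart ; φ-face = φ-face ; φ-side = φ-side
      ; root = root ; climbs = climbs ; euler = euler-check ; no-loop = no-loop ; no-multi = no-multi }

    graph : PlaneGraph
    graph = Connected.graph connected

    open PlaneGraph graph using (degree; Incident)

    spoke : Fin #V → Fin (suc δ) → Fin #D
    spoke v i = iter σ (toℕ i) (dart v)

    tail-spoke : ∀ v i → tail (spoke v i) ≡ v
    tail-spoke v i = go (toℕ i)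
      where
      go : ∀ n → tail (iter σ n (dart v)) ≡ v
      go zero = tail-dart v
      go (suc n) = trans (σ-tail _) (go n)

    sector : Fin #V → Fin (suc δ) → Fin #F
    sector v i = face (spoke v i)

    incident : ∀ v i → Incident v (sector v i)
    incident v i = inj₁ (spoke v i , tail-spoke v i , refl)

    sectorₙ : ℕ → ℕ → ℕ
    sectorₙ v n = faceₙ (fan v n)

    ⌜sector⌝ : ∀ v i → toℕ (sector v i) ≡ sectorₙ (toℕ v) (toℕ i)
    ⌜sector⌝ v i = trans (⌜face⌝ _) (cong faceₙ (⌜fan⌝ (toℕ i) v))

    separated : ℕ → Bool
    separated v = below (suc δ) (λ i → below (suc δ) (λ j →
      if i ≡ᵇ j then true else not (sectorₙ v i ≡ᵇ sectorₙ v j)))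

    sector-inj : ∀ v → separated (toℕ v) ≡ true → ∀ {i j} → sector v i ≡ sector v j → i ≡ j
    sector-inj v ok {i} {j} q with toℕ i ≡ᵇ toℕ j in s | below-sound (suc δ) _ (below-sound (suc δ) _ ok (Finₚ.toℕ<n i)) (Finₚ.toℕ<n j)
    ... | true  | _ = Finₚ.toℕ-injective (eqᵇ s)
    ... | false | t = ⊥-elim (not-true t
            (T⇒≡true (ℕₚ.≡⇒≡ᵇ _ _ (trans (sym (⌜sector⌝ v i)) (trans (cong toℕ q) (⌜sector⌝ v j))))))

    degree≤ : ∀ v → degree v ≤ suc δ
    degree≤ v = subst (degree v ≤_) (length-tabulate (spoke v)) (count-≤ (λ d → tail d ≟ v) {tabulate (spoke v)} λ where
      d refl → let (n , n≤ , e) = dart-σ d in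
        subst (_∈ tabulate (spoke (tail d)))
          (trans (cong (λ m → iter σ m (dart (tail d))) (Finₚ.toℕ-fromℕ< (s≤s n≤))) e)
          (∈-tabulate⁺ {f = spoke (tail d)} (fromℕ< (s≤s n≤))))

    maxDegree : ∀ v → separated (toℕ v) ≡ true → MaxDegree graph (suc δ)
    maxDegree v ok = degree≤ , v , ℕₚ.≤-antisym (degree≤ v)
      (subst (_≤ degree v) (length-tabulate (spoke v))
        (count-≥ (λ d → tail d ≟ v) (tabulate⁺ {f = spoke v} (λ e → sector-inj v ok (cong face e)))
          (λ m → let (i , e) = ∈-tabulate⁻ {f = spoke v} m in trans (cong tail e) (tail-spoke v i))))

-- The tetrahedron, on which two cops fail.

module TetrahedronGraph where
  open PlayingOut
  open DegreeThree
  open NumberedMaps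

  tetrahedron : Tables
  tetrahedron = record
    { #V = 4 ; #D = 12 ; #F = 4
    ; tailₙ = λ d → d / 3
    ; αₙ = nth 0 (3 ∷ 6 ∷ 9 ∷ 0 ∷ 11 ∷ 7 ∷ 1 ∷ 5 ∷ 10 ∷ 2 ∷ 8 ∷ 4 ∷ [])
    ; σₙ = λ d → d / 3 * 3 + (d % 3 + 1) % 3
    ; faceₙ = nth 0 (0 ∷ 1 ∷ 2 ∷ 1 ∷ 0 ∷ 3 ∷ 2 ∷ 1 ∷ 3 ∷ 0 ∷ 2 ∷ 3 ∷ [])
    ; dartₙ = λ v → v * 3
    ; sideₙ = nth 0 (0 ∷ 1 ∷ 2 ∷ 5 ∷ [])
    ; parentₙ = λ v → nth 0 (0 ∷ 3 ∷ 6 ∷ 9 ∷ []) v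
    ; rootₙ = 0 ; δ = 2 ; period = 2 ; longest = 2 ; height = 1 }

  abstract
    tetrahedron-ok : Numbering tetrahedron
    tetrahedron-ok = record { tail-bounded = refl ; α-bounded = refl ; σ-bounded = refl ; face-bounded = refl ; dart-bounded = refl
      ; parent-bounded = refl ; side-bounded = refl ; root-bounded = refl
      ; α-check = refl ; loop-check = refl ; σ-tail-check = refl ; period-check = refl ; σ-dart-check = refl
      ; dart-σ-check = refl ; φ-face-check = refl ; φ-side-check = refl ; dart-check = refl ; side-check = refl
      ; parent-check = refl ; up-check = refl ; multi-check = refl ; euler-check = refl }

  module Tetrahedron = Numbering tetrahedron-ok

  tetrahedron-separated : ∀ v → Tetrahedron.separated (toℕ v) ≡ true
  tetrahedron-separated = Tetrahedron.holds {4} Tetrahedron.separated refl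

  tetrahedron-Δ : MaxDegree Tetrahedron.graph 3
  tetrahedron-Δ = Tetrahedron.maxDegree zero refl

  three-needed : ∀ j → j < 3 → ¬ CopsWin Tetrahedron.graph j
  three-needed j j<3 = copsLose (λ _ _ → ⊤) (λ _ → zero , tt) (λ {c} {v} _ → free c v)
    (λ {_} {v} _ c′ _ → free c′ v , v , inj₁ refl , tt)
    where
    open Strategies Tetrahedron.graph j
    open Game Tetrahedron.graph j using (Config; Captured)
    free : ∀ (c : Config) v → ¬ Captured c v
    free c v cap = ℕₚ.<⇒≱ j<3 (injective⇒≤ {f = λ i → proj₁ (cap _ (Tetrahedron.incident v i))} λ {i} {i′} e →
      Tetrahedron.sector-inj v (tetrahedron-separated v)
        (trans (sym (proj₂ (cap _ (Tetrahedron.incident v i)))) (trans (cong c e) (proj₂ (cap _ (Tetrahedron.incident v i′))))))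

  three-tight : Σ PlaneGraph (λ G → MaxDegree G 3 × CopNumberIs G 3)
  three-tight = exactly-three Tetrahedron.graph tetrahedron-Δ three-needed

-- Evasion along a network with symmetries.

module Evasions where
  open Forests
  open PlayingOut
  open ConnectedMaps
  open NumberedMaps
  open import Data.List using (map)
  open import Data.Nat.ListAction using (sum)
  open import Algebra.Properties.CommutativeSemigroup ℕₚ.+-commutativeSemigroup using (interchange)

  ⟦_⟧ : Bool → ℕ
  ⟦ true ⟧ = 1
  ⟦ false ⟧ = 0

  weigh : {A : Set} → (A → ℕ) → List A → ℕ
  weigh w xs = sum (map w xs)

  weigh-+ : ∀ {A : Set} (f g : A → ℕ) xs → weigh (λ x → f x + g x) xs ≡ weigh f xs + weigh g xs
  weigh-+ f g [] = refl
  weigh-+ f g (x ∷ xs) = trans (cong (f x + g x +_) (weigh-+ f g xs)) (interchange (f x) (g x) _ _)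

  weigh-≤ : ∀ {A : Set} {f g : A → ℕ} xs → (∀ x → f x ≤ g x) → weigh f xs ≤ weigh g xs
  weigh-≤ [] le = z≤n
  weigh-≤ (x ∷ xs) le = ℕₚ.+-mono-≤ (le x) (weigh-≤ xs le)

  weigh-1 : ∀ {A : Set} (xs : List A) → weigh (λ _ → 1) xs ≡ length xs
  weigh-1 [] = refl
  weigh-1 (x ∷ xs) = cong suc (weigh-1 xs)

  weigh-filter : ∀ {A : Set} (P : A → Bool) xs → weigh (⟦_⟧ ∘ P) xs ≡ length (filter (λ x → T? (P x)) xs)
  weigh-filter P [] = refl
  weigh-filter P (x ∷ xs) with P x
  ... | true  = cong suc (weigh-filter P xs)
  ... | false = weigh-filter P xs

  crowd : ∀ {n} → (Fin n → Bool) → ℕ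
  crowd {n} P = weigh (⟦_⟧ ∘ P) (allFin n)

  crowd-count : ∀ {n} (P : Fin n → Bool) → crowd P ≡ count (λ i → T? (P i))
  crowd-count {n} P = weigh-filter P (allFin n)

  ⟦⟧-mono : ∀ {a b} → (T a → T b) → ⟦ a ⟧ ≤ ⟦ b ⟧
  ⟦⟧-mono {false} f = z≤n
  ⟦⟧-mono {true} {true} f = ℕₚ.≤-refl
  ⟦⟧-mono {true} {false} f = ⊥-elim (f tt)

  crowd-mono : ∀ {n} {P Q : Fin n → Bool} → (∀ i → T (P i) → T (Q i)) → crowd P ≤ crowd Q
  crowd-mono {n} imp = weigh-≤ (allFin n) λ i → ⟦⟧-mono (imp i)

  crowd-≥ : ∀ {n m} (P : Fin n → Bool) (f : Fin m → Fin n) → (∀ {i j} → f i ≡ f j → i ≡ j) →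
            (∀ i → T (P (f i))) → m ≤ crowd P
  crowd-≥ P f inj all = subst₂ _≤_ (length-tabulate f) (sym (crowd-count P))
    (count-≥ (λ i → T? (P i)) (tabulate⁺ {f = f} inj)
      (λ m → let (i , e) = ∈-tabulate⁻ {f = f} m in subst (T ∘ P) (sym e) (all i)))

  ≤-true : ∀ {m n} → (m ≤ᵇ n) ≡ true → m ≤ n
  ≤-true {m} {n} e = ℕₚ.≤ᵇ⇒≤ m n (≡true⇒T e)

  ≡ᵇ-refl : ∀ n → (n ≡ᵇ n) ≡ true
  ≡ᵇ-refl n = T⇒≡true (ℕₚ.≡⇒≡ᵇ n n refl)

  module Evasion {tables : Tables} (N : Numbering tables) where
    open Numbering N
    open PlaneGraph graph using (VAdj; FAdj; Incident)

    -- Vertices are pushed forward to the robber's actual position; the cops' faces are pulled back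
    -- to the standard position, where the tables apply. `lift` says that each face around a
    -- standard vertex is the pull-back of one around the actual vertex, so a capture there would
    -- cover all standard sectors.
    record Symmetry : Set where
      field
        push     : Fin #V → Fin #V
        pull     : Fin #F → Fin #F
        push-adj : ∀ {v w} → VAdj v w → VAdj (push v) (push w)
        pull-adj : ∀ {f g} → FAdj f g → FAdj (pull f) (pull g)
        lift     : ∀ d → ∃[ e ] (tail e ≡ push (tail d) × pull (face e) ≡ face d)
    open Symmetry

    unmoved : Symmetry
    unmoved = record { push = id ; pull = id ; push-adj = id ; pull-adj = id ; lift = λ d → d , refl , refl }

    _then_ : Symmetry → Symmetry → Symmetry
    φ then ψ = record
      { push = push φ ∘ push ψ ; pull = pull ψ ∘ pull φ
      ; push-adj = push-adj φ ∘ push-adj ψ ; pull-adj = pull-adj ψ ∘ pull-adj φ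
      ; lift = λ d → let (e , p , q) = lift ψ d ; (e′ , p′ , q′) = lift φ e in
          e′ , trans p′ (cong (push φ) p) , trans (cong (pull ψ) q′) q }

    module _ (dartMove dartBack vertexMove faceBack : ℕ → ℕ) where
      dart-fits : ℕ → Bool
      dart-fits d = (dartMove d <ᵇ #D) ∧ ((dartBack d <ᵇ #D) ∧
        ((tailₙ (dartMove d) ≡ᵇ vertexMove (tailₙ d)) ∧
        ((tailₙ (αₙ (dartMove d)) ≡ᵇ vertexMove (tailₙ (αₙ d))) ∧
        ((faceBack (faceₙ (dartMove d)) ≡ᵇ faceₙ d) ∧
        ((faceₙ (dartBack d) ≡ᵇ faceBack (faceₙ d)) ∧
         (faceₙ (αₙ (dartBack d)) ≡ᵇ faceBack (faceₙ (αₙ d))))))))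

      module _ (dart-check : ∀ {d} → d < #D → dart-fits d ≡ true) (vertex-check : ∀ {v} → v < #V → vertexMove v < #V)
               (face-check : ∀ {f} → f < #F → faceBack f < #F) where
        pushed : Fin #V → Fin #V
        pushed = finite (vertexMove) vertex-check
        pulled : Fin #F → Fin #F
        pulled = finite (faceBack) face-check

        ⌜pushed⌝ : ∀ v → toℕ (pushed v) ≡ vertexMove (toℕ v)
        ⌜pushed⌝ = toℕ-finite (vertexMove) vertex-check
        ⌜pulled⌝ : ∀ f → toℕ (pulled f) ≡ faceBack (toℕ f)
        ⌜pulled⌝ = toℕ-finite (faceBack) face-check

        module Fit (d : Fin #D) where
          private
            r₀ = ∧-true {dartMove (toℕ d) <ᵇ #D} (dart-check (Finₚ.toℕ<n d))
            r₁ = ∧-true {dartBack (toℕ d) <ᵇ #D} (proj₂ r₀)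
            r₂ = ∧-true {tailₙ (dartMove (toℕ d)) ≡ᵇ vertexMove (tailₙ (toℕ d))} (proj₂ r₁)
            r₃ = ∧-true {tailₙ (αₙ (dartMove (toℕ d))) ≡ᵇ vertexMove (tailₙ (αₙ (toℕ d)))} (proj₂ r₂)
            r₄ = ∧-true {faceBack (faceₙ (dartMove (toℕ d))) ≡ᵇ faceₙ (toℕ d)} (proj₂ r₃)
            r₅ = ∧-true {faceₙ (dartBack (toℕ d)) ≡ᵇ faceBack (faceₙ (toℕ d))} (proj₂ r₄)
            onward< = ℕₚ.<ᵇ⇒< _ #D (≡true⇒T (proj₁ r₀))
            backward< = ℕₚ.<ᵇ⇒< _ #D (≡true⇒T (proj₁ r₁))
          onward backward : Fin #D
          onward = fromℕ< onward<
          backward = fromℕ< backward<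
          private
            onwardₙ : toℕ onward ≡ dartMove (toℕ d)
            onwardₙ = Finₚ.toℕ-fromℕ< onward<
            backwardₙ : toℕ backward ≡ dartBack (toℕ d)
            backwardₙ = Finₚ.toℕ-fromℕ< backward<
          tail-onward : tail onward ≡ pushed (tail d)
          tail-onward = Finₚ.toℕ-injective (trans (⌜tail⌝ onward) (trans (cong tailₙ onwardₙ)
            (trans (eqᵇ (proj₁ r₂)) (trans (cong (vertexMove) (sym (⌜tail⌝ d))) (sym (⌜pushed⌝ _))))))
          head-onward : tail (α onward) ≡ pushed (tail (α d))
          head-onward = Finₚ.toℕ-injective (trans (⌜tailα⌝ onward) (trans (cong (λ x → tailₙ (αₙ x)) onwardₙ)
            (trans (eqᵇ (proj₁ r₃)) (trans (cong (vertexMove) (sym (⌜tailα⌝ d))) (sym (⌜pushed⌝ _))))))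
          face-onward : pulled (face onward) ≡ face d
          face-onward = Finₚ.toℕ-injective (trans (⌜pulled⌝ _) (trans (cong (faceBack) (trans (⌜face⌝ onward) (cong faceₙ onwardₙ)))
            (trans (eqᵇ (proj₁ r₄)) (sym (⌜face⌝ d)))))
          face-backward : face backward ≡ pulled (face d)
          face-backward = Finₚ.toℕ-injective (trans (⌜face⌝ backward) (trans (cong faceₙ backwardₙ)
            (trans (eqᵇ (proj₁ r₅)) (trans (cong (faceBack) (sym (⌜face⌝ d))) (sym (⌜pulled⌝ _))))))
          face-back : face (α backward) ≡ pulled (face (α d))
          face-back = Finₚ.toℕ-injective (trans (⌜faceα⌝ backward) (trans (cong (λ x → faceₙ (αₙ x)) backwardₙ)
            (trans (eqᵇ (proj₂ r₅)) (trans (cong (faceBack) (sym (⌜faceα⌝ d))) (sym (⌜pulled⌝ _))))))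

        rotation : Symmetry
        rotation = record
          { push = pushed ; pull = pulled
          ; push-adj = λ { (d , refl , refl) → Fit.onward d , Fit.tail-onward d , Fit.head-onward d }
          ; pull-adj = λ { (d , refl , refl) → Fit.backward d , Fit.face-backward d , Fit.face-back d }
          ; lift = λ d → Fit.onward d , Fit.tail-onward d , Fit.face-onward d }

    record Turn : Set where
      field
        dartMove dartBack vertexMove faceBack : ℕ → ℕ
        dart-check   : ∀ {d} → d < #D → dart-fits dartMove dartBack vertexMove faceBack d ≡ true
        vertex-check : ∀ {v} → v < #V → vertexMove v < #V
        face-check   : ∀ {f} → f < #F → faceBack f < #F

    module _ (turn : ℕ → Turn) (distance span : ℕ → ℕ) (stepₙ : ℕ → ℕ → ℕ) (home : ℕ) where
      open Turn

      spotₙ : ℕ → ℕ → ℕ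
      spotₙ o r = tailₙ (αₙ (stepₙ o r))

      -- `r` counts the moves still ahead after this one: `stepₙ o r` leads to spot `r`, coming from
      -- spot `r + 1` or, at `r = span o`, from `home`. Spot 0 is the image of `home` under turn
      -- `o`. All faces at spot `r` are within `r` of the set that matters on arrival.
      step-fits : ℕ → ℕ → Bool
      step-fits o r = (stepₙ o r <ᵇ #D) ∧
        ((tailₙ (stepₙ o r) ≡ᵇ (if r ≡ᵇ span o then home else spotₙ o (suc r))) ∧
        (separated (spotₙ o r) ∧
        (below (suc δ) (λ i → distance (faceBack (turn o) (sectorₙ (spotₙ o r) i)) ≤ᵇ r) ∧
        (if r ≡ᵇ 0 then spotₙ o 0 ≡ᵇ vertexMove (turn o) home else true))))

      -- A face is close to at most one of the three ways on, or to all three if it lies in the set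
      -- at distance 0. At most `δ` cops are in that set, so the three ways together see at most
      -- `j + 2 δ` cops. This is less than `3 (δ + 1)`, and one way sees at most `δ`.
      disperses : ℕ → Bool
      disperses f = (⟦ distance (faceBack (turn 0) f) ≤ᵇ suc (span 0) ⟧ + ⟦ distance (faceBack (turn 1) f) ≤ᵇ suc (span 1) ⟧
        + ⟦ distance (faceBack (turn 2) f) ≤ᵇ suc (span 2) ⟧) ≤ᵇ (1 + (⟦ distance f ≤ᵇ 0 ⟧ + ⟦ distance f ≤ᵇ 0 ⟧))

      -- For the start: a single cop can spoil only one of two remote positions, and
      -- `j < 2 (δ + 1)`.
      far-apart : ℕ → Bool
      far-apart f = (⟦ distance (faceBack (turn 0) f) ≤ᵇ 1 ⟧ +
                     ⟦ distance (faceBack (turn 0) (faceBack (turn 3) f)) ≤ᵇ 1 ⟧) ≤ᵇ 1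

      module _ (step-check : ∀ {o r} → o < 3 → r < suc (span o) → step-fits o r ≡ true)
               (near-check : ∀ {d} → d < #D → (distance (faceₙ d) ≤ᵇ suc (distance (faceₙ (αₙ d)))) ≡ true)
               (disperse-check : ∀ {f} → f < #F → disperses f ≡ true)
               (far-check : ∀ {f} → f < #F → far-apart f ≡ true)
               (home-check : home < #V) where

        decision : Fin #V
        decision = fromℕ< home-check
        ⌜decision⌝ : toℕ decision ≡ home
        ⌜decision⌝ = Finₚ.toℕ-fromℕ< home-check

        rotate : ℕ → Symmetry
        rotate o = rotation (dartMove (turn o)) (dartBack (turn o)) (vertexMove (turn o)) (faceBack (turn o))
          (dart-check (turn o)) (vertex-check (turn o)) (face-check (turn o))

        ⌜push⌝ : ∀ o v → toℕ (push (rotate o) v) ≡ vertexMove (turn o) (toℕ v)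
        ⌜push⌝ o = ⌜pushed⌝ (dartMove (turn o)) (dartBack (turn o)) (vertexMove (turn o)) (faceBack (turn o))
          (dart-check (turn o)) (vertex-check (turn o)) (face-check (turn o))

        ⌜pull⌝ : ∀ o f → toℕ (pull (rotate o) f) ≡ faceBack (turn o) (toℕ f)
        ⌜pull⌝ o = ⌜pulled⌝ (dartMove (turn o)) (dartBack (turn o)) (vertexMove (turn o)) (faceBack (turn o))
          (dart-check (turn o)) (vertex-check (turn o)) (face-check (turn o))

        remote : Fin #F → ℕ
        remote f = distance (toℕ f)

        remote-adj : ∀ {f g} → FAdj f g → remote f ≤ suc (remote g)
        remote-adj (d , refl , refl) = subst₂ (λ x y → distance x ≤ suc (distance y)) (sym (⌜face⌝ d)) (sym (⌜faceα⌝ d))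
          (≤-true (near-check (Finₚ.toℕ<n d)))

        module Step {o r} (o<3 : o < 3) (r< : r < suc (span o)) where
          private
            r₀ = ∧-true {stepₙ o r <ᵇ #D} (step-check {o} {r} o<3 r<)
            r₁ = ∧-true {tailₙ (stepₙ o r) ≡ᵇ (if r ≡ᵇ span o then home else spotₙ o (suc r))} (proj₂ r₀)
            r₂ = ∧-true {separated (spotₙ o r)} (proj₂ r₁)
            r₃ = ∧-true {below (suc δ) (λ i → distance (faceBack (turn o) (sectorₙ (spotₙ o r) i)) ≤ᵇ r)} (proj₂ r₂)
            step< = ℕₚ.<ᵇ⇒< _ #D (≡true⇒T (proj₁ r₀))
            step : Fin #D
            step = fromℕ< step<
            step≡ : toℕ step ≡ stepₙ o r
            step≡ = Finₚ.toℕ-fromℕ< step<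
          spot : Fin #V
          spot = tail (α step)
          ⌜spot⌝ : toℕ spot ≡ spotₙ o r
          ⌜spot⌝ = trans (⌜tailα⌝ step) (cong (λ d → tailₙ (αₙ d)) step≡)
          from : ∀ {v} → toℕ v ≡ (if r ≡ᵇ span o then home else spotₙ o (suc r)) → VAdj v spot
          from e = step , Finₚ.toℕ-injective (trans (⌜tail⌝ step) (trans (cong tailₙ step≡) (trans (eqᵇ (proj₁ r₁)) (sym e)))) , refl
          spot-separated : ∀ {v} → toℕ v ≡ spotₙ o r → ∀ {i j} → sector v i ≡ sector v j → i ≡ j
          spot-separated {v} e = sector-inj v (trans (cong separated e) (proj₁ r₂))
          spot-near : ∀ {v} → toℕ v ≡ spotₙ o r → ∀ i → remote (pull (rotate o) (sector v i)) ≤ r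
          spot-near {v} e i = subst (λ x → distance x ≤ r)
            (sym (trans (⌜pull⌝ o _) (cong (faceBack (turn o)) (trans (⌜sector⌝ v i) (cong (λ x → sectorₙ x (toℕ i)) e)))))
            (≤-true (below-sound (suc δ) _ (proj₁ r₃) (Finₚ.toℕ<n i)))
          last : r ≡ 0 → spotₙ o 0 ≡ vertexMove (turn o) home
          last refl = eqᵇ (proj₂ r₃)

        module Fugitive {j} (j+2δ<3δ+3 : j + (δ + δ) < suc δ + suc δ + suc δ) (j<2δ+2 : j < suc δ + suc δ) where
          open Game graph j using (Config; Captured; ValidCopMove; ValidRobberMove)
          open Strategies graph j

          close : Symmetry → ℕ → Config → ℕ
          close φ r c = crowd λ i → remote (pull φ (c i)) ≤ᵇ r

          -- The bound `few` refers to the moment before a cop move, hence the radius `suc r`. The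
          -- move costs one; afterwards at most `δ` cops are within `r`, where all `δ + 1` faces at
          -- the robber's vertex lie.
          record State (c : Config) (v : Fin #V) : Set where
            field
              φ      : Symmetry
              o r    : ℕ
              o<3    : o < 3
              r<     : r < suc (span o)
              w      : Fin #V
              w-spot : toℕ w ≡ spotₙ o r
              v-w    : v ≡ push φ w
              few    : close (φ then rotate o) (suc r) c ≤ δ

          free : ∀ φ o r {o<3 : o < 3} {r< : r < suc (span o)} {c w} → toℕ w ≡ spotₙ o r →
                 close (φ then rotate o) r c ≤ δ → ¬ Captured c (push φ w)
          free φ o r {o<3} {r<} {c} {w} e few cap = ℕₚ.<⇒≱ (s≤s few) (crowd-≥ _ guard guard-inj λ i →
            subst (λ f → T (remote (pull (rotate o) f) ≤ᵇ r)) (sym (at-guard i)) (ℕₚ.≤⇒≤ᵇ (Step.spot-near o<3 r< e i)))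
            where
            exposed : ∀ i → Incident (push φ w) (face (proj₁ (lift φ (spoke w i))))
            exposed i = let (d , p , q) = lift φ (spoke w i) in inj₁ (d , trans p (cong (push φ) (tail-spoke w i)) , refl)
            guard : Fin (suc δ) → Fin j
            guard i = proj₁ (cap _ (exposed i))
            at-guard : ∀ i → pull φ (c (guard i)) ≡ sector w i
            at-guard i = trans (cong (pull φ) (proj₂ (cap _ (exposed i)))) (proj₂ (proj₂ (lift φ (spoke w i))))
            guard-inj : ∀ {i i′} → guard i ≡ guard i′ → i ≡ i′
            guard-inj {i} {i′} q = Step.spot-separated o<3 r< e (trans (sym (at-guard i)) (trans (cong (pull φ ∘ c) q) (at-guard i′)))

          close-widen : ∀ φ r {c} → close φ r c ≤ close φ (suc r) c
          close-widen φ r {c} = crowd-mono {P = λ i → remote (pull φ (c i)) ≤ᵇ r} {λ i → remote (pull φ (c i)) ≤ᵇ suc r}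
            λ i t → ℕₚ.≤⇒≤ᵇ (ℕₚ.m≤n⇒m≤1+n (ℕₚ.≤ᵇ⇒≤ (remote (pull φ (c i))) r t))

          safe : ∀ {c v} → State c v → ¬ Captured c v
          safe s cap = free φ o r {o<3} {r<} w-spot
            (ℕₚ.≤-trans (close-widen (φ then rotate o) r) few) (subst (Captured _) v-w cap)
            where open State s

          close-move : ∀ φ r {c c′} → ValidCopMove c c′ → close φ r c′ ≤ close φ (suc r) c
          close-move φ r {c} {c′} ok = crowd-mono {P = λ i → remote (pull φ (c′ i)) ≤ᵇ r} {λ i → remote (pull φ (c i)) ≤ᵇ suc r} λ i t → ℕₚ.≤⇒≤ᵇ (nearby (ok i) (ℕₚ.≤ᵇ⇒≤ _ r t))
            where
            nearby : ∀ {f g} → (g ≡ f) ⊎ FAdj f g → remote (pull φ g) ≤ r → remote (pull φ f) ≤ suc r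
            nearby (inj₁ refl) le = ℕₚ.m≤n⇒m≤1+n le
            nearby (inj₂ a) le = ℕₚ.≤-trans (remote-adj (pull-adj φ a)) (s≤s le)

          leave : ∀ φ {c} → close φ 0 c ≤ δ → Σ (Fin #V) λ v → VAdj (push φ decision) v × State c v
          leave φ {c} few = pick (close (φ then rotate 0) (suc (span 0)) c ℕₚ.≤? δ) (close (φ then rotate 1) (suc (span 1)) c ℕₚ.≤? δ)
                                 (close (φ then rotate 2) (suc (span 2)) c ℕₚ.≤? δ)
            where
            go : ∀ o r (o<3 : o < 3) (r< : r < suc (span o)) {e : (r ≡ᵇ span o) ≡ true} →
                 close (φ then rotate o) (suc r) c ≤ δ → Σ (Fin #V) λ v → VAdj (push φ decision) v × State c v
            go o r o<3 r< {e} le = push φ (Step.spot o<3 r<) ,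
              push-adj φ (Step.from o<3 r< (trans ⌜decision⌝ (sym (whole e)))) ,
              record { φ = φ ; o = o ; r = r ; o<3 = o<3 ; r< = r< ; w = Step.spot o<3 r< ; w-spot = Step.⌜spot⌝ o<3 r<
                     ; v-w = refl ; few = le }
              where
              whole : ∀ {b x} → b ≡ true → (if b then home else x) ≡ home
              whole refl = refl
            weight : close (φ then rotate 0) (suc (span 0)) c + close (φ then rotate 1) (suc (span 1)) c + close (φ then rotate 2) (suc (span 2)) c
                     ≤ j + (close φ 0 c + close φ 0 c)
            weight = subst₂ _≤_
              (trans (weigh-+ (λ i → P 0 (suc (span 0)) i + P 1 (suc (span 1)) i) (P 2 (suc (span 2))) js) (cong (_+ weigh (P 2 (suc (span 2))) js) (weigh-+ (P 0 (suc (span 0))) (P 1 (suc (span 1))) js)))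
              (trans (weigh-+ (λ _ → 1) (λ i → Z i + Z i) js)
                (cong₂ _+_ (trans (weigh-1 js) (length-tabulate (id {A = Fin j}))) (weigh-+ Z Z js)))
              (weigh-≤ js λ i → subst (_≤ 1 + (Z i + Z i)) (sym (cong₂ _+_ (cong₂ _+_ (P≡ 0 (suc (span 0)) i) (P≡ 1 (suc (span 1)) i)) (P≡ 2 (suc (span 2)) i)))
                (≤-true (disperse-check (Finₚ.toℕ<n (pull φ (c i))))))
              where
              js = allFin j
              Z : Fin j → ℕ
              Z i = ⟦ remote (pull φ (c i)) ≤ᵇ 0 ⟧
              P : ℕ → ℕ → Fin j → ℕ
              P o r i = ⟦ remote (pull (rotate o) (pull φ (c i))) ≤ᵇ r ⟧
              P≡ : ∀ o r i → P o r i ≡ ⟦ distance (faceBack (turn o) (toℕ (pull φ (c i)))) ≤ᵇ r ⟧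
              P≡ o r i = cong (λ x → ⟦ distance x ≤ᵇ r ⟧) (⌜pull⌝ o (pull φ (c i)))
            pick : Dec (close (φ then rotate 0) (suc (span 0)) c ≤ δ) → Dec (close (φ then rotate 1) (suc (span 1)) c ≤ δ) →
                   Dec (close (φ then rotate 2) (suc (span 2)) c ≤ δ) → Σ (Fin #V) λ v → VAdj (push φ decision) v × State c v
            pick (yes le) _ _ = go 0 (span 0) (s≤s z≤n) ℕₚ.≤-refl {≡ᵇ-refl (span 0)} le
            pick (no _) (yes le) _ = go 1 (span 1) (s≤s (s≤s z≤n)) ℕₚ.≤-refl {≡ᵇ-refl (span 1)} le
            pick (no _) (no _) (yes le) = go 2 (span 2) ℕₚ.≤-refl ℕₚ.≤-refl {≡ᵇ-refl (span 2)} le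
            pick (no a) (no b) (no d) = ⊥-elim (ℕₚ.<⇒≱ j+2δ<3δ+3
              (ℕₚ.≤-trans (ℕₚ.+-mono-≤ (ℕₚ.+-mono-≤ (ℕₚ.≰⇒> a) (ℕₚ.≰⇒> b)) (ℕₚ.≰⇒> d))
                (ℕₚ.≤-trans weight (ℕₚ.+-monoʳ-≤ j (ℕₚ.+-mono-≤ few few)))))

          evade : ∀ {c v} → State c v → ∀ c′ → ValidCopMove c c′ →
                  ¬ Captured c′ v × Σ (Fin #V) (λ v′ → ValidRobberMove v v′ × State c′ v′)
          evade {c} {v} s c′ ok = (λ cap → free φ o r {o<3} {r<} w-spot few′ (subst (Captured _) v-w cap)) , proceed r refl
            where
            open State s
            few′ : close (φ then rotate o) r c′ ≤ δ
            few′ = ℕₚ.≤-trans (close-move (φ then rotate o) r ok) few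
            proceed : ∀ q → q ≡ r → Σ (Fin #V) (λ v′ → ValidRobberMove v v′ × State c′ v′)
            -- This spot is the image of `home`. The frame is composed with the rotation, and the
            -- choice among the three ways is made afresh in the new frame.
            proceed zero refl =
              let (v′ , a , s′) = leave (φ then rotate o) few′ in
              v′ , inj₂ (subst (λ u → VAdj u v′) (sym (trans v-w (cong (push φ) arrived))) a) , s′
              where
              arrived : w ≡ push (rotate o) decision
              arrived = Finₚ.toℕ-injective (trans w-spot (trans (Step.last o<3 r< refl)
                (sym (trans (⌜push⌝ o decision) (cong (vertexMove (turn o)) ⌜decision⌝)))))
            proceed (suc q) refl = push φ (Step.spot o<3 q<) ,
              inj₂ (subst (λ u → VAdj u (push φ (Step.spot o<3 q<))) (sym v-w) (push-adj φ (Step.from o<3 q< (trans w-spot (sym partway))))) ,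
              record { φ = φ ; o = o ; r = q ; o<3 = o<3 ; r< = q< ; w = Step.spot o<3 q< ; w-spot = Step.⌜spot⌝ o<3 q<
                     ; v-w = refl ; few = few′ }
              where
              q< : q < suc (span o)
              q< = ℕₚ.<-trans ℕₚ.≤-refl r<
              partway : (if q ≡ᵇ span o then home else spotₙ o (suc q)) ≡ spotₙ o (suc q)
              partway with q ≡ᵇ span o in e
              ... | true  = ⊥-elim (ℕₚ.<-irrefl (eqᵇ e) r<)
              ... | false = refl

          init : ∀ c → Σ (Fin #V) (State c)
          init c = pick (close (unmoved then rotate 0) 1 c ℕₚ.≤? δ) (close (rotate 3 then rotate 0) 1 c ℕₚ.≤? δ)
            where
            go : ∀ φ → close (φ then rotate 0) 1 c ≤ δ → Σ (Fin #V) (State c)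
            go φ le = push φ (Step.spot {0} {0} (s≤s z≤n) (s≤s z≤n)) ,
              record { φ = φ ; o = 0 ; r = 0 ; o<3 = s≤s z≤n ; r< = s≤s z≤n ; w = Step.spot {0} {0} (s≤s z≤n) (s≤s z≤n)
                     ; w-spot = Step.⌜spot⌝ {0} {0} (s≤s z≤n) (s≤s z≤n) ; v-w = refl ; few = le }
            weight : close (unmoved then rotate 0) 1 c + close (rotate 3 then rotate 0) 1 c ≤ j
            weight = subst₂ _≤_ (weigh-+ (P unmoved) (P (rotate 3)) (allFin j))
              (trans (weigh-1 (allFin j)) (length-tabulate (id {A = Fin j})))
              (weigh-≤ (allFin j) λ i → subst (_≤ 1)
                (sym (cong₂ (λ x y → ⟦ distance x ≤ᵇ 1 ⟧ + ⟦ distance y ≤ᵇ 1 ⟧) (⌜pull⌝ 0 (c i))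
                  (trans (⌜pull⌝ 0 (pull (rotate 3) (c i))) (cong (faceBack (turn 0)) (⌜pull⌝ 3 (c i))))))
                (≤-true (far-check (Finₚ.toℕ<n (c i)))))
              where
              P : Symmetry → Fin j → ℕ
              P φ i = ⟦ remote (pull (rotate 0) (pull φ (c i))) ≤ᵇ 1 ⟧
            pick : Dec (close (unmoved then rotate 0) 1 c ≤ δ) → Dec (close (rotate 3 then rotate 0) 1 c ≤ δ) → Σ (Fin #V) (State c)
            pick (yes le) _ = go unmoved le
            pick (no _) (yes le) = go (rotate 3) le
            pick (no a) (no b) = ⊥-elim (ℕₚ.<⇒≱ j<2δ+2
              (ℕₚ.≤-trans (ℕₚ.+-mono-≤ (ℕₚ.≰⇒> a) (ℕₚ.≰⇒> b)) weight))

          cops-lose : ¬ CopsWin graph j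
          cops-lose = copsLose State init safe evade

-- A maze of maximum degree four that defeats five cops.

module DodecahedralMaze where
  open NumberedMaps
  open Evasions
  open DegreeFour

  -- A graph of maximum degree 4 on which five cops fail.  Every edge of the
  -- dodecahedron becomes two crossing points (1320 + …) joined by a diamond,
  -- every node a hexagon.  Each of the twelve pentagons has ten places P on its
  -- boundary; place P carries a corner vertex with two spokes, the crossing point
  -- following it, and two columns of five concentric rings that keep the cops
  -- from taking shortcuts.  The 44 darts of place P are numbered 44 P + m.

  partners : List (List ℕ)
  partners =
    ((17 ∷ 16 ∷ 27 ∷ 26 ∷ 37 ∷ 36 ∷ 47 ∷ 46 ∷ 57 ∷ 56 ∷ [])
    ∷ (105 ∷ 104 ∷ 67 ∷ 66 ∷ 29 ∷ 28 ∷ 1 ∷ 0 ∷ 55 ∷ 54 ∷ [])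
    ∷ (65 ∷ 64 ∷ 77 ∷ 76 ∷ 39 ∷ 38 ∷ 3 ∷ 2 ∷ 15 ∷ 14 ∷ [])
    ∷ (75 ∷ 74 ∷ 87 ∷ 86 ∷ 49 ∷ 48 ∷ 5 ∷ 4 ∷ 25 ∷ 24 ∷ [])
    ∷ (85 ∷ 84 ∷ 97 ∷ 96 ∷ 59 ∷ 58 ∷ 7 ∷ 6 ∷ 35 ∷ 34 ∷ [])
    ∷ (95 ∷ 94 ∷ 107 ∷ 106 ∷ 19 ∷ 18 ∷ 9 ∷ 8 ∷ 45 ∷ 44 ∷ [])
    ∷ (117 ∷ 116 ∷ 79 ∷ 78 ∷ 21 ∷ 20 ∷ 13 ∷ 12 ∷ 103 ∷ 102 ∷ [])
    ∷ (115 ∷ 114 ∷ 89 ∷ 88 ∷ 31 ∷ 30 ∷ 23 ∷ 22 ∷ 63 ∷ 62 ∷ [])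
    ∷ (113 ∷ 112 ∷ 99 ∷ 98 ∷ 41 ∷ 40 ∷ 33 ∷ 32 ∷ 73 ∷ 72 ∷ [])
    ∷ (111 ∷ 110 ∷ 109 ∷ 108 ∷ 51 ∷ 50 ∷ 43 ∷ 42 ∷ 83 ∷ 82 ∷ [])
    ∷ (119 ∷ 118 ∷ 69 ∷ 68 ∷ 11 ∷ 10 ∷ 53 ∷ 52 ∷ 93 ∷ 92 ∷ [])
    ∷ (91 ∷ 90 ∷ 81 ∷ 80 ∷ 71 ∷ 70 ∷ 61 ∷ 60 ∷ 101 ∷ 100 ∷ [])
    ∷ [])

  crossings : List (List ℕ)
  crossings =
    ((0 ∷ 1 ∷ 2 ∷ 3 ∷ 4 ∷ 5 ∷ 6 ∷ 7 ∷ 8 ∷ 9 ∷ [])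
    ∷ (10 ∷ 11 ∷ 12 ∷ 13 ∷ 14 ∷ 15 ∷ 1 ∷ 0 ∷ 16 ∷ 17 ∷ [])
    ∷ (18 ∷ 19 ∷ 20 ∷ 21 ∷ 22 ∷ 23 ∷ 3 ∷ 2 ∷ 15 ∷ 14 ∷ [])
    ∷ (24 ∷ 25 ∷ 26 ∷ 27 ∷ 28 ∷ 29 ∷ 5 ∷ 4 ∷ 23 ∷ 22 ∷ [])
    ∷ (30 ∷ 31 ∷ 32 ∷ 33 ∷ 34 ∷ 35 ∷ 7 ∷ 6 ∷ 29 ∷ 28 ∷ [])
    ∷ (36 ∷ 37 ∷ 38 ∷ 39 ∷ 17 ∷ 16 ∷ 9 ∷ 8 ∷ 35 ∷ 34 ∷ [])
    ∷ (40 ∷ 41 ∷ 42 ∷ 43 ∷ 19 ∷ 18 ∷ 13 ∷ 12 ∷ 44 ∷ 45 ∷ [])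
    ∷ (46 ∷ 47 ∷ 48 ∷ 49 ∷ 25 ∷ 24 ∷ 21 ∷ 20 ∷ 43 ∷ 42 ∷ [])
    ∷ (50 ∷ 51 ∷ 52 ∷ 53 ∷ 31 ∷ 30 ∷ 27 ∷ 26 ∷ 49 ∷ 48 ∷ [])
    ∷ (54 ∷ 55 ∷ 56 ∷ 57 ∷ 37 ∷ 36 ∷ 33 ∷ 32 ∷ 53 ∷ 52 ∷ [])
    ∷ (58 ∷ 59 ∷ 45 ∷ 44 ∷ 11 ∷ 10 ∷ 39 ∷ 38 ∷ 57 ∷ 56 ∷ [])
    ∷ (55 ∷ 54 ∷ 51 ∷ 50 ∷ 47 ∷ 46 ∷ 41 ∷ 40 ∷ 59 ∷ 58 ∷ [])
    ∷ [])

  crossing-places : List (List ℕ)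
  crossing-places =
    ((0 ∷ 1 ∷ 2 ∷ 3 ∷ 4 ∷ 5 ∷ 6 ∷ 7 ∷ 8 ∷ 9 ∷ [])
    ∷ (10 ∷ 11 ∷ 12 ∷ 13 ∷ 14 ∷ 15 ∷ 18 ∷ 19 ∷ 20 ∷ 21 ∷ [])
    ∷ (22 ∷ 23 ∷ 24 ∷ 25 ∷ 30 ∷ 31 ∷ 32 ∷ 33 ∷ 34 ∷ 35 ∷ [])
    ∷ (40 ∷ 41 ∷ 42 ∷ 43 ∷ 44 ∷ 45 ∷ 50 ∷ 51 ∷ 52 ∷ 53 ∷ [])
    ∷ (60 ∷ 61 ∷ 62 ∷ 63 ∷ 68 ∷ 69 ∷ 70 ∷ 71 ∷ 72 ∷ 73 ∷ [])
    ∷ (80 ∷ 81 ∷ 82 ∷ 83 ∷ 90 ∷ 91 ∷ 92 ∷ 93 ∷ 100 ∷ 101 ∷ [])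
    ∷ [])

  blocks : List (List ℕ)
  blocks =
    ((0 ∷ 20 ∷ 1 ∷ 23 ∷ 2 ∷ 25 ∷ 3 ∷ 27 ∷ 4 ∷ 21 ∷ [])
    ∷ (5 ∷ 30 ∷ 10 ∷ 32 ∷ 6 ∷ 24 ∷ 1 ∷ 20 ∷ 0 ∷ 22 ∷ [])
    ∷ (6 ∷ 33 ∷ 11 ∷ 34 ∷ 7 ∷ 26 ∷ 2 ∷ 23 ∷ 1 ∷ 24 ∷ [])
    ∷ (7 ∷ 35 ∷ 12 ∷ 36 ∷ 8 ∷ 28 ∷ 3 ∷ 25 ∷ 2 ∷ 26 ∷ [])
    ∷ (8 ∷ 37 ∷ 13 ∷ 38 ∷ 9 ∷ 29 ∷ 4 ∷ 27 ∷ 3 ∷ 28 ∷ [])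
    ∷ (9 ∷ 39 ∷ 14 ∷ 31 ∷ 5 ∷ 22 ∷ 0 ∷ 21 ∷ 4 ∷ 29 ∷ [])
    ∷ (15 ∷ 45 ∷ 16 ∷ 41 ∷ 11 ∷ 33 ∷ 6 ∷ 32 ∷ 10 ∷ 40 ∷ [])
    ∷ (16 ∷ 47 ∷ 17 ∷ 42 ∷ 12 ∷ 35 ∷ 7 ∷ 34 ∷ 11 ∷ 41 ∷ [])
    ∷ (17 ∷ 48 ∷ 18 ∷ 43 ∷ 13 ∷ 37 ∷ 8 ∷ 36 ∷ 12 ∷ 42 ∷ [])
    ∷ (18 ∷ 49 ∷ 19 ∷ 44 ∷ 14 ∷ 39 ∷ 9 ∷ 38 ∷ 13 ∷ 43 ∷ [])
    ∷ (19 ∷ 46 ∷ 15 ∷ 40 ∷ 10 ∷ 30 ∷ 5 ∷ 31 ∷ 14 ∷ 44 ∷ [])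
    ∷ (19 ∷ 49 ∷ 18 ∷ 48 ∷ 17 ∷ 47 ∷ 16 ∷ 45 ∷ 15 ∷ 46 ∷ [])
    ∷ [])

  block-places : List (List ℕ)
  block-places =
    ((0 ∷ 2 ∷ 4 ∷ 6 ∷ 8 ∷ 10 ∷ 14 ∷ 24 ∷ 34 ∷ 44 ∷ [])
    ∷ (12 ∷ 22 ∷ 32 ∷ 42 ∷ 52 ∷ 60 ∷ 62 ∷ 72 ∷ 82 ∷ 92 ∷ [])
    ∷ (1 ∷ 9 ∷ 19 ∷ 3 ∷ 15 ∷ 5 ∷ 25 ∷ 7 ∷ 35 ∷ 45 ∷ [])
    ∷ (11 ∷ 53 ∷ 13 ∷ 21 ∷ 23 ∷ 31 ∷ 33 ∷ 41 ∷ 43 ∷ 51 ∷ [])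
    ∷ (69 ∷ 63 ∷ 73 ∷ 83 ∷ 93 ∷ 61 ∷ 101 ∷ 71 ∷ 81 ∷ 91 ∷ [])
    ∷ [])

  α-codes : List (List ℕ)
  α-codes =
    ((5 ∷ 10 ∷ 6 ∷ 92 ∷ 47 ∷ 0 ∷ 2 ∷ 13 ∷ 14 ∷ 99 ∷ [])
    ∷ (1 ∷ 53 ∷ 18 ∷ 7 ∷ 8 ∷ 21 ∷ 22 ∷ 107 ∷ 12 ∷ 61 ∷ [])
    ∷ (26 ∷ 15 ∷ 16 ∷ 29 ∷ 30 ∷ 115 ∷ 20 ∷ 69 ∷ 34 ∷ 23 ∷ [])
    ∷ (24 ∷ 37 ∷ 38 ∷ 123 ∷ 28 ∷ 77 ∷ 41 ∷ 31 ∷ 32 ∷ 43 ∷ [])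
    ∷ (130 ∷ 36 ∷ 84 ∷ 39 ∷ [])
    ∷ [])

  σ-codes : List (List ℕ)
  σ-codes =
    ((1 ∷ 2 ∷ 3 ∷ 0 ∷ 5 ∷ 136 ∷ 7 ∷ 8 ∷ 9 ∷ 6 ∷ [])
    ∷ (11 ∷ 12 ∷ 13 ∷ 10 ∷ 15 ∷ 16 ∷ 17 ∷ 14 ∷ 19 ∷ 20 ∷ [])
    ∷ (21 ∷ 18 ∷ 23 ∷ 24 ∷ 25 ∷ 22 ∷ 27 ∷ 28 ∷ 29 ∷ 26 ∷ [])
    ∷ (31 ∷ 32 ∷ 33 ∷ 30 ∷ 35 ∷ 36 ∷ 37 ∷ 34 ∷ 39 ∷ 40 ∷ [])
    ∷ (38 ∷ 42 ∷ 43 ∷ 41 ∷ [])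
    ∷ [])

  tail-codes : List (List ℕ)
  tail-codes =
    ((0 ∷ 0 ∷ 0 ∷ 0 ∷ 11 ∷ 11 ∷ 1 ∷ 1 ∷ 1 ∷ 1 ∷ [])
    ∷ (2 ∷ 2 ∷ 2 ∷ 2 ∷ 3 ∷ 3 ∷ 3 ∷ 3 ∷ 4 ∷ 4 ∷ [])
    ∷ (4 ∷ 4 ∷ 5 ∷ 5 ∷ 5 ∷ 5 ∷ 6 ∷ 6 ∷ 6 ∷ 6 ∷ [])
    ∷ (7 ∷ 7 ∷ 7 ∷ 7 ∷ 8 ∷ 8 ∷ 8 ∷ 8 ∷ 9 ∷ 9 ∷ [])
    ∷ (9 ∷ 10 ∷ 10 ∷ 10 ∷ [])
    ∷ [])

  face-codes : List (List ℕ)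
  face-codes =
    ((20 ∷ 1 ∷ 0 ∷ 11 ∷ 21 ∷ 1 ∷ 11 ∷ 0 ∷ 2 ∷ 13 ∷ [])
    ∷ (0 ∷ 1 ∷ 3 ∷ 2 ∷ 13 ∷ 2 ∷ 4 ∷ 15 ∷ 2 ∷ 3 ∷ [])
    ∷ (5 ∷ 4 ∷ 15 ∷ 4 ∷ 6 ∷ 17 ∷ 4 ∷ 5 ∷ 7 ∷ 6 ∷ [])
    ∷ (17 ∷ 6 ∷ 8 ∷ 19 ∷ 6 ∷ 7 ∷ 9 ∷ 8 ∷ 19 ∷ 8 ∷ [])
    ∷ (22 ∷ 8 ∷ 9 ∷ 22 ∷ [])
    ∷ [])

  corner-parents : List (List ℕ)
  corner-parents =
    ((0 ∷ 3 ∷ 3 ∷ 3 ∷ 3 ∷ 3 ∷ 0 ∷ 0 ∷ 0 ∷ 0 ∷ [])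
    ∷ (3 ∷ 3 ∷ 3 ∷ 0 ∷ 0 ∷ 0 ∷ 0 ∷ 0 ∷ 3 ∷ 3 ∷ [])
    ∷ (3 ∷ 3 ∷ 3 ∷ 0 ∷ 0 ∷ 0 ∷ 0 ∷ 0 ∷ 3 ∷ 3 ∷ [])
    ∷ (3 ∷ 3 ∷ 3 ∷ 0 ∷ 0 ∷ 0 ∷ 0 ∷ 0 ∷ 3 ∷ 3 ∷ [])
    ∷ (3 ∷ 3 ∷ 0 ∷ 0 ∷ 0 ∷ 0 ∷ 0 ∷ 3 ∷ 3 ∷ 3 ∷ [])
    ∷ (3 ∷ 3 ∷ 0 ∷ 0 ∷ 0 ∷ 0 ∷ 0 ∷ 3 ∷ 3 ∷ 3 ∷ [])
    ∷ (3 ∷ 3 ∷ 0 ∷ 0 ∷ 0 ∷ 0 ∷ 0 ∷ 3 ∷ 3 ∷ 3 ∷ [])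
    ∷ (3 ∷ 3 ∷ 0 ∷ 0 ∷ 0 ∷ 0 ∷ 0 ∷ 3 ∷ 3 ∷ 3 ∷ [])
    ∷ (3 ∷ 0 ∷ 0 ∷ 0 ∷ 0 ∷ 0 ∷ 0 ∷ 3 ∷ 3 ∷ 3 ∷ [])
    ∷ (3 ∷ 0 ∷ 0 ∷ 0 ∷ 0 ∷ 0 ∷ 0 ∷ 3 ∷ 3 ∷ 3 ∷ [])
    ∷ (3 ∷ 0 ∷ 0 ∷ 0 ∷ 0 ∷ 0 ∷ 3 ∷ 3 ∷ 3 ∷ 3 ∷ [])
    ∷ (0 ∷ 3 ∷ 3 ∷ 3 ∷ 0 ∷ 0 ∷ 0 ∷ 0 ∷ 3 ∷ 3 ∷ [])
    ∷ [])

  crossing-parents : List (List ℕ)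
  crossing-parents =
    ((0 ∷ 49 ∷ 93 ∷ 137 ∷ 181 ∷ 225 ∷ 268 ∷ 312 ∷ 356 ∷ 400 ∷ [])
    ∷ (445 ∷ 489 ∷ 532 ∷ 576 ∷ 620 ∷ 664 ∷ 797 ∷ 841 ∷ 885 ∷ 929 ∷ [])
    ∷ (973 ∷ 1016 ∷ 1060 ∷ 1104 ∷ 1325 ∷ 1369 ∷ 1413 ∷ 1456 ∷ 1500 ∷ 2117 ∷ [])
    ∷ (1765 ∷ 1808 ∷ 1852 ∷ 1896 ∷ 1940 ∷ 2557 ∷ 2205 ∷ 2248 ∷ 2292 ∷ 2336 ∷ [])
    ∷ (2645 ∷ 2688 ∷ 2732 ∷ 2776 ∷ 4536 ∷ 3041 ∷ 3085 ∷ 3129 ∷ 3172 ∷ 3216 ∷ [])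
    ∷ (3525 ∷ 3568 ∷ 3612 ∷ 4317 ∷ 3964 ∷ 4008 ∷ 4052 ∷ 4757 ∷ 4405 ∷ 4448 ∷ [])
    ∷ [])

  -- Each entry packs the distances of the ten faces of one place into a decimal numeral, face 0 in
  -- the last digit.
  near-table : List (List ℕ)
  near-table =
    ((5545342312 ∷ 3423120100 ∷ 3423120100 ∷ 5443322110 ∷ 5555544332 ∷ 5555555554 ∷ 5555555555 ∷ 5555555555 ∷ 5555555555 ∷ 5555554534 ∷ [])
    ∷ (5555555555 ∷ 5555555555 ∷ 5555555555 ∷ 5555554534 ∷ 5545342312 ∷ 3423120100 ∷ 3423120100 ∷ 5443322110 ∷ 5555544332 ∷ 5555555554 ∷ [])
    ∷ (1122334332 ∷ 1122334434 ∷ 1122332312 ∷ 1122322110 ∷ 1122334332 ∷ 1122334434 ∷ 1122332312 ∷ 1122120100 ∷ 1121100000 ∷ 1122322110 ∷ [])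
    ∷ (5555554534 ∷ 5555555554 ∷ 5555555555 ∷ 5555555555 ∷ 5555555555 ∷ 5555555555 ∷ 5555555555 ∷ 5555554534 ∷ 5555554534 ∷ 5555554534 ∷ [])
    ∷ (5555555555 ∷ 5555555555 ∷ 5555555555 ∷ 5555555555 ∷ 5555555555 ∷ 5555555555 ∷ 5555555555 ∷ 5555555555 ∷ 5555555555 ∷ 5555555555 ∷ [])
    ∷ (5555555555 ∷ 5555555555 ∷ 5555555555 ∷ 5555555555 ∷ 5555555555 ∷ 5555554534 ∷ 5555554534 ∷ 5555555554 ∷ 5555555555 ∷ 5555555555 ∷ [])
    ∷ (5555555555 ∷ 5555555555 ∷ 5555555555 ∷ 5555554534 ∷ 5555554534 ∷ 5555554534 ∷ 5555554534 ∷ 5555555554 ∷ 5555555555 ∷ 5555555555 ∷ [])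
    ∷ (5555555555 ∷ 5555555555 ∷ 5555555555 ∷ 5555555555 ∷ 5555555555 ∷ 5555554534 ∷ 5545342312 ∷ 5443322110 ∷ 5555544332 ∷ 5555555554 ∷ [])
    ∷ (5555555555 ∷ 5555555555 ∷ 5555555555 ∷ 5555555555 ∷ 5555555555 ∷ 5555555555 ∷ 5555555555 ∷ 5555555555 ∷ 5555555555 ∷ 5555555555 ∷ [])
    ∷ (5555555555 ∷ 5555555555 ∷ 5555555555 ∷ 5555555555 ∷ 5555555555 ∷ 5555555555 ∷ 5555555555 ∷ 5555555555 ∷ 5555555555 ∷ 5555555555 ∷ [])
    ∷ (5555555555 ∷ 5555555555 ∷ 5555555555 ∷ 5555555555 ∷ 5555555555 ∷ 5555555555 ∷ 5555555555 ∷ 5555555555 ∷ 5555555555 ∷ 5555555555 ∷ [])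
    ∷ (5555555555 ∷ 5555555555 ∷ 5555555555 ∷ 5555555555 ∷ 5555555555 ∷ 5555555555 ∷ 5555555555 ∷ 5555555555 ∷ 5555555555 ∷ 5555555555 ∷ [])
    ∷ [])

  cap-table : List (List ℕ)
  cap-table =
    ((4 ∷ 4 ∷ 0 ∷ 5 ∷ 5 ∷ 5 ∷ 5 ∷ 5 ∷ 5 ∷ 5 ∷ [])
    ∷ (5 ∷ 5 ∷ [])
    ∷ [])

  block-table : List (List ℕ)
  block-table =
    ((2 ∷ 0 ∷ 2 ∷ 5 ∷ 5 ∷ 5 ∷ 2 ∷ 2 ∷ 5 ∷ 5 ∷ [])
    ∷ (5 ∷ 2 ∷ 5 ∷ 5 ∷ 5 ∷ 5 ∷ 5 ∷ 5 ∷ 5 ∷ 5 ∷ [])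
    ∷ (0 ∷ 4 ∷ 4 ∷ 0 ∷ 0 ∷ 4 ∷ 4 ∷ 5 ∷ 5 ∷ 5 ∷ [])
    ∷ (5 ∷ 5 ∷ 4 ∷ 4 ∷ 0 ∷ 4 ∷ 5 ∷ 5 ∷ 5 ∷ 5 ∷ [])
    ∷ (5 ∷ 4 ∷ 5 ∷ 5 ∷ 5 ∷ 5 ∷ 5 ∷ 5 ∷ 5 ∷ 5 ∷ [])
    ∷ [])

  -- `turn₀` and `turn₃` turn about pentagon 0, the latter being the square of the former; `turn₁`
  -- turns about pentagon 1. `turn₂` is the half-turn that interchanges these two pentagons and is
  -- its own inverse. Vertex 1321 lies on the edge between the two.
  turn₀ : List (List ℕ)
  turn₀ =
    ((2 ∷ 3 ∷ 4 ∷ 5 ∷ 6 ∷ 7 ∷ 8 ∷ 9 ∷ 0 ∷ 1 ∷ [])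
    ∷ (20 ∷ 21 ∷ 22 ∷ 23 ∷ 24 ∷ 25 ∷ 26 ∷ 27 ∷ 28 ∷ 29 ∷ [])
    ∷ (30 ∷ 31 ∷ 32 ∷ 33 ∷ 34 ∷ 35 ∷ 36 ∷ 37 ∷ 38 ∷ 39 ∷ [])
    ∷ (40 ∷ 41 ∷ 42 ∷ 43 ∷ 44 ∷ 45 ∷ 46 ∷ 47 ∷ 48 ∷ 49 ∷ [])
    ∷ (50 ∷ 51 ∷ 52 ∷ 53 ∷ 54 ∷ 55 ∷ 56 ∷ 57 ∷ 58 ∷ 59 ∷ [])
    ∷ (10 ∷ 11 ∷ 12 ∷ 13 ∷ 14 ∷ 15 ∷ 16 ∷ 17 ∷ 18 ∷ 19 ∷ [])
    ∷ (70 ∷ 71 ∷ 72 ∷ 73 ∷ 74 ∷ 75 ∷ 76 ∷ 77 ∷ 78 ∷ 79 ∷ [])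
    ∷ (80 ∷ 81 ∷ 82 ∷ 83 ∷ 84 ∷ 85 ∷ 86 ∷ 87 ∷ 88 ∷ 89 ∷ [])
    ∷ (90 ∷ 91 ∷ 92 ∷ 93 ∷ 94 ∷ 95 ∷ 96 ∷ 97 ∷ 98 ∷ 99 ∷ [])
    ∷ (100 ∷ 101 ∷ 102 ∷ 103 ∷ 104 ∷ 105 ∷ 106 ∷ 107 ∷ 108 ∷ 109 ∷ [])
    ∷ (60 ∷ 61 ∷ 62 ∷ 63 ∷ 64 ∷ 65 ∷ 66 ∷ 67 ∷ 68 ∷ 69 ∷ [])
    ∷ (118 ∷ 119 ∷ 110 ∷ 111 ∷ 112 ∷ 113 ∷ 114 ∷ 115 ∷ 116 ∷ 117 ∷ [])
    ∷ [])

  unturn₀ : List (List ℕ)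
  unturn₀ =
    ((8 ∷ 9 ∷ 0 ∷ 1 ∷ 2 ∷ 3 ∷ 4 ∷ 5 ∷ 6 ∷ 7 ∷ [])
    ∷ (50 ∷ 51 ∷ 52 ∷ 53 ∷ 54 ∷ 55 ∷ 56 ∷ 57 ∷ 58 ∷ 59 ∷ [])
    ∷ (10 ∷ 11 ∷ 12 ∷ 13 ∷ 14 ∷ 15 ∷ 16 ∷ 17 ∷ 18 ∷ 19 ∷ [])
    ∷ (20 ∷ 21 ∷ 22 ∷ 23 ∷ 24 ∷ 25 ∷ 26 ∷ 27 ∷ 28 ∷ 29 ∷ [])
    ∷ (30 ∷ 31 ∷ 32 ∷ 33 ∷ 34 ∷ 35 ∷ 36 ∷ 37 ∷ 38 ∷ 39 ∷ [])
    ∷ (40 ∷ 41 ∷ 42 ∷ 43 ∷ 44 ∷ 45 ∷ 46 ∷ 47 ∷ 48 ∷ 49 ∷ [])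
    ∷ (100 ∷ 101 ∷ 102 ∷ 103 ∷ 104 ∷ 105 ∷ 106 ∷ 107 ∷ 108 ∷ 109 ∷ [])
    ∷ (60 ∷ 61 ∷ 62 ∷ 63 ∷ 64 ∷ 65 ∷ 66 ∷ 67 ∷ 68 ∷ 69 ∷ [])
    ∷ (70 ∷ 71 ∷ 72 ∷ 73 ∷ 74 ∷ 75 ∷ 76 ∷ 77 ∷ 78 ∷ 79 ∷ [])
    ∷ (80 ∷ 81 ∷ 82 ∷ 83 ∷ 84 ∷ 85 ∷ 86 ∷ 87 ∷ 88 ∷ 89 ∷ [])
    ∷ (90 ∷ 91 ∷ 92 ∷ 93 ∷ 94 ∷ 95 ∷ 96 ∷ 97 ∷ 98 ∷ 99 ∷ [])
    ∷ (112 ∷ 113 ∷ 114 ∷ 115 ∷ 116 ∷ 117 ∷ 118 ∷ 119 ∷ 110 ∷ 111 ∷ [])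
    ∷ [])

  turn₁ : List (List ℕ)
  turn₁ =
    ((28 ∷ 29 ∷ 20 ∷ 21 ∷ 22 ∷ 23 ∷ 24 ∷ 25 ∷ 26 ∷ 27 ∷ [])
    ∷ (18 ∷ 19 ∷ 10 ∷ 11 ∷ 12 ∷ 13 ∷ 14 ∷ 15 ∷ 16 ∷ 17 ∷ [])
    ∷ (68 ∷ 69 ∷ 60 ∷ 61 ∷ 62 ∷ 63 ∷ 64 ∷ 65 ∷ 66 ∷ 67 ∷ [])
    ∷ (70 ∷ 71 ∷ 72 ∷ 73 ∷ 74 ∷ 75 ∷ 76 ∷ 77 ∷ 78 ∷ 79 ∷ [])
    ∷ (32 ∷ 33 ∷ 34 ∷ 35 ∷ 36 ∷ 37 ∷ 38 ∷ 39 ∷ 30 ∷ 31 ∷ [])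
    ∷ (6 ∷ 7 ∷ 8 ∷ 9 ∷ 0 ∷ 1 ∷ 2 ∷ 3 ∷ 4 ∷ 5 ∷ [])
    ∷ (108 ∷ 109 ∷ 100 ∷ 101 ∷ 102 ∷ 103 ∷ 104 ∷ 105 ∷ 106 ∷ 107 ∷ [])
    ∷ (110 ∷ 111 ∷ 112 ∷ 113 ∷ 114 ∷ 115 ∷ 116 ∷ 117 ∷ 118 ∷ 119 ∷ [])
    ∷ (82 ∷ 83 ∷ 84 ∷ 85 ∷ 86 ∷ 87 ∷ 88 ∷ 89 ∷ 80 ∷ 81 ∷ [])
    ∷ (42 ∷ 43 ∷ 44 ∷ 45 ∷ 46 ∷ 47 ∷ 48 ∷ 49 ∷ 40 ∷ 41 ∷ [])
    ∷ (50 ∷ 51 ∷ 52 ∷ 53 ∷ 54 ∷ 55 ∷ 56 ∷ 57 ∷ 58 ∷ 59 ∷ [])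
    ∷ (96 ∷ 97 ∷ 98 ∷ 99 ∷ 90 ∷ 91 ∷ 92 ∷ 93 ∷ 94 ∷ 95 ∷ [])
    ∷ [])

  unturn₁ : List (List ℕ)
  unturn₁ =
    ((54 ∷ 55 ∷ 56 ∷ 57 ∷ 58 ∷ 59 ∷ 50 ∷ 51 ∷ 52 ∷ 53 ∷ [])
    ∷ (12 ∷ 13 ∷ 14 ∷ 15 ∷ 16 ∷ 17 ∷ 18 ∷ 19 ∷ 10 ∷ 11 ∷ [])
    ∷ (2 ∷ 3 ∷ 4 ∷ 5 ∷ 6 ∷ 7 ∷ 8 ∷ 9 ∷ 0 ∷ 1 ∷ [])
    ∷ (48 ∷ 49 ∷ 40 ∷ 41 ∷ 42 ∷ 43 ∷ 44 ∷ 45 ∷ 46 ∷ 47 ∷ [])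
    ∷ (98 ∷ 99 ∷ 90 ∷ 91 ∷ 92 ∷ 93 ∷ 94 ∷ 95 ∷ 96 ∷ 97 ∷ [])
    ∷ (100 ∷ 101 ∷ 102 ∷ 103 ∷ 104 ∷ 105 ∷ 106 ∷ 107 ∷ 108 ∷ 109 ∷ [])
    ∷ (22 ∷ 23 ∷ 24 ∷ 25 ∷ 26 ∷ 27 ∷ 28 ∷ 29 ∷ 20 ∷ 21 ∷ [])
    ∷ (30 ∷ 31 ∷ 32 ∷ 33 ∷ 34 ∷ 35 ∷ 36 ∷ 37 ∷ 38 ∷ 39 ∷ [])
    ∷ (88 ∷ 89 ∷ 80 ∷ 81 ∷ 82 ∷ 83 ∷ 84 ∷ 85 ∷ 86 ∷ 87 ∷ [])
    ∷ (114 ∷ 115 ∷ 116 ∷ 117 ∷ 118 ∷ 119 ∷ 110 ∷ 111 ∷ 112 ∷ 113 ∷ [])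
    ∷ (62 ∷ 63 ∷ 64 ∷ 65 ∷ 66 ∷ 67 ∷ 68 ∷ 69 ∷ 60 ∷ 61 ∷ [])
    ∷ (70 ∷ 71 ∷ 72 ∷ 73 ∷ 74 ∷ 75 ∷ 76 ∷ 77 ∷ 78 ∷ 79 ∷ [])
    ∷ [])

  turn₂ : List (List ℕ)
  turn₂ =
    ((16 ∷ 17 ∷ 18 ∷ 19 ∷ 10 ∷ 11 ∷ 12 ∷ 13 ∷ 14 ∷ 15 ∷ [])
    ∷ (4 ∷ 5 ∷ 6 ∷ 7 ∷ 8 ∷ 9 ∷ 0 ∷ 1 ∷ 2 ∷ 3 ∷ [])
    ∷ (58 ∷ 59 ∷ 50 ∷ 51 ∷ 52 ∷ 53 ∷ 54 ∷ 55 ∷ 56 ∷ 57 ∷ [])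
    ∷ (108 ∷ 109 ∷ 100 ∷ 101 ∷ 102 ∷ 103 ∷ 104 ∷ 105 ∷ 106 ∷ 107 ∷ [])
    ∷ (60 ∷ 61 ∷ 62 ∷ 63 ∷ 64 ∷ 65 ∷ 66 ∷ 67 ∷ 68 ∷ 69 ∷ [])
    ∷ (22 ∷ 23 ∷ 24 ∷ 25 ∷ 26 ∷ 27 ∷ 28 ∷ 29 ∷ 20 ∷ 21 ∷ [])
    ∷ (40 ∷ 41 ∷ 42 ∷ 43 ∷ 44 ∷ 45 ∷ 46 ∷ 47 ∷ 48 ∷ 49 ∷ [])
    ∷ (98 ∷ 99 ∷ 90 ∷ 91 ∷ 92 ∷ 93 ∷ 94 ∷ 95 ∷ 96 ∷ 97 ∷ [])
    ∷ (112 ∷ 113 ∷ 114 ∷ 115 ∷ 116 ∷ 117 ∷ 118 ∷ 119 ∷ 110 ∷ 111 ∷ [])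
    ∷ (72 ∷ 73 ∷ 74 ∷ 75 ∷ 76 ∷ 77 ∷ 78 ∷ 79 ∷ 70 ∷ 71 ∷ [])
    ∷ (32 ∷ 33 ∷ 34 ∷ 35 ∷ 36 ∷ 37 ∷ 38 ∷ 39 ∷ 30 ∷ 31 ∷ [])
    ∷ (88 ∷ 89 ∷ 80 ∷ 81 ∷ 82 ∷ 83 ∷ 84 ∷ 85 ∷ 86 ∷ 87 ∷ [])
    ∷ [])

  unturn₂ : List (List ℕ)
  unturn₂ =
    ((16 ∷ 17 ∷ 18 ∷ 19 ∷ 10 ∷ 11 ∷ 12 ∷ 13 ∷ 14 ∷ 15 ∷ [])
    ∷ (4 ∷ 5 ∷ 6 ∷ 7 ∷ 8 ∷ 9 ∷ 0 ∷ 1 ∷ 2 ∷ 3 ∷ [])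
    ∷ (58 ∷ 59 ∷ 50 ∷ 51 ∷ 52 ∷ 53 ∷ 54 ∷ 55 ∷ 56 ∷ 57 ∷ [])
    ∷ (108 ∷ 109 ∷ 100 ∷ 101 ∷ 102 ∷ 103 ∷ 104 ∷ 105 ∷ 106 ∷ 107 ∷ [])
    ∷ (60 ∷ 61 ∷ 62 ∷ 63 ∷ 64 ∷ 65 ∷ 66 ∷ 67 ∷ 68 ∷ 69 ∷ [])
    ∷ (22 ∷ 23 ∷ 24 ∷ 25 ∷ 26 ∷ 27 ∷ 28 ∷ 29 ∷ 20 ∷ 21 ∷ [])
    ∷ (40 ∷ 41 ∷ 42 ∷ 43 ∷ 44 ∷ 45 ∷ 46 ∷ 47 ∷ 48 ∷ 49 ∷ [])
    ∷ (98 ∷ 99 ∷ 90 ∷ 91 ∷ 92 ∷ 93 ∷ 94 ∷ 95 ∷ 96 ∷ 97 ∷ [])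
    ∷ (112 ∷ 113 ∷ 114 ∷ 115 ∷ 116 ∷ 117 ∷ 118 ∷ 119 ∷ 110 ∷ 111 ∷ [])
    ∷ (72 ∷ 73 ∷ 74 ∷ 75 ∷ 76 ∷ 77 ∷ 78 ∷ 79 ∷ 70 ∷ 71 ∷ [])
    ∷ (32 ∷ 33 ∷ 34 ∷ 35 ∷ 36 ∷ 37 ∷ 38 ∷ 39 ∷ 30 ∷ 31 ∷ [])
    ∷ (88 ∷ 89 ∷ 80 ∷ 81 ∷ 82 ∷ 83 ∷ 84 ∷ 85 ∷ 86 ∷ 87 ∷ [])
    ∷ [])

  turn₃ : List (List ℕ)
  turn₃ =
    ((4 ∷ 5 ∷ 6 ∷ 7 ∷ 8 ∷ 9 ∷ 0 ∷ 1 ∷ 2 ∷ 3 ∷ [])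
    ∷ (30 ∷ 31 ∷ 32 ∷ 33 ∷ 34 ∷ 35 ∷ 36 ∷ 37 ∷ 38 ∷ 39 ∷ [])
    ∷ (40 ∷ 41 ∷ 42 ∷ 43 ∷ 44 ∷ 45 ∷ 46 ∷ 47 ∷ 48 ∷ 49 ∷ [])
    ∷ (50 ∷ 51 ∷ 52 ∷ 53 ∷ 54 ∷ 55 ∷ 56 ∷ 57 ∷ 58 ∷ 59 ∷ [])
    ∷ (10 ∷ 11 ∷ 12 ∷ 13 ∷ 14 ∷ 15 ∷ 16 ∷ 17 ∷ 18 ∷ 19 ∷ [])
    ∷ (20 ∷ 21 ∷ 22 ∷ 23 ∷ 24 ∷ 25 ∷ 26 ∷ 27 ∷ 28 ∷ 29 ∷ [])
    ∷ (80 ∷ 81 ∷ 82 ∷ 83 ∷ 84 ∷ 85 ∷ 86 ∷ 87 ∷ 88 ∷ 89 ∷ [])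
    ∷ (90 ∷ 91 ∷ 92 ∷ 93 ∷ 94 ∷ 95 ∷ 96 ∷ 97 ∷ 98 ∷ 99 ∷ [])
    ∷ (100 ∷ 101 ∷ 102 ∷ 103 ∷ 104 ∷ 105 ∷ 106 ∷ 107 ∷ 108 ∷ 109 ∷ [])
    ∷ (60 ∷ 61 ∷ 62 ∷ 63 ∷ 64 ∷ 65 ∷ 66 ∷ 67 ∷ 68 ∷ 69 ∷ [])
    ∷ (70 ∷ 71 ∷ 72 ∷ 73 ∷ 74 ∷ 75 ∷ 76 ∷ 77 ∷ 78 ∷ 79 ∷ [])
    ∷ (116 ∷ 117 ∷ 118 ∷ 119 ∷ 110 ∷ 111 ∷ 112 ∷ 113 ∷ 114 ∷ 115 ∷ [])
    ∷ [])

  unturn₃ : List (List ℕ)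
  unturn₃ =
    ((6 ∷ 7 ∷ 8 ∷ 9 ∷ 0 ∷ 1 ∷ 2 ∷ 3 ∷ 4 ∷ 5 ∷ [])
    ∷ (40 ∷ 41 ∷ 42 ∷ 43 ∷ 44 ∷ 45 ∷ 46 ∷ 47 ∷ 48 ∷ 49 ∷ [])
    ∷ (50 ∷ 51 ∷ 52 ∷ 53 ∷ 54 ∷ 55 ∷ 56 ∷ 57 ∷ 58 ∷ 59 ∷ [])
    ∷ (10 ∷ 11 ∷ 12 ∷ 13 ∷ 14 ∷ 15 ∷ 16 ∷ 17 ∷ 18 ∷ 19 ∷ [])
    ∷ (20 ∷ 21 ∷ 22 ∷ 23 ∷ 24 ∷ 25 ∷ 26 ∷ 27 ∷ 28 ∷ 29 ∷ [])
    ∷ (30 ∷ 31 ∷ 32 ∷ 33 ∷ 34 ∷ 35 ∷ 36 ∷ 37 ∷ 38 ∷ 39 ∷ [])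
    ∷ (90 ∷ 91 ∷ 92 ∷ 93 ∷ 94 ∷ 95 ∷ 96 ∷ 97 ∷ 98 ∷ 99 ∷ [])
    ∷ (100 ∷ 101 ∷ 102 ∷ 103 ∷ 104 ∷ 105 ∷ 106 ∷ 107 ∷ 108 ∷ 109 ∷ [])
    ∷ (60 ∷ 61 ∷ 62 ∷ 63 ∷ 64 ∷ 65 ∷ 66 ∷ 67 ∷ 68 ∷ 69 ∷ [])
    ∷ (70 ∷ 71 ∷ 72 ∷ 73 ∷ 74 ∷ 75 ∷ 76 ∷ 77 ∷ 78 ∷ 79 ∷ [])
    ∷ (80 ∷ 81 ∷ 82 ∷ 83 ∷ 84 ∷ 85 ∷ 86 ∷ 87 ∷ 88 ∷ 89 ∷ [])
    ∷ (114 ∷ 115 ∷ 116 ∷ 117 ∷ 118 ∷ 119 ∷ 110 ∷ 111 ∷ 112 ∷ 113 ∷ [])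
    ∷ [])

  place slot : ℕ → ℕ
  place d = d / 44
  slot d = d % 44

  following preceding : ℕ → ℕ
  following p = p / 10 * 10 + (p % 10 + 1) % 10
  preceding p = p / 10 * 10 + (p % 10 + 9) % 10

  shift : ℕ → ℕ → ℕ
  shift 0 p = p
  shift 1 p = following p
  shift 2 p = preceding p
  shift _ p = at partners p

  -- The tables of slots are the same at every place. The remainder modulo 44 is a slot, and the
  -- quotient says where: at this place, the following one, the preceding one, or the partner across
  -- the edge of the dodecahedron.
  decode : ℕ → ℕ → ℕ
  decode p c = shift (c / 44) p * 44 + c % 44

  αₙ σₙ : ℕ → ℕ
  αₙ d = decode (place d) (at α-codes (slot d))
  σₙ d = decode (place d) (at σ-codes (slot d))

  vertex-code : ℕ → ℕ → ℕ
  vertex-code p 11 = 1320 + at crossings p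
  vertex-code p i = p * 11 + i

  tailₙ : ℕ → ℕ
  tailₙ d = vertex-code (place d) (at tail-codes (slot d))

  face-code : ℕ → ℕ → ℕ
  face-code p c = if c <ᵇ 10 then p * 10 + c
    else (if c <ᵇ 20 then preceding p * 10 + (c ∸ 10)
    else (if c ≡ᵇ 20 then 1212 + at blocks p
    else (if c ≡ᵇ 21 then 1212 + at blocks (following p) else 1200 + p / 10)))

  faceₙ : ℕ → ℕ
  faceₙ d = face-code (place d) (at face-codes (slot d))

  vertex-slots face-slots : List (List ℕ)
  vertex-slots = (0 ∷ 6 ∷ 10 ∷ 14 ∷ 18 ∷ 22 ∷ 26 ∷ 30 ∷ 34 ∷ 38 ∷ []) ∷ (41 ∷ []) ∷ []
  face-slots = (2 ∷ 1 ∷ 8 ∷ 12 ∷ 16 ∷ 20 ∷ 24 ∷ 28 ∷ 32 ∷ 36 ∷ []) ∷ []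

  dartₙ parentₙ sideₙ : ℕ → ℕ
  dartₙ v = if v <ᵇ 1320 then v / 11 * 44 + at vertex-slots (v % 11) else at crossing-places (v ∸ 1320) * 44 + 4
  parentₙ v = if v <ᵇ 1320
    then (if v % 11 ≡ᵇ 0 then v / 11 * 44 + at corner-parents (v / 11) else dartₙ v)
    else at crossing-parents (v ∸ 1320)
  sideₙ f = if f <ᵇ 1200 then f / 10 * 44 + at face-slots (f % 10)
    else (if f <ᵇ 1212 then (f ∸ 1200) * 440 + 40 else at block-places (f ∸ 1212) * 44)

  -- The orbits of `σ` have length 3 or 4, whence `period` 11.
  maze : Tables
  maze = record { #V = 1380 ; #D = 5280 ; #F = 1262 ; tailₙ = tailₙ ; αₙ = αₙ ; σₙ = σₙ ; faceₙ = faceₙ ; dartₙ = dartₙ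
    ; sideₙ = sideₙ ; parentₙ = parentₙ ; rootₙ = 1320 ; δ = 3 ; period = 11 ; longest = 20 ; height = 24 }

  abstract
    maze-ok : Numbering maze
    maze-ok = record
      { tail-bounded = refl ; α-bounded = refl ; σ-bounded = refl ; face-bounded = refl ; dart-bounded = refl
      ; parent-bounded = refl ; side-bounded = refl ; root-bounded = refl
      ; α-check = refl ; loop-check = refl ; σ-tail-check = refl ; period-check = refl ; σ-dart-check = refl
      ; dart-σ-check = refl ; φ-face-check = refl ; φ-side-check = refl ; dart-check = refl ; side-check = refl
      ; parent-check = refl ; up-check = refl ; multi-check = refl ; euler-check = refl }

  module Maze = Numbering maze-ok
  open Evasion maze-ok

  -- The rotations of the dodecahedron act on places; the four used here are
  -- given with their inverses.
  dartMove faceMove vertexMove : List (List ℕ) → ℕ → ℕ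
  dartMove t d = at t (place d) * 44 + slot d
  faceMove t f = if f <ᵇ 1200 then at t (f / 10) * 10 + f % 10
    else (if f <ᵇ 1212 then 1200 + at t ((f ∸ 1200) * 10) / 10
    else 1212 + at blocks (at t (at block-places (f ∸ 1212))))
  vertexMove t v = if v <ᵇ 1320 then at t (v / 11) * 11 + v % 11
    else 1320 + at crossings (at t (at crossing-places (v ∸ 1320)))

  abstract
    fits₀ : ∀ {d} → d < 5280 → dart-fits (dartMove turn₀) (dartMove unturn₀) (vertexMove turn₀) (faceMove unturn₀) d ≡ true
    fits₀ = below-sound 5280 (dart-fits (dartMove turn₀) (dartMove unturn₀) (vertexMove turn₀) (faceMove unturn₀)) refl
    vertices₀ : ∀ {v} → v < 1380 → vertexMove turn₀ v < 1380
    vertices₀ = bounded 1380 1380 (vertexMove turn₀) refl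
    faces₀ : ∀ {f} → f < 1262 → faceMove unturn₀ f < 1262
    faces₀ = bounded 1262 1262 (faceMove unturn₀) refl
    fits₁ : ∀ {d} → d < 5280 → dart-fits (dartMove turn₁) (dartMove unturn₁) (vertexMove turn₁) (faceMove unturn₁) d ≡ true
    fits₁ = below-sound 5280 (dart-fits (dartMove turn₁) (dartMove unturn₁) (vertexMove turn₁) (faceMove unturn₁)) refl
    vertices₁ : ∀ {v} → v < 1380 → vertexMove turn₁ v < 1380
    vertices₁ = bounded 1380 1380 (vertexMove turn₁) refl
    faces₁ : ∀ {f} → f < 1262 → faceMove unturn₁ f < 1262
    faces₁ = bounded 1262 1262 (faceMove unturn₁) refl
    fits₂ : ∀ {d} → d < 5280 → dart-fits (dartMove turn₂) (dartMove unturn₂) (vertexMove turn₂) (faceMove unturn₂) d ≡ true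
    fits₂ = below-sound 5280 (dart-fits (dartMove turn₂) (dartMove unturn₂) (vertexMove turn₂) (faceMove unturn₂)) refl
    vertices₂ : ∀ {v} → v < 1380 → vertexMove turn₂ v < 1380
    vertices₂ = bounded 1380 1380 (vertexMove turn₂) refl
    faces₂ : ∀ {f} → f < 1262 → faceMove unturn₂ f < 1262
    faces₂ = bounded 1262 1262 (faceMove unturn₂) refl
    fits₃ : ∀ {d} → d < 5280 → dart-fits (dartMove turn₃) (dartMove unturn₃) (vertexMove turn₃) (faceMove unturn₃) d ≡ true
    fits₃ = below-sound 5280 (dart-fits (dartMove turn₃) (dartMove unturn₃) (vertexMove turn₃) (faceMove unturn₃)) refl
    vertices₃ : ∀ {v} → v < 1380 → vertexMove turn₃ v < 1380
    vertices₃ = bounded 1380 1380 (vertexMove turn₃) refl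
    faces₃ : ∀ {f} → f < 1262 → faceMove unturn₃ f < 1262
    faces₃ = bounded 1262 1262 (faceMove unturn₃) refl

  turns : ℕ → Turn
  turns 0 = record { dartMove = dartMove turn₀ ; dartBack = dartMove unturn₀ ; vertexMove = vertexMove turn₀
    ; faceBack = faceMove unturn₀ ; dart-check = fits₀ ; vertex-check = vertices₀ ; face-check = faces₀ }
  turns 1 = record { dartMove = dartMove turn₁ ; dartBack = dartMove unturn₁ ; vertexMove = vertexMove turn₁
    ; faceBack = faceMove unturn₁ ; dart-check = fits₁ ; vertex-check = vertices₁ ; face-check = faces₁ }
  turns 2 = record { dartMove = dartMove turn₂ ; dartBack = dartMove unturn₂ ; vertexMove = vertexMove turn₂
    ; faceBack = faceMove unturn₂ ; dart-check = fits₂ ; vertex-check = vertices₂ ; face-check = faces₂ }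
  turns _ = record { dartMove = dartMove turn₃ ; dartBack = dartMove unturn₃ ; vertexMove = vertexMove turn₃
    ; faceBack = faceMove unturn₃ ; dart-check = fits₃ ; vertex-check = vertices₃ ; face-check = faces₃ }

  digit : ℕ → ℕ → ℕ
  digit zero n = n % 10
  digit (suc k) n = digit k (n / 10)

  -- The distance, cut off at 5, to the set Z of 31 faces whose occupation by at
  -- most three cops makes vertex 1321 a safe place to decide where to go next.
  distance : ℕ → ℕ
  distance f = if f <ᵇ 1200 then digit (f % 10) (at near-table (f / 10))
    else (if f <ᵇ 1212 then at cap-table (f ∸ 1200) else at block-table (f ∸ 1212))

  -- From 1321 the robber can move on to the image of 1321 under rotation 0 or 1
  -- in four steps, or turn back to that under rotation 2 in two.
  span : ℕ → ℕ
  span 2 = 1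
  span _ = 3

  steps : List (List ℕ)
  steps = (132 ∷ 92 ∷ 88 ∷ 48 ∷ []) ∷ (663 ∷ 665 ∷ 707 ∷ 709 ∷ []) ∷ (47 ∷ 49 ∷ []) ∷ []

  stepₙ : ℕ → ℕ → ℕ
  stepₙ o r = nth 0 (nth [] steps o) r

  abstract
    step-check : ∀ {o r} → o < 3 → r < suc (span o) → step-fits turns distance span stepₙ 1321 o r ≡ true
    step-check {o} o<3 = below-sound (suc (span o)) (step-fits turns distance span stepₙ 1321 o)
      (below-sound 3 (λ o → below (suc (span o)) (step-fits turns distance span stepₙ 1321 o)) refl o<3)
    near-check : ∀ {d} → d < 5280 → (distance (faceₙ d) ≤ᵇ suc (distance (faceₙ (αₙ d)))) ≡ true
    near-check = below-sound 5280 (λ d → distance (faceₙ d) ≤ᵇ suc (distance (faceₙ (αₙ d)))) refl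
    disperse-check : ∀ {f} → f < 1262 → disperses turns distance span stepₙ 1321 f ≡ true
    disperse-check = below-sound 1262 (disperses turns distance span stepₙ 1321) refl
    far-check : ∀ {f} → f < 1262 → far-apart turns distance span stepₙ 1321 f ≡ true
    far-check = below-sound 1262 (far-apart turns distance span stepₙ 1321) refl
    home-check : 1321 < 1380
    home-check = ℕₚ.<ᵇ⇒< 1321 1380 tt

  module Hunted = Fugitive turns distance span stepₙ 1321 step-check near-check disperse-check far-check home-check

  abstract
    maze-separated : Maze.separated 1320 ≡ true
    maze-separated = refl

  maze-Δ : MaxDegree Maze.graph 4
  maze-Δ = Maze.maxDegree Maze.root (trans (cong Maze.separated Maze.toℕ-root) maze-separated)

  six-needed : ∀ j → j < 6 → ¬ CopsWin Maze.graph j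
  six-needed j j<6 = Hunted.cops-lose (ℕₚ.+-monoˡ-≤ 6 j<6) (ℕₚ.≤-trans j<6 (ℕₚ.m≤n+m 6 2))

  six-tight : Σ PlaneGraph (λ G → MaxDegree G 4 × CopNumberIs G 6)
  six-tight = exactly-six Maze.graph maze-Δ six-needed

-- Plane maps on structured finite carriers.

module Surfaces where
  open ConnectedMaps
  open Forests

  -- A copy of `Connected` with arbitrary carriers. The large grids are then described by data types
  -- whose equations hold by case analysis, and the numbering is confined to three bijections.
  record Surface : Set₁ where
    field
      Vert Dart Face : Set
      #V #D #F  : ℕ
      verts     : Vert ↔ Fin #V
      darts     : Dart ↔ Fin #D
      faces     : Face ↔ Fin #F
      tail      : Dart → Vert
      α σ       : Dart → Dart
      face      : Dart → Face
      dart      : Vert → Dart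
      side      : Face → Dart
      tail-dart : ∀ v → tail (dart v) ≡ v
      face-side : ∀ f → face (side f) ≡ f
      α-invol   : ∀ d → α (α d) ≡ d
      σ-inj     : ∀ d e → σ d ≡ σ e → d ≡ e
      σ-tail    : ∀ d → tail (σ d) ≡ tail d
      σ-dart    : ∀ d → ∃[ n ] (iter σ n d ≡ dart (tail d))
      φ-face    : ∀ d → face (σ (α d)) ≡ face d
      φ-side    : ∀ d → ∃[ n ] (iter (λ e → σ (α e)) n d ≡ side (face d))
      root      : Vert

    Joined : Vert → Vert → Set
    Joined v w = ∃[ d ] (tail d ≡ v × tail (α d) ≡ w)

    field
      climbs    : ∀ v → Conn Joined v root
      euler     : 2 * (#V + #F) ≡ #D + 4
      no-loop   : ∀ d → tail (α d) ≢ tail d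
      no-multi  : ∀ d e → tail d ≡ tail e → tail (α d) ≡ tail (α e) → d ≡ e

    open Inverse verts public using () renaming (to to ⌜_⌝ᵛ; from to ⌞_⌟ᵛ; strictlyInverseˡ to ⌜⌞_⌟⌝ᵛ; strictlyInverseʳ to ⌞⌜_⌝⌟ᵛ)
    open Inverse darts public using () renaming (to to ⌜_⌝ᵈ; from to ⌞_⌟ᵈ; strictlyInverseˡ to ⌜⌞_⌟⌝ᵈ; strictlyInverseʳ to ⌞⌜_⌝⌟ᵈ)
    open Inverse faces public using () renaming (to to ⌜_⌝ᶠ; from to ⌞_⌟ᶠ; strictlyInverseˡ to ⌜⌞_⌟⌝ᶠ; strictlyInverseʳ to ⌞⌜_⌝⌟ᶠ)

    ⌜⌝ᵛ-inj : ∀ {v w} → ⌜ v ⌝ᵛ ≡ ⌜ w ⌝ᵛ → v ≡ w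
    ⌜⌝ᵛ-inj {v} {w} e = trans (sym (⌞⌜ v ⌝⌟ᵛ)) (trans (cong ⌞_⌟ᵛ e) (⌞⌜ w ⌝⌟ᵛ))
    ⌜⌝ᵈ-inj : ∀ {v w} → ⌜ v ⌝ᵈ ≡ ⌜ w ⌝ᵈ → v ≡ w
    ⌜⌝ᵈ-inj {v} {w} e = trans (sym (⌞⌜ v ⌝⌟ᵈ)) (trans (cong ⌞_⌟ᵈ e) (⌞⌜ w ⌝⌟ᵈ))
    ⌞⌟ᵈ-inj : ∀ {v w} → ⌞ v ⌟ᵈ ≡ ⌞ w ⌟ᵈ → v ≡ w
    ⌞⌟ᵈ-inj {v} {w} e = trans (sym (⌜⌞ v ⌟⌝ᵈ)) (trans (cong ⌜_⌝ᵈ e) (⌜⌞ w ⌟⌝ᵈ))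

    iter-⌜⌝ : ∀ (f : Dart → Dart) (g : Fin #D → Fin #D) → (∀ d → g d ≡ ⌜ f ⌞ d ⌟ᵈ ⌝ᵈ) →
              ∀ n d → iter g n d ≡ ⌜ iter f n ⌞ d ⌟ᵈ ⌝ᵈ
    iter-⌜⌝ f g e zero d = sym (⌜⌞ d ⌟⌝ᵈ)
    iter-⌜⌝ f g e (suc n) d = trans (cong g (iter-⌜⌝ f g e n d)) (trans (e _) (cong (λ x → ⌜ f x ⌝ᵈ) (⌞⌜ _ ⌝⌟ᵈ)))

    Encoded : Fin #V → Fin #V → Set
    Encoded v w = ∃[ d ] (⌜ tail ⌞ d ⌟ᵈ ⌝ᵛ ≡ v × ⌜ tail ⌞ ⌜ α ⌞ d ⌟ᵈ ⌝ᵈ ⌟ᵈ ⌝ᵛ ≡ w)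

    encode : ∀ {v w} → Joined v w → Encoded ⌜ v ⌝ᵛ ⌜ w ⌝ᵛ
    encode (d , refl , refl) = ⌜ d ⌝ᵈ , cong (λ x → ⌜ tail x ⌝ᵛ) (⌞⌜ d ⌝⌟ᵈ) ,
      cong (λ x → ⌜ tail x ⌝ᵛ) (trans (⌞⌜ _ ⌝⌟ᵈ) (cong α (⌞⌜ d ⌝⌟ᵈ)))

    Conn-encode : ∀ {v w} → Conn Joined v w → Conn Encoded ⌜ v ⌝ᵛ ⌜ w ⌝ᵛ
    Conn-encode here = here
    Conn-encode (fwd e c) = fwd (encode e) (Conn-encode c)
    Conn-encode (bwd e c) = bwd (encode e) (Conn-encode c)

    connected : Connected
    connected = record
      { V = #V ; D = #D ; F = #F
      ; tail = λ d → ⌜ tail ⌞ d ⌟ᵈ ⌝ᵛ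
      ; α = λ d → ⌜ α ⌞ d ⌟ᵈ ⌝ᵈ
      ; σ = λ d → ⌜ σ ⌞ d ⌟ᵈ ⌝ᵈ
      ; face = λ d → ⌜ face ⌞ d ⌟ᵈ ⌝ᶠ
      ; dart = λ v → ⌜ dart ⌞ v ⌟ᵛ ⌝ᵈ
      ; side = λ f → ⌜ side ⌞ f ⌟ᶠ ⌝ᵈ
      ; tail-dart = λ v → trans (cong ⌜_⌝ᵛ (trans (cong tail (⌞⌜ _ ⌝⌟ᵈ)) (tail-dart _))) (⌜⌞ v ⌟⌝ᵛ)
      ; face-side = λ f → trans (cong ⌜_⌝ᶠ (trans (cong face (⌞⌜ _ ⌝⌟ᵈ)) (face-side _))) (⌜⌞ f ⌟⌝ᶠ)
      ; α-invol = λ d → trans (cong ⌜_⌝ᵈ (trans (cong α (⌞⌜ _ ⌝⌟ᵈ)) (α-invol _))) (⌜⌞ d ⌟⌝ᵈ)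
      ; α-nofix = λ d e → no-loop ⌞ d ⌟ᵈ (cong tail (⌜⌝ᵈ-inj (trans e (sym (⌜⌞ d ⌟⌝ᵈ)))))
      ; σ-inj = λ d e q → ⌞⌟ᵈ-inj (σ-inj _ _ (⌜⌝ᵈ-inj q))
      ; σ-tail = λ d → cong ⌜_⌝ᵛ (trans (cong tail (⌞⌜ _ ⌝⌟ᵈ)) (σ-tail _))
      ; σ-dart = λ d → let (n , e) = σ-dart ⌞ d ⌟ᵈ in
          n , trans (iter-⌜⌝ σ _ (λ _ → refl) n d) (cong ⌜_⌝ᵈ (trans e (cong dart (sym (⌞⌜ _ ⌝⌟ᵛ)))))
      ; φ-face = λ d → cong ⌜_⌝ᶠ (trans (cong face (trans (⌞⌜ _ ⌝⌟ᵈ) (cong σ (⌞⌜ _ ⌝⌟ᵈ)))) (φ-face _))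
      ; φ-side = λ d → let (n , e) = φ-side ⌞ d ⌟ᵈ in
          n , trans (iter-⌜⌝ (λ x → σ (α x)) _ (λ x → cong (λ y → ⌜ σ y ⌝ᵈ) (⌞⌜ _ ⌝⌟ᵈ)) n d)
                (cong ⌜_⌝ᵈ (trans e (cong side (sym (⌞⌜ _ ⌝⌟ᶠ)))))
      ; root = ⌜ root ⌝ᵛ
      ; climbs = λ v → subst (λ x → Conn Encoded x ⌜ root ⌝ᵛ) (⌜⌞ v ⌟⌝ᵛ) (Conn-encode (climbs ⌞ v ⌟ᵛ))
      ; euler = euler
      ; no-loop = λ d e → no-loop ⌞ d ⌟ᵈ (trans (cong tail (sym (⌞⌜ _ ⌝⌟ᵈ))) (⌜⌝ᵛ-inj e))
      ; no-multi = λ d e p q → ⌞⌟ᵈ-inj (no-multi _ _ (⌜⌝ᵛ-inj p)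
          (trans (cong tail (sym (⌞⌜ _ ⌝⌟ᵈ))) (trans (⌜⌝ᵛ-inj q) (cong tail (⌞⌜ _ ⌝⌟ᵈ)))))
      }

    graph : PlaneGraph
    graph = Connected.graph connected

  module _ (S : Surface) where
    open Surface S
    open PlaneGraph graph using (degree)

    module _ {unσ : Dart → Dart} {m : ℕ} (unσ-σ : ∀ d → unσ (σ d) ≡ d)
             (nears : ∀ d → ∃[ k ] (k ≤ m × iter σ k d ≡ dart (tail d))) where

      degree≤ : ∀ v → degree v ≤ suc m
      degree≤ v = subst (degree v ≤_) (length-tabulate fan)
        (count-≤ (λ d → PlaneGraph.tail graph d ≟ v) {tabulate fan} λ {
          d refl → let (k , k≤m , e) = nears ⌞ d ⌟ᵈ in
            subst (_∈ tabulate fan) (trans (cong ⌜_⌝ᵈ (trans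
                (cong (λ x → iter unσ x (dart ⌞ v ⌟ᵛ)) (Finₚ.toℕ-fromℕ< (s≤s k≤m)))
                (trans (cong (iter unσ k) (trans (cong dart ⌞⌜ _ ⌝⌟ᵛ) (sym e))) (undo k _)))) (⌜⌞ d ⌟⌝ᵈ))
              (∈-tabulate⁺ {f = fan} (fromℕ< (s≤s k≤m))) })
        where
        fan : Fin (suc m) → Fin #D
        fan i = ⌜ iter unσ (toℕ i) (dart ⌞ v ⌟ᵛ) ⌝ᵈ
        undo : ∀ k d → iter unσ k (iter σ k d) ≡ d
        undo zero d = refl
        undo (suc k) d = trans (sym (shift k _)) (trans (cong (iter unσ k) (unσ-σ _)) (undo k d))
          where
          shift : ∀ k d → iter unσ k (unσ d) ≡ unσ (iter unσ k d)
          shift zero d = refl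
          shift (suc k) d = cong unσ (shift k d)

      star-maxDegree : ∀ v {star} → Unique star → (∀ {d} → d ∈ star → tail d ≡ v) → length star ≡ suc m → MaxDegree graph (suc m)
      star-maxDegree v {star} distinct ends size = degree≤ , ⌜ v ⌝ᵛ , ℕₚ.≤-antisym (degree≤ ⌜ v ⌝ᵛ)
        (subst (_≤ degree ⌜ v ⌝ᵛ) (trans (length-map ⌜_⌝ᵈ star) size)
          (count-≥ (λ d → PlaneGraph.tail graph d ≟ ⌜ v ⌝ᵛ) (map⁺ ⌜⌝ᵈ-inj distinct) λ m →
            let (d , d∈ , e) = ∈-map⁻ ⌜_⌝ᵈ m in
            trans (cong (λ x → ⌜ tail ⌞ x ⌟ᵈ ⌝ᵛ) e) (cong ⌜_⌝ᵛ (trans (cong tail (⌞⌜ d ⌝⌟ᵈ)) (ends d∈)))))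

-- One cell of the grid: a boundary of twelve edges around three rings.

module CellGadget where
  open import Data.Fin.Patterns
  open import Data.Vec using (lookup)

  Side : Set
  Side = Fin 4

  Spoke : Set
  Spoke = Fin 13

  after before : Spoke → Spoke
  after = lookup (1F ∷ 2F ∷ 3F ∷ 4F ∷ 5F ∷ 6F ∷ 7F ∷ 8F ∷ 9F ∷ (suc 9F) ∷ (suc (suc 9F)) ∷ (suc (suc (suc 9F))) ∷ 0F ∷ [])
  before = lookup ((suc (suc (suc 9F))) ∷ 0F ∷ 1F ∷ 2F ∷ 3F ∷ 4F ∷ 5F ∷ 6F ∷ 7F ∷ 8F ∷ 9F ∷ (suc 9F) ∷ (suc (suc 9F)) ∷ [])

  abstract
    before-after : ∀ q → before (after q) ≡ q
    before-after = toWitness {a? = Finₚ.all? λ q → before (after q) ≟ q} tt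
    after-before : ∀ q → after (before q) ≡ q
    after-before = toWitness {a? = Finₚ.all? λ q → after (before q) ≟ q} tt

  -- The darts of a cell.  Its boundary is a walk of twelve darts, three on each
  -- side; inside lie three concentric rings of 13 vertices joined by spokes.
  -- Level l has the spokes leading to ring l and the darts of ring l.
  data Slot : Set where
    road                       : Side → Fin 3 → Slot
    inward outward ahead back  : Fin 3 → Spoke → Slot

  data Place : Set where
    ring : Fin 3 → Spoke → Place
    rim  : Side → Fin 3 → Place

  data Region : Set where
    sector : Fin 3 → Spoke → Region
    centre : Region

  -- Where the spokes meet the boundary: every side carries two, one and no
  -- spokes at its first point, second point and final corner, except that the
  -- third side has one spoke at its final corner.
  foot : Spoke → Side × Fin 3
  foot 0F = 0F , 1F
  foot 1F = 0F , 1F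
  foot 2F = 0F , 2F
  foot 3F = 1F , 1F
  foot 4F = 1F , 1F
  foot 5F = 1F , 2F
  foot 6F = 2F , 1F
  foot 7F = 2F , 1F
  foot 8F = 2F , 2F
  foot 9F = 3F , 0F
  foot (suc 9F) = 3F , 1F
  foot (suc (suc 9F)) = 3F , 1F
  foot (suc (suc (suc 9F))) = 3F , 2F

  leave : Spoke → Slot
  leave 0F = inward 0F 1F
  leave 1F = road 0F 1F
  leave 2F = road 0F 2F
  leave 3F = inward 0F 4F
  leave 4F = road 1F 1F
  leave 5F = road 1F 2F
  leave 6F = inward 0F 7F
  leave 7F = road 2F 1F
  leave 8F = road 2F 2F
  leave 9F = road 3F 0F
  leave (suc 9F) = inward 0F (suc (suc 9F))
  leave (suc (suc 9F)) = road 3F 1F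
  leave (suc (suc (suc 9F))) = road 3F 2F

  enter : Side → Fin 3 → Slot
  enter 0F 0F = inward 0F 0F
  enter 0F 1F = inward 0F 2F
  enter 0F 2F = road 1F 0F
  enter 1F 0F = inward 0F 3F
  enter 1F 1F = inward 0F 5F
  enter 1F 2F = road 2F 0F
  enter 2F 0F = inward 0F 6F
  enter 2F 1F = inward 0F 8F
  enter 2F 2F = inward 0F 9F
  enter 3F 0F = inward 0F (suc 9F)
  enter 3F 1F = inward 0F (suc (suc (suc 9F)))
  enter 3F 2F = road 0F 0F

  φ : Slot → Slot
  φ (road s k) = enter s k
  φ (inward l q) = back l (before q)
  φ (back l q) = outward l q
  φ (outward 0F q) = leave q
  φ (outward (suc l) q) = ahead (inject₁ l) q
  φ (ahead 0F q) = inward 1F (after q)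
  φ (ahead 1F q) = inward 2F (after q)
  φ (ahead 2F q) = ahead 2F (after q)

  uninward : Spoke → Slot
  uninward 0F = road 0F 0F
  uninward 1F = outward 0F 0F
  uninward 2F = road 0F 1F
  uninward 3F = road 1F 0F
  uninward 4F = outward 0F 3F
  uninward 5F = road 1F 1F
  uninward 6F = road 2F 0F
  uninward 7F = outward 0F 6F
  uninward 8F = road 2F 1F
  uninward 9F = road 2F 2F
  uninward (suc 9F) = road 3F 0F
  uninward (suc (suc 9F)) = outward 0F (suc 9F)
  uninward (suc (suc (suc 9F))) = road 3F 1F

  unroad : Side → Fin 3 → Slot
  unroad 0F 0F = road 3F 2F
  unroad 0F 1F = outward 0F 1F
  unroad 0F 2F = outward 0F 2F
  unroad 1F 0F = road 0F 2F
  unroad 1F 1F = outward 0F 4F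
  unroad 1F 2F = outward 0F 5F
  unroad 2F 0F = road 1F 2F
  unroad 2F 1F = outward 0F 7F
  unroad 2F 2F = outward 0F 8F
  unroad 3F 0F = outward 0F 9F
  unroad 3F 1F = outward 0F (suc (suc 9F))
  unroad 3F 2F = outward 0F (suc (suc (suc 9F)))

  unφ : Slot → Slot
  unφ (road s k) = unroad s k
  unφ (inward 0F q) = uninward q
  unφ (inward (suc l) q) = ahead (inject₁ l) (before q)
  unφ (back l q) = inward l (after q)
  unφ (outward l q) = back l q
  unφ (ahead 0F q) = outward 1F q
  unφ (ahead 1F q) = outward 2F q
  unφ (ahead 2F q) = ahead 2F (before q)

  unφ-φ : ∀ m → unφ (φ m) ≡ m
  unφ-φ (road s k) = go s k
    where
    go : ∀ s k → unφ (enter s k) ≡ road s k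
    go 0F 0F = refl
    go 0F 1F = refl
    go 0F 2F = refl
    go 1F 0F = refl
    go 1F 1F = refl
    go 1F 2F = refl
    go 2F 0F = refl
    go 2F 1F = refl
    go 2F 2F = refl
    go 3F 0F = refl
    go 3F 1F = refl
    go 3F 2F = refl
  unφ-φ (inward l q) = cong (inward l) (after-before q)
  unφ-φ (back l q) = refl
  unφ-φ (outward 0F q) = go q
    where
    go : ∀ q → unφ (leave q) ≡ outward 0F q
    go 0F = refl
    go 1F = refl
    go 2F = refl
    go 3F = refl
    go 4F = refl
    go 5F = refl
    go 6F = refl
    go 7F = refl
    go 8F = refl
    go 9F = refl
    go (suc 9F) = refl
    go (suc (suc 9F)) = refl
    go (suc (suc (suc 9F))) = refl
  unφ-φ (outward 1F q) = refl
  unφ-φ (outward 2F q) = refl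
  unφ-φ (ahead 0F q) = cong (ahead 0F) (before-after q)
  unφ-φ (ahead 1F q) = cong (ahead 1F) (before-after q)
  unφ-φ (ahead 2F q) = cong (ahead 2F) (before-after q)

  start : Slot → Place
  start (road s k) = rim s k
  start (inward 0F q) = rim (proj₁ (foot q)) (proj₂ (foot q))
  start (inward (suc l) q) = ring (inject₁ l) q
  start (outward l q) = ring l q
  start (ahead l q) = ring l q
  start (back l q) = ring l (after q)

  turn : Side → Side
  turn 0F = 1F
  turn 1F = 2F
  turn 2F = 3F
  turn 3F = 0F

  end : Slot → Place
  end (road s 0F) = rim s 1F
  end (road s 1F) = rim s 2F
  end (road s 2F) = rim (turn s) 0F
  end (inward l q) = ring l q
  end (outward 0F q) = rim (proj₁ (foot q)) (proj₂ (foot q))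
  end (outward (suc l) q) = ring (inject₁ l) q
  end (ahead l q) = ring l (after q)
  end (back l q) = ring l q

  start-φ : ∀ m → start (φ m) ≡ end m
  start-φ (road s k) = go s k
    where
    go : ∀ s k → start (enter s k) ≡ end (road s k)
    go 0F 0F = refl
    go 0F 1F = refl
    go 0F 2F = refl
    go 1F 0F = refl
    go 1F 1F = refl
    go 1F 2F = refl
    go 2F 0F = refl
    go 2F 1F = refl
    go 2F 2F = refl
    go 3F 0F = refl
    go 3F 1F = refl
    go 3F 2F = refl
  start-φ (inward l q) = cong (ring l) (after-before q)
  start-φ (back l q) = refl
  start-φ (outward 0F q) = go q
    where
    go : ∀ q → start (leave q) ≡ end (outward 0F q)
    go 0F = refl
    go 1F = refl
    go 2F = refl
    go 3F = refl
    go 4F = refl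
    go 5F = refl
    go 6F = refl
    go 7F = refl
    go 8F = refl
    go 9F = refl
    go (suc 9F) = refl
    go (suc (suc 9F)) = refl
    go (suc (suc (suc 9F))) = refl
  start-φ (outward 1F q) = refl
  start-φ (outward 2F q) = refl
  start-φ (ahead 0F q) = refl
  start-φ (ahead 1F q) = refl
  start-φ (ahead 2F q) = refl

  -- The outermost sector along a boundary dart. The sectors 0, 3, 6 and 10 do not occur: they lie
  -- between two spokes that share a foot and so meet the boundary in a single point.
  kerb : Side → Fin 3 → Spoke
  kerb 0F 0F = (suc (suc (suc 9F)))
  kerb 0F 1F = 1F
  kerb 0F 2F = 2F
  kerb 1F 0F = 2F
  kerb 1F 1F = 4F
  kerb 1F 2F = 5F
  kerb 2F 0F = 5F
  kerb 2F 1F = 7F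
  kerb 2F 2F = 8F
  kerb 3F 0F = 9F
  kerb 3F 1F = (suc (suc 9F))
  kerb 3F 2F = (suc (suc (suc 9F)))

  region : Slot → Region
  region (road s k) = sector 0F (kerb s k)
  region (inward l q) = sector l (before q)
  region (outward l q) = sector l q
  region (back l q) = sector l q
  region (ahead 0F q) = sector 1F q
  region (ahead 1F q) = sector 2F q
  region (ahead 2F q) = centre

  region-φ : ∀ m → region (φ m) ≡ region m
  region-φ (road s k) = go s k
    where
    go : ∀ s k → region (enter s k) ≡ region (road s k)
    go 0F 0F = refl
    go 0F 1F = refl
    go 0F 2F = refl
    go 1F 0F = refl
    go 1F 1F = refl
    go 1F 2F = refl
    go 2F 0F = refl
    go 2F 1F = refl
    go 2F 2F = refl
    go 3F 0F = refl
    go 3F 1F = refl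
    go 3F 2F = refl
  region-φ (inward l q) = refl
  region-φ (back l q) = refl
  region-φ (outward 0F q) = go q
    where
    go : ∀ q → region (leave q) ≡ region (outward 0F q)
    go 0F = refl
    go 1F = refl
    go 2F = refl
    go 3F = refl
    go 4F = refl
    go 5F = refl
    go 6F = refl
    go 7F = refl
    go 8F = refl
    go 9F = refl
    go (suc 9F) = refl
    go (suc (suc 9F)) = refl
    go (suc (suc (suc 9F))) = refl
  region-φ (outward 1F q) = refl
  region-φ (outward 2F q) = refl
  region-φ (ahead 0F q) = cong (sector 1F) (before-after q)
  region-φ (ahead 1F q) = cong (sector 2F) (before-after q)
  region-φ (ahead 2F q) = refl

  border : Region → Slot
  border (sector l q) = back l q
  border centre = ahead 2F 0F

  region-border : ∀ f → region (border f) ≡ f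
  region-border (sector l q) = refl
  region-border centre = refl

  φ-border : ∀ m → ∃[ n ] (iter φ n m ≡ border (region m))
  φ-border (back l q) = 0 , refl
  φ-border (inward l q) = 1 , refl
  φ-border (outward 0F q) = go q
    where
    go : ∀ q → ∃[ n ] (iter φ n (outward 0F q) ≡ back 0F q)
    go 0F = 2 , refl
    go 1F = 3 , refl
    go 2F = 4 , refl
    go 3F = 2 , refl
    go 4F = 3 , refl
    go 5F = 4 , refl
    go 6F = 2 , refl
    go 7F = 3 , refl
    go 8F = 3 , refl
    go 9F = 3 , refl
    go (suc 9F) = 2 , refl
    go (suc (suc 9F)) = 3 , refl
    go (suc (suc (suc 9F))) = 4 , refl
  φ-border (outward 1F q) = 3 , cong (back 1F) (before-after q)
  φ-border (outward 2F q) = 3 , cong (back 2F) (before-after q)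
  φ-border (ahead 0F q) = 2 , cong (back 1F) (before-after q)
  φ-border (ahead 1F q) = 2 , cong (back 2F) (before-after q)
  φ-border (ahead 2F q) = go q
    where
    go : ∀ q → ∃[ n ] (iter φ n (ahead 2F q) ≡ ahead 2F 0F)
    go 0F = 0 , refl
    go 1F = 12 , refl
    go 2F = 11 , refl
    go 3F = 10 , refl
    go 4F = 9 , refl
    go 5F = 8 , refl
    go 6F = 7 , refl
    go 7F = 6 , refl
    go 8F = 5 , refl
    go 9F = 4 , refl
    go (suc 9F) = 3 , refl
    go (suc (suc 9F)) = 2 , refl
    go (suc (suc (suc 9F))) = 1 , refl
  φ-border (road s k) = go s k
    where
    go : ∀ s k → ∃[ n ] (iter φ n (road s k) ≡ back 0F (kerb s k))
    go 0F 0F = 2 , refl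
    go 0F 1F = 2 , refl
    go 0F 2F = 3 , refl
    go 1F 0F = 2 , refl
    go 1F 1F = 2 , refl
    go 1F 2F = 3 , refl
    go 2F 0F = 2 , refl
    go 2F 1F = 2 , refl
    go 2F 2F = 2 , refl
    go 3F 0F = 2 , refl
    go 3F 1F = 2 , refl
    go 3F 2F = 3 , refl

  slots : Slot ↔ Fin (4 * 3 + 4 * (3 * 13))
  slots = ↔-trans split (↔-trans (↔-sym Finₚ.*↔× ⊎-↔ ↔-trans (four ×-↔ ↔-sym Finₚ.*↔×) (↔-sym Finₚ.*↔×)) (↔-sym Finₚ.+↔⊎))
    where
    four : Fin 4 ↔ Fin 4
    four = mk↔ₛ′ (λ x → x) (λ x → x) (λ _ → refl) (λ _ → refl)
    split : Slot ↔ ((Side × Fin 3) ⊎ (Fin 4 × (Fin 3 × Spoke)))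
    split = mk↔ₛ′
      (λ { (road s k) → inj₁ (s , k) ; (inward l q) → inj₂ (0F , l , q) ; (outward l q) → inj₂ (1F , l , q)
         ; (ahead l q) → inj₂ (2F , l , q) ; (back l q) → inj₂ (3F , l , q) })
      (λ { (inj₁ (s , k)) → road s k ; (inj₂ (0F , l , q)) → inward l q ; (inj₂ (1F , l , q)) → outward l q
         ; (inj₂ (2F , l , q)) → ahead l q ; (inj₂ (3F , l , q)) → back l q })
      (λ { (inj₁ (s , k)) → refl ; (inj₂ (0F , l , q)) → refl ; (inj₂ (1F , l , q)) → refl
         ; (inj₂ (2F , l , q)) → refl ; (inj₂ (3F , l , q)) → refl })
      (λ { (road s k) → refl ; (inward l q) → refl ; (outward l q) → refl ; (ahead l q) → refl ; (back l q) → refl })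

  regions : Region ↔ Fin (3 * 13 + 1)
  regions = ↔-trans split (↔-trans (↔-sym Finₚ.*↔× ⊎-↔ one) (↔-sym Finₚ.+↔⊎))
    where
    one : Fin 1 ↔ Fin 1
    one = mk↔ₛ′ (λ x → x) (λ x → x) (λ _ → refl) (λ _ → refl)
    split : Region ↔ ((Fin 3 × Spoke) ⊎ Fin 1)
    split = mk↔ₛ′ (λ { (sector l q) → inj₁ (l , q) ; centre → inj₂ 0F }) (λ { (inj₁ (l , q)) → sector l q ; (inj₂ 0F) → centre })
      (λ { (inj₁ (l , q)) → refl ; (inj₂ 0F) → refl }) (λ { (sector l q) → refl ; centre → refl })

-- A sphere of cells, obtained by folding a square.

module FoldedGrid where
  open Surfaces
  open CellGadget
  open import Data.Fin.Patterns

  -- A coordinate together with its distance from the far side.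
  record Pos (n : ℕ) : Set where
    constructor pos
    field
      lo hi : ℕ
      .total : lo + hi ≡ n
  open Pos public

  pos-≡ : ∀ {n} (p q : Pos n) → lo p ≡ lo q → p ≡ q
  pos-≡ (pos a x e) (pos .a y f) refl with recompute (x ℕₚ.≟ y) (ℕₚ.+-cancelˡ-≡ a x y (trans e (sym f)))
  ... | refl = refl

  .up : ∀ {n} a b → a + suc b ≡ n → suc a + b ≡ n
  up a b e = trans (sym (ℕₚ.+-suc a b)) e

  .down : ∀ {n} a b → suc a + b ≡ n → a + suc b ≡ n
  down a b e = trans (ℕₚ.+-suc a b) e

  positions : ∀ n → Pos n ↔ Fin (suc n)
  positions n = mk↔ₛ′ (λ p → fromℕ< (bound p)) (λ i → pos (toℕ i) (n ∸ toℕ i) (ℕₚ.m+[n∸m]≡n (ℕₚ.≤-pred (Finₚ.toℕ<n i))))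
    (λ i → Finₚ.toℕ-injective (Finₚ.toℕ-fromℕ< _)) (λ p → pos-≡ _ p (Finₚ.toℕ-fromℕ< (bound p)))
    where
    bound : ∀ (p : Pos n) → lo p < suc n
    bound (pos a b e) = recompute (a ℕₚ.<? suc n) (s≤s (subst (a ≤_) e (ℕₚ.m≤m+n a b)))

  -- A square of cells, folded along its diagonal: the boundary of the square is
  -- glued to itself by transposing cells.  Sides 0, 1, 2, 3 of the cell (a , b)
  -- face the cells (a , b - 1), (a + 1 , b), (a , b + 1), (a - 1 , b).
  module _ {n : ℕ} where

    Cell : Set
    Cell = Pos n × Pos n

    step : Side → Cell → Cell × Side
    step 0F (a , pos zero b′ e) = (pos zero b′ e , a) , 3F
    step 0F (a , pos (suc b) b′ e) = (a , pos b (suc b′) (down b b′ e)) , 2F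
    step 1F (pos a zero e , b) = (b , pos a zero e) , 2F
    step 1F (pos a (suc a′) e , b) = (pos (suc a) a′ (up a a′ e) , b) , 3F
    step 2F (a , pos b zero e) = (pos b zero e , a) , 1F
    step 2F (a , pos b (suc b′) e) = (a , pos (suc b) b′ (up b b′ e)) , 0F
    step 3F (pos zero a′ e , b) = (b , pos zero a′ e) , 0F
    step 3F (pos (suc a) a′ e , b) = (pos a (suc a′) (down a a′ e) , b) , 1F

    cross : Cell × Side → Cell × Side
    cross (c , s) = step s c

    cross-invol : ∀ x → cross (cross x) ≡ x
    cross-invol ((a , pos zero b′ e) , 0F) = refl
    cross-invol ((a , pos (suc b) b′ e) , 0F) = refl
    cross-invol ((pos a zero e , b) , 1F) = refl
    cross-invol ((pos a (suc a′) e , b) , 1F) = refl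
    cross-invol ((a , pos b zero e) , 2F) = refl
    cross-invol ((a , pos b (suc b′) e) , 2F) = refl
    cross-invol ((pos zero a′ e , b) , 3F) = refl
    cross-invol ((pos (suc a) a′ e , b) , 3F) = refl

    cross-side : ∀ x → proj₂ (cross x) ≢ proj₂ x
    cross-side ((a , pos zero b′ e) , 0F) ()
    cross-side ((a , pos (suc b) b′ e) , 0F) ()
    cross-side ((pos a zero e , b) , 1F) ()
    cross-side ((pos a (suc a′) e , b) , 1F) ()
    cross-side ((a , pos b zero e) , 2F) ()
    cross-side ((a , pos b (suc b′) e) , 2F) ()
    cross-side ((pos zero a′ e , b) , 3F) ()
    cross-side ((pos (suc a) a′ e , b) , 3F) ()

    -- The corner between sides 2 and 3 and the first point of each side belong to
    -- the cell; the only corners of the folded square left over are west and east.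
    data Vert : Set where
      inner     : Cell → Fin 3 → Spoke → Vert
      mid       : Cell × Side → Vert
      node      : Cell → Vert
      west east : Vert

    -- The corners at which the sides 0, 1 and 2 begin, each traced through neighbouring cells to
    -- the cell that owns it.
    nodeW nodeN nodeE : Cell → Vert
    nodeW (a , pos (suc b) b′ e) = node (a , pos b (suc b′) (down b b′ e))
    nodeW (pos zero _ _ , pos zero _ _) = west
    nodeW (pos (suc a) a′ e , pos zero b′ f) = node (pos zero b′ f , pos a (suc a′) (down a a′ e))
    nodeN (pos a zero e , b) = node (b , pos a zero e)
    nodeN (pos a (suc a′) e , b) = nodeW (pos (suc a) a′ (up a a′ e) , b)
    nodeE (a , pos b (suc b′) e) = nodeN (a , pos (suc b) b′ (up b b′ e))
    nodeE (pos a (suc a′) e , pos b zero f) = node (pos (suc a) a′ (up a a′ e) , pos b zero f)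
    nodeE (pos a zero e , pos b zero f) = east

    nodeOf : Cell → Side → Vert
    nodeOf c 0F = nodeW c
    nodeOf c 1F = nodeN c
    nodeOf c 2F = nodeE c
    nodeOf c 3F = node c

    node-turn : ∀ c s → nodeOf (proj₁ (cross (c , s))) (turn (proj₂ (cross (c , s)))) ≡ nodeOf c s
    node-turn (pos zero a′ e , pos zero b′ f) 0F = refl
    node-turn (pos (suc a) a′ e , pos zero b′ f) 0F = refl
    node-turn (a , pos (suc b) b′ e) 0F = refl
    node-turn (pos a zero e , b) 1F = refl
    node-turn (pos a (suc a′) e , b) 1F = refl
    node-turn (a , pos b (suc b′) e) 2F = refl
    node-turn (pos a (suc a′) e , pos b zero f) 2F = refl
    node-turn (pos a zero e , pos b zero f) 2F = refl
    node-turn (pos zero a′ e , pos b zero f) 3F = refl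
    node-turn (pos zero a′ e , pos b (suc b′) f) 3F = refl
    node-turn (pos (suc a) a′ e , pos b zero f) 3F = refl
    node-turn (pos (suc a) a′ e , pos b (suc b′) f) 3F = refl

    at : Cell → Place → Vert
    at c (ring l q) = inner c l q
    at c (rim s 0F) = nodeOf c s
    at c (rim s 1F) = mid (c , s)
    at c (rim s 2F) = mid (cross (c , s))

    Dart : Set
    Dart = Cell × Slot

    tail : Dart → Vert
    tail (c , m) = at c (start m)

    α : Dart → Dart
    α (c , road s k) = proj₁ (cross (c , s)) , road (proj₂ (cross (c , s))) (opposite k)
    α (c , inward l q) = c , outward l q
    α (c , outward l q) = c , inward l q
    α (c , ahead l q) = c , back l q
    α (c , back l q) = c , ahead l q

    σ unσ : Dart → Dart
    σ d = proj₁ (α d) , φ (proj₂ (α d))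
    unσ (c , m) = α (c , unφ m)

    α-invol : ∀ d → α (α d) ≡ d
    α-invol (c , road s k) = cong₂ (λ x j → proj₁ x , road (proj₂ x) j) (cross-invol (c , s)) (Finₚ.opposite-involutive k)
    α-invol (c , inward l q) = refl
    α-invol (c , outward l q) = refl
    α-invol (c , ahead l q) = refl
    α-invol (c , back l q) = refl

    unσ-σ : ∀ d → unσ (σ d) ≡ d
    unσ-σ d = trans (cong (λ m → α (proj₁ (α d) , m)) (unφ-φ (proj₂ (α d)))) (α-invol d)

    head : ∀ c m → tail (α (c , m)) ≡ at c (end m)
    head c (road s 0F) = cong mid (cross-invol (c , s))
    head c (road s 1F) = refl
    head c (road s 2F) = trans (sym (node-turn (proj₁ (cross (c , s))) (proj₂ (cross (c , s))))) (cong (λ x → nodeOf (proj₁ x) (turn (proj₂ x))) (cross-invol (c , s)))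
    head c (inward l q) = refl
    head c (outward 0F q) = refl
    head c (outward 1F q) = refl
    head c (outward 2F q) = refl
    head c (ahead l q) = refl
    head c (back l q) = refl

    σ-tail : ∀ d → tail (σ d) ≡ tail d
    σ-tail d = trans (cong (at (proj₁ (α d))) (start-φ (proj₂ (α d)))) (trans (sym (head (proj₁ (α d)) (proj₂ (α d)))) (cong tail (α-invol d)))

    face : Dart → Cell × Region
    face (c , m) = c , region m

    side : Cell × Region → Dart
    side (c , f) = c , border f

    φ-cell : ∀ d → σ (α d) ≡ (proj₁ d , φ (proj₂ d))
    φ-cell d = cong (λ x → proj₁ x , φ (proj₂ x)) (α-invol d)

    φ-side : ∀ d → ∃[ k ] (iter (λ e → σ (α e)) k d ≡ side (face d))
    φ-side (c , m) with φ-border m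
    ... | k , e = k , trans (go k) (cong (c ,_) e)
      where
      go : ∀ k → iter (λ e → σ (α e)) k (c , m) ≡ (c , iter φ k m)
      go zero = refl
      go (suc k) = trans (cong (λ x → σ (α x)) (go k)) (φ-cell (c , iter φ k m))

    low high : Pos n
    low = pos 0 n refl
    high = pos n 0 (ℕₚ.+-identityʳ n)

    dart : Vert → Dart
    dart (inner c l q) = c , outward l q
    dart (mid (c , s)) = c , road s 1F
    dart (node c) = c , road 3F 0F
    dart west = (low , low) , road 0F 0F
    dart east = (high , high) , road 2F 0F

    -- The bound 4 serves twice: it makes `σ` transitive around a vertex and limits the degree to 5.
    Nears : Dart → Set
    Nears d = ∃[ k ] (k ≤ 4 × iter σ k d ≡ dart (tail d))

    leave-mid : ∀ c s → iter σ 2 (c , φ (road s 0F)) ≡ (c , road s 1F)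
    leave-mid c 0F = refl
    leave-mid c 1F = refl
    leave-mid c 2F = refl
    leave-mid c 3F = refl

    pattern 4≥0 = z≤n
    pattern 4≥1 = s≤s z≤n
    pattern 4≥2 = s≤s (s≤s z≤n)
    pattern 4≥3 = s≤s (s≤s (s≤s z≤n))
    pattern 4≥4 = s≤s (s≤s (s≤s (s≤s z≤n)))

    iter-σ : ∀ k d → iter σ k (σ d) ≡ σ (iter σ k d)
    iter-σ zero d = refl
    iter-σ (suc k) d = cong σ (iter-σ k d)

    nears-second : ∀ c s → iter σ 3 (c , road s 2F) ≡ dart (mid (cross (c , s)))
    nears-second c s = trans (sym (iter-σ 2 (c , road s 2F))) (leave-mid _ _)

    nears-node : ∀ c s → Nears (c , road s 0F)
    nears-node (pos zero a′ e , pos zero b′ f) 0F = 0 , 4≥0 , cong₂ (λ x y → (x , y) , road 0F 0F) (pos-≡ _ low refl) (pos-≡ _ low refl)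
    nears-node (pos (suc a) a′ e , pos zero b′ f) 0F = 3 , 4≥3 , refl
    nears-node (a , pos (suc b) b′ e) 0F = 2 , 4≥2 , refl
    nears-node (pos a zero e , b) 1F = 2 , 4≥2 , refl
    nears-node (pos a (suc a′) e , pos zero b′ f) 1F = 4 , 4≥4 , refl
    nears-node (pos a (suc a′) e , pos (suc b) b′ f) 1F = 3 , 4≥3 , refl
    nears-node (pos a zero e , pos b (suc b′) f) 2F = 3 , 4≥3 , refl
    nears-node (pos a (suc a′) e , pos b (suc b′) f) 2F = 4 , 4≥4 , refl
    nears-node (pos a (suc a′) e , pos b zero f) 2F = 4 , 4≥4 , refl
    nears-node (pos a zero e , pos b zero f) 2F = 0 , 4≥0 , cong₂ (λ x y → (x , y) , road 2F 0F) (top a e) (top b f)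
      where
      top : ∀ a .(e : a + 0 ≡ n) → pos a 0 e ≡ high
      top a e = pos-≡ _ high (recompute (a ℕₚ.≟ n) (trans (sym (ℕₚ.+-identityʳ a)) e))
    nears-node c 3F = 0 , 4≥0 , refl

    nears : ∀ d → Nears d
    nears (c , road s 0F) = nears-node c s
    nears (c , road s 1F) = 0 , 4≥0 , refl
    nears (c , road s 2F) = 3 , 4≥3 , nears-second c s
    nears (c , outward l q) = 0 , 4≥0 , refl
    nears (c , ahead l q) = 1 , 4≥1 , refl
    nears (c , back 0F q) = 3 , 4≥3 , refl
    nears (c , back 1F q) = 3 , 4≥3 , refl
    nears (c , back 2F q) = 2 , 4≥2 , refl
    nears (c , inward 1F q) = 2 , 4≥2 , refl
    nears (c , inward 2F q) = 2 , 4≥2 , refl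
    nears (c , inward 0F q) = go q
      where
      via : ∀ q s → σ (c , inward 0F q) ≡ (c , road s 2F) → iter σ 4 (c , inward 0F q) ≡ dart (mid (cross (c , s)))
      via q s e = trans (sym (iter-σ 3 (c , inward 0F q))) (trans (cong (iter σ 3) e) (nears-second c s))
      go : ∀ q → Nears (c , inward 0F q)
      go 0F = 2 , 4≥2 , refl
      go 1F = 1 , 4≥1 , refl
      go 2F = 4 , 4≥4 , via 2F 0F refl
      go 3F = 2 , 4≥2 , refl
      go 4F = 1 , 4≥1 , refl
      go 5F = 4 , 4≥4 , via 5F 1F refl
      go 6F = 2 , 4≥2 , refl
      go 7F = 1 , 4≥1 , refl
      go 8F = 4 , 4≥4 , via 8F 2F refl
      go 9F = 1 , 4≥1 , refl
      go (suc 9F) = 2 , 4≥2 , refl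
      go (suc (suc 9F)) = 1 , 4≥1 , refl
      go (suc (suc (suc 9F))) = 4 , 4≥4 , via (suc (suc (suc 9F))) 3F refl

    tail-dart : ∀ v → tail (dart v) ≡ v
    tail-dart (inner c l q) = refl
    tail-dart (mid (c , s)) = refl
    tail-dart (node c) = refl
    tail-dart west = refl
    tail-dart east = lemma n (ℕₚ.+-identityʳ n)
      where
      lemma : ∀ a .(e : a + 0 ≡ n) → nodeE (pos a 0 e , pos a 0 e) ≡ east
      lemma a e = refl

    data Nodal : Vert → Set where
      nodal : ∀ {c} → Nodal (node c)
      western : Nodal west
      eastern : Nodal east

    nodeW-nodal : ∀ c → Nodal (nodeW c)
    nodeW-nodal (a , pos (suc b) b′ e) = nodal
    nodeW-nodal (pos zero a′ e , pos zero b′ f) = western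
    nodeW-nodal (pos (suc a) a′ e , pos zero b′ f) = nodal

    nodeN-nodal : ∀ c → Nodal (nodeN c)
    nodeN-nodal (pos a zero e , b) = nodal
    nodeN-nodal (pos a (suc a′) e , b) = nodeW-nodal (pos (suc a) a′ (up a a′ e) , b)

    nodeE-nodal : ∀ c → Nodal (nodeE c)
    nodeE-nodal (a , pos b (suc b′) f) = nodeN-nodal (a , pos (suc b) b′ (up b b′ f))
    nodeE-nodal (pos a (suc a′) e , pos b zero f) = nodal
    nodeE-nodal (pos a zero e , pos b zero f) = eastern

    nodeOf-nodal : ∀ c s → Nodal (nodeOf c s)
    nodeOf-nodal c 0F = nodeW-nodal c
    nodeOf-nodal c 1F = nodeN-nodal c
    nodeOf-nodal c 2F = nodeE-nodal c
    nodeOf-nodal c 3F = nodal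

    -- Recovers a dart from its two ends; this is why the graph is simple.
    ringDart : Fin 3 → Spoke → Fin 3 → Spoke → Slot
    ringDart 0F q 1F _ = inward 1F q
    ringDart 1F q 2F _ = inward 2F q
    ringDart 1F q 0F _ = outward 1F q
    ringDart 2F q 1F _ = outward 2F q
    ringDart l q _ q′ with q′ ≟ after q
    ... | yes _ = ahead l q
    ... | no _  = back l q′

    between : Vert → Vert → Dart
    between (inner c l q) (inner _ l′ q′) = c , ringDart l q l′ q′
    between (inner c l q) _ = c , outward l q
    between _ (inner c l q) = c , inward l q
    between (mid (c , s)) (mid _) = c , road s 1F
    between (mid x) _ = proj₁ (cross x) , road (proj₂ (cross x)) 2F
    between _ (mid (c , s)) = c , road s 0F
    between _ _ = (low , low) , road 0F 0F

    after²≢ : ∀ q → q ≢ after (after q)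
    after²≢ = toWitness {a? = Finₚ.all? λ q → ¬? (q ≟ after (after q))} tt

    after≢ : ∀ q → after q ≢ q
    after≢ = toWitness {a? = Finₚ.all? λ q → ¬? (after q ≟ q)} tt

    ringDart-ahead : ∀ l q → ringDart l q l (after q) ≡ ahead l q
    ringDart-ahead 0F q with after q ≟ after q
    ... | yes _ = refl
    ... | no ne = ⊥-elim (ne refl)
    ringDart-ahead 1F q with after q ≟ after q
    ... | yes _ = refl
    ... | no ne = ⊥-elim (ne refl)
    ringDart-ahead 2F q with after q ≟ after q
    ... | yes _ = refl
    ... | no ne = ⊥-elim (ne refl)

    ringDart-back : ∀ l q → ringDart l (after q) l q ≡ back l q
    ringDart-back 0F q with q ≟ after (after q)
    ... | yes e = ⊥-elim (after²≢ q e)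
    ... | no _ = refl
    ringDart-back 1F q with q ≟ after (after q)
    ... | yes e = ⊥-elim (after²≢ q e)
    ... | no _ = refl
    ringDart-back 2F q with q ≟ after (after q)
    ... | yes e = ⊥-elim (after²≢ q e)
    ... | no _ = refl

    between-ends : ∀ c m → between (at c (start m)) (at c (end m)) ≡ (c , m)
    between-ends c (road s 0F) with nodeOf c s | nodeOf-nodal c s
    ... | _ | nodal = refl
    ... | _ | western = refl
    ... | _ | eastern = refl
    between-ends c (road s 1F) = refl
    between-ends c (road s 2F) with nodeOf c (turn s) | nodeOf-nodal c (turn s)
    ... | _ | nodal = cong (λ x → proj₁ x , road (proj₂ x) 2F) (cross-invol (c , s))
    ... | _ | western = cong (λ x → proj₁ x , road (proj₂ x) 2F) (cross-invol (c , s))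
    ... | _ | eastern = cong (λ x → proj₁ x , road (proj₂ x) 2F) (cross-invol (c , s))
    between-ends c (inward 0F q) = go (proj₁ (foot q)) (proj₂ (foot q))
      where
      go : ∀ s k → between (at c (rim s k)) (inner c 0F q) ≡ (c , inward 0F q)
      go s 0F with nodeOf c s | nodeOf-nodal c s
      ... | _ | nodal = refl
      ... | _ | western = refl
      ... | _ | eastern = refl
      go s 1F = refl
      go s 2F = refl
    between-ends c (inward 1F q) = refl
    between-ends c (inward 2F q) = refl
    between-ends c (outward 0F q) = go (proj₁ (foot q)) (proj₂ (foot q))
      where
      go : ∀ s k → between (inner c 0F q) (at c (rim s k)) ≡ (c , outward 0F q)
      go s 0F with nodeOf c s | nodeOf-nodal c s
      ... | _ | nodal = refl
      ... | _ | western = refl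
      ... | _ | eastern = refl
      go s 1F = refl
      go s 2F = refl
    between-ends c (outward 1F q) = refl
    between-ends c (outward 2F q) = refl
    between-ends c (ahead l q) = cong (c ,_) (ringDart-ahead l q)
    between-ends c (back l q) = cong (c ,_) (ringDart-back l q)

    between-tail-head : ∀ d → between (tail d) (tail (α d)) ≡ d
    between-tail-head (c , m) = trans (cong (between _) (head c m)) (between-ends c m)

    no-loop : ∀ d → tail (α d) ≢ tail d
    no-loop (c , m) e = go m (trans (sym (head c m)) e)
      where
      go : ∀ m → at c (end m) ≢ at c (start m)
      go (road s 0F) e with nodeOf c s | nodeOf-nodal c s | e
      ... | _ | nodal | ()
      ... | _ | western | ()
      ... | _ | eastern | ()
      go (road s 1F) e = cross-side (c , s) (cong proj₂ (mid-inj e))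
        where
        mid-inj : ∀ {x y} → mid x ≡ mid y → x ≡ y
        mid-inj refl = refl
      go (road s 2F) e with nodeOf c (turn s) | nodeOf-nodal c (turn s) | e
      ... | _ | nodal | ()
      ... | _ | western | ()
      ... | _ | eastern | ()
      go (inward 0F q) e = off (proj₁ (foot q)) (proj₂ (foot q)) (sym e)
        where
        off : ∀ s k → at c (rim s k) ≢ inner c 0F q
        off s 0F e with nodeOf c s | nodeOf-nodal c s | e
        ... | _ | nodal | ()
        ... | _ | western | ()
        ... | _ | eastern | ()
        off s 1F ()
        off s 2F ()
      go (inward 1F q) ()
      go (inward 2F q) ()
      go (outward 0F q) e = go (inward 0F q) (sym e)
      go (outward 1F q) ()
      go (outward 2F q) ()
      go (ahead l q) e = after≢ q (spoke-inj e)
        where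
        spoke-inj : ∀ {l l′ q q′} → inner c l q ≡ inner c l′ q′ → q ≡ q′
        spoke-inj refl = refl
      go (back l q) e = go (ahead l q) (sym e)

    Joined : Vert → Vert → Set
    Joined v w = ∃[ d ] (tail d ≡ v × tail (α d) ≡ w)

    joined : ∀ c m → Joined (at c (start m)) (at c (end m))
    joined c m = (c , m) , refl , head c m

    Conn-++ : ∀ {A : Set} {R : A → A → Set} {x y z} → Conn R x y → Conn R y z → Conn R x z
    Conn-++ here r = r
    Conn-++ (fwd e c) r = fwd e (Conn-++ c r)
    Conn-++ (bwd e c) r = bwd e (Conn-++ c r)

    along : ∀ c s {x} → Conn Joined (nodeOf c s) x → ∀ k → Conn Joined (at c (rim s k)) x
    along c s p 0F = p
    along c s p 1F = bwd (joined c (road s 0F)) p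
    along c s p 2F = bwd (joined c (road s 1F)) (bwd (joined c (road s 0F)) p)

    descend : ∀ c s k → Conn Joined (at c (rim s k)) (nodeW c)
    descend c = λ where
        0F → along c 0F here
        1F → along c 1F N
        2F → along c 2F E
        3F → along c 3F (bwd (joined c (road 2F 2F)) (along c 2F E 2F))
      where
      N = bwd (joined c (road 0F 2F)) (along c 0F here 2F)
      E = bwd (joined c (road 1F 2F)) (along c 1F N 2F)

    surface-first : ∀ c q → Conn Joined (inner c 0F q) (nodeW c)
    surface-first c q = fwd (joined c (outward 0F q)) (descend c (proj₁ (foot q)) (proj₂ (foot q)))

    westward : ∀ c → Conn Joined (nodeW c) west
    westward (pos a a′ e , pos b b′ f) = go a a′ b b′
      where
      go : ∀ a a′ b b′ .{e : a + a′ ≡ n} .{f : b + b′ ≡ n} → Conn Joined (nodeW (pos a a′ e , pos b b′ f)) west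
      go zero a′ zero b′ = here
      go zero a′ (suc b) b′ {e} {f} = Conn-++ (descend (pos zero a′ e , pos b (suc b′) (down b b′ f)) 3F 0F) (go zero a′ b (suc b′))
      go (suc a) a′ b b′ {e} {f} = Conn-++ (descend (pos a (suc a′) (down a a′ e) , pos b b′ f) 1F 0F) (go a (suc a′) b b′)

    climbs : ∀ v → Conn Joined v west
    climbs (inner c 0F q) = Conn-++ (surface-first c q) (westward c)
    climbs (inner c 1F q) = fwd (joined c (outward 1F q)) (Conn-++ (surface-first c q) (westward c))
    climbs (inner c 2F q) = fwd (joined c (outward 2F q)) (fwd (joined c (outward 1F q)) (Conn-++ (surface-first c q) (westward c)))
    climbs (mid (c , s)) = Conn-++ (descend c s 1F) (westward c)
    climbs (node c) = Conn-++ (descend c 3F 0F) (westward c)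
    climbs west = here
    climbs east = subst (λ v → Conn Joined v west) (tail-dart east) (Conn-++ (descend (high , high) 2F 0F) (westward _))

    #cells : ℕ
    #cells = suc n * suc n

    same : ∀ {k} → Fin k ↔ Fin k
    same = mk↔ₛ′ (λ x → x) (λ x → x) (λ _ → refl) (λ _ → refl)

    abstract
      cells : Cell ↔ Fin (suc n * suc n)
      cells = ↔-trans (positions n ×-↔ positions n) (↔-sym (Finₚ.*↔× {suc n} {suc n}))

      times : ∀ {A : Set} {k} → A ↔ Fin k → (Cell × A) ↔ Fin (#cells * k)
      times e = ↔-trans (cells ×-↔ e) (↔-sym (Finₚ.*↔× {#cells}))

      vertices : Vert ↔ Fin (#cells * (3 * 13) + (#cells * 4 + (#cells + 2)))
      vertices = ↔-trans split (↔-trans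
          (times (↔-sym (Finₚ.*↔× {3} {13})) ⊎-↔
            ↔-trans (times same ⊎-↔
              ↔-trans (cells ⊎-↔ same) (↔-sym (Finₚ.+↔⊎ {#cells} {2}))) (↔-sym (Finₚ.+↔⊎ {#cells * 4} {#cells + 2})))
          (↔-sym (Finₚ.+↔⊎ {#cells * (3 * 13)} {#cells * 4 + (#cells + 2)})))
        where
        split : Vert ↔ ((Cell × (Fin 3 × Spoke)) ⊎ ((Cell × Side) ⊎ (Cell ⊎ Fin 2)))
        split = mk↔ₛ′
          (λ { (inner c l q) → inj₁ (c , l , q) ; (mid x) → inj₂ (inj₁ x) ; (node c) → inj₂ (inj₂ (inj₁ c))
             ; west → inj₂ (inj₂ (inj₂ 0F)) ; east → inj₂ (inj₂ (inj₂ 1F)) })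
          (λ { (inj₁ (c , l , q)) → inner c l q ; (inj₂ (inj₁ x)) → mid x ; (inj₂ (inj₂ (inj₁ c))) → node c
             ; (inj₂ (inj₂ (inj₂ 0F))) → west ; (inj₂ (inj₂ (inj₂ 1F))) → east })
          (λ { (inj₁ (c , l , q)) → refl ; (inj₂ (inj₁ x)) → refl ; (inj₂ (inj₂ (inj₁ c))) → refl
             ; (inj₂ (inj₂ (inj₂ 0F))) → refl ; (inj₂ (inj₂ (inj₂ 1F))) → refl })
          (λ { (inner c l q) → refl ; (mid x) → refl ; (node c) → refl ; west → refl ; east → refl })

  grid : ℕ → Surface
  grid n = record
    { Vert = Vert {n} ; Dart = Dart ; Face = Cell × Region
    ; #V = #cells {n} * (3 * 13) + (#cells {n} * 4 + (#cells {n} + 2))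
    ; #D = #cells {n} * (4 * 3 + 4 * (3 * 13)) ; #F = #cells {n} * (3 * 13 + 1)
    ; verts = vertices
    ; darts = times {n} {Slot} {4 * 3 + 4 * (3 * 13)} slots
    ; faces = times {n} {Region} {3 * 13 + 1} regions
    ; tail = tail ; α = α ; σ = σ ; face = face ; dart = dart ; side = side
    ; tail-dart = tail-dart ; face-side = λ { (c , f) → cong (c ,_) (region-border f) }
    ; α-invol = α-invol ; σ-inj = λ d e q → trans (sym (unσ-σ d)) (trans (cong unσ q) (unσ-σ e))
    ; σ-tail = σ-tail ; σ-dart = λ d → let (k , _ , e) = nears d in k , e
    ; φ-face = λ d → trans (cong face (φ-cell d)) (cong (proj₁ d ,_) (region-φ (proj₂ d)))
    ; φ-side = φ-side ; root = west ; climbs = climbs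
    ; euler = solve 1 (λ x → con 2 :* ((x :* con 39 :+ (x :* con 4 :+ (x :+ con 2))) :+ x :* con 40)
                       := x :* con 168 :+ con 4) refl (#cells {n})
    ; no-loop = no-loop
    ; no-multi = λ d e p q → trans (sym (between-tail-head d)) (trans (cong₂ between p q) (between-tail-head e))
    }
    where open +-*-Solver

  grid-Δ : ∀ n → MaxDegree (Surface.graph (grid (suc n))) 5
  grid-Δ n = star-maxDegree (grid (suc n)) {unσ = unσ} unσ-σ nears v distinct ends refl
    where
    c c′ : Cell {suc n}
    c = pos 0 (suc n) refl , low
    c′ = pos 1 n refl , low
    v : Vert {suc n}
    v = mid (c , 1F)
    -- A point inside a side has two road darts, two spokes in the cell where it comes first, and
    -- one spoke in the neighbouring cell.
    star : List (Dart {suc n})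
    star = (c , road 1F 1F) ∷ (c , inward 0F 3F) ∷ (c , inward 0F 4F) ∷ (c′ , road 3F 2F) ∷ (c′ , inward 0F (suc (suc (suc 9F)))) ∷ []
    distinct : Unique star
    distinct = ((λ ()) ∷ (λ ()) ∷ (λ ()) ∷ (λ ()) ∷ []) ∷ ((λ ()) ∷ (λ ()) ∷ (λ ()) ∷ []) ∷ ((λ ()) ∷ (λ ()) ∷ []) ∷ ((λ ()) ∷ []) ∷ [] ∷ []
    ends : ∀ {d} → d ∈ star → tail d ≡ v
    ends (here refl) = refl
    ends (there (here refl)) = refl
    ends (there (there (here refl))) = refl
    ends (there (there (there (here refl)))) = refl
    ends (there (there (there (there (here refl))))) = refl

-- Dodging cops one after another.

module Dodging where
  open Evasions
  open import Data.List.Relation.Unary.All as All using (All; []; _∷_)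

  m+n∸o≤m∸o+n : ∀ m n o → m + n ∸ o ≤ m ∸ o + n
  m+n∸o≤m∸o+n m n zero = ℕₚ.≤-refl
  m+n∸o≤m∸o+n zero n (suc o) = ℕₚ.m∸n≤m n (suc o)
  m+n∸o≤m∸o+n (suc m) n (suc o) = m+n∸o≤m∸o+n m n o

  m≤m∸n+n : ∀ m n → m ≤ m ∸ n + n
  m≤m∸n+n m n = subst (m ≤_) (ℕₚ.+-comm n (m ∸ n)) (ℕₚ.m≤n+m∸n m n)

  module Evading (κ : ℕ) where
    open +-*-Solver

    -- A cop is dodged once he is within limit (suc u), u being the number of cops
    -- not yet taken care of; window u bounds the time needed to pass u cops.
    limit window : ℕ → ℕ
    limit zero = 0
    limit (suc u) = 15 * κ + 13 + 182 * window u
    window zero = 0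
    window (suc u) = limit (suc u) + window u

    limit-step : ∀ u → limit u + 13 ≤ limit (suc u)
    limit-step zero = ℕₚ.≤-trans (ℕₚ.m≤n+m 13 (15 * κ)) (ℕₚ.m≤m+n (15 * κ + 13) 0)
    limit-step (suc u) = subst (_≤ limit (suc (suc u))) (ℕₚ.+-comm 13 _)
      (ℕₚ.+-mono-≤ (ℕₚ.m≤n+m 13 (15 * κ)) (ℕₚ.≤-trans (ℕₚ.m≤m+n _ (window u)) (ℕₚ.m≤n*m (window (suc u)) 182)))

    limit-mono : ∀ {u v} → u ≤ v → limit u ≤ limit v
    limit-mono {u} {v} le with ℕₚ.m≤n⇒∃[o]m+o≡n le
    ... | o , refl = go o
      where
      go : ∀ o → limit u ≤ limit (u + o)
      go zero = ℕₚ.≤-reflexive (cong limit (sym (ℕₚ.+-identityʳ u)))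
      go (suc o) = ℕₚ.≤-trans (go o) (ℕₚ.≤-trans (ℕₚ.m≤m+n _ 13) (subst (λ x → limit (u + o) + 13 ≤ limit x) (sym (ℕₚ.+-suc u o)) (limit-step (u + o))))

    window-mono : ∀ {u v} → u ≤ v → window u ≤ window v
    window-mono {v = v} z≤n = z≤n
    window-mono (s≤s le) = ℕₚ.+-mono-≤ (limit-mono (s≤s le)) (window-mono le)

    module Cops (k m : ℕ) (k≤m : k ≤ m) where
      Sight : Set
      Sight = Fin k → ℕ

      -- p measures how far ahead of the robber (plus κ) a cop is, s how far to the
      -- side.
      record Moves (p s p′ s′ : Sight) : Set where
        field
          nearer : ∀ c → p′ c ≤ p c ∸ 1
          steady : ∀ c → p c ≤ p′ c + 13
          apart  : ∀ c → s c ≤ s′ c + 13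
      open Moves

      leader : Sight → List (Fin k) → Maybe (Fin k)
      leader p [] = nothing
      leader p (c ∷ es) with p c
      ... | zero = leader p es
      ... | suc _ = just c

      -- In one step `13 * s + p` loses at most 13 * 13 + 13 = 182. For the leader it loses nothing,
      -- as `s` grows by one and `p` falls by at most 13. An entry behind the leader pays out of
      -- `182 * R`: its `R` contains the leader's `p` and falls at every step. The remainder
      -- `15 * κ` is for the end: with `p ≤ 2 * κ` it forces `s ≥ κ`.
      Good : Sight → Sight → ℕ → List (Fin k) → Set
      Good p s R [] = ⊤
      Good p s R (c ∷ es) = ((p c ≡ 0 ⊎ 15 * κ + 182 * R ≤ 13 * s c + p c) × p c ≤ limit m) × Good p s (p c + R) es

      total : Sight → ℕ → List (Fin k) → ℕ
      total p R [] = R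
      total p R (c ∷ es) = total p (p c + R) es

      Good-weaken : ∀ {p s R R′} es → R′ ≤ R → Good p s R es → Good p s R′ es
      Good-weaken [] le g = tt
      Good-weaken {p} (c ∷ es) le ((inj₁ e , b) , g) = (inj₁ e , b) , Good-weaken es (ℕₚ.+-monoʳ-≤ (p c) le) g
      Good-weaken {p} (c ∷ es) le ((inj₂ e , b) , g) =
        (inj₂ (ℕₚ.≤-trans (ℕₚ.+-monoʳ-≤ (15 * κ) (ℕₚ.*-monoʳ-≤ 182 le)) e) , b) , Good-weaken es (ℕₚ.+-monoʳ-≤ (p c) le) g

      total-mono : ∀ {p p′ R R′} es → (∀ c → p′ c ≤ p c) → R′ ≤ R → total p′ R′ es ≤ total p R es
      total-mono [] pp le = le
      total-mono (c ∷ es) pp le = total-mono es pp (ℕₚ.+-mono-≤ (pp c) le)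

      total-< : ∀ {p p′ R R′} es → (∀ c → p′ c ≤ p c) → R′ < R → total p′ R′ es < total p R es
      total-< [] pp le = le
      total-< {p} (c ∷ es) pp le = total-< es pp (ℕₚ.≤-trans (ℕₚ.+-monoʳ-< _ le) (ℕₚ.+-monoˡ-≤ _ (pp c)))

      module _ {p s p′ s′ : Sight} (mv : Moves p s p′ s′) where
        shrinks : ∀ c → p′ c ≤ p c
        shrinks c = ℕₚ.≤-trans (nearer mv c) (ℕₚ.m∸n≤m (p c) 1)

        gone : ∀ {c} → p c ≡ 0 → p′ c ≡ 0
        gone {c} e = ℕₚ.n≤0⇒n≡0 (subst (λ x → p′ c ≤ x ∸ 1) e (nearer mv c))

        closer : ∀ {c x} → p c ≡ suc x → p′ c < p c
        closer {c} {x} e = subst (p′ c <_) (sym e) (s≤s (subst (λ y → p′ c ≤ y ∸ 1) e (nearer mv c)))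

        Good-below : ∀ {R R′} es → R′ < R → Good p s R es → Good p′ s′ R′ es
        Good-below [] lt g = tt
        Good-below {R} {R′} (c ∷ es) lt ((e , b) , g) =
          (entry e , ℕₚ.≤-trans (shrinks c) b) ,
          Good-below es (ℕₚ.≤-trans (s≤s (ℕₚ.+-monoˡ-≤ R′ (shrinks c))) (ℕₚ.+-monoʳ-< (p c) lt)) g
          where
          entry : p c ≡ 0 ⊎ 15 * κ + 182 * R ≤ 13 * s c + p c → p′ c ≡ 0 ⊎ 15 * κ + 182 * R′ ≤ 13 * s′ c + p′ c
          entry (inj₁ z) = inj₁ (gone z)
          entry (inj₂ le) = inj₂ (ℕₚ.+-cancelʳ-≤ 182 _ _ (begin
            15 * κ + 182 * R′ + 182            ≡⟨ solve 2 (λ a r → a :+ con 182 :* r :+ con 182 := a :+ con 182 :* (con 1 :+ r)) refl (15 * κ) R′ ⟩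
            15 * κ + 182 * suc R′              ≤⟨ ℕₚ.+-monoʳ-≤ (15 * κ) (ℕₚ.*-monoʳ-≤ 182 lt) ⟩
            15 * κ + 182 * R                   ≤⟨ le ⟩
            13 * s c + p c                     ≤⟨ ℕₚ.+-mono-≤ (ℕₚ.*-monoʳ-≤ 13 (apart mv c)) (steady mv c) ⟩
            13 * (s′ c + 13) + (p′ c + 13)     ≡⟨ solve 2 (λ a b → con 13 :* (a :+ con 13) :+ (b :+ con 13) := con 13 :* a :+ b :+ con 182) refl (s′ c) (p′ c) ⟩
            13 * s′ c + p′ c + 182             ∎))
            where open ℕₚ.≤-Reasoning

        -- Only the foremost active entry is being dodged; each entry below it gives
        -- up at most 182 per step, which is paid for by R getting smaller.
        Good-step : ∀ {R} es → (∀ c → leader p es ≡ just c → s c < s′ c) → Good p s R es → Good p′ s′ R es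
        Good-step [] av g = tt
        Good-step {R} (c ∷ es) av ((e , b) , g) with p c in eq
        ... | zero = (inj₁ (gone eq) , ℕₚ.≤-trans (shrinks c) (subst (_≤ limit m) (sym eq) b)) ,
                     subst (λ x → Good p′ s′ (x + R) es) (sym (gone eq)) (Good-step es av g)
        ... | suc x = (inj₂ (entry e) , ℕₚ.≤-trans (shrinks c) (subst (_≤ limit m) (sym eq) b)) ,
                      Good-below es (ℕₚ.+-monoˡ-< R (subst (p′ c <_) eq (closer eq))) g
          where
          entry : suc x ≡ 0 ⊎ 15 * κ + 182 * R ≤ 13 * s c + suc x → 15 * κ + 182 * R ≤ 13 * s′ c + p′ c
          entry (inj₁ ())
          entry (inj₂ le) = begin
            15 * κ + 182 * R          ≤⟨ le ⟩
            13 * s c + suc x          ≡⟨ cong (13 * s c +_) (sym eq) ⟩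
            13 * s c + p c            ≤⟨ ℕₚ.+-monoʳ-≤ (13 * s c) (steady mv c) ⟩
            13 * s c + (p′ c + 13)    ≡⟨ solve 2 (λ a b → con 13 :* a :+ (b :+ con 13) := con 13 :* (con 1 :+ a) :+ b) refl (s c) (p′ c) ⟩
            13 * suc (s c) + p′ c     ≤⟨ ℕₚ.+-monoˡ-≤ (p′ c) (ℕₚ.*-monoʳ-≤ 13 (av c refl)) ⟩
            13 * s′ c + p′ c          ∎
            where open ℕₚ.≤-Reasoning

        total-led : ∀ {R x} es → leader p es ≡ just x → total p′ R es < total p R es
        total-led [] ()
        total-led {R} (c ∷ es) e with p c in eq
        ... | zero = subst (λ y → total p′ (y + R) es < total p R es) (sym (gone eq)) (total-led es e)
        ... | suc x = total-< es shrinks (ℕₚ.+-monoˡ-< R (subst (p′ c <_) eq (closer eq)))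

      total-idle : ∀ {p R} es → leader p es ≡ nothing → total p R es ≡ R
      total-idle [] e = refl
      total-idle {p} (c ∷ es) e with p c
      ... | zero = total-idle es e
      total-idle {p} (c ∷ es) () | suc x

      record Plan (p s : Sight) : Set where
        field
          ws es  : List (Fin k)
          few    : length ws ≤ m
          covers : ∀ c → c ∈ ws ⊎ c ∈ es
          waits  : All (λ c → p c ≡ 0 ⊎ limit (length ws) < p c) ws
          good   : Good p s (window (length ws)) es
        burden : ℕ
        burden = total p (window (length ws)) es
        guide : Maybe (Fin k)
        guide = leader p es
      open Plan

      choose : ∀ {p : Sight} L ws → All (λ c → p c ≡ 0 ⊎ L < p c + 13) ws →
               All (λ c → p c ≡ 0 ⊎ L < p c) ws ⊎
               (∃[ c ] ∃[ rest ] (length ws ≡ suc (length rest) × (∀ {d} → d ∈ ws → d ≡ c ⊎ d ∈ rest) ×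
                 All (λ c → p c ≡ 0 ⊎ L < p c + 13) rest × p c ≤ L × L < p c + 13))
      choose L [] [] = inj₁ []
      choose {p} L (c ∷ ws) (a ∷ as) with a
      ... | inj₁ z with choose L ws as
      ...   | inj₁ ok = inj₁ (inj₁ z ∷ ok)
      ...   | inj₂ (d , rest , n , sub , al , lo , hi) = inj₂ (d , c ∷ rest , cong suc n ,
              (λ { (here refl) → inj₂ (here refl) ; (there i) → Data.Sum.map₂ there (sub i) }) , inj₁ z ∷ al , lo , hi)
      choose {p} L (c ∷ ws) (a ∷ as) | inj₂ hi with p c ℕₚ.≤? L
      ... | yes lo = inj₂ (c , ws , refl , (λ { (here e) → inj₁ e ; (there i) → inj₂ i }) , as , lo , hi)
      ... | no gt with choose L ws as
      ...   | inj₁ ok = inj₁ (inj₂ (ℕₚ.≰⇒> gt) ∷ ok)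
      ...   | inj₂ (d , rest , n , sub , al , lo , hi′) = inj₂ (d , c ∷ rest , cong suc n ,
              (λ { (here refl) → inj₂ (here refl) ; (there i) → Data.Sum.map₂ there (sub i) }) , inj₂ hi ∷ al , lo , hi′)

      advance : ∀ {p s p′ s′} (P : Plan p s) → Moves p s p′ s′ → (∀ c → guide P ≡ just c → s c < s′ c) →
                Σ (Plan p′ s′) λ P′ → burden P′ ≤ total p′ (window (length (ws P))) (es P)
      advance {p} {s} {p′} {s′} P mv av with choose {p′} (limit (length (ws P))) (ws P) (All.map late (waits P))
        where
        late : ∀ {c} → p c ≡ 0 ⊎ limit (length (ws P)) < p c → p′ c ≡ 0 ⊎ limit (length (ws P)) < p′ c + 13
        late (inj₁ z) = inj₁ (gone mv z)
        late (inj₂ lt) = inj₂ (ℕₚ.≤-trans lt (steady mv _))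
      ... | inj₁ ok = record { ws = ws P ; es = es P ; few = few P ; covers = covers P ; waits = ok
                             ; good = Good-step mv (es P) av (good P) } , ℕₚ.≤-refl
      ... | inj₂ (c , rest , n , sub , al , lo , hi) =
        record { ws = rest ; es = c ∷ es P ; few = ℕₚ.≤-trans (ℕₚ.n≤1+n u) u<m
               ; covers = λ d → covered (covers P d)
               ; waits = All.map (λ { (inj₁ z) → inj₁ z ; (inj₂ lt) → inj₂ (still lt) }) al
               ; good = (inj₂ entry , ℕₚ.≤-trans lo′ (limit-mono u<m)) ,
                        Good-weaken (es P) room (subst (λ x → Good p′ s′ (window x) (es P)) n (Good-step mv (es P) av (good P))) } ,
        total-mono (es P) (λ _ → ℕₚ.≤-refl) (subst (λ x → p′ c + window u ≤ window x) (sym n) room)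
        where
        u = length rest
        u<m : suc u ≤ m
        u<m = subst (_≤ m) n (few P)
        lo′ : p′ c ≤ limit (suc u)
        lo′ = subst (λ x → p′ c ≤ limit x) n lo
        room : p′ c + window u ≤ window (suc u)
        room = ℕₚ.+-monoˡ-≤ (window u) lo′
        covered : ∀ {d} → d ∈ ws P ⊎ d ∈ es P → d ∈ rest ⊎ d ∈ c ∷ es P
        covered (inj₂ i) = inj₂ (there i)
        covered (inj₁ i) with sub i
        ... | inj₁ refl = inj₂ (here refl)
        ... | inj₂ j = inj₁ j
        -- One admission per step is enough: lowering the threshold makes up for the approach of all
        -- remaining cops.
        still : ∀ {d} → limit (length (ws P)) < p′ d + 13 → limit u < p′ d
        still {d} lt = ℕₚ.+-cancelʳ-≤ 13 _ _ (ℕₚ.≤-trans (s≤s (limit-step u)) (subst (λ x → limit x < p′ d + 13) n lt))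
        -- The new cop has only just crossed the threshold, so `p` exceeds `limit (suc u)` minus 13,
        -- which is exactly the required `15 * κ + 182 * window u`. Nothing is asked of its sideways
        -- distance.
        entry : 15 * κ + 182 * window u ≤ 13 * s′ c + p′ c
        entry = ℕₚ.≤-trans (ℕₚ.<⇒≤ (ℕₚ.+-cancelʳ-≤ 13 _ _ (ℕₚ.≤-trans
            (s≤s (ℕₚ.≤-reflexive (solve 2 (λ a b → a :+ b :+ con 13 := a :+ con 13 :+ b) refl (15 * κ) (182 * window u))))
            (subst (λ x → limit x < p′ c + 13) n hi))))
          (ℕₚ.m≤n+m (p′ c) (13 * s′ c))

      begin-plan : ∀ {p s} → (∀ c → p c ≡ 0 ⊎ limit m < p c) → Plan p s
      begin-plan {p} far = record
        { ws = allFin k ; es = [] ; few = ℕₚ.≤-trans (ℕₚ.≤-reflexive size) k≤m ; covers = λ c → inj₁ (∈-allFin c)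
        ; waits = All.universal (λ c → Data.Sum.map₂ (ℕₚ.≤-<-trans (limit-mono (ℕₚ.≤-trans (ℕₚ.≤-reflexive size) k≤m))) (far c)) (allFin k)
        ; good = tt }
        where
        size : length (allFin k) ≡ k
        size = length-tabulate (λ i → i)

      begin-burden : ∀ {p s} (far : ∀ c → p c ≡ 0 ⊎ limit m < p c) → burden (begin-plan {p} {s} far) ≤ window m
      begin-burden far = window-mono (few (begin-plan {s = λ _ → 0} far))

      -- `p` is offset by `κ`: the value 0 means at least `κ` behind the robber, a value above
      -- `2 * κ` means more than `κ` ahead.
      Unseen : Sight → Sight → Set
      Unseen p s = ∀ c → p c ≡ 0 ⊎ (2 * κ < p c ⊎ κ ≤ s c)

      unseen : ∀ {p s} → Plan p s → Unseen p s
      unseen {p} {s} P c with covers P c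
      ... | inj₁ i = Data.Sum.map₂ (λ lt → inj₁ (ℕₚ.≤-trans (s≤s (wide i)) lt)) (All.lookup (waits P) i)
        where
        wide : ∀ {c ws} → c ∈ ws → 2 * κ ≤ limit (length ws)
        wide {ws = _ ∷ ws} _ = ℕₚ.≤-trans (ℕₚ.*-monoˡ-≤ κ (ℕₚ.m≤m+n 2 13)) (ℕₚ.≤-trans (ℕₚ.m≤m+n _ 13) (ℕₚ.m≤m+n _ (182 * window (length ws))))
      ... | inj₂ i = go (es P) (good P) i
        where
        go : ∀ {R} es → Good p s R es → c ∈ es → p c ≡ 0 ⊎ (2 * κ < p c ⊎ κ ≤ s c)
        go (c ∷ es) ((inj₁ z , _) , _) (here refl) = inj₁ z
        go {R} (c ∷ es) ((inj₂ le , _) , _) (here refl) with p c ℕₚ.≤? 2 * κ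
        ... | no gt = inj₂ (inj₁ (ℕₚ.≰⇒> gt))
        ... | yes small = inj₂ (inj₂ (ℕₚ.*-cancelˡ-≤ 13 (ℕₚ.+-cancelʳ-≤ (2 * κ) _ _ (begin
            13 * κ + 2 * κ      ≡⟨ solve 1 (λ a → con 13 :* a :+ con 2 :* a := con 15 :* a) refl κ ⟩
            15 * κ              ≤⟨ ℕₚ.m≤m+n _ (182 * R) ⟩
            15 * κ + 182 * R    ≤⟨ le ⟩
            13 * s c + p c      ≤⟨ ℕₚ.+-monoʳ-≤ (13 * s c) small ⟩
            13 * s c + 2 * κ    ∎))))
          where open ℕₚ.≤-Reasoning
        go (d ∷ es) (_ , g) (there i) = go es g i

      guide-idle : ∀ {p s} (P : Plan p s) → (∀ c → p c ≡ 0 ⊎ limit m < p c) → guide P ≡ nothing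
      guide-idle {p} {s} P far = go (es P) (good P)
        where
        go : ∀ {R} es → Good p s R es → leader p es ≡ nothing
        go [] g = refl
        go (c ∷ es) ((_ , b) , g) with p c in eq
        ... | zero = go es g
        ... | suc x with far c
        ...   | inj₁ z = ⊥-elim (ℕₚ.0≢1+n (trans (sym z) eq))
        ...   | inj₂ lt = ⊥-elim (ℕₚ.<⇒≱ (subst (limit m <_) eq lt) b)

-- Sweeping back and forth across the board.

module Hunting where
  open Evasions
  open Dodging

  weigh-< : ∀ {A : Set} {f g : A → ℕ} {x} xs → (∀ y → f y ≤ g y) → x ∈ xs → f x < g x → weigh f xs < weigh g xs
  weigh-< (x ∷ xs) le (here refl) lt = ℕₚ.+-mono-<-≤ lt (weigh-≤ xs le)
  weigh-< (x ∷ xs) le (there i) lt = ℕₚ.+-mono-≤-< (le x) (weigh-< xs le i lt)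

  weigh-const : ∀ {A : Set} n (xs : List A) → weigh (λ _ → n) xs ≡ length xs * n
  weigh-const n [] = refl
  weigh-const n (x ∷ xs) = cong (n +_) (weigh-const n xs)

  ∣-∣-shift : ∀ {a b c d} → a ≤ b + d → b ≤ a + d → ∣ a - c ∣ ≤ ∣ b - c ∣ + d
  ∣-∣-shift {a} {b} {c} {d} le₁ le₂ = ℕₚ.≤-trans (ℕₚ.∣-∣-triangle a b c)
    (subst (∣ a - b ∣ + ∣ b - c ∣ ≤_) (ℕₚ.+-comm d ∣ b - c ∣) (ℕₚ.+-monoˡ-≤ _ close))
    where
    close : ∣ a - b ∣ ≤ d
    close with ℕₚ.≤-total a b
    ... | inj₁ a≤b = subst (_≤ d) (sym (ℕₚ.m≤n⇒∣m-n∣≡n∸m a≤b)) (ℕₚ.m≤n+o⇒m∸n≤o b a le₂)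
    ... | inj₂ b≤a = subst (_≤ d) (sym (ℕₚ.m≤n⇒∣n-m∣≡n∸m b≤a)) (ℕₚ.m≤n+o⇒m∸n≤o a b le₁)

  m<n∸o⇒m+o<n : ∀ m n o → m < n ∸ o → m + o < n
  m<n∸o⇒m+o<n m n o lt with o ℕₚ.≤? n
  ... | yes o≤n = ℕₚ.≤-trans (ℕₚ.+-monoˡ-≤ o lt) (ℕₚ.≤-reflexive (ℕₚ.m∸n+n≡m o≤n))
  ... | no o≰n = ⊥-elim (ℕₚ.n≮0 (subst (m <_) (ℕₚ.m≤n⇒m∸n≡0 (ℕₚ.≰⇒≥ o≰n)) lt))

  module Chasing (κ : ℕ) (κ>0 : 0 < κ) (k m : ℕ) (k≤m : k ≤ m) (y₀ z₀ : ℕ)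
                 (drift<y₀ : suc (Evading.window κ m) < y₀) where
    open Evading κ
    open Cops k m k≤m
    open Plan
    open +-*-Solver

    -- `reach` is chosen so that a cop farther behind than that is beyond `limit m` once the
    -- direction is reversed. `cap` is the first value past the window of width `2 * reach`. Capping
    -- the terms makes `slack` a bound for the potential wherever the cops stand, and hence for the
    -- overshoot.
    drift reach cap slack : ℕ
    drift = suc (window m)
    reach = limit m + κ
    cap = suc (2 * reach)
    slack = 2 * (m * cap) + drift

    ahead around : ℕ → Sight → Sight
    ahead x X c = X c + κ ∸ x
    around x X c = X c + reach ∸ x
    aside : ℕ → Sight → Sight
    aside η Y c = ∣ Y c - 7 * η ∣

    potential : ℕ → ℕ → Sight → ℕ
    potential x η X = 2 * weigh (λ c → around x X c ⊓ cap) (allFin k) + ∣ η - y₀ ∣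

    record Hunt (x z η : ℕ) (X Y : Sight) : Set where
      field
        plan  : Plan (ahead x X) (aside η Y)
        level : ∣ η - y₀ ∣ + burden plan ≤ drift
        high  : z + potential x η X ≤ suc (z₀ + slack)
        low   : z₀ ≤ z + suc slack
    open Hunt

    -- The robber may turn round when no cop is within reach of his column.
    Ready : ℕ → ℕ → Sight → Set
    Ready x η X = ∣ η - y₀ ∣ ≤ 1 × (∀ c → around x X c ≡ 0 ⊎ 2 * reach < around x X c)

    ready? : ∀ x η X → Dec (Ready x η X)
    ready? x η X = (∣ η - y₀ ∣ ℕₚ.≤? 1) ×-dec Finₚ.all? λ c → (around x X c ℕₚ.≟ 0) ⊎-dec (2 * reach ℕₚ.<? around x X c)

    level′ : ∀ {x z η X Y} → Hunt x z η X Y → ∣ η - y₀ ∣ ≤ drift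
    level′ h = ℕₚ.≤-trans (ℕₚ.m≤m+n _ _) (level h)

    size : length (allFin k) ≡ k
    size = length-tabulate (λ i → i)

    potential≤ : ∀ {x η X} → ∣ η - y₀ ∣ ≤ drift → potential x η X ≤ slack
    potential≤ {x} {η} {X} le = ℕₚ.+-mono-≤ (ℕₚ.*-monoʳ-≤ 2 (ℕₚ.≤-trans
      (weigh-≤ {g = λ _ → cap} (allFin k) (λ c → ℕₚ.m⊓n≤n (around x X c) cap))
      (ℕₚ.≤-trans (ℕₚ.≤-reflexive (trans (weigh-const cap (allFin k)) (cong (λ w → w * cap) size))) (ℕₚ.*-monoˡ-≤ cap {k} {m} k≤m)))) le

    positive : ∀ {η} → ∣ η - y₀ ∣ ≤ drift → 0 < η
    positive {zero} le = ⊥-elim (ℕₚ.<⇒≱ drift<y₀ le)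
    positive {suc η} le = s≤s z≤n

    -- Every trip changes `η` by exactly one, so the robber cannot hold his level; without a guide
    -- he returns to `y₀` and then hovers between `y₀` and `y₀ ∸ 1`.
    heads-up : ℕ → Sight → Maybe (Fin k) → Bool
    heads-up η Y (just c) with 7 * η ℕₚ.≤? Y c
    ... | yes _ = false
    ... | no _  = true
    heads-up η Y nothing with η ℕₚ.<? y₀
    ... | yes _ = true
    ... | no _  = false

    heading : ∀ {x z η X Y} → Hunt x z η X Y → Bool
    heading {η = η} {Y = Y} h = heads-up η Y (guide (plan h))

    _towards_ : ℕ → Bool → ℕ
    η towards true = suc η
    η towards false = η ∸ 1

    towards-close : ∀ η b y → ∣ (η towards b) - y ∣ ≤ ∣ η - y ∣ + 1 × ∣ η - y ∣ ≤ ∣ (η towards b) - y ∣ + 1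
    towards-close η true y = ∣-∣-shift (ℕₚ.≤-reflexive (ℕₚ.+-comm 1 η)) (ℕₚ.≤-trans (ℕₚ.n≤1+n η) (ℕₚ.m≤m+n _ 1)) ,
      ∣-∣-shift (ℕₚ.≤-trans (ℕₚ.n≤1+n η) (ℕₚ.m≤m+n _ 1)) (ℕₚ.≤-reflexive (ℕₚ.+-comm 1 η))
    towards-close η false y = ∣-∣-shift (ℕₚ.≤-trans (ℕₚ.m∸n≤m η 1) (ℕₚ.m≤m+n _ 1)) (m≤m∸n+n η 1) ,
      ∣-∣-shift (m≤m∸n+n η 1) (ℕₚ.≤-trans (ℕₚ.m∸n≤m η 1) (ℕₚ.m≤m+n _ 1))

    Drift : Sight → Sight → Set
    Drift X X′ = ∀ c → X c ≤ X′ c + 6 × X′ c ≤ X c + 6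

    module _ {x z η : ℕ} {X Y X′ Y′ : Sight} (h : Hunt x z η X Y) (dx : Drift X X′) (dy : Drift Y Y′) where
      private
        b = heading h
        η′ = η towards b

        recede : ∀ e X X′ → Drift X X′ → ∀ c → X′ c + e ∸ (x + 7) ≤ X c + e ∸ x ∸ 1
        recede e X X′ d c = begin
          X′ c + e ∸ (x + 7)          ≤⟨ ℕₚ.∸-monoˡ-≤ (x + 7) (ℕₚ.+-monoˡ-≤ e (proj₂ (d c))) ⟩
          X c + 6 + e ∸ (x + 7)       ≡⟨ cong₂ _∸_ (solve 2 (λ a e → a :+ con 6 :+ e := con 6 :+ (a :+ e)) refl (X c) e)
                                                   (solve 1 (λ x → x :+ con 7 := con 6 :+ (x :+ con 1)) refl x) ⟩
          X c + e ∸ (x + 1)           ≡⟨ sym (ℕₚ.∸-+-assoc (X c + e) x 1) ⟩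
          X c + e ∸ x ∸ 1             ∎
          where open ℕₚ.≤-Reasoning

        moves : Moves (ahead x X) (aside η Y) (ahead (x + 7) X′) (aside η′ Y′)
        moves = record
          { nearer = recede κ X X′ dx
          ; steady = λ c → begin
              X c + κ ∸ x                        ≤⟨ ℕₚ.∸-monoˡ-≤ x (ℕₚ.+-monoˡ-≤ κ (proj₁ (dx c))) ⟩
              X′ c + 6 + κ ∸ x                   ≡⟨ cong (_∸ x) (solve 2 (λ a e → a :+ con 6 :+ e := a :+ e :+ con 6) refl (X′ c) κ) ⟩
              X′ c + κ + 6 ∸ x                   ≤⟨ m+n∸o≤m∸o+n (X′ c + κ) 6 x ⟩
              (X′ c + κ ∸ x) + 6                 ≤⟨ ℕₚ.+-monoˡ-≤ 6 (m≤m∸n+n _ 7) ⟩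
              (X′ c + κ ∸ x) ∸ 7 + 7 + 6         ≡⟨ cong (λ w → w + 7 + 6) (ℕₚ.∸-+-assoc (X′ c + κ) x 7) ⟩
              (X′ c + κ ∸ (x + 7)) + 7 + 6       ≡⟨ ℕₚ.+-assoc (X′ c + κ ∸ (x + 7)) 7 6 ⟩
              (X′ c + κ ∸ (x + 7)) + 13          ∎
          ; apart = λ c → begin
              ∣ Y c - 7 * η ∣                    ≤⟨ ∣-∣-shift (proj₁ (dy c)) (proj₂ (dy c)) ⟩
              ∣ Y′ c - 7 * η ∣ + 6               ≡⟨ cong (_+ 6) (ℕₚ.∣-∣-comm (Y′ c) (7 * η)) ⟩
              ∣ 7 * η - Y′ c ∣ + 6               ≤⟨ ℕₚ.+-monoˡ-≤ 6 (∣-∣-shift (wide₁ b) (wide₂ b)) ⟩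
              ∣ 7 * η′ - Y′ c ∣ + 7 + 6          ≡⟨ trans (ℕₚ.+-assoc _ 7 6) (cong (_+ 13) (ℕₚ.∣-∣-comm (7 * η′) (Y′ c))) ⟩
              ∣ Y′ c - 7 * η′ ∣ + 13             ∎
          }
          where
          open ℕₚ.≤-Reasoning
          wide₁ : ∀ b → 7 * η ≤ 7 * (η towards b) + 7
          wide₁ true = ℕₚ.≤-trans (ℕₚ.*-monoʳ-≤ 7 (ℕₚ.n≤1+n η)) (ℕₚ.m≤m+n _ 7)
          wide₁ false = ℕₚ.≤-trans (ℕₚ.*-monoʳ-≤ 7 (m≤m∸n+n η 1)) (ℕₚ.≤-reflexive (ℕₚ.*-distribˡ-+ 7 (η ∸ 1) 1))
          wide₂ : ∀ b → 7 * (η towards b) ≤ 7 * η + 7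
          wide₂ true = ℕₚ.≤-reflexive (trans (ℕₚ.*-suc 7 η) (ℕₚ.+-comm 7 (7 * η)))
          wide₂ false = ℕₚ.≤-trans (ℕₚ.*-monoʳ-≤ 7 (ℕₚ.m∸n≤m η 1)) (ℕₚ.m≤m+n _ 7)

        -- The robber moves 7 sideways and the cop at most 6. Downwards this needs `0 < η`, which
        -- `positive` supplies.
        away : ∀ g c → g ≡ just c → aside η Y c < aside (η towards heads-up η Y g) Y′ c
        away (just .c) c refl with 7 * η ℕₚ.≤? Y c
        ... | yes le = begin-strict
              ∣ Y c - 7 * η ∣                    ≡⟨ ℕₚ.m≤n⇒∣n-m∣≡n∸m le ⟩
              Y c ∸ 7 * η                        <⟨ ℕₚ.n<1+n _ ⟩
              suc (Y c ∸ 7 * η)                  ≡⟨ sym (ℕₚ.+-∸-assoc 1 le) ⟩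
              suc (Y c) ∸ 7 * η                  ≤⟨ ℕₚ.∸-monoˡ-≤ (7 * η) (s≤s (proj₁ (dy c))) ⟩
              suc (Y′ c + 6) ∸ 7 * η             ≡⟨ cong₂ _∸_ (trans (sym (ℕₚ.+-suc (Y′ c) 6)) (ℕₚ.+-comm (Y′ c) 7)) seven ⟩
              7 + Y′ c ∸ (7 + 7 * (η ∸ 1))       ≡⟨ ℕₚ.[m+n]∸[m+o]≡n∸o 7 (Y′ c) (7 * (η ∸ 1)) ⟩
              Y′ c ∸ 7 * (η ∸ 1)                 ≤⟨ ℕₚ.m∸n≤∣m-n∣ (Y′ c) (7 * (η ∸ 1)) ⟩
              ∣ Y′ c - 7 * (η ∸ 1) ∣             ∎
          where
          open ℕₚ.≤-Reasoning
          seven : 7 * η ≡ 7 + 7 * (η ∸ 1)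
          seven = trans (cong (7 *_) (sym (ℕₚ.m+[n∸m]≡n (positive {η} (level′ h))))) (ℕₚ.*-distribˡ-+ 7 1 (η ∸ 1))
        ... | no gt = begin-strict
              ∣ Y c - 7 * η ∣                    ≡⟨ ℕₚ.m≤n⇒∣m-n∣≡n∸m (ℕₚ.≰⇒≥ gt) ⟩
              7 * η ∸ Y c                        <⟨ ℕₚ.n<1+n _ ⟩
              suc (7 * η ∸ Y c)                  ≡⟨ sym (ℕₚ.+-∸-assoc 1 (ℕₚ.≰⇒≥ gt)) ⟩
              suc (7 * η) ∸ Y c                  ≡⟨ sym (ℕₚ.[m+n]∸[m+o]≡n∸o 6 (suc (7 * η)) (Y c)) ⟩
              6 + suc (7 * η) ∸ (6 + Y c)        ≤⟨ ℕₚ.∸-monoʳ-≤ (6 + suc (7 * η)) (ℕₚ.≤-trans (proj₂ (dy c)) (ℕₚ.≤-reflexive (ℕₚ.+-comm (Y c) 6))) ⟩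
              6 + suc (7 * η) ∸ Y′ c             ≡⟨ cong (_∸ Y′ c) (solve 1 (λ a → con 6 :+ (con 1 :+ con 7 :* a) := con 7 :* (con 1 :+ a)) refl η) ⟩
              7 * suc η ∸ Y′ c                   ≤⟨ ℕₚ.m∸n≤∣m-n∣ (7 * suc η) (Y′ c) ⟩
              ∣ 7 * suc η - Y′ c ∣               ≡⟨ ℕₚ.∣-∣-comm (7 * suc η) (Y′ c) ⟩
              ∣ Y′ c - 7 * suc η ∣               ∎
          where open ℕₚ.≤-Reasoning

        avoids : ∀ c → guide (plan h) ≡ just c → aside η Y c < aside η′ Y′ c
        avoids = away (guide (plan h))

        home : ∀ g → g ≡ nothing → suc ∣ (η towards heads-up η Y g) - y₀ ∣ ≤ ∣ η - y₀ ∣ ⊎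
                                   (∣ η - y₀ ∣ ≡ 0 × ∣ (η towards heads-up η Y g) - y₀ ∣ ≤ 1)
        home nothing refl with η ℕₚ.<? y₀
        ... | yes lt = inj₁ (begin
              suc ∣ suc η - y₀ ∣    ≡⟨ cong suc (ℕₚ.m≤n⇒∣m-n∣≡n∸m lt) ⟩
              suc (y₀ ∸ suc η)      ≡⟨ sym (ℕₚ.+-∸-assoc 1 lt) ⟩
              y₀ ∸ η                ≡⟨ sym (ℕₚ.m≤n⇒∣m-n∣≡n∸m (ℕₚ.<⇒≤ lt)) ⟩
              ∣ η - y₀ ∣            ∎)
          where open ℕₚ.≤-Reasoning
        ... | no ge with η ℕₚ.≟ y₀
        ...   | yes refl = inj₂ (ℕₚ.∣n-n∣≡0 η , ℕₚ.≤-trans (proj₁ (towards-close η false η)) (ℕₚ.≤-reflexive (cong (_+ 1) (ℕₚ.∣n-n∣≡0 η))))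
        ...   | no ne = inj₁ (down η (ℕₚ.≤∧≢⇒< (ℕₚ.≮⇒≥ ge) (λ q → ne (sym q))))
          where
          down : ∀ η → y₀ < η → suc ∣ (η ∸ 1) - y₀ ∣ ≤ ∣ η - y₀ ∣
          down (suc η) (s≤s le) = ℕₚ.≤-reflexive (trans (cong suc (ℕₚ.m≤n⇒∣n-m∣≡n∸m le))
            (trans (sym (ℕₚ.+-∸-assoc 1 le)) (sym (ℕₚ.m≤n⇒∣n-m∣≡n∸m (ℕₚ.m≤n⇒m≤1+n le)))))

        homeward : guide (plan h) ≡ nothing → suc ∣ η′ - y₀ ∣ ≤ ∣ η - y₀ ∣ ⊎ (∣ η - y₀ ∣ ≡ 0 × ∣ η′ - y₀ ∣ ≤ 1)
        homeward = home (guide (plan h))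

        next : Σ (Plan (ahead (x + 7) X′) (aside η′ Y′)) λ P′ →
               burden P′ ≤ total (ahead (x + 7) X′) (window (length (ws (plan h)))) (es (plan h))
        next = advance (plan h) moves avoids

        -- While a cop is dodged, the deviation grows by at most one and the burden falls by at
        -- least one. Otherwise the deviation falls, or the robber hovers: then it is at most 1
        -- while the burden is at most `window m`. This case is the reason for the successor in
        -- `drift`.
        settle : ∀ g → guide (plan h) ≡ g → ∣ η′ - y₀ ∣ + burden (proj₁ next) ≤ drift
        settle (just c) e = ℕₚ.≤-trans (ℕₚ.+-mono-≤ (proj₁ (towards-close η b y₀)) (proj₂ next))
          (ℕₚ.≤-trans (ℕₚ.≤-reflexive (ℕₚ.+-assoc ∣ η - y₀ ∣ 1 _))
            (ℕₚ.≤-trans (ℕₚ.+-monoʳ-≤ ∣ η - y₀ ∣ (total-led moves (es (plan h)) e)) (level h)))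
        settle nothing e with homeward e
        ... | inj₁ lt = ℕₚ.≤-trans (ℕₚ.+-mono-≤ (ℕₚ.<⇒≤ lt) (ℕₚ.≤-trans (proj₂ next) (total-mono (es (plan h)) (shrinks moves) ℕₚ.≤-refl))) (level h)
        ... | inj₂ (_ , le) = ℕₚ.+-mono-≤ le (ℕₚ.≤-trans (proj₂ next) (ℕₚ.≤-trans
                (ℕₚ.≤-trans (total-mono (es (plan h)) (shrinks moves) ℕₚ.≤-refl) (ℕₚ.≤-reflexive (total-idle (es (plan h)) e)))
                (window-mono (few (plan h)))))

        level-next : ∣ η′ - y₀ ∣ + burden (proj₁ next) ≤ drift
        level-next = settle (guide (plan h)) refl

        around-shrinks : ∀ c → around (x + 7) X′ c ⊓ cap ≤ around x X c ⊓ cap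
        around-shrinks c = ℕₚ.⊓-monoˡ-≤ cap (ℕₚ.≤-trans (recede reach X X′ dx c) (ℕₚ.m∸n≤m _ 1))

        -- A cop inside the window lowers its capped term, and the factor 2 outweighs the possible
        -- growth of `∣ η - y₀ ∣` by one. With no cop inside there is no guide either
        -- (`guide-idle`), and the robber comes closer to `y₀`; he is not there yet, as otherwise he
        -- would be ready.
        potential-falls : ¬ Ready x η X → potential (x + 7) η′ X′ < potential x η X
        potential-falls unready with Finₚ.any? (λ c → ¬? ((around x X c ℕₚ.≟ 0) ⊎-dec (2 * reach ℕₚ.<? around x X c)))
        ... | yes (c , in-window) = begin-strict
              2 * weigh new (allFin k) + ∣ η′ - y₀ ∣          <⟨ ℕₚ.+-monoʳ-< (2 * weigh new (allFin k)) (s≤s (proj₁ (towards-close η b y₀))) ⟩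
              2 * weigh new (allFin k) + suc (∣ η - y₀ ∣ + 1)  ≡⟨ solve 2 (λ a d → con 2 :* a :+ (con 1 :+ (d :+ con 1)) := con 2 :* (con 1 :+ a) :+ d) refl (weigh new (allFin k)) ∣ η - y₀ ∣ ⟩
              2 * suc (weigh new (allFin k)) + ∣ η - y₀ ∣      ≤⟨ ℕₚ.+-monoˡ-≤ _ (ℕₚ.*-monoʳ-≤ 2 (weigh-< (allFin k) around-shrinks (∈-allFin c) less)) ⟩
              2 * weigh old (allFin k) + ∣ η - y₀ ∣            ∎
          where
          open ℕₚ.≤-Reasoning
          new old : Fin k → ℕ
          new c = around (x + 7) X′ c ⊓ cap
          old c = around x X c ⊓ cap
          nonzero : 0 < around x X c
          nonzero = ℕₚ.n≢0⇒n>0 (λ z → in-window (inj₁ z))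
          below-cap : around x X c ≤ cap
          below-cap = ℕₚ.m≤n⇒m≤1+n (ℕₚ.≮⇒≥ (λ gt → in-window (inj₂ gt)))
          less : new c < old c
          less = ℕₚ.≤-<-trans (ℕₚ.m⊓n≤m _ cap) (subst (around (x + 7) X′ c <_) (sym (ℕₚ.m≤n⇒m⊓n≡m below-cap))
                   (ℕₚ.≤-<-trans (recede reach X X′ dx c) (ℕₚ.∸-monoʳ-< {around x X c} {1} {0} (s≤s z≤n) nonzero)))
        ... | no none = ℕₚ.+-mono-≤-< (ℕₚ.*-monoʳ-≤ 2 (weigh-≤ (allFin k) around-shrinks)) closes
          where
          clear : ∀ c → around x X c ≡ 0 ⊎ 2 * reach < around x X c
          clear c with (around x X c ℕₚ.≟ 0) ⊎-dec (2 * reach ℕₚ.<? around x X c)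
          ... | yes ok = ok
          ... | no bad = ⊥-elim (none (c , bad))
          distant : ∀ c → ahead x X c ≡ 0 ⊎ limit m < ahead x X c
          distant c with clear c
          ... | inj₁ z = inj₁ (ℕₚ.n≤0⇒n≡0 (subst (ahead x X c ≤_) z (ℕₚ.∸-monoˡ-≤ x (ℕₚ.+-monoʳ-≤ (X c) (ℕₚ.m≤n+m κ (limit m))))))
          ... | inj₂ gt = inj₂ (ℕₚ.+-cancelʳ-< (limit m) _ _ (begin-strict
                limit m + limit m                 ≤⟨ ℕₚ.+-mono-≤ (ℕₚ.m≤m+n (limit m) κ) (ℕₚ.≤-trans (ℕₚ.m≤m+n (limit m) κ) (ℕₚ.m≤m+n reach 0)) ⟩
                2 * reach                         <⟨ gt ⟩
                X c + (limit m + κ) ∸ x           ≡⟨ cong (_∸ x) (solve 3 (λ a b c → a :+ (b :+ c) := a :+ c :+ b) refl (X c) (limit m) κ) ⟩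
                X c + κ + limit m ∸ x             ≤⟨ m+n∸o≤m∸o+n (X c + κ) (limit m) x ⟩
                ahead x X c + limit m             ∎))
            where open ℕₚ.≤-Reasoning
          closes : ∣ η′ - y₀ ∣ < ∣ η - y₀ ∣
          closes with homeward (guide-idle (plan h) distant)
          ... | inj₁ lt = lt
          ... | inj₂ (z , _) = ⊥-elim (unready (ℕₚ.≤-trans (ℕₚ.≤-reflexive z) z≤n , clear))

      -- Up to `z₀` the bound `high` follows from the bound on the potential. Beyond it the robber
      -- goes on only while he is not ready, and the growth of `z` is paid for by the potential.
      hunt-step : z ≤ z₀ ⊎ ¬ Ready x η X → Hunt (x + 7) (suc z) η′ X′ Y′
      hunt-step why = record
        { plan = proj₁ next ; level = level-next ; high = rises why
        ; low = ℕₚ.≤-trans (low h) (ℕₚ.n≤1+n _) }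
        where
        rises : z ≤ z₀ ⊎ ¬ Ready x η X → suc z + potential (x + 7) η′ X′ ≤ suc (z₀ + slack)
        rises (inj₁ le) = ℕₚ.+-mono-≤ (s≤s le) (potential≤ {x + 7} {η′} {X′} (ℕₚ.≤-trans (ℕₚ.m≤m+n _ _) level-next))
        rises (inj₂ unready) = ℕₚ.≤-trans (ℕₚ.≤-reflexive (sym (ℕₚ.+-suc z _))) (ℕₚ.≤-trans (ℕₚ.+-monoʳ-≤ z (potential-falls unready)) (high h))

    hunt-begin : ∀ {x z η X Y} → ∣ η - y₀ ∣ ≤ 1 → z ≤ z₀ → z₀ ≤ z + suc slack →
                 (∀ c → ahead x X c ≡ 0 ⊎ limit m < ahead x X c) → Hunt x z η X Y
    hunt-begin {x} {z} {η} {X} d z≤ z≥ far = record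
      { plan = begin-plan far
      ; level = ℕₚ.+-mono-≤ d (begin-burden {s = λ _ → 0} far)
      ; high = ℕₚ.m≤n⇒m≤1+n (ℕₚ.+-mono-≤ z≤ (potential≤ {x} {η} {X} (ℕₚ.≤-trans d (s≤s z≤n))))
      ; low = z≥ }

    -- In the reversed coordinates the cops far ahead count as passed, and those left at least
    -- `reach` behind come from beyond `limit m`. So a new plan can begin with all cops waiting.
    hunt-turn : ∀ {x z η X Y x̄ z̄ X̄} → Hunt x z η X Y → Ready x η X → z₀ ≤ z → z + z̄ ≡ z₀ + z₀ →
                (∀ c → X c + X̄ c ≡ x + x̄) → Hunt x̄ z̄ η X̄ Y
    hunt-turn {x} {z} {η} {X} {Y} {x̄} {z̄} {X̄} h (d , clear) z≥ zz XX = hunt-begin d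
      (ℕₚ.+-cancelˡ-≤ z₀ _ _ (ℕₚ.≤-trans (ℕₚ.+-monoˡ-≤ z̄ z≥) (ℕₚ.≤-reflexive zz)))
      (ℕₚ.+-cancelˡ-≤ z₀ _ _ (ℕₚ.≤-trans (ℕₚ.≤-reflexive (sym zz)) (ℕₚ.≤-trans (ℕₚ.+-monoˡ-≤ z̄ (ℕₚ.≤-trans (ℕₚ.m≤m+n z _) (high h)))
        (ℕₚ.≤-reflexive (solve 3 (λ a b c → con 1 :+ (a :+ b) :+ c := a :+ (c :+ (con 1 :+ b))) refl z₀ slack z̄)))))
      far
      where
      open ℕₚ.≤-Reasoning
      far : ∀ c → ahead x̄ X̄ c ≡ 0 ⊎ limit m < ahead x̄ X̄ c
      far c with clear c
      ... | inj₁ zero′ = inj₂ (ℕₚ.≤-trans (ℕₚ.≤-trans (ℕₚ.m<m+n (limit m) κ>0) (ℕₚ.m≤m+n reach κ))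
              (ℕₚ.≤-trans (ℕₚ.≤-reflexive (sym (ℕₚ.m+n∸m≡n x̄ (reach + κ)))) (ℕₚ.∸-monoˡ-≤ x̄
                (ℕₚ.≤-trans (ℕₚ.≤-reflexive (sym (ℕₚ.+-assoc x̄ reach κ))) (ℕₚ.+-monoˡ-≤ κ (ℕₚ.+-cancelˡ-≤ (X c) _ _ (begin
                  X c + (x̄ + reach)  ≡⟨ solve 3 (λ a b c → a :+ (b :+ c) := a :+ c :+ b) refl (X c) x̄ reach ⟩
                  X c + reach + x̄    ≤⟨ ℕₚ.+-monoˡ-≤ x̄ (ℕₚ.m∸n≡0⇒m≤n zero′) ⟩
                  x + x̄              ≡⟨ sym (XX c) ⟩
                  X c + X̄ c          ∎)))))))
      ... | inj₂ gt = inj₁ (ℕₚ.m≤n⇒m∸n≡0 (ℕₚ.≤-trans (ℕₚ.+-monoʳ-≤ (X̄ c) (ℕₚ.m≤n+m κ (limit m)))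
              (ℕₚ.+-cancelˡ-≤ x _ _ (begin
                x + (X̄ c + reach)            ≡⟨ solve 3 (λ a b c → a :+ (b :+ c) := a :+ c :+ b) refl x (X̄ c) reach ⟩
                x + reach + X̄ c              ≤⟨ ℕₚ.+-monoˡ-≤ (X̄ c) (ℕₚ.+-cancelʳ-≤ reach _ _ (begin
                  x + reach + reach            ≡⟨ solve 2 (λ a b → a :+ b :+ b := con 2 :* b :+ a) refl x reach ⟩
                  2 * reach + x                ≤⟨ ℕₚ.<⇒≤ (m<n∸o⇒m+o<n (2 * reach) (X c + reach) x gt) ⟩
                  X c + reach                  ∎)) ⟩
                X c + X̄ c                    ≡⟨ XX c ⟩
                x + x̄                        ∎))))

    -- Of m + 1 columns more than limit m apart, one has no cop near it.
    hunt-init : ∀ x₀ (X : Sight) → m * cap ≤ z₀ → ∃[ z ] (z ≤ z₀ × z₀ ≤ z + suc slack ×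
                (∀ c → ahead (7 * z + x₀) X c ≡ 0 ⊎ limit m < ahead (7 * z + x₀) X c))
    hunt-init x₀ X room with Finₚ.any? (λ (i : Fin (suc m)) → Finₚ.all? λ c → clear? i c)
      where
      column : Fin (suc m) → ℕ
      column i = (z₀ ∸ m * cap) + toℕ i * cap
      clear? : ∀ i c → Dec (ahead (7 * column i + x₀) X c ≡ 0 ⊎ limit m < ahead (7 * column i + x₀) X c)
      clear? i c = (ahead (7 * column i + x₀) X c ℕₚ.≟ 0) ⊎-dec (limit m ℕₚ.<? ahead (7 * column i + x₀) X c)
    ... | yes (i , ok) = _ , ℕₚ.≤-trans (ℕₚ.+-monoʳ-≤ (z₀ ∸ m * cap) (ℕₚ.*-monoˡ-≤ cap (ℕₚ.≤-pred (Finₚ.toℕ<n i))))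
            (ℕₚ.≤-reflexive (ℕₚ.m∸n+n≡m room)) ,
          ℕₚ.≤-trans (ℕₚ.≤-reflexive (sym (ℕₚ.m∸n+n≡m room))) (ℕₚ.+-mono-≤ (ℕₚ.m≤m+n _ _)
            (ℕₚ.≤-trans (ℕₚ.m≤m+n (m * cap) _) (ℕₚ.≤-trans (ℕₚ.m≤m+n _ drift) (ℕₚ.n≤1+n _)))) , ok
    ... | no none = ⊥-elim (ℕₚ.<⇒≱ (ℕₚ.n<1+n m) (ℕₚ.≤-trans (Finₚ.injective⇒≤ {f = λ i → proj₁ (blocked i)} (λ {i} {j} → inj i j)) k≤m))
      where
      column : Fin (suc m) → ℕ
      column i = (z₀ ∸ m * cap) + toℕ i * cap
      Clear : Fin (suc m) → Fin k → Set
      Clear i c = ahead (7 * column i + x₀) X c ≡ 0 ⊎ limit m < ahead (7 * column i + x₀) X c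
      blocked : ∀ i → ∃[ c ] ¬ Clear i c
      blocked i = Finₚ.¬∀⟶∃¬ k (Clear i) (λ c → (ahead (7 * column i + x₀) X c ℕₚ.≟ 0) ⊎-dec (limit m ℕₚ.<? ahead (7 * column i + x₀) X c))
        (λ all → none (i , all))
      ordered : ∀ i j c → toℕ i < toℕ j → ¬ Clear i c → ¬ Clear j c → ⊥
      ordered i j c lt ci cj = cj (inj₁ (ℕₚ.m≤n⇒m∸n≡0 (begin
          X c + κ                             ≤⟨ m≤m∸n+n (X c + κ) (7 * column i + x₀) ⟩
          ahead (7 * column i + x₀) X c + (7 * column i + x₀)
                                              ≤⟨ ℕₚ.+-monoˡ-≤ (7 * column i + x₀) (ℕₚ.≤-trans (ℕₚ.≮⇒≥ (λ gt → ci (inj₂ gt))) (ℕₚ.≤-trans (ℕₚ.m≤m+n (limit m) κ)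
                                                   (ℕₚ.≤-trans (ℕₚ.m≤m+n reach (reach + 0)) (ℕₚ.≤-trans (ℕₚ.n≤1+n (2 * reach)) (ℕₚ.m≤n*m cap 7))))) ⟩
          7 * cap + (7 * column i + x₀)       ≡⟨ solve 4 (λ a b c x → con 7 :* c :+ (con 7 :* (a :+ b :* c) :+ x) := con 7 :* (a :+ (con 1 :+ b) :* c) :+ x) refl (z₀ ∸ m * cap) (toℕ i) cap x₀ ⟩
          7 * ((z₀ ∸ m * cap) + suc (toℕ i) * cap) + x₀
                                              ≤⟨ ℕₚ.+-monoˡ-≤ x₀ (ℕₚ.*-monoʳ-≤ 7 (ℕₚ.+-monoʳ-≤ (z₀ ∸ m * cap) (ℕₚ.*-monoˡ-≤ cap lt))) ⟩
          7 * column j + x₀                   ∎)))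
        where open ℕₚ.≤-Reasoning
      inj : ∀ i j → proj₁ (blocked i) ≡ proj₁ (blocked j) → i ≡ j
      inj i j e with ℕₚ.<-cmp (toℕ i) (toℕ j)
      ... | tri≈ _ q _ = Finₚ.toℕ-injective q
      ... | tri< lt _ _ = ⊥-elim (ordered i j _ lt (proj₂ (blocked i)) (subst (λ c → ¬ Clear j c) (sym e) (proj₂ (blocked j))))
      ... | tri> _ _ gt = ⊥-elim (ordered j i _ gt (proj₂ (blocked j)) (subst (λ c → ¬ Clear i c) e (proj₂ (blocked i))))

-- The robber on the folded grid.

module FastRobber where
  open PlayingOut
  open Surfaces
  open CellGadget
  open FoldedGrid hiding (high; low)
  open Dodging
  open Hunting
  open import Data.Fin.Patterns
  open import Data.Vec using (lookup)

  -- Coordinates of the regions of a cell.  Adding 7 (a + b) to xOf and 7 (a - b)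
  -- to yOf - 6 gives functions on all faces that change by at most 2 when a cop
  -- moves, although the robber crosses a cell, changing both by 7, in three moves.
  xOf yOf : Region → ℕ
  xOf (sector 0F q) = lookup (2 ∷ 4 ∷ 5 ∷ 7 ∷ 9 ∷ 10 ∷ 10 ∷ 9 ∷ 7 ∷ 5 ∷ 4 ∷ 2 ∷ 0 ∷ []) q
  xOf (sector 1F q) = lookup (4 ∷ 6 ∷ 7 ∷ 9 ∷ 10 ∷ 10 ∷ 10 ∷ 10 ∷ 9 ∷ 7 ∷ 6 ∷ 4 ∷ 2 ∷ []) q
  xOf (sector 2F q) = lookup (6 ∷ 8 ∷ 8 ∷ 8 ∷ 8 ∷ 8 ∷ 8 ∷ 8 ∷ 8 ∷ 8 ∷ 8 ∷ 6 ∷ 4 ∷ []) q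
  xOf centre = 6
  yOf (sector 0F q) = lookup (7 ∷ 9 ∷ 11 ∷ 10 ∷ 8 ∷ 6 ∷ 4 ∷ 2 ∷ 0 ∷ 1 ∷ 2 ∷ 3 ∷ 5 ∷ []) q
  yOf (sector 1F q) = lookup (7 ∷ 9 ∷ 10 ∷ 9 ∷ 8 ∷ 6 ∷ 4 ∷ 3 ∷ 2 ∷ 2 ∷ 3 ∷ 3 ∷ 5 ∷ []) q
  yOf (sector 2F q) = lookup (6 ∷ 7 ∷ 8 ∷ 7 ∷ 6 ∷ 6 ∷ 6 ∷ 5 ∷ 4 ∷ 4 ∷ 5 ∷ 5 ∷ 6 ∷ []) q
  yOf centre = 6

  Within : ℕ → ℕ → ℕ → Set
  Within d m n = m ≤ n + d × n ≤ m + d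

  within? : ∀ d m n → Dec (Within d m n)
  within? d m n = (m ℕₚ.≤? n + d) ×-dec (n ℕₚ.≤? m + d)

  within-sym : ∀ {d m n} → Within d m n → Within d n m
  within-sym (p , q) = q , p

  within-refl : ∀ {d} m → Within d m m
  within-refl m = ℕₚ.m≤m+n m _ , ℕₚ.m≤m+n m _

  within-trans : ∀ {d e l m n} → Within d l m → Within e m n → Within (d + e) l n
  within-trans {d} {e} {l} {m} {n} (p , q) (p′ , q′) =
    ℕₚ.≤-trans p (ℕₚ.≤-trans (ℕₚ.+-monoˡ-≤ d p′) (ℕₚ.≤-reflexive (trans (ℕₚ.+-assoc n e d) (cong (n +_) (ℕₚ.+-comm e d))))) ,
    ℕₚ.≤-trans q′ (ℕₚ.≤-trans (ℕₚ.+-monoˡ-≤ e q) (ℕₚ.≤-reflexive (ℕₚ.+-assoc l d e)))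

  within-+ : ∀ {d m n} c → Within d m n → Within d (c + m) (c + n)
  within-+ {d} {m} {n} c (p , q) = ℕₚ.≤-trans (ℕₚ.+-monoʳ-≤ c p) (ℕₚ.≤-reflexive (sym (ℕₚ.+-assoc c n d))) ,
    ℕₚ.≤-trans (ℕₚ.+-monoʳ-≤ c q) (ℕₚ.≤-reflexive (sym (ℕₚ.+-assoc c m d)))

  within-∣-∣ : ∀ {d m n} c → Within d m n → Within d ∣ m - c ∣ ∣ n - c ∣
  within-∣-∣ c (p , q) = ∣-∣-shift p q , ∣-∣-shift q p

  abstract
    x≤10 : ∀ f → xOf f + (10 ∸ xOf f) ≡ 10
    x≤10 centre = refl
    x≤10 (sector l q) = toWitness {a? = Finₚ.all? λ l → Finₚ.all? λ q → xOf (sector l q) + (10 ∸ xOf (sector l q)) ℕₚ.≟ 10} tt l q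

    y≤12 : ∀ f → Within 6 (yOf f) 6
    y≤12 centre = toWitness {a? = within? 6 (yOf centre) 6} tt
    y≤12 (sector l q) = toWitness {a? = Finₚ.all? λ l → Finₚ.all? λ q → within? 6 (yOf (sector l q)) 6} tt l q

  Beside : Region → Region → Set
  Beside f g = Within 2 (xOf f) (xOf g) × Within 2 (yOf f) (yOf g)

  beside? : ∀ f g → Dec (Beside f g)
  beside? f g = within? 2 (xOf f) (xOf g) ×-dec within? 2 (yOf f) (yOf g)

  abstract
    beside-spoke : ∀ l q → Beside (sector l (before q)) (sector l q)
    beside-spoke = toWitness {a? = Finₚ.all? λ l → Finₚ.all? λ q → beside? (sector l (before q)) (sector l q)} tt

    beside-ring : ∀ l q → Beside (region (ahead l q)) (sector l q)
    beside-ring = toWitness {a? = Finₚ.all? λ l → Finₚ.all? λ q → beside? (region (ahead l q)) (sector l q)} tt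

  shore : Side → Fin 3 → Region
  shore s k = sector 0F (kerb s k)

  abstract
    beside-0 : ∀ k → Within 2 (7 + xOf (shore 0F k)) (xOf (shore 2F (opposite k))) × Within 2 (yOf (shore 0F k)) (7 + yOf (shore 2F (opposite k)))
    beside-0 = toWitness {a? = Finₚ.all? λ k → within? 2 (7 + xOf (shore 0F k)) (xOf (shore 2F (opposite k)))
      ×-dec within? 2 (yOf (shore 0F k)) (7 + yOf (shore 2F (opposite k)))} tt

    beside-1 : ∀ k → Within 2 (xOf (shore 1F k)) (7 + xOf (shore 3F (opposite k))) × Within 2 (yOf (shore 1F k)) (7 + yOf (shore 3F (opposite k)))
    beside-1 = toWitness {a? = Finₚ.all? λ k → within? 2 (xOf (shore 1F k)) (7 + xOf (shore 3F (opposite k)))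
      ×-dec within? 2 (yOf (shore 1F k)) (7 + yOf (shore 3F (opposite k)))} tt

    beside-fold-0 : ∀ k → Within 2 (xOf (shore 0F k)) (xOf (shore 3F (opposite k))) × Within 2 (yOf (shore 0F k) + yOf (shore 3F (opposite k))) 12
    beside-fold-0 = toWitness {a? = Finₚ.all? λ k → within? 2 (xOf (shore 0F k)) (xOf (shore 3F (opposite k)))
      ×-dec within? 2 (yOf (shore 0F k) + yOf (shore 3F (opposite k))) 12} tt

    beside-fold-1 : ∀ k → Within 2 (xOf (shore 1F k)) (xOf (shore 2F (opposite k))) × Within 2 (yOf (shore 1F k) + yOf (shore 2F (opposite k))) 12
    beside-fold-1 = toWitness {a? = Finₚ.all? λ k → within? 2 (xOf (shore 1F k)) (xOf (shore 2F (opposite k)))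
      ×-dec within? 2 (yOf (shore 1F k) + yOf (shore 2F (opposite k))) 12} tt

  module Coordinates (n : ℕ) where
    open +-*-Solver

    Tile : Set
    Tile = Cell {n} × Region

    -- The fold transposes cells, so `X` depends on the sum of the coordinates and `Y` on the
    -- absolute value of their difference. `X̄` is `X` seen from the opposite end, where 10 is the
    -- width of `xOf`; 6 is the middle of the range of `yOf`.
    X X̄ Y : Tile → ℕ
    X ((a , b) , f) = 7 * (lo a + lo b) + xOf f
    X̄ ((a , b) , f) = 7 * (hi a + hi b) + (10 ∸ xOf f)
    Y ((a , b) , f) = ∣ (7 * lo a + yOf f) - (7 * lo b + 6) ∣

    whole : ∀ (p : Pos n) → lo p + hi p ≡ n
    whole (pos a b e) = recompute (a + b ℕₚ.≟ n) e

    X+X̄ : ∀ t → X t + X̄ t ≡ 7 * (n + n) + 10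
    X+X̄ ((a , b) , f) = trans
      (solve 6 (λ a b a′ b′ x y → con 7 :* (a :+ b) :+ x :+ (con 7 :* (a′ :+ b′) :+ y) := con 7 :* ((a :+ a′) :+ (b :+ b′)) :+ (x :+ y))
        refl (lo a) (lo b) (hi a) (hi b) (xOf f) (10 ∸ xOf f))
      (cong₂ (λ u v → 7 * u + v) (cong₂ _+_ (whole a) (whole b)) (x≤10 f))

    Adj : Tile → Tile → Set
    Adj t u = Within 2 (X t) (X u) × Within 2 (Y t) (Y u)

    adj-sym : ∀ t u → Adj t u → Adj u t
    adj-sym t u (p , q) = within-sym p , within-sym q

    adj-inside : ∀ c f g → Beside f g → Adj (c , f) (c , g)
    adj-inside (a , b) f g (p , q) = within-+ (7 * (lo a + lo b)) p , within-∣-∣ (7 * lo b + 6) (within-+ (7 * lo a) q)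

    -- On the seam the sign of a - b changes, so there it is the sums of the y
    -- offsets that have to be close to 2 · 6.
    mirror : ∀ a b u v → Within 2 (u + v) 12 → Within 2 ∣ (7 * a + u) - (7 * b + 6) ∣ ∣ (7 * b + v) - (7 * a + 6) ∣
    mirror a b u v w = subst₂ (Within 2) left right (within-∣-∣ (7 * b + 6 + v) (within-+ (7 * a) w))
      where
      left : ∣ (7 * a + (u + v)) - (7 * b + 6 + v) ∣ ≡ ∣ (7 * a + u) - (7 * b + 6) ∣
      left = trans (cong₂ ∣_-_∣ (trans (sym (ℕₚ.+-assoc (7 * a) u v)) (ℕₚ.+-comm (7 * a + u) v)) (ℕₚ.+-comm (7 * b + 6) v))
        (ℕₚ.∣m+n-m+o∣≡∣n-o∣ v (7 * a + u) (7 * b + 6))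
      right : ∣ (7 * a + 12) - (7 * b + 6 + v) ∣ ≡ ∣ (7 * b + v) - (7 * a + 6) ∣
      right = trans (cong₂ ∣_-_∣ (solve 1 (λ a → a :+ con 12 := con 6 :+ (a :+ con 6)) refl (7 * a))
                                 (solve 2 (λ b v → b :+ con 6 :+ v := con 6 :+ (b :+ v)) refl (7 * b) v))
        (trans (ℕₚ.∣m+n-m+o∣≡∣n-o∣ 6 (7 * a + 6) (7 * b + v)) (ℕₚ.∣-∣-comm (7 * a + 6) (7 * b + v)))

    adj-fold : ∀ (a b : Pos n) f g → Within 2 (xOf f) (xOf g) → Within 2 (yOf f + yOf g) 12 → Adj ((a , b) , f) ((b , a) , g)
    adj-fold a b f g p q = subst (λ w → Within 2 (7 * (lo a + lo b) + xOf f) (7 * w + xOf g)) (ℕₚ.+-comm (lo a) (lo b)) (within-+ (7 * (lo a + lo b)) p) ,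
      mirror (lo a) (lo b) (yOf f) (yOf g) q

    adj-01 : ∀ c s k → (s ≡ 0F ⊎ s ≡ 1F) → Adj (face (c , road s k)) (face (α (c , road s k)))
    adj-01 (a , pos zero b′ e) .0F k (inj₁ refl) = adj-fold a (pos zero b′ e) (shore 0F k) (shore 3F (opposite k)) (proj₁ (beside-fold-0 k)) (proj₂ (beside-fold-0 k))
    adj-01 (a , pos (suc b) b′ e) .0F k (inj₁ refl) =
      subst (λ w → Within 2 w (7 * (lo a + b) + xOf (shore 2F (opposite k)))) (solve 3 (λ a b x → con 7 :* (a :+ b) :+ (con 7 :+ x) := con 7 :* (a :+ (con 1 :+ b)) :+ x) refl (lo a) b (xOf (shore 0F k)))
        (within-+ (7 * (lo a + b)) (proj₁ (beside-0 k))) ,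
      subst₂ (λ u v → Within 2 ∣ (7 * lo a + yOf (shore 0F k)) - u ∣ v) (solve 1 (λ b → con 7 :+ (con 7 :* b :+ con 6) := con 7 :* (con 1 :+ b) :+ con 6) refl b)
        (trans (cong (λ w → ∣ w - (7 + (7 * b + 6)) ∣) (solve 2 (λ a y → con 7 :* a :+ (con 7 :+ y) := con 7 :+ (con 7 :* a :+ y)) refl (lo a) (yOf (shore 2F (opposite k)))))
          (ℕₚ.∣m+n-m+o∣≡∣n-o∣ 7 (7 * lo a + yOf (shore 2F (opposite k))) (7 * b + 6)))
        (within-∣-∣ (7 + (7 * b + 6)) (within-+ (7 * lo a) (proj₂ (beside-0 k))))
    adj-01 (pos a zero e , b) .1F k (inj₂ refl) = adj-fold (pos a zero e) b (shore 1F k) (shore 2F (opposite k)) (proj₁ (beside-fold-1 k)) (proj₂ (beside-fold-1 k))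
    adj-01 (pos a (suc a′) e , b) .1F k (inj₂ refl) =
      subst (Within 2 (7 * (a + lo b) + xOf (shore 1F k))) (solve 3 (λ a b x → con 7 :* (a :+ b) :+ (con 7 :+ x) := con 7 :* (con 1 :+ a :+ b) :+ x) refl a (lo b) (xOf (shore 3F (opposite k))))
        (within-+ (7 * (a + lo b)) (proj₁ (beside-1 k))) ,
      subst (λ w → Within 2 ∣ (7 * a + yOf (shore 1F k)) - (7 * lo b + 6) ∣ ∣ w - (7 * lo b + 6) ∣) (solve 2 (λ a y → con 7 :* a :+ (con 7 :+ y) := con 7 :* (con 1 :+ a) :+ y) refl a (yOf (shore 3F (opposite k))))
        (within-∣-∣ (7 * lo b + 6) (within-+ (7 * a) (proj₂ (beside-1 k))))

    adj-back : ∀ d → Adj (face (α d)) (face (α (α d))) → Adj (face d) (face (α d))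
    adj-back d p = subst (λ e → Adj (face e) (face (α d))) (α-invol d) (adj-sym (face (α d)) (face (α (α d))) p)

    adj : ∀ d → Adj (face d) (face (α d))
    adj (c , inward l q) = adj-inside c (sector l (before q)) (sector l q) (beside-spoke l q)
    adj (c , outward l q) = adj-sym (c , sector l (before q)) (c , sector l q) (adj-inside c (sector l (before q)) (sector l q) (beside-spoke l q))
    adj (c , ahead l q) = adj-inside c (region (ahead l q)) (sector l q) (beside-ring l q)
    adj (c , back l q) = adj-sym (c , region (ahead l q)) (c , sector l q) (adj-inside c (region (ahead l q)) (sector l q) (beside-ring l q))
    adj (c , road 0F k) = adj-01 c 0F k (inj₁ refl)
    adj (c , road 1F k) = adj-01 c 1F k (inj₂ refl)
    adj d@((a , pos b zero e) , road 2F k) = adj-back d (adj-01 (proj₁ (α d)) 1F (opposite k) (inj₂ refl))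
    adj d@((a , pos b (suc b′) e) , road 2F k) = adj-back d (adj-01 (proj₁ (α d)) 0F (opposite k) (inj₁ refl))
    adj d@((pos zero a′ e , b) , road 3F k) = adj-back d (adj-01 (proj₁ (α d)) 0F (opposite k) (inj₁ refl))
    adj d@((pos (suc a) a′ e , b) , road 3F k) = adj-back d (adj-01 (proj₁ (α d)) 1F (opposite k) (inj₂ refl))

    X̄-within : ∀ {d} t u → Within d (X t) (X u) → Within d (X̄ t) (X̄ u)
    X̄-within {d} t u (p , q) = go t u q , go u t p
      where
      go : ∀ t u → X u ≤ X t + d → X̄ t ≤ X̄ u + d
      go t u le = ℕₚ.+-cancelˡ-≤ (X t) _ _ (begin
        X t + X̄ t          ≡⟨ trans (X+X̄ t) (sym (X+X̄ u)) ⟩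
        X u + X̄ u          ≤⟨ ℕₚ.+-monoˡ-≤ (X̄ u) le ⟩
        X t + d + X̄ u      ≡⟨ trans (ℕₚ.+-assoc (X t) d (X̄ u)) (cong (X t +_) (ℕₚ.+-comm d (X̄ u))) ⟩
        X t + (X̄ u + d)    ∎)
        where open ℕₚ.≤-Reasoning

    coord : Bool → Tile → ℕ
    coord true = X
    coord false = X̄

    diagonal : Bool → Cell {n} → ℕ
    diagonal true (a , b) = lo a + lo b
    diagonal false (a , b) = hi a + hi b

    column : Bool → Cell {n} → ℕ
    column o c = 7 * diagonal o c + 5

    diagonals : ∀ o c → diagonal o c + diagonal (not o) c ≡ n + n
    diagonals true (a , b) = trans (solve 4 (λ a b a′ b′ → a :+ b :+ (a′ :+ b′) := (a :+ a′) :+ (b :+ b′)) refl (lo a) (lo b) (hi a) (hi b))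
      (cong₂ _+_ (whole a) (whole b))
    diagonals false c = trans (ℕₚ.+-comm (diagonal false c) (diagonal true c)) (diagonals true c)

    columns : ∀ o c t → coord o t + coord (not o) t ≡ column o c + column (not o) c
    columns o c t = trans (both o) (sym (trans
        (solve 2 (λ a b → con 7 :* a :+ con 5 :+ (con 7 :* b :+ con 5) := con 7 :* (a :+ b) :+ con 10) refl (diagonal o c) (diagonal (not o) c))
        (cong (λ w → 7 * w + 10) (diagonals o c))))
      where
      both : ∀ o → coord o t + coord (not o) t ≡ 7 * (n + n) + 10
      both true = X+X̄ t
      both false = trans (ℕₚ.+-comm (X̄ t) (X t)) (X+X̄ t)

    coord-within : ∀ {d} o t u → Within d (X t) (X u) → Within d (coord o t) (coord o u)
    coord-within true t u w = w
    coord-within false t u w = X̄-within t u w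

    _↦_ : ℕ → Bool → ℕ
    η ↦ true = suc η
    η ↦ false = η ∸ 1

    Slope : ℕ → Cell {n} → Set
    Slope η (a , b) = lo a ≡ η + lo b

    -- One crossing of a cell: the three stops all lie on the boundary of host.
    record Trip (c : Cell {n}) (o b : Bool) (η : ℕ) : Set where
      field
        host dest : Cell {n}
        stop      : Fin 3 → Side × Fin 3
        departs   : at host (rim (proj₁ (stop 0F)) (proj₂ (stop 0F))) ≡ nodeW c
        hop₁      : Joined (at host (rim (proj₁ (stop 0F)) (proj₂ (stop 0F)))) (at host (rim (proj₁ (stop 1F)) (proj₂ (stop 1F))))
        hop₂      : Joined (at host (rim (proj₁ (stop 1F)) (proj₂ (stop 1F)))) (at host (rim (proj₁ (stop 2F)) (proj₂ (stop 2F))))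
        hop₃      : Joined (at host (rim (proj₁ (stop 2F)) (proj₂ (stop 2F)))) (nodeW dest)
        host-z    : Within 1 (diagonal o host) (diagonal o c)
        host-η    : ∃[ θ ] (Slope θ host × Within 1 θ η)
        dest-z    : diagonal o dest ≡ suc (diagonal o c)
        dest-η    : Slope (η ↦ b) dest

    backwards : ∀ {v w : Vert {n}} → Joined v w → Joined w v
    backwards (d , p , q) = α d , q , trans (cong tail (α-invol d)) p

    next₁ : ∀ {x y} → x ≡ suc y → Within 1 x y
    next₁ {y = y} refl = ℕₚ.≤-reflexive (ℕₚ.+-comm 1 y) , ℕₚ.≤-trans (ℕₚ.n≤1+n y) (ℕₚ.m≤m+n (suc y) 1)

    towards₁ : ∀ b η → Within 1 (η ↦ b) η
    towards₁ true η = next₁ refl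
    towards₁ false η = ℕₚ.≤-trans (ℕₚ.m∸n≤m η 1) (ℕₚ.m≤m+n η 1) , m≤m∸n+n η 1

    -- Exactly one of `a`, `b` changes by one, so `diagonal` and `η` change by one each, and the
    -- four combinations of `o` and `b` are the four directions. Running backwards, the boundary
    -- walked along is that of the destination, which is then the `host`.
    trip : ∀ o b c {η} → Slope η c → 0 < η → 0 < hi (proj₁ c) → 0 < lo (proj₂ c) → Trip c o b η
    trip true true c@(pos a (suc a′) e , b) {η} sl _ _ _ = record
      { host = c ; dest = pos (suc a) a′ (up a a′ e) , b
      ; stop = λ { 0F → 0F , 0F ; 1F → 0F , 1F ; 2F → 0F , 2F } ; departs = refl
      ; hop₁ = joined c (road 0F 0F) ; hop₂ = joined c (road 0F 1F) ; hop₃ = joined c (road 0F 2F)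
      ; host-z = within-refl _ ; host-η = η , sl , within-refl η
      ; dest-z = refl ; dest-η = cong suc sl }
    trip true false c@(a , pos b (suc b′) e) {suc η} sl _ _ _ = record
      { host = c ; dest = a , pos (suc b) b′ (up b b′ e)
      ; stop = λ { 0F → 0F , 0F ; 1F → 3F , 2F ; 2F → 3F , 1F } ; departs = refl
      ; hop₁ = backwards (joined c (road 3F 2F)) ; hop₂ = backwards (joined c (road 3F 1F)) ; hop₃ = backwards (joined c (road 3F 0F))
      ; host-z = within-refl _ ; host-η = suc η , sl , within-refl (suc η)
      ; dest-z = ℕₚ.+-suc (lo a) b ; dest-η = trans sl (sym (ℕₚ.+-suc η b)) }
    trip true false c@(a@(pos al ah e) , pos b zero f) {suc η} sl _ 0<ah _ = ⊥-elim (ℕₚ.<⇒≱ {n} {al}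
      (subst (n <_) (sym sl) (s≤s (ℕₚ.≤-trans (ℕₚ.≤-reflexive (trans (sym (whole (pos b zero f))) (ℕₚ.+-identityʳ b))) (ℕₚ.m≤n+m b η))))
      (ℕₚ.≤-trans (ℕₚ.m≤m+n al ah) (ℕₚ.≤-reflexive (whole a))))
    trip false true c@(a , pos (suc b) b′ e) {η} sl _ _ _ = record
      { host = h ; dest = h
      ; stop = λ { 0F → 3F , 0F ; 1F → 3F , 1F ; 2F → 3F , 2F } ; departs = refl
      ; hop₁ = joined h (road 3F 0F) ; hop₂ = joined h (road 3F 1F) ; hop₃ = joined h (road 3F 2F)
      ; host-z = next₁ (ℕₚ.+-suc (hi a) b′) ; host-η = suc η , trans sl (ℕₚ.+-suc η b) , towards₁ true η
      ; dest-z = ℕₚ.+-suc (hi a) b′ ; dest-η = trans sl (ℕₚ.+-suc η b) }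
      where
      h : Cell {n}
      h = a , pos b (suc b′) (down b b′ e)
    trip false false c@(pos (suc a) a′ e , b) {suc η} sl _ _ _ = record
      { host = h ; dest = h
      ; stop = λ { 0F → 1F , 0F ; 1F → 0F , 2F ; 2F → 0F , 1F } ; departs = refl
      ; hop₁ = backwards (joined h (road 0F 2F)) ; hop₂ = backwards (joined h (road 0F 1F)) ; hop₃ = backwards (joined h (road 0F 0F))
      ; host-z = next₁ refl ; host-η = η , ℕₚ.suc-injective sl , towards₁ false (suc η)
      ; dest-z = refl ; dest-η = ℕₚ.suc-injective sl }
      where
      h : Cell {n}
      h = pos a (suc a′) (down a a′ e) , b

    host-x : ∀ o c f → Within 5 (coord o (c , f)) (column o c)
    host-x o c f = close o
      where
      bounded : ∀ u v → u + v ≡ 10 → ∀ w → Within 5 (w + u) (w + 5)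
      bounded u v e w = ℕₚ.≤-trans (ℕₚ.+-monoʳ-≤ w (ℕₚ.≤-trans (ℕₚ.m≤m+n u v) (ℕₚ.≤-reflexive e))) (ℕₚ.≤-reflexive (sym (ℕₚ.+-assoc w 5 5))) ,
        ℕₚ.+-monoˡ-≤ 5 (ℕₚ.m≤m+n w u)
      close : ∀ o → Within 5 (coord o (c , f)) (column o c)
      close true = bounded (xOf f) (10 ∸ xOf f) (x≤10 f) (7 * diagonal true c)
      close false = bounded (10 ∸ xOf f) (xOf f) (trans (ℕₚ.+-comm (10 ∸ xOf f) (xOf f)) (x≤10 f)) (7 * diagonal false c)

    host-y : ∀ c f {θ} → Slope θ c → Within 6 (Y (c , f)) (7 * θ)
    host-y (a , b) f {θ} sl = subst₂ (Within 6) (cong (λ w → ∣ (7 * w + yOf f) - (7 * lo b + 6) ∣) (sym sl)) level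
      (within-∣-∣ (7 * lo b + 6) (within-+ (7 * (θ + lo b)) (y≤12 f)))
      where
      level : ∣ (7 * (θ + lo b) + 6) - (7 * lo b + 6) ∣ ≡ 7 * θ
      level = trans (cong (λ w → ∣ w - (7 * lo b + 6) ∣) (solve 2 (λ t b → con 7 :* (t :+ b) :+ con 6 := con 7 :* b :+ con 6 :+ con 7 :* t) refl θ (lo b)))
        (trans (ℕₚ.∣-∣-comm (7 * lo b + 6 + 7 * θ) (7 * lo b + 6)) (ℕₚ.∣m-m+n∣≡n (7 * lo b + 6) (7 * θ)))

    within-7 : ∀ {u v} → Within 1 u v → Within 7 (7 * u) (7 * v)
    within-7 {u} {v} (p , q) = ℕₚ.≤-trans (ℕₚ.*-monoʳ-≤ 7 p) (ℕₚ.≤-reflexive (ℕₚ.*-distribˡ-+ 7 v 1)) ,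
      ℕₚ.≤-trans (ℕₚ.*-monoʳ-≤ 7 q) (ℕₚ.≤-reflexive (ℕₚ.*-distribˡ-+ 7 u 1))

  module Scale (m : ℕ) where
    -- The value 20 for `κ` exceeds the two distances in `hidden`, namely 6 + 5 + 7 = 18 and 6 + 6 +
    -- 7 = 19: cop moves during one trip, position within the host cell, and host against starting
    -- cell.
    open Evading 20 using (window; limit)

    drift reach cap slack y₀ extent : ℕ
    drift = suc (window m)
    reach = limit m + 20
    cap = suc (2 * reach)
    slack = 2 * (m * cap) + drift
    y₀ = suc drift
    extent = suc slack + (y₀ + drift)

  module Board (m size : ℕ) (roomy : Scale.extent m < size) where
    open Scale m
    open Coordinates size
    open Surface (grid size) using (graph; encode; ⌜_⌝ᵛ; ⌞_⌟ᵛ; ⌜_⌝ᵈ; ⌞_⌟ᵈ; ⌜_⌝ᶠ; ⌞_⌟ᶠ; ⌞⌜_⌝⌟ᵈ; ⌞⌜_⌝⌟ᶠ; ⌜⌞_⌟⌝ᵈ)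

    module Flight (k : ℕ) (k≤m : k ≤ m) where
      open Evading 20 using (limit)
      open Chasing 20 (s≤s z≤n) k m k≤m y₀ size ℕₚ.≤-refl hiding (drift; reach; cap; slack; size)
      open Evading.Cops 20 k m k≤m using (Plan; unseen; Sight)
      open Hunt
      open Game graph k using (Config; Captured; ValidCopMove; ValidRobberMove)
      open Strategies graph k using (copsLose)
      open PlaneGraph graph using (VAdj; FAdj; Incident)
      open +-*-Solver

      xs : Bool → Config → Sight
      xs o c i = coord o ⌞ c i ⌟ᶠ
      ys : Config → Sight
      ys c i = Y ⌞ c i ⌟ᶠ

      Near : ℕ → Config → Config → Set
      Near d c c′ = ∀ i → Within d (X ⌞ c i ⌟ᶠ) (X ⌞ c′ i ⌟ᶠ) × Within d (ys c i) (ys c′ i)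

      near-move : ∀ {c c′} → ValidCopMove c c′ → Near 2 c c′
      near-move {c} {c′} ok i = go (ok i)
        where
        go : ∀ {f g} → (g ≡ f) ⊎ FAdj f g → Within 2 (X ⌞ f ⌟ᶠ) (X ⌞ g ⌟ᶠ) × Within 2 (Y ⌞ f ⌟ᶠ) (Y ⌞ g ⌟ᶠ)
        go {f} (inj₁ refl) = within-refl (X ⌞ f ⌟ᶠ) , within-refl (Y ⌞ f ⌟ᶠ)
        go (inj₂ (d , refl , refl)) = subst₂ Adj (sym (⌞⌜ face ⌞ d ⌟ᵈ ⌝⌟ᶠ))
          (trans (cong face (sym (⌞⌜ α ⌞ d ⌟ᵈ ⌝⌟ᵈ))) (sym (⌞⌜ face ⌞ ⌜ α ⌞ d ⌟ᵈ ⌝ᵈ ⌟ᵈ ⌝⌟ᶠ))) (adj ⌞ d ⌟ᵈ)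

      near-trans : ∀ {d e a b c} → Near d a b → Near e b c → Near (d + e) a c
      near-trans p q i = within-trans (proj₁ (p i)) (proj₁ (q i)) , within-trans (proj₂ (p i)) (proj₂ (q i))

      record Camp (c₀ : Config) : Set where
        field
          o     : Bool
          cell  : Cell {size}
          η     : ℕ
          slope : Slope η cell
          hunt  : Hunt (column o cell) (diagonal o cell) η (xs o c₀) (ys c₀)
          why   : diagonal o cell ≤ size ⊎ ¬ Ready (column o cell) η (xs o c₀)
          route : Trip cell o (heading hunt) η

      near-size : ∀ o c {η X Y} → Hunt (column o c) (diagonal o c) η X Y →
                  diagonal true c ≤ suc (size + slack) × size ≤ diagonal true c + suc slack
      near-size true c h = ℕₚ.≤-trans (ℕₚ.m≤m+n _ _) (high h) , low h
      near-size false c h =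
        ℕₚ.+-cancelʳ-≤ (diagonal false c) _ _ (ℕₚ.≤-trans (ℕₚ.≤-reflexive (diagonals true c))
          (ℕₚ.≤-trans (ℕₚ.+-monoʳ-≤ size (low h)) (ℕₚ.≤-reflexive (solve 3 (λ a b d → a :+ (d :+ (con 1 :+ b)) := con 1 :+ (a :+ b) :+ d) refl size slack (diagonal false c))))) ,
        ℕₚ.+-cancelˡ-≤ size _ _ (ℕₚ.≤-trans (ℕₚ.≤-reflexive (sym (diagonals true c)))
          (ℕₚ.≤-trans (ℕₚ.+-monoʳ-≤ (diagonal true c) (ℕₚ.≤-trans (ℕₚ.m≤m+n _ _) (high h)))
            (ℕₚ.≤-reflexive (solve 3 (λ a b d → d :+ (con 1 :+ (a :+ b)) := a :+ (d :+ (con 1 :+ b))) refl size slack (diagonal true c)))))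

      η≤ : ∀ {x z η X Y} → Hunt x z η X Y → η ≤ y₀ + drift
      η≤ {η = η} h = ℕₚ.≤-trans (ℕₚ.m≤n+∣m-n∣ η y₀) (ℕₚ.+-monoʳ-≤ y₀ (level′ h))

      room : ∀ {η} → η ≤ y₀ + drift → suc slack + η < size
      room le = ℕₚ.≤-<-trans (ℕₚ.+-monoʳ-≤ (suc slack) le) roomy

      -- The diagonal stays within `suc slack` of the middle and `η` below `y₀ + drift`. Reaching an
      -- edge of the board, `hi a = 0` or `lo b = 0`, would make the board no larger than the sum of
      -- these, against `roomy`; so a trip is always possible.
      camp : ∀ {c₀} o cell η → Slope η cell → (h : Hunt (column o cell) (diagonal o cell) η (xs o c₀) (ys c₀)) →
             diagonal o cell ≤ size ⊎ ¬ Ready (column o cell) η (xs o c₀) → Camp c₀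
      camp o cell@(a , b) η sl h why = record { o = o ; cell = cell ; η = η ; slope = sl ; hunt = h ; why = why
        ; route = trip o (heading h) cell sl (positive {η} (level′ h)) (ℕₚ.n≢0⇒n>0 left) (ℕₚ.n≢0⇒n>0 right) }
        where
        tight : ∀ {w} → size ≤ η + w → w ≤ suc slack → ⊥
        tight {w} le w≤ = ℕₚ.<⇒≱ (room (η≤ h)) (ℕₚ.≤-trans le (ℕₚ.≤-trans (ℕₚ.≤-reflexive (ℕₚ.+-comm η w)) (ℕₚ.+-monoˡ-≤ η w≤)))
        left : hi a ≢ 0
        left z = tight {suc slack} (ℕₚ.≤-trans (ℕₚ.≤-reflexive (sym full)) (ℕₚ.≤-trans (ℕₚ.≤-reflexive sl) (ℕₚ.+-monoʳ-≤ η b≤))) ℕₚ.≤-refl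
          where
          full : lo a ≡ size
          full = trans (sym (ℕₚ.+-identityʳ (lo a))) (trans (cong (lo a +_) (sym z)) (whole a))
          b≤ : lo b ≤ suc slack
          b≤ = ℕₚ.+-cancelˡ-≤ size _ _ (ℕₚ.≤-trans (ℕₚ.≤-reflexive (cong (_+ lo b) (sym full)))
            (ℕₚ.≤-trans (proj₁ (near-size o cell h)) (ℕₚ.≤-reflexive (sym (ℕₚ.+-suc size slack)))))
        right : lo b ≢ 0
        right z = tight {suc slack} (ℕₚ.≤-trans (proj₂ (near-size o cell h)) (ℕₚ.≤-reflexive (cong (_+ suc slack)
          (trans (cong (lo a +_) z) (trans (ℕₚ.+-identityʳ (lo a)) (trans sl (trans (cong (η +_) z) (ℕₚ.+-identityʳ η)))))))) ℕₚ.≤-refl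

      settle-in : ∀ {c₀} o cell η → Slope η cell → Hunt (column o cell) (diagonal o cell) η (xs o c₀) (ys c₀) →
                  Σ (Camp c₀) λ C → Camp.cell C ≡ cell
      settle-in {c₀} o cell η sl h = pick (diagonal o cell ℕₚ.≤? size) (ready? (column o cell) η (xs o c₀))
        where
        pick : Dec (diagonal o cell ≤ size) → Dec (Ready (column o cell) η (xs o c₀)) → Σ (Camp c₀) λ C → Camp.cell C ≡ cell
        pick (yes le) _ = camp o cell η sl h (inj₁ le) , refl
        pick (no gt) (no unready) = camp o cell η sl h (inj₂ unready) , refl
        pick (no gt) (yes ready) = camp (not o) cell η sl turned (inj₁ within) , refl
          where
          turned : Hunt (column (not o) cell) (diagonal (not o) cell) η (xs (not o) c₀) (ys c₀)
          turned = hunt-turn h ready (ℕₚ.≰⇒≥ gt) (diagonals o cell) (λ i → columns o cell ⌞ c₀ i ⌟ᶠ)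
          within : diagonal (not o) cell ≤ size
          within = ℕₚ.+-cancelˡ-≤ size _ _ (ℕₚ.≤-trans (ℕₚ.+-monoˡ-≤ (diagonal (not o) cell) (ℕₚ.≰⇒≥ gt)) (ℕₚ.≤-reflexive (diagonals o cell)))

      module _ {c₀ : Config} (C : Camp c₀) where
        open Camp C
        open Trip route

        spot : Fin 3 → Vert {size}
        spot t = at host (rim (proj₁ (stop t)) (proj₂ (stop t)))

        -- All stops of a trip lie on the boundary of one cell, so a capture needs a cop on a face
        -- of that cell. Such a cop is close to the robber in both coordinates even when compared
        -- with the start of the trip, which the plan excludes.
        hidden : ∀ t {d c} → d ≤ 6 → Near d c c₀ → ¬ Captured c ⌜ spot t ⌝ᵛ
        hidden t {d} {c} d≤6 near cap = blocked (unseen (plan hunt) i)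
          where
          dart₀ = host , road (proj₁ (stop t)) (proj₂ (stop t))
          incident : Incident ⌜ spot t ⌝ᵛ ⌜ face dart₀ ⌝ᶠ
          incident = inj₁ (⌜ dart₀ ⌝ᵈ , cong (λ d → ⌜ tail d ⌝ᵛ) ⌞⌜ dart₀ ⌝⌟ᵈ , cong (λ d → ⌜ face d ⌝ᶠ) ⌞⌜ dart₀ ⌝⌟ᵈ)
          i = proj₁ (cap _ incident)
          there′ : ⌞ c i ⌟ᶠ ≡ face dart₀
          there′ = trans (cong ⌞_⌟ᶠ (proj₂ (cap _ incident))) ⌞⌜ face dart₀ ⌝⌟ᶠ
          x-near : Within (6 + (5 + 7)) (xs o c₀ i) (column o cell)
          x-near = within-trans (widen (coord-within o _ _ (within-sym (proj₁ (near i)))))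
            (within-trans (subst (λ u → Within 5 (coord o u) (column o host)) (sym there′) (host-x o host (proj₂ (face dart₀))))
              (shift (within-7 host-z)))
            where
            widen : ∀ {u v} → Within d u v → Within 6 u v
            widen {u} {v} (p , q) = ℕₚ.≤-trans p (ℕₚ.+-monoʳ-≤ v d≤6) , ℕₚ.≤-trans q (ℕₚ.+-monoʳ-≤ u d≤6)
            shift : ∀ {u v} → Within 7 u v → Within 7 (u + 5) (v + 5)
            shift {u} {v} w = subst₂ (Within 7) (ℕₚ.+-comm 5 u) (ℕₚ.+-comm 5 v) (within-+ 5 w)
          y-near : Within (6 + (6 + 7)) (ys c₀ i) (7 * η)
          y-near = within-trans (widen (within-sym (proj₂ (near i))))
            (within-trans (subst (λ u → Within 6 (Y u) (7 * proj₁ host-η)) (sym there′) (host-y host (proj₂ (face dart₀)) (proj₁ (proj₂ host-η))))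
              (within-7 (proj₂ (proj₂ host-η))))
            where
            widen : ∀ {u v} → Within d u v → Within 6 u v
            widen {u} {v} (p , q) = ℕₚ.≤-trans p (ℕₚ.+-monoʳ-≤ v d≤6) , ℕₚ.≤-trans q (ℕₚ.+-monoʳ-≤ u d≤6)
          blocked : xs o c₀ i + 20 ∸ column o cell ≡ 0 ⊎ (40 < xs o c₀ i + 20 ∸ column o cell ⊎ 20 ≤ ∣ ys c₀ i - 7 * η ∣) → ⊥
          blocked (inj₁ z) = ℕₚ.<⇒≱ (ℕₚ.≤-<-trans (proj₂ x-near) (ℕₚ.+-monoʳ-< (xs o c₀ i) (ℕₚ.m≤m+n 19 1))) (ℕₚ.m∸n≡0⇒m≤n z)
          blocked (inj₂ (inj₁ gt)) = ℕₚ.<⇒≱ (m<n∸o⇒m+o<n 40 _ (column o cell) gt)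
            (ℕₚ.≤-trans (ℕₚ.+-monoˡ-≤ 20 (proj₁ x-near)) (ℕₚ.≤-trans (ℕₚ.≤-reflexive (solve 1 (λ x → x :+ con 18 :+ con 20 := con 38 :+ x) refl (column o cell)))
              (ℕₚ.+-monoˡ-≤ (column o cell) (ℕₚ.m≤m+n 38 2))))
          blocked (inj₂ (inj₂ le)) = ℕₚ.<⇒≱ {19} {20} ℕₚ.≤-refl (ℕₚ.≤-trans le
            (subst (∣ ys c₀ i - 7 * η ∣ ≤_) (cong (_+ 19) (ℕₚ.∣n-n∣≡0 (7 * η))) (∣-∣-shift (proj₁ y-near) (proj₂ y-near))))

        arrive : ∀ {c′} → Near 6 c₀ c′ → Σ (Camp c′) λ C′ → Camp.cell C′ ≡ dest
        arrive {c′} near = settle-in o dest (η ↦ heading hunt) dest-η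
          (subst₂ (λ x z → Hunt x z (η ↦ heading hunt) (xs o c′) (ys c′)) moved (sym dest-z)
            (subst (λ y → Hunt (column o cell + 7) (suc (diagonal o cell)) y (xs o c′) (ys c′)) (same-way (heading hunt))
              (hunt-step hunt (λ i → coord-within o _ _ (proj₁ (near i))) (λ i → proj₂ (near i)) why)))
          where
          moved : column o cell + 7 ≡ column o dest
          moved = trans (solve 1 (λ z → con 7 :* z :+ con 5 :+ con 7 := con 7 :* (con 1 :+ z) :+ con 5) refl (diagonal o cell))
            (cong (λ z → 7 * z + 5) (sym dest-z))
          same-way : ∀ b → η towards b ≡ η ↦ b
          same-way true = refl
          same-way false = refl

      record State (c : Config) (v : Fin (Surface.#V (grid size))) : Set where
        field
          {c₀} : Config
          base : Camp c₀
          t    : Fin 3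
          near : Near (2 * toℕ t) c₀ c
          here′ : v ≡ ⌜ spot base t ⌝ᵛ

      near-sym : ∀ {d a b} → Near d a b → Near d b a
      near-sym p i = within-sym (proj₁ (p i)) , within-sym (proj₂ (p i))

      safe : ∀ {c v} → State c v → ¬ Captured c v
      safe s cap = hidden base t (ℕₚ.≤-trans (ℕₚ.*-monoʳ-≤ 2 (ℕₚ.≤-pred (Finₚ.toℕ<n t))) (ℕₚ.m≤m+n 4 2)) (near-sym near)
        (subst (Captured _) here′ cap)
        where open State s

      evade : ∀ {c v} → State c v → ∀ c′ → ValidCopMove c c′ →
              ¬ Captured c′ v × Σ _ (λ v′ → ValidRobberMove v v′ × State c′ v′)
      evade {c} record { c₀ = c₀ ; base = C ; t = t ; near = near ; here′ = refl } c′ ok =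
        hidden C t (bound t) (near-sym (further t)) , go t (further t)
        where
        bound : ∀ (t : Fin 3) → 2 * toℕ t + 2 ≤ 6
        bound t = ℕₚ.+-monoˡ-≤ 2 (ℕₚ.*-monoʳ-≤ 2 (ℕₚ.≤-pred (Finₚ.toℕ<n t)))
        further : ∀ t′ → Near (2 * toℕ t + 2) c₀ c′
        further _ = near-trans near (near-move ok)
        go : ∀ t → Near (2 * toℕ t + 2) c₀ c′ → Σ _ (λ v′ → ValidRobberMove ⌜ spot C t ⌝ᵛ v′ × State c′ v′)
        go 0F n = _ , inj₂ (encode (Trip.hop₁ (Camp.route C))) , record { base = C ; t = 1F ; near = n ; here′ = refl }
        go 1F n = _ , inj₂ (encode (Trip.hop₂ (Camp.route C))) , record { base = C ; t = 2F ; near = n ; here′ = refl }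
        go 2F n = ⌜ nodeW (Trip.dest (Camp.route C)) ⌝ᵛ , inj₂ (encode (Trip.hop₃ (Camp.route C))) ,
          (let (C′ , e) = arrive C n in
           record { base = C′ ; t = 0F ; near = λ i → within-refl _ , within-refl _
                  ; here′ = cong ⌜_⌝ᵛ (sym (trans (Trip.departs (Camp.route C′)) (cong nodeW e))) })

      Clear : Config → ℕ → Set
      Clear c z = ∀ i → xs true c i + 20 ∸ (7 * z + 5) ≡ 0 ⊎ limit m < xs true c i + 20 ∸ (7 * z + 5)

      start-at : ∀ c z → z ≤ size → size ≤ z + suc slack → Clear c z → Σ _ (State c)
      start-at c z z≤ z≥ far = ⌜ spot C 0F ⌝ᵛ , record { base = C ; t = 0F ; near = λ i → within-refl _ , within-refl _ ; here′ = refl }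
        where
        -- The cell has to satisfy `a + b = z` and `a = η + b`, so `η` must have the parity of `z`:
        -- it is `y₀` or `y₀ + 1`.
        r q η b : ℕ
        r = z ∸ y₀
        q = r % 2
        b = r / 2
        η = y₀ + q
        y₀≤z : y₀ ≤ z
        y₀≤z = ℕₚ.+-cancelʳ-≤ (suc slack) _ _ (ℕₚ.≤-trans (ℕₚ.≤-trans (ℕₚ.≤-reflexive (ℕₚ.+-comm y₀ (suc slack)))
          (ℕₚ.≤-trans (ℕₚ.+-monoʳ-≤ (suc slack) (ℕₚ.m≤m+n y₀ drift)) (ℕₚ.<⇒≤ roomy))) z≥)
        split : (η + b) + b ≡ z
        split = trans (solve 3 (λ y q b → y :+ q :+ b :+ b := y :+ (q :+ b :* con 2)) refl y₀ q b)
          (trans (cong (y₀ +_) (sym (m≡m%n+[m/n]*n r 2))) (ℕₚ.m+[n∸m]≡n y₀≤z))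
        a≤ : η + b ≤ size
        a≤ = ℕₚ.≤-trans (ℕₚ.m≤m+n (η + b) b) (ℕₚ.≤-trans (ℕₚ.≤-reflexive split) z≤)
        b≤ : b ≤ size
        b≤ = ℕₚ.≤-trans (ℕₚ.m≤n+m b η) a≤
        cell : Cell {size}
        cell = pos (η + b) (size ∸ (η + b)) (ℕₚ.m+[n∸m]≡n a≤) , pos b (size ∸ b) (ℕₚ.m+[n∸m]≡n b≤)
        close : ∣ η - y₀ ∣ ≤ 1
        close = ℕₚ.≤-trans (ℕₚ.≤-reflexive (trans (ℕₚ.∣-∣-comm η y₀) (ℕₚ.∣m-m+n∣≡n y₀ q))) (ℕₚ.≤-pred (m%n<n r 2))
        C : Camp c
        C = proj₁ (settle-in true cell η refl (subst₂ (λ x z → Hunt x z η (xs true c) (ys c)) (cong (λ w → 7 * w + 5) (sym split)) (sym split)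
              (hunt-begin close z≤ z≥ far)))

      initial : ∀ c → Σ _ (State c)
      initial c = let (z , z≤ , z≥ , far) = hunt-init 5 (xs true c) (ℕₚ.≤-trans (ℕₚ.≤-trans (ℕₚ.m≤m+n (m * cap) _) (ℕₚ.m≤m+n _ drift))
                        (ℕₚ.≤-trans (ℕₚ.n≤1+n slack) (ℕₚ.≤-trans (ℕₚ.m≤m+n (suc slack) (y₀ + drift)) (ℕₚ.<⇒≤ roomy))))
                  in start-at c z z≤ z≥ far

      cops-fail : ¬ CopsWin graph k
      cops-fail = copsLose State initial safe evade

-- Size of the grids against the number of cops.

module LargeGrids where
  open Surfaces
  open FoldedGrid
  open Dodging
  open FastRobber

  open Evading 20 using (window; limit)
  open +-*-Solver

  -- An opaque power of two, so that large numerals are never multiplied out.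
  abstract
    exp : ℕ → ℕ
    exp n = 2 ^ n
    exp≡ : ∀ n → exp n ≡ 2 ^ n
    exp≡ n = refl
    exp-+ : ∀ m n → exp m * exp n ≡ exp (m + n)
    exp-+ m n = sym (ℕₚ.^-distribˡ-+-* 2 m n)
    exp-mono : ∀ {m n} → m ≤ n → exp m ≤ exp n
    exp-mono = ℕₚ.^-monoʳ-≤ 2
    exp-above : ∀ m n → (m ≤ᵇ 2 ^ n) ≡ true → m ≤ exp n
    exp-above m n e = ℕₚ.≤ᵇ⇒≤ m (2 ^ n) (subst T (sym e) tt)
    n<exp : ∀ n → n < exp n
    n<exp zero = s≤s z≤n
    n<exp (suc n) = ℕₚ.≤-trans (ℕₚ.+-mono-≤ (ℕₚ.≤-trans (s≤s z≤n) (n<exp n)) (n<exp n))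
      (ℕₚ.≤-reflexive (cong (2 ^ n +_) (sym (ℕₚ.+-identityʳ (2 ^ n)))))

  -- With `κ = 20` the recursion is `window (suc u) = 183 * window u + 313`. The summand 2 absorbs
  -- the constant, because 183 * 2 is at least 315, and 183 is below 2 to the power 8.
  window≤ : ∀ u → window u + 2 ≤ exp (1 + 8 * u)
  window≤ zero = exp-above 2 1 refl
  window≤ (suc u) = begin
    313 + 182 * window u + window u + 2    ≡⟨ solve 1 (λ w → con 313 :+ con 182 :* w :+ w :+ con 2 := con 183 :* w :+ con 315) refl (window u) ⟩
    183 * window u + 315                   ≤⟨ ℕₚ.+-monoʳ-≤ (183 * window u) (ℕₚ.m≤m+n 315 51) ⟩
    183 * window u + 366                   ≡⟨ sym (ℕₚ.*-distribˡ-+ 183 (window u) 2) ⟩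
    183 * (window u + 2)                   ≤⟨ ℕₚ.*-mono-≤ (exp-above 183 8 refl) (window≤ u) ⟩
    exp 8 * exp (1 + 8 * u)                ≡⟨ exp-+ 8 (1 + 8 * u) ⟩
    exp (8 + (1 + 8 * u))                  ≡⟨ cong exp (solve 1 (λ u → con 8 :+ (con 1 :+ con 8 :* u) := con 1 :+ con 8 :* (con 1 :+ u)) refl u) ⟩
    exp (1 + 8 * suc u)                    ∎
    where open ℕₚ.≤-Reasoning

  limit≤window : ∀ u → limit u ≤ window u
  limit≤window zero = z≤n
  limit≤window (suc u) = ℕₚ.m≤m+n _ (window u)

  module _ (m : ℕ) where
    open Scale m

    private
      P Q : ℕ
      P = exp (8 * m)
      Q = P * P
      1≤P : 1 ≤ P
      1≤P = ℕₚ.≤-trans (s≤s z≤n) (n<exp (8 * m))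
      P≤Q : P ≤ Q
      P≤Q = ℕₚ.≤-trans (ℕₚ.≤-reflexive (sym (ℕₚ.*-identityˡ P))) (ℕₚ.*-monoˡ-≤ P 1≤P)
      1≤Q : 1 ≤ Q
      1≤Q = ℕₚ.≤-trans 1≤P P≤Q
      m≤P : m ≤ P
      m≤P = ℕₚ.≤-trans (ℕₚ.m≤n*m m 8) (ℕₚ.<⇒≤ (n<exp (8 * m)))
      window≤P : window m + 2 ≤ 2 * P
      window≤P = ℕₚ.≤-trans (window≤ m) (ℕₚ.≤-reflexive (trans (sym (exp-+ 1 (8 * m))) (cong (_* P) (exp≡ 1))))
      drift≤ : drift ≤ 2 * P
      drift≤ = ℕₚ.≤-trans (ℕₚ.≤-trans (ℕₚ.n≤1+n _) (ℕₚ.≤-reflexive (ℕₚ.+-comm 2 (window m)))) window≤P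
      cap≤ : cap ≤ 45 * P
      cap≤ = begin
        1 + 2 * (limit m + 20)        ≤⟨ ℕₚ.+-mono-≤ 1≤P (ℕₚ.*-monoʳ-≤ 2 (ℕₚ.+-mono-≤ limit≤ (ℕₚ.*-monoʳ-≤ 20 1≤P))) ⟩
        P + 2 * (2 * P + 20 * P)      ≡⟨ solve 1 (λ p → p :+ con 2 :* (con 2 :* p :+ con 20 :* p) := con 45 :* p) refl P ⟩
        45 * P                        ∎
        where
        open ℕₚ.≤-Reasoning
        limit≤ : limit m ≤ 2 * P
        limit≤ = ℕₚ.≤-trans (limit≤window m) (ℕₚ.≤-trans (ℕₚ.m≤m+n _ 2) window≤P)
      extent≤ : 2 + extent ≤ exp (7 + 16 * m)
      extent≤ = begin
        2 + (suc (2 * (m * cap) + drift) + (suc drift + drift))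
          ≡⟨ solve 2 (λ c d → con 2 :+ (con 1 :+ (con 2 :* c :+ d) :+ (con 1 :+ d :+ d)) := con 4 :* con 1 :+ con 2 :* c :+ con 3 :* d) refl (m * cap) drift ⟩
        4 * 1 + 2 * (m * cap) + 3 * drift
          ≤⟨ ℕₚ.+-mono-≤ (ℕₚ.+-mono-≤ (ℕₚ.*-monoʳ-≤ 4 1≤Q) (ℕₚ.*-monoʳ-≤ 2 (ℕₚ.*-mono-≤ m≤P cap≤))) (ℕₚ.*-monoʳ-≤ 3 (ℕₚ.≤-trans drift≤ (ℕₚ.*-monoʳ-≤ 2 P≤Q))) ⟩
        4 * Q + 2 * (P * (45 * P)) + 3 * (2 * Q)
          ≡⟨ solve 1 (λ p → con 4 :* (p :* p) :+ con 2 :* (p :* (con 45 :* p)) :+ con 3 :* (con 2 :* (p :* p)) := con 100 :* (p :* p)) refl P ⟩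
        100 * Q
          ≤⟨ ℕₚ.*-mono-≤ (exp-above 100 7 refl) (ℕₚ.≤-reflexive (trans (exp-+ (8 * m) (8 * m))
               (cong exp (solve 1 (λ m → con 8 :* m :+ con 8 :* m := con 16 :* m) refl m)))) ⟩
        exp 7 * exp (16 * m)
          ≡⟨ exp-+ 7 (16 * m) ⟩
        exp (7 + 16 * m) ∎
        where open ℕₚ.≤-Reasoning

    vertices≤ : Surface.#V (grid (suc extent)) ≤ 2 ^ (32 * suc m)
    vertices≤ = begin
      s * s * 39 + (s * s * 4 + (s * s + 2 * 1))
        ≤⟨ ℕₚ.+-monoʳ-≤ (s * s * 39) (ℕₚ.+-monoʳ-≤ (s * s * 4) (ℕₚ.+-monoʳ-≤ (s * s) (ℕₚ.*-monoʳ-≤ 2 {1} {s * s} (s≤s z≤n)))) ⟩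
      s * s * 39 + (s * s * 4 + (s * s + 2 * (s * s)))
        ≡⟨ solve 1 (λ c → c :* con 39 :+ (c :* con 4 :+ (c :+ con 2 :* c)) := con 46 :* c) refl (s * s) ⟩
      46 * (s * s)
        ≤⟨ ℕₚ.*-mono-≤ (exp-above 46 6 refl) (ℕₚ.≤-trans (ℕₚ.*-mono-≤ extent≤ extent≤) (ℕₚ.≤-reflexive (exp-+ (7 + 16 * m) (7 + 16 * m)))) ⟩
      exp 6 * exp (7 + 16 * m + (7 + 16 * m))
        ≡⟨ exp-+ 6 (7 + 16 * m + (7 + 16 * m)) ⟩
      exp (6 + (7 + 16 * m + (7 + 16 * m)))
        ≤⟨ exp-mono (ℕₚ.≤-trans (ℕₚ.m≤m+n _ 12) (ℕₚ.≤-reflexive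
             (solve 1 (λ m → con 6 :+ (con 7 :+ con 16 :* m :+ (con 7 :+ con 16 :* m)) :+ con 12 := con 32 :* (con 1 :+ m)) refl m))) ⟩
      exp (32 * suc m)
        ≡⟨ exp≡ (32 * suc m) ⟩
      2 ^ (32 * suc m) ∎
      where
      open ℕₚ.≤-Reasoning
      s : ℕ
      s = suc (suc extent)

    m≤vertices : m ≤ Surface.#V (grid (suc extent))
    m≤vertices = begin
      m                      ≤⟨ ℕₚ.m≤m*n m cap ⟩
      m * cap                ≤⟨ ℕₚ.≤-trans (ℕₚ.m≤m+n (m * cap) _) (ℕₚ.m≤m+n _ drift) ⟩
      slack                  ≤⟨ ℕₚ.≤-trans (ℕₚ.n≤1+n slack) (ℕₚ.m≤m+n (suc slack) (y₀ + drift)) ⟩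
      extent                 ≤⟨ ℕₚ.≤-trans (ℕₚ.n≤1+n _) (ℕₚ.n≤1+n _) ⟩
      s                      ≤⟨ ℕₚ.m≤m*n s s ⟩
      s * s                  ≤⟨ ℕₚ.m≤m*n (s * s) 39 ⟩
      s * s * 39             ≤⟨ ℕₚ.m≤m+n _ _ ⟩
      s * s * 39 + (s * s * 4 + (s * s + 2)) ∎
      where
      open ℕₚ.≤-Reasoning
      s : ℕ
      s = suc (suc extent)

  -- The logarithm is at most `32 * suc m`, linear in the number of cops; `suc m` is then estimated
  -- by its square to obtain the form stated in the theorem.
  log-bound : ∀ v m j → v ≤ 2 ^ (32 * suc m) → m < j → ⌊log₂ v ⌋ ≤ 32 * (j * j)
  log-bound v m j v≤ m<j = begin
    ⌊log₂ v ⌋                    ≤⟨ ⌊log₂⌋-mono-≤ v≤ ⟩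
    ⌊log₂ (2 ^ (32 * suc m)) ⌋   ≡⟨ ⌊log₂[2^n]⌋≡n (32 * suc m) ⟩
    32 * suc m                   ≤⟨ ℕₚ.*-monoʳ-≤ 32 (ℕₚ.≤-trans (ℕₚ.m≤m*n (suc m) (suc m)) (ℕₚ.*-mono-≤ m<j m<j)) ⟩
    32 * (j * j)                 ∎
    where open ℕₚ.≤-Reasoning

  needs-more : ∀ m j → CopsWin (Surface.graph (grid (suc (Scale.extent m)))) j → m < j
  needs-more m j win = go (j ℕₚ.≤? m)
    where
    go : Dec (j ≤ m) → m < j
    go (yes j≤m) = ⊥-elim (Board.Flight.cops-fail m (suc (Scale.extent m)) ℕₚ.≤-refl j j≤m win)
    go (no j≰m) = ℕₚ.≰⇒> j≰m

  -- `N` itself is taken as the number of cops that fail; the board built for that many has more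
  -- than enough vertices.
  many-cops-needed : ∀ N → Σ PlaneGraph (λ G → MaxDegree G 5 × N ≤ numVertices G ×
                     (∀ j → CopsWin G j → ⌊log₂ numVertices G ⌋ ≤ 32 * (j * j)))
  many-cops-needed m = Surface.graph (grid (suc (Scale.extent m))) , grid-Δ (Scale.extent m) , m≤vertices m ,
    λ j win → log-bound (numVertices (Surface.graph (grid (suc (Scale.extent m))))) m j (vertices≤ m) (needs-more m j win)

theorem1 :
  -- (1) Δ(G) = 3 : c*(G) ≤ 3, tight
  ((∀ (G : PlaneGraph) → MaxDegree G 3 → CopsWin G 3)
    × (Σ PlaneGraph (λ G → MaxDegree G 3 × CopNumberIs G 3)))
  -- (2) Δ(G) = 4 : c*(G) ≤ 6, tight
  × ((∀ (G : PlaneGraph) → MaxDegree G 4 → CopsWin G 6)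
    × (Σ PlaneGraph (λ G → MaxDegree G 4 × CopNumberIs G 6)))
  -- (3) Δ(G) = 5 : c*(G) = Ω(sqrt(log n)) for arbitrarily large n,
  --     i.e. log₂ n ≤ d · c*(G)² for a fixed constant d
  × (∃[ d ] (∀ (N : ℕ) → Σ PlaneGraph (λ G →
      MaxDegree G 5 × N ≤ numVertices G
      × (∀ (j : ℕ) → CopsWin G j → ⌊log₂ numVertices G ⌋ ≤ d * (j * j)))))
theorem1 =
  (DegreeThree.three-suffice , TetrahedronGraph.three-tight) , (DegreeFour.six-suffice , DodecahedralMaze.six-tight) , 32 , LargeGrids.many-cops-needed
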